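{- The edge generating series of the Schröder lattices is $$\sum_{n\ge0}\ell(\mathcal{S}_n)x^n=\frac{(1-x)\big(1-4x+x^2-(1-x)\sqrt{1-6x+x^2}\big)}{2x\sqrt{1-6x+x^2}}.$$ Moreover, for $n\ge1$, $\ell(\mathcal{S}_n)=d_n-r_n-d_{n-1}+r_{n-1}$, and for $n\ge0$ $$\ell(\mathcal{S}_n)=\sum_{k=0}^n\left(\!\!\binom{2k}{n-k}\!\!\right)\binom{2k}{k}\frac{k}{k+1},$$ where $\left(\!\binom{m}{j}\!\right)=\frac{m(m+1)\cdots(m+j-1)}{j!}$ is the multiset coefficient. Finally, $\ell(\mathcal{S}_n)\sim\frac{(1+\sqrt2)^{2n}}{\sqrt{\sqrt2\,n\pi}}$ and $i(\mathcal{S}_n)=\ell(\mathcal{S}_n)/|\mathcal{S}_n|\sim(2-\sqrt2)n$.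
   Context: Steps: $U=(1,1)$, $D=(1,-1)$, $H=(2,0)$. $\mathcal{S}_n$ is the set of Schröder paths of semi-length $n$ (lattice paths from $(0,0)$ to $(2n,0)$ with steps $U,D,H$ never going below the $x$-axis), partially ordered by $\gamma_1\le\gamma_2$ iff $\gamma_1$ lies weakly below $\gamma_2$. $\ell(P)$ is the number of edges (covering pairs) of the Hasse diagram of a finite poset $P$ and $i(P)=\ell(P)/|P|$. $d_n$ are the central Delannoy numbers, $\sum_n d_nx^n=1/\sqrt{1-6x+x^2}$, and $r_n=|\mathcal{S}_n|$ are the large Schröder numbers, $\sum_nr_nx^n=(1-x-\sqrt{1-6x+x^2})/(2x)$. $a_n\sim b_n$ means $a_n/b_n\to1$. -}

module Defs where

open import Data.Empty using (⊥-elim)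
open import Data.Integer.Base as ℤ using (+_)
import Data.Integer.Properties as ℤₚ
import Data.Integer.Tactic.RingSolver as ℤ-Ring
open import Data.List.Base using (List; []; _∷_; _++_; map; length; filter; cartesianProduct)
open import Data.List.Membership.Propositional using (_∈_)
open import Data.List.Membership.Propositional.Properties using (∈-map⁺; ∈-map⁻; ∈-++⁺ˡ; ∈-++⁺ʳ; ∈-++⁻)
open import Data.List.Relation.Binary.Disjoint.Propositional using (Disjoint)
import Data.List.Relation.Unary.All as All
open import Data.List.Relation.Unary.AllPairs using ([]; _∷_)
open import Data.List.Relation.Unary.Any using (here)
open import Data.List.Relation.Unary.Unique.Propositional using (Unique)
import Data.List.Relation.Unary.Unique.Propositional.Properties as Uniq
open import Data.Nat.Base as ℕ using (ℕ; zero; suc; NonZero)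
import Data.Nat.Properties as ℕₚ
open import Data.Product.Base using (∃; Σ; _×_; _,_; proj₁; proj₂; uncurry)
open import Data.Rational.Base as ℚ using (ℚ; 0ℚ; 1ℚ; ½; _+_; _*_; _-_; -_; _/_; 1/_; ∣_∣; _≤_; _<_; positive; nonNegative)
import Data.Rational.Properties as ℚₚ
import Data.Rational.Unnormalised.Base as ℚᵘ
import Data.Rational.Unnormalised.Properties as ℚᵘₚ
open import Data.Rational.Solver using (module +-*-Solver)
open import Data.Sum.Base using (_⊎_; inj₁; inj₂; [_,_]′; map₁)
open import Data.Vec.Base using (Vec; []; _∷_; head; tail)
open import Data.Vec.Properties using (≡-dec)
open import Data.Vec.Relation.Binary.Pointwise.Inductive as PW using (Pointwise)
open import Level using (0ℓ)
open import Relation.Binary.Core using (Rel)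
open import Relation.Binary.PropositionalEquality using (_≡_; _≢_; refl; sym; trans; cong; cong₂; subst; subst₂; isEquivalence)
open import Relation.Binary.Structures using (IsDecPartialOrder)
open import Relation.Nullary.Decidable using (Dec; yes; no; ¬?; _×-dec_; map′)
open import Relation.Nullary.Negation using (¬_)

record FinitePoset : Set₁ where
  infix 4 _⊑_
  field
    Carrier           : Set
    _⊑_               : Rel Carrier 0ℓ
    isDecPartialOrder : IsDecPartialOrder _≡_ _⊑_
    elements          : List Carrier
    complete          : ∀ x → x ∈ elements
    unique            : Unique elements

  open IsDecPartialOrder isDecPartialOrder public using (_≟_; _≤?_)

  open import Relation.Binary.Construct.NonStrictToStrict _≡_ _⊑_ public
    using () renaming (_<_ to _⊏_)

  infix 4 _⋖_
  _⋖_ : Rel Carrier 0ℓ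
  x ⋖ y = x ⊏ y × (∀ z → ¬ (x ⊏ z × z ⊏ y))

  _⊏?_ : ∀ x y → Dec (x ⊏ y)
  x ⊏? y = (x ≤? y) ×-dec ¬? (x ≟ y)

  _⋖?_ : ∀ x y → Dec (x ⋖ y)
  x ⋖? y = (x ⊏? y) ×-dec
    map′ (λ none z → All.lookup none (complete z)) (λ none → All.tabulate λ {z} _ → none z)
         (All.all? (λ z → ¬? ((x ⊏? z) ×-dec (z ⊏? y))) elements)

∣_∣ₚ : FinitePoset → ℕ
∣ P ∣ₚ = length (FinitePoset.elements P)

ℓ : FinitePoset → ℕ
ℓ P = length (filter (uncurry _⋖?_) (cartesianProduct elements elements))
  where open FinitePoset P

-- Path h w: the ways to go from height h down to height 0 with steps of total
-- width w, never passing below height 0.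
data Path : ℕ → ℕ → Set where
  end : Path 0 0
  U   : ∀ {h w} → Path (suc h) w → Path h (suc w)
  D   : ∀ {h w} → Path h w → Path (suc h) (suc w)
  H   : ∀ {h w} → Path h w → Path h (suc (suc w))

SchröderPath : ℕ → Set
SchröderPath n = Path 0 (2 ℕ.* n)

-- The heights at the abscissas 0, 1, …, w, including the midpoint of each H.
-- Paths are linear in between, so comparing these compares the paths everywhere.
heights : ∀ {h w} → Path h w → Vec ℕ (suc w)
heights             end   = 0 ∷ []
heights {h}         (U p) = h ∷ heights p
heights {h}         (D p) = h ∷ heights p
heights {h}         (H p) = h ∷ h ∷ heights p

infix 4 _⊴_
_⊴_ : ∀ {h w} → Rel (Path h w) 0ℓ
p ⊴ q = Pointwise ℕ._≤_ (heights p) (heights q)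

module _ where

  head-heights : ∀ {h w} (p : Path h w) → head (heights p) ≡ h
  head-heights end   = refl
  head-heights (U p) = refl
  head-heights (D p) = refl
  head-heights (H p) = refl

  start-≡ : ∀ {h k w} (p : Path h w) (q : Path k w) → heights p ≡ heights q → h ≡ k
  start-≡ p q eq = trans (sym (head-heights p)) (trans (cong head eq) (head-heights q))

  suc² : ∀ {n} → ¬ suc (suc n) ≡ n
  suc² ()

  heights-injective : ∀ {h w} (p q : Path h w) → heights p ≡ heights q → p ≡ q
  heights-injective end   end   eq = refl
  heights-injective (U p) (U q) eq = cong U (heights-injective p q (cong tail eq))
  heights-injective (D p) (D q) eq = cong D (heights-injective p q (cong tail eq))
  heights-injective (H p) (H q) eq =
    cong H (heights-injective p q (cong (λ v → tail (tail v)) eq))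
  heights-injective (U p) (D q) eq = ⊥-elim (suc² (start-≡ p q (cong tail eq)))
  heights-injective (D p) (U q) eq = ⊥-elim (suc² (start-≡ q p (sym (cong tail eq))))
  heights-injective (U p) (H q) eq =
    ⊥-elim (ℕₚ.1+n≢n (trans (sym (head-heights p)) (cong (λ v → head (tail v)) eq)))
  heights-injective (H p) (U q) eq =
    ⊥-elim (ℕₚ.1+n≢n (trans (sym (head-heights q)) (cong (λ v → head (tail v)) (sym eq))))
  heights-injective (D p) (H q) eq =
    ⊥-elim (ℕₚ.1+n≢n (trans (cong (λ v → head (tail v)) (sym eq)) (head-heights p)))
  heights-injective (H p) (D q) eq =
    ⊥-elim (ℕₚ.1+n≢n (trans (cong (λ v → head (tail v)) eq) (head-heights q)))

  pointwise-antisym : ∀ {n} {u v : Vec ℕ n} →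
                      Pointwise ℕ._≤_ u v → Pointwise ℕ._≤_ v u → u ≡ v
  pointwise-antisym Pointwise.[]       Pointwise.[]       = refl
  pointwise-antisym (x Pointwise.∷ xs) (y Pointwise.∷ ys) =
    cong₂ _∷_ (ℕₚ.≤-antisym x y) (pointwise-antisym xs ys)

⊴-isDecPartialOrder : ∀ {h w} → IsDecPartialOrder {A = Path h w} _≡_ _⊴_
⊴-isDecPartialOrder = record
  { isPartialOrder = record
    { isPreorder = record
      { isEquivalence = isEquivalence
      ; reflexive     = λ { refl → PW.refl ℕₚ.≤-refl }
      ; trans         = PW.trans ℕₚ.≤-trans
      }
    ; antisym = λ p≤q q≤p → heights-injective _ _ (pointwise-antisym p≤q q≤p)
    }
  ; _≟_  = λ p q → map′ (heights-injective p q) (cong heights)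
                        (≡-dec ℕₚ._≟_ (heights p) (heights q))
  ; _≤?_ = λ p q → PW.decidable ℕₚ._≤?_ (heights p) (heights q)
  }

paths   : ∀ h w → List (Path h w)
pathsU  : ∀ h w → List (Path h (suc w))
pathsD  : ∀ h w → List (Path h (suc w))
pathsH  : ∀ h w → List (Path h (suc w))

paths h       (suc w) = pathsU h w ++ pathsD h w ++ pathsH h w
paths zero    zero    = end ∷ []
paths (suc h) zero    = []

pathsU h       w       = map U (paths (suc h) w)
pathsD zero    w       = []
pathsD (suc h) w       = map D (paths h w)
pathsH h       zero    = []
pathsH h       (suc w) = map H (paths h w)

paths-complete : ∀ {h w} (p : Path h w) → p ∈ paths h w
paths-complete end = here refl
paths-complete {h} {suc w} (U p) = ∈-++⁺ˡ (∈-map⁺ U (paths-complete p))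
paths-complete {h} {suc w} (D p) =
  ∈-++⁺ʳ (pathsU h w) (∈-++⁺ˡ (∈-map⁺ D (paths-complete p)))
paths-complete {h} {suc w} (H p) =
  ∈-++⁺ʳ (pathsU h w) (∈-++⁺ʳ (pathsD h w) (∈-map⁺ H (paths-complete p)))

module _ where

  U-disjoint : ∀ h w → Disjoint (pathsU h w) (pathsD h w ++ pathsH h w)
  U-disjoint h w (∈U , ∈DH) with ∈-map⁻ U ∈U | ∈-++⁻ (pathsD h w) ∈DH
  U-disjoint (suc h) w       _ | _ , _ , refl | inj₁ ∈D with ∈-map⁻ D ∈D
  ... | _ , _ , ()
  U-disjoint h       (suc w) _ | _ , _ , refl | inj₂ ∈H with ∈-map⁻ H ∈H
  ... | _ , _ , ()

  D-disjoint : ∀ h w → Disjoint (pathsD h w) (pathsH h w)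
  D-disjoint (suc h) (suc w) (∈D , ∈H) with ∈-map⁻ D ∈D | ∈-map⁻ H ∈H
  ... | _ , _ , refl | _ , _ , ()

paths-unique : ∀ h w → Unique (paths h w)
pathsD-unique : ∀ h w → Unique (pathsD h w)
pathsH-unique : ∀ h w → Unique (pathsH h w)
paths-unique zero    zero    = All.[] ∷ []
paths-unique (suc h) zero    = []
paths-unique h       (suc w) =
  Uniq.++⁺ (Uniq.map⁺ (λ { refl → refl }) (paths-unique (suc h) w))
    (Uniq.++⁺ (pathsD-unique h w) (pathsH-unique h w) (D-disjoint h w)) (U-disjoint h w)
pathsD-unique zero    w = []
pathsD-unique (suc h) w = Uniq.map⁺ (λ { refl → refl }) (paths-unique h w)
pathsH-unique h zero    = []
pathsH-unique h (suc w) = Uniq.map⁺ (λ { refl → refl }) (paths-unique h w)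

𝒮 : ℕ → FinitePoset
𝒮 n = record
  { Carrier           = SchröderPath n
  ; _⊑_               = _⊴_
  ; isDecPartialOrder = ⊴-isDecPartialOrder
  ; elements          = paths 0 (2 ℕ.* n)
  ; complete          = paths-complete
  ; unique            = paths-unique 0 (2 ℕ.* n)
  }

flatPath : ∀ n → SchröderPath n
flatPath zero    = end
flatPath (suc n) = subst (Path 0) (sym (ℕₚ.*-suc 2 n)) (H (flatPath n))

𝒮-nonEmpty : ∀ n → NonZero ∣ 𝒮 n ∣ₚ
𝒮-nonEmpty n = nonEmpty (paths-complete (flatPath n))
  where
  nonEmpty : ∀ {A : Set} {x : A} {xs} → x ∈ xs → NonZero (length xs)
  nonEmpty {xs = _ ∷ _} _ = _

i : (P : FinitePoset) → .{{NonZero ∣ P ∣ₚ}} → ℚ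
i P = + ℓ P / ∣ P ∣ₚ

r : ℕ → ℕ
r n = ∣ 𝒮 n ∣ₚ

-- delannoy m n counts the lattice paths from (0,0) to (m,n) with steps (1,0), (0,1), (1,1).
delannoy : ℕ → ℕ → ℕ
delannoy zero    n       = 1
delannoy (suc m) zero    = 1
delannoy (suc m) (suc n) = delannoy m (suc n) ℕ.+ delannoy (suc m) n ℕ.+ delannoy m n

d : ℕ → ℕ
d n = delannoy n n

-- m (m+1) ⋯ (m+j-1)
rising : ℕ → ℕ → ℕ
rising m zero    = 1
rising m (suc j) = rising m j ℕ.* (m ℕ.+ j)

multichoose : ℕ → ℕ → ℚ
multichoose m j = (+ rising m j / j ℕ.!) {{j ℕₚ.!≢0}}

-- The formal power series Σ fₙ xⁿ, given by its coefficients.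
Series : Set
Series = ℕ → ℚ

Σ≤ : ℕ → (ℕ → ℚ) → ℚ
Σ≤ zero    f = f 0
Σ≤ (suc n) f = Σ≤ n f + f (suc n)

infixl 6 _⊕_ _⊖_
infixl 7 _⊛_
_⊕_ _⊖_ _⊛_ : Series → Series → Series
(f ⊕ g) n = f n + g n
(f ⊖ g) n = f n - g n
(f ⊛ g) n = Σ≤ n (λ i → f i * g (n ℕ.∸ i))

monomial : ℚ → ℕ → Series
monomial c m n with n ℕₚ.≟ m
... | yes _ = c
... | no  _ = 0ℚ

const : ℕ → Series
const c = monomial (+ c / 1) 0

X : Series
X = monomial 1ℚ 1

-- √ˢ f is the square root with constant term 1 of a series f with constant term 1.
-- partialRoot f n is its truncation after the xⁿ term: when t is the truncation
-- after xⁿ, the next coefficient c is fixed by [xⁿ⁺¹] t² + 2c = [xⁿ⁺¹] f.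
partialRoot : Series → ℕ → Series
partialRoot f zero    = const 1
partialRoot f (suc n) = t ⊕ monomial (½ * (f (suc n) - (t ⊛ t) (suc n))) (suc n)
  where t = partialRoot f n

√ˢ : Series → Series
√ˢ f n = partialRoot f n n

open +-*-Solver
open ℚₚ.≤-Reasoning

module _ where

  monomial-at : ∀ c m → monomial c m m ≡ c
  monomial-at c m with m ℕₚ.≟ m
  ... | yes _  = refl
  ... | no m≢m = ⊥-elim (m≢m refl)

  monomial-off : ∀ c m {n} → n ≢ m → monomial c m n ≡ 0ℚ
  monomial-off c m {n} n≢m with n ℕₚ.≟ m
  ... | yes n≡m = ⊥-elim (n≢m n≡m)
  ... | no _    = refl

  Σ≤-cong : ∀ n {f g : ℕ → ℚ} → (∀ i → i ℕ.≤ n → f i ≡ g i) → Σ≤ n f ≡ Σ≤ n g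
  Σ≤-cong zero    eq = eq 0 ℕ.z≤n
  Σ≤-cong (suc n) eq =
    cong₂ _+_ (Σ≤-cong n (λ i i≤n → eq i (ℕₚ.m≤n⇒m≤1+n i≤n))) (eq (suc n) ℕₚ.≤-refl)

  Σ≤-zero : ∀ n → Σ≤ n (λ _ → 0ℚ) ≡ 0ℚ
  Σ≤-zero zero    = refl
  Σ≤-zero (suc n) = trans (ℚₚ.+-identityʳ (Σ≤ n (λ _ → 0ℚ))) (Σ≤-zero n)

  Σ≤-+ : ∀ n f g → Σ≤ n (λ i → f i + g i) ≡ Σ≤ n f + Σ≤ n g
  Σ≤-+ zero    f g = refl
  Σ≤-+ (suc n) f g = trans (cong (_+ (f (suc n) + g (suc n))) (Σ≤-+ n f g))
    (solve 4 (λ a b c d → (a :+ b) :+ (c :+ d) := (a :+ c) :+ (b :+ d)) refl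
      (Σ≤ n f) (Σ≤ n g) (f (suc n)) (g (suc n)))

  Σ≤-first : ∀ n f → (∀ i → f (suc i) ≡ 0ℚ) → Σ≤ n f ≡ f 0
  Σ≤-first zero    f _  = refl
  Σ≤-first (suc n) f eq = trans (cong₂ _+_ (Σ≤-first n f eq) (eq n)) (ℚₚ.+-identityʳ (f 0))

  Σ≤-last : ∀ n f → (∀ i → i ℕ.≤ n → f i ≡ 0ℚ) → Σ≤ (suc n) f ≡ f (suc n)
  Σ≤-last n f eq = trans (cong (_+ f (suc n)) (trans (Σ≤-cong n eq) (Σ≤-zero n)))
                         (ℚₚ.+-identityˡ (f (suc n)))

  monomial-⊛ : ∀ c n g → (monomial c (suc n) ⊛ g) (suc n) ≡ c * g 0
  monomial-⊛ c n g = trans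
    (Σ≤-last n (λ i → monomial c (suc n) i * g (suc n ℕ.∸ i)) (λ i i≤n →
      trans (cong (_* g (suc n ℕ.∸ i)) (monomial-off c (suc n) (ℕₚ.<⇒≢ (ℕ.s≤s i≤n))))
            (ℚₚ.*-zeroˡ (g (suc n ℕ.∸ i)))))
    (cong₂ _*_ (monomial-at c (suc n)) (cong g (ℕₚ.n∸n≡0 n)))

  ⊛-monomial : ∀ c n f → (f ⊛ monomial c (suc n)) (suc n) ≡ f 0 * c
  ⊛-monomial c n f = trans
    (Σ≤-first (suc n) (λ i → f i * monomial c (suc n) (suc n ℕ.∸ i)) (λ i →
      trans (cong (f (suc i) *_) (monomial-off c (suc n) (ℕₚ.<⇒≢ (ℕ.s≤s (ℕₚ.m∸n≤m n i)))))
            (ℚₚ.*-zeroʳ (f (suc i)))))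
    (cong (f 0 *_) (monomial-at c (suc n)))

  partialRoot-suc : ∀ f n k → k ℕ.≤ n → partialRoot f (suc n) k ≡ partialRoot f n k
  partialRoot-suc f n k k≤n = trans
    (cong (λ z → partialRoot f n k + z) (monomial-off _ (suc n) (ℕₚ.<⇒≢ (ℕ.s≤s k≤n))))
    (ℚₚ.+-identityʳ (partialRoot f n k))

  partialRoot-√ˢ : ∀ f {n k} → k ℕ.≤′ n → partialRoot f n k ≡ √ˢ f k
  partialRoot-√ˢ f ℕ.≤′-refl = refl
  partialRoot-√ˢ f {suc n} {k} (ℕ.≤′-step k≤n) =
    trans (partialRoot-suc f n k (ℕₚ.≤′⇒≤ k≤n)) (partialRoot-√ˢ f k≤n)

  partialRoot-0 : ∀ f n → partialRoot f n 0 ≡ 1ℚ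
  partialRoot-0 f n = partialRoot-√ˢ f (ℕₚ.z≤′n {n})

√ˢ-square : ∀ f → f 0 ≡ 1ℚ → ∀ n → (√ˢ f ⊛ √ˢ f) n ≡ f n
√ˢ-square f f0≡1 zero    = sym f0≡1
√ˢ-square f f0≡1 (suc n) = begin-equality
  (√ˢ f ⊛ √ˢ f) (suc n)
    ≡⟨ Σ≤-cong (suc n) (λ i i≤ → cong₂ _*_ (agree i i≤) (agree (suc n ℕ.∸ i) (ℕₚ.m∸n≤m (suc n) i))) ⟩
  ((t ⊕ m) ⊛ (t ⊕ m)) (suc n)
    ≡⟨ Σ≤-cong (suc n) (λ i _ → expand (t i) (m i) (t (suc n ℕ.∸ i)) (m (suc n ℕ.∸ i))) ⟩
  Σ≤ (suc n) (λ i → (t i * t (suc n ℕ.∸ i) + t i * m (suc n ℕ.∸ i)) + m i * (t ⊕ m) (suc n ℕ.∸ i))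
    ≡⟨ Σ≤-+ (suc n) (λ i → t i * t (suc n ℕ.∸ i) + t i * m (suc n ℕ.∸ i)) (λ i → m i * (t ⊕ m) (suc n ℕ.∸ i)) ⟩
  Σ≤ (suc n) (λ i → t i * t (suc n ℕ.∸ i) + t i * m (suc n ℕ.∸ i)) + (m ⊛ (t ⊕ m)) (suc n)
    ≡⟨ cong (_+ (m ⊛ (t ⊕ m)) (suc n)) (Σ≤-+ (suc n) (λ i → t i * t (suc n ℕ.∸ i)) (λ i → t i * m (suc n ℕ.∸ i))) ⟩
  ((t ⊛ t) (suc n) + (t ⊛ m) (suc n)) + (m ⊛ (t ⊕ m)) (suc n)
    ≡⟨ cong₂ (λ a b → ((t ⊛ t) (suc n) + a) + b)
         (trans (⊛-monomial c n t) (cong (_* c) (partialRoot-0 f n)))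
         (trans (monomial-⊛ c n (t ⊕ m)) (cong (c *_) (partialRoot-0 f (suc n)))) ⟩
  ((t ⊛ t) (suc n) + 1ℚ * c) + c * 1ℚ
    ≡⟨ solve 2 (λ a b → (a :+ con 1ℚ :* (con ½ :* (b :- a))) :+ (con ½ :* (b :- a)) :* con 1ℚ := b) refl
         ((t ⊛ t) (suc n)) (f (suc n)) ⟩
  f (suc n) ∎
  where
  t = partialRoot f n
  c = ½ * (f (suc n) - (t ⊛ t) (suc n))
  m = monomial c (suc n)
  agree : ∀ i → i ℕ.≤ suc n → √ˢ f i ≡ (t ⊕ m) i
  agree i i≤ = sym (partialRoot-√ˢ f (ℕₚ.≤⇒≤′ i≤))
  expand : ∀ a b c d → (a + b) * (c + d) ≡ (a * c + a * d) + b * (c + d)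
  expand = solve 4 (λ a b c d → (a :+ b) :* (c :+ d) := (a :* c :+ a :* d) :+ b :* (c :+ d)) refl

-- Elements of the field of fractions of ℚ[[x]].
infix 5 _//_[_]
record Fraction : Set where
  constructor _//_[_]
  field
    num      : Series
    den      : Series
    den≢0    : ∃ λ n → den n ≢ 0ℚ

⌜_⌝ : Series → Fraction
⌜ f ⌝ = f // const 1 [ 0 , (λ ()) ]

infix 4 _≈ᶠ_
_≈ᶠ_ : Fraction → Fraction → Set
p ≈ᶠ q = ∀ n → (num p ⊛ den q) n ≡ (num q ⊛ den p) n
  where open Fraction

Δ : Series
Δ = const 1 ⊖ const 6 ⊛ X ⊕ X ⊛ X

2X√Δ≢0 : ∃ λ n → (const 2 ⊛ X ⊛ √ˢ Δ) n ≢ 0ℚ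
2X√Δ≢0 = 1 , λ ()

Eventually : (ℕ → Set) → Set
Eventually P = ∃ λ N → ∀ n → N ℕ.≤ n → P n

-- Real numbers as Cauchy sequences of rationals.
record ℝ : Set where
  constructor mkℝ
  field
    approx : ℕ → ℚ
    cauchy : ∀ ε → 0ℚ < ε → ∃ λ N → ∀ m n → N ℕ.≤ m → N ℕ.≤ n →
             ∣ approx m - approx n ∣ ≤ ε
open ℝ public

module _ where

  swap-- : ∀ p q → - (p - q) ≡ q - p
  swap-- = solve 2 (λ p q → (:- (p :- q)) := (q :- p)) refl

  abs-≤ : ∀ p {e} → p ≤ e → - p ≤ e → ∣ p ∣ ≤ e
  abs-≤ p {e} p≤e -p≤e with ℚₚ.∣p∣≡p∨∣p∣≡-p p
  ... | inj₁ eq = subst (_≤ e) (sym eq) p≤e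
  ... | inj₂ eq = subst (_≤ e) (sym eq) -p≤e

  p≤∣p∣ : ∀ p → p ≤ ∣ p ∣
  p≤∣p∣ p with ℚₚ.≤-total 0ℚ p
  ... | inj₁ 0≤p = ℚₚ.≤-reflexive (sym (ℚₚ.0≤p⇒∣p∣≡p 0≤p))
  ... | inj₂ p≤0 = ℚₚ.≤-trans p≤0 (ℚₚ.0≤∣p∣ p)

  dist-sym : ∀ p q → ∣ p - q ∣ ≡ ∣ q - p ∣
  dist-sym p q = trans (sym (ℚₚ.∣-p∣≡∣p∣ (p - q))) (cong ∣_∣ (swap-- p q))

  ≤-dist : ∀ {p q e} → ∣ p - q ∣ ≤ e → p ≤ q + e
  ≤-dist {p} {q} {e} d = begin
    p             ≡⟨ solve 2 (λ p q → p := q :+ (p :- q)) refl p q ⟩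
    q + (p - q)   ≤⟨ ℚₚ.+-monoʳ-≤ q (ℚₚ.≤-trans (p≤∣p∣ (p - q)) d) ⟩
    q + e         ∎

  dist-≤ : ∀ {p q e} → p ≤ q + e → q ≤ p + e → ∣ p - q ∣ ≤ e
  dist-≤ {p} {q} {e} a b = abs-≤ (p - q) (half p q a) (subst (_≤ e) (sym (swap-- p q)) (half q p b))
    where
    half : ∀ p q → p ≤ q + e → p - q ≤ e
    half p q a = begin
      p - q        ≤⟨ ℚₚ.+-monoˡ-≤ (- q) a ⟩
      q + e - q    ≡⟨ solve 2 (λ q e → q :+ e :- q := e) refl q e ⟩
      e            ∎

  *-mono-≤-nonNeg : ∀ {a b c d} → 0ℚ ≤ a → a ≤ b → 0ℚ ≤ c → c ≤ d → a * c ≤ b * d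
  *-mono-≤-nonNeg {a} {b} {c} {d} 0≤a a≤b 0≤c c≤d = begin
    a * c  ≤⟨ ℚₚ.*-monoʳ-≤-nonNeg c {{nonNegative 0≤c}} a≤b ⟩
    b * c  ≤⟨ ℚₚ.*-monoˡ-≤-nonNeg b {{nonNegative (ℚₚ.≤-trans 0≤a a≤b)}} c≤d ⟩
    b * d  ∎

  0≤* : ∀ {a b} → 0ℚ ≤ a → 0ℚ ≤ b → 0ℚ ≤ a * b
  0≤* 0≤a 0≤b = *-mono-≤-nonNeg ℚₚ.≤-refl 0≤a ℚₚ.≤-refl 0≤b

  0<* : ∀ {a b} → 0ℚ < a → 0ℚ < b → 0ℚ < a * b
  0<* {a} {b} 0<a 0<b = ℚₚ.positive⁻¹ (a * b) {{ℚₚ.pos*pos⇒pos a {{positive 0<a}} b {{positive 0<b}}}}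

  0<½ : 0ℚ < ½
  0<½ = ℚₚ.positive⁻¹ ½

  0<1 : 0ℚ < 1ℚ
  0<1 = ℚₚ.positive⁻¹ 1ℚ

  halves : ∀ e → ½ * e + ½ * e ≡ e
  halves = solve 1 (λ e → con ½ :* e :+ con ½ :* e := e) refl

  ⊔-l : ∀ {i} m n → m ℕ.⊔ n ℕ.≤ i → m ℕ.≤ i
  ⊔-l m n = ℕₚ.m⊔n≤o⇒m≤o m n

  ⊔-r : ∀ {i} m n → m ℕ.⊔ n ℕ.≤ i → n ℕ.≤ i
  ⊔-r m n = ℕₚ.m⊔n≤o⇒n≤o m n

fromℚ : ℚ → ℝ
fromℚ q = mkℝ (λ _ → q) λ ε 0<ε → 0 , λ _ _ _ _ →
  ℚₚ.≤-trans (ℚₚ.≤-reflexive (cong ∣_∣ (ℚₚ.+-inverseʳ q))) (ℚₚ.<⇒≤ 0<ε)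

infix 8 -ᴿ_
-ᴿ_ : ℝ → ℝ
-ᴿ x = mkℝ (λ n → - approx x n) λ ε 0<ε → let (N , f) = cauchy x ε 0<ε in
  N , λ m n N≤m N≤n → subst (_≤ ε)
    (cong ∣_∣ (solve 2 (λ p q → q :- p := (:- p) :- (:- q)) refl (approx x m) (approx x n)))
    (f n m N≤n N≤m)

∣_∣ᴿ : ℝ → ℝ
∣ x ∣ᴿ = mkℝ (λ n → ∣ approx x n ∣) λ ε 0<ε → let (N , f) = cauchy x ε 0<ε in
  N , λ m n N≤m N≤n → dist-≤ (tri (approx x m) (approx x n) (f m n N≤m N≤n))
                              (tri (approx x n) (approx x m) (f n m N≤n N≤m))
  where
  tri : ∀ p q {e} → ∣ p - q ∣ ≤ e → ∣ p ∣ ≤ ∣ q ∣ + e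
  tri p q {e} d = begin
    ∣ p ∣              ≡⟨ cong ∣_∣ (solve 2 (λ p q → p := q :+ (p :- q)) refl p q) ⟩
    ∣ q + (p - q) ∣    ≤⟨ ℚₚ.∣p+q∣≤∣p∣+∣q∣ q (p - q) ⟩
    ∣ q ∣ + ∣ p - q ∣  ≤⟨ ℚₚ.+-monoʳ-≤ ∣ q ∣ d ⟩
    ∣ q ∣ + e          ∎

infixl 6 _+ᴿ_ _-ᴿ_
_+ᴿ_ : ℝ → ℝ → ℝ
x +ᴿ y = mkℝ (λ n → approx x n + approx y n) λ ε 0<ε →
  let (N , f) = cauchy x (½ * ε) (0<* 0<½ 0<ε)
      (M , g) = cauchy y (½ * ε) (0<* 0<½ 0<ε)
  in N ℕ.⊔ M , λ m n ≤m ≤n → begin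
    ∣ (approx x m + approx y m) - (approx x n + approx y n) ∣
      ≡⟨ cong ∣_∣ (solve 4 (λ a b c d → (a :+ b) :- (c :+ d) := (a :- c) :+ (b :- d)) refl
           (approx x m) (approx y m) (approx x n) (approx y n)) ⟩
    ∣ (approx x m - approx x n) + (approx y m - approx y n) ∣
      ≤⟨ ℚₚ.∣p+q∣≤∣p∣+∣q∣ (approx x m - approx x n) (approx y m - approx y n) ⟩
    ∣ approx x m - approx x n ∣ + ∣ approx y m - approx y n ∣
      ≤⟨ ℚₚ.+-mono-≤ (f m n (⊔-l N M ≤m) (⊔-l N M ≤n)) (g m n (⊔-r N M ≤m) (⊔-r N M ≤n)) ⟩
    ½ * ε + ½ * ε
      ≡⟨ halves ε ⟩
    ε ∎

_-ᴿ_ : ℝ → ℝ → ℝ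
x -ᴿ y = x +ᴿ (-ᴿ y)

module _ where

  bounded : ∀ x → ∃ λ B → 0ℚ < B × Eventually (λ n → ∣ approx x n ∣ ≤ B)
  bounded x = let (N , f) = cauchy x 1ℚ 0<1 in
    ∣ approx x N ∣ + 1ℚ ,
    ℚₚ.<-≤-trans 0<1 (subst (_≤ ∣ approx x N ∣ + 1ℚ) (ℚₚ.+-identityˡ 1ℚ)
                        (ℚₚ.+-monoˡ-≤ 1ℚ (ℚₚ.0≤∣p∣ (approx x N)))) ,
    N , λ n N≤n → begin
      ∣ approx x n ∣
        ≡⟨ cong ∣_∣ (solve 2 (λ p q → p := q :+ (p :- q)) refl (approx x n) (approx x N)) ⟩
      ∣ approx x N + (approx x n - approx x N) ∣
        ≤⟨ ℚₚ.∣p+q∣≤∣p∣+∣q∣ (approx x N) (approx x n - approx x N) ⟩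
      ∣ approx x N ∣ + ∣ approx x n - approx x N ∣
        ≤⟨ ℚₚ.+-monoʳ-≤ ∣ approx x N ∣ (f n N N≤n ℕₚ.≤-refl) ⟩
      ∣ approx x N ∣ + 1ℚ ∎

-- The reciprocal of a rational, with the junk value 0 at 0.
inv : ℚ → ℚ
inv q with q ℚₚ.≟ 0ℚ
... | yes _   = 0ℚ
... | no q≢0 = (1/ q) {{ℚ.≢-nonZero q≢0}}

module _ where

  inv-inverse : ∀ q → q ≢ 0ℚ → inv q * q ≡ 1ℚ
  inv-inverse q q≢0 with q ℚₚ.≟ 0ℚ
  ... | yes q≡0 = ⊥-elim (q≢0 q≡0)
  ... | no  ¬q  = ℚₚ.*-inverseˡ q {{ℚ.≢-nonZero ¬q}}

  pos⇒≢ : ∀ {q} → 0ℚ < q → q ≢ 0ℚ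
  pos⇒≢ 0<q refl = ℚₚ.<-irrefl refl 0<q

  inv-pos : ∀ q → 0ℚ < q → 0ℚ < inv q
  inv-pos q 0<q = ℚₚ.*-cancelʳ-<-nonNeg q {{nonNegative (ℚₚ.<⇒≤ 0<q)}}
    (subst₂ _<_ (sym (ℚₚ.*-zeroˡ q)) (sym (inv-inverse q (pos⇒≢ 0<q))) 0<1)

infixl 7 _*ᴿ_
_*ᴿ_ : ℝ → ℝ → ℝ
x *ᴿ y = mkℝ (λ n → approx x n * approx y n) λ ε 0<ε →
  let (B , 0<B , K , b) = bounded x
      (C , 0<C , L , c) = bounded y
      0<ε/B = 0<* (0<* 0<½ 0<ε) (inv-pos B 0<B)
      0<ε/C = 0<* (0<* 0<½ 0<ε) (inv-pos C 0<C)
      (M , g) = cauchy y (½ * ε * inv B) 0<ε/B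
      (N , f) = cauchy x (½ * ε * inv C) 0<ε/C
      T = (K ℕ.⊔ L) ℕ.⊔ (M ℕ.⊔ N)
  in T , λ m n ≤m ≤n →
    let xm = approx x m ; xn = approx x n ; ym = approx y m ; yn = approx y n
        K≤m = ⊔-l K L (⊔-l (K ℕ.⊔ L) (M ℕ.⊔ N) ≤m)
        L≤n = ⊔-r K L (⊔-l (K ℕ.⊔ L) (M ℕ.⊔ N) ≤n)
        MN≤ : ∀ {i} → T ℕ.≤ i → M ℕ.⊔ N ℕ.≤ i
        MN≤ = ⊔-r (K ℕ.⊔ L) (M ℕ.⊔ N)
    in begin
    ∣ xm * ym - xn * yn ∣
      ≡⟨ cong ∣_∣ (solve 4 (λ a b c d → a :* b :- c :* d := a :* (b :- d) :+ d :* (a :- c))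
                    refl xm ym xn yn) ⟩
    ∣ xm * (ym - yn) + yn * (xm - xn) ∣
      ≤⟨ ℚₚ.∣p+q∣≤∣p∣+∣q∣ (xm * (ym - yn)) (yn * (xm - xn)) ⟩
    ∣ xm * (ym - yn) ∣ + ∣ yn * (xm - xn) ∣
      ≡⟨ cong₂ _+_ (ℚₚ.∣p*q∣≡∣p∣*∣q∣ xm (ym - yn)) (ℚₚ.∣p*q∣≡∣p∣*∣q∣ yn (xm - xn)) ⟩
    ∣ xm ∣ * ∣ ym - yn ∣ + ∣ yn ∣ * ∣ xm - xn ∣
      ≤⟨ ℚₚ.+-mono-≤
           (*-mono-≤-nonNeg (ℚₚ.0≤∣p∣ xm) (b m K≤m) (ℚₚ.0≤∣p∣ (ym - yn))
                     (g m n (⊔-l M N (MN≤ ≤m)) (⊔-l M N (MN≤ ≤n))))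
           (*-mono-≤-nonNeg (ℚₚ.0≤∣p∣ yn) (c n L≤n) (ℚₚ.0≤∣p∣ (xm - xn))
                     (f m n (⊔-r M N (MN≤ ≤m)) (⊔-r M N (MN≤ ≤n)))) ⟩
    B * (½ * ε * inv B) + C * (½ * ε * inv C)
      ≡⟨ cong₂ _+_ (cancel B ε 0<B) (cancel C ε 0<C) ⟩
    ½ * ε + ½ * ε
      ≡⟨ halves ε ⟩
    ε ∎
  where
  cancel : ∀ b e → 0ℚ < b → b * (½ * e * inv b) ≡ ½ * e
  cancel b e 0<b = begin-equality
    b * (½ * e * inv b)  ≡⟨ solve 3 (λ b h i → b :* (h :* i) := (i :* b) :* h) refl b (½ * e) (inv b) ⟩
    (inv b * b) * (½ * e) ≡⟨ cong (_* (½ * e)) (inv-inverse b (pos⇒≢ 0<b)) ⟩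
    1ℚ * (½ * e)         ≡⟨ ℚₚ.*-identityˡ (½ * e) ⟩
    ½ * e                ∎

infixr 8 _^ᴿ_
_^ᴿ_ : ℝ → ℕ → ℝ
x ^ᴿ zero  = fromℚ 1ℚ
x ^ᴿ suc n = x *ᴿ x ^ᴿ n

infix 4 _<ᴿ_
_<ᴿ_ : ℝ → ℝ → Set
x <ᴿ y = ∃ λ δ → 0ℚ < δ × Eventually (λ n → approx x n + δ ≤ approx y n)

0ᴿ : ℝ
0ᴿ = fromℚ 0ℚ

Apart0 : ℝ → Set
Apart0 x = 0ᴿ <ᴿ ∣ x ∣ᴿ

0<⇒apart0 : ∀ {x} → 0ᴿ <ᴿ x → Apart0 x
0<⇒apart0 {x} (δ , 0<δ , N , f) =
  δ , 0<δ , N , λ n N≤n → ℚₚ.≤-trans (f n N≤n) (p≤∣p∣ (approx x n))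

recip : (x : ℝ) → Apart0 x → ℝ
recip x (δ , 0<δ , K , away) = mkℝ (λ n → inv (approx x n)) λ ε 0<ε →
  let (N , f) = cauchy x (ε * (δ * δ)) (0<* 0<ε (0<* 0<δ 0<δ)) in
  K ℕ.⊔ N , λ m n ≤m ≤n →
    let p = approx x m ; q = approx x n ; i = inv δ
        δ≤p = δ≤ m (⊔-l K N ≤m) ; δ≤q = δ≤ n (⊔-l K N ≤n)
    in begin
    ∣ inv p - inv q ∣
      ≡⟨ cong ∣_∣ (diff p q δ≤p δ≤q) ⟩
    ∣ (inv p * inv q) * (q - p) ∣
      ≡⟨ ℚₚ.∣p*q∣≡∣p∣*∣q∣ (inv p * inv q) (q - p) ⟩
    ∣ inv p * inv q ∣ * ∣ q - p ∣
      ≡⟨ cong (_* ∣ q - p ∣) (ℚₚ.∣p*q∣≡∣p∣*∣q∣ (inv p) (inv q)) ⟩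
    (∣ inv p ∣ * ∣ inv q ∣) * ∣ q - p ∣
      ≤⟨ *-mono-≤-nonNeg (0≤* (ℚₚ.0≤∣p∣ (inv p)) (ℚₚ.0≤∣p∣ (inv q)))
           (*-mono-≤-nonNeg (ℚₚ.0≤∣p∣ (inv p)) (inv≤ p δ≤p) (ℚₚ.0≤∣p∣ (inv q)) (inv≤ q δ≤q))
           (ℚₚ.0≤∣p∣ (q - p)) (f n m (⊔-r K N ≤n) (⊔-r K N ≤m)) ⟩
    (i * i) * (ε * (δ * δ))
      ≡⟨ solve 3 (λ i e d → (i :* i) :* (e :* (d :* d)) := e :* ((i :* d) :* (i :* d))) refl i ε δ ⟩
    ε * ((i * δ) * (i * δ))
      ≡⟨ cong (λ t → ε * (t * t)) (inv-inverse δ (pos⇒≢ 0<δ)) ⟩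
    ε * (1ℚ * 1ℚ)
      ≡⟨ ℚₚ.*-identityʳ ε ⟩
    ε ∎
  where
  δ≤ : ∀ n → K ℕ.≤ n → δ ≤ ∣ approx x n ∣
  δ≤ n K≤n = subst (_≤ ∣ approx x n ∣) (ℚₚ.+-identityˡ δ) (away n K≤n)
  ≢0 : ∀ {p} → δ ≤ ∣ p ∣ → p ≢ 0ℚ
  ≢0 δ≤p refl = ℚₚ.<-irrefl refl (ℚₚ.<-≤-trans 0<δ δ≤p)
  diff : ∀ p q → δ ≤ ∣ p ∣ → δ ≤ ∣ q ∣ → inv p - inv q ≡ (inv p * inv q) * (q - p)
  diff p q δ≤p δ≤q = begin-equality
    inv p - inv q
      ≡⟨ solve 2 (λ i j → i :- j := i :* con 1ℚ :- j :* con 1ℚ) refl (inv p) (inv q) ⟩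
    inv p * 1ℚ - inv q * 1ℚ
      ≡⟨ cong₂ (λ s t → inv p * s - inv q * t)
           (sym (inv-inverse q (≢0 δ≤q))) (sym (inv-inverse p (≢0 δ≤p))) ⟩
    inv p * (inv q * q) - inv q * (inv p * p)
      ≡⟨ solve 4 (λ i j p q → i :* (j :* q) :- j :* (i :* p) := (i :* j) :* (q :- p)) refl
           (inv p) (inv q) p q ⟩
    (inv p * inv q) * (q - p) ∎
  inv≤ : ∀ p → δ ≤ ∣ p ∣ → ∣ inv p ∣ ≤ inv δ
  inv≤ p δ≤p = ℚₚ.*-cancelʳ-≤-pos δ {{positive 0<δ}} (begin
    ∣ inv p ∣ * δ     ≤⟨ ℚₚ.*-monoˡ-≤-nonNeg ∣ inv p ∣ {{nonNegative (ℚₚ.0≤∣p∣ (inv p))}} δ≤p ⟩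
    ∣ inv p ∣ * ∣ p ∣ ≡⟨ ℚₚ.∣p*q∣≡∣p∣*∣q∣ (inv p) p ⟨
    ∣ inv p * p ∣     ≡⟨ cong ∣_∣ (inv-inverse p (≢0 δ≤p)) ⟩
    1ℚ                ≡⟨ inv-inverse δ (pos⇒≢ 0<δ) ⟨
    inv δ * δ         ∎)

infixl 7 _÷ᴿ_[_]
_÷ᴿ_[_] : ℝ → (y : ℝ) → Apart0 y → ℝ
x ÷ᴿ y [ y#0 ] = x *ᴿ recip y y#0

-- r / (k + 1)
grid : ℕ → ℕ → ℚ
grid k r = + r / suc k

-- The largest r ≤ B with P r, or 0.
largest : {P : ℕ → Set} → (∀ r → Dec (P r)) → ℕ → ℕ
largest P? zero    = zero
largest P? (suc r) with P? (suc r)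
... | yes _ = suc r
... | no  _ = largest P? r

SquareBelow : ℚ → ℕ → ℕ → Set
SquareBelow q k r = grid k r * grid k r ≤ q

squareBelow? : ∀ q k r → Dec (SquareBelow q k r)
squareBelow? q k r = grid k r * grid k r ℚₚ.≤? q

-- The largest multiple s ≥ 0 of 1/(k+1) with s² ≤ q, or 0 when q < 0.  The search
-- may start at |numerator of q| + 1, whose square exceeds q.
rootℚ : ℚ → ℕ → ℚ
rootℚ q k = grid k (largest (squareBelow? q k) (suc ℤ.∣ ℚ.↥ q ∣ ℕ.* suc k))

module _ where

  toℚᵘ-/ : ∀ i n → ℚ.toℚᵘ (i / suc n) ℚᵘ.≃ ℚᵘ.mkℚᵘ i n
  toℚᵘ-/ i n = ℚₚ.toℚᵘ-fromℚᵘ (ℚᵘ.mkℚᵘ i n)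

  /-≤ : ∀ i m j n → i ℤ.* + suc n ℤ.≤ j ℤ.* + suc m → i / suc m ≤ j / suc n
  /-≤ i m j n le = ℚₚ.toℚᵘ-cancel-≤
    (ℚᵘₚ.≤-respˡ-≃ (ℚᵘₚ.≃-sym (toℚᵘ-/ i m))
      (ℚᵘₚ.≤-respʳ-≃ (ℚᵘₚ.≃-sym (toℚᵘ-/ j n)) (ℚᵘ.*≤* le)))

  +/-≤ : ∀ a m b n → a ℕ.* suc n ℕ.≤ b ℕ.* suc m → + a / suc m ≤ + b / suc n
  +/-≤ a m b n le = /-≤ (+ a) m (+ b) n
    (subst₂ ℤ._≤_ (ℤₚ.pos-* a (suc n)) (ℤₚ.pos-* b (suc m)) (ℤ.+≤+ le))

  grid-+ : ∀ k r → grid k (suc r) ≡ grid k r + grid k 1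
  grid-+ k r = ℚₚ.toℚᵘ-injective
    (ℚᵘₚ.≃-trans (toℚᵘ-/ (+ suc r) k)
    (ℚᵘₚ.≃-trans (ℚᵘ.*≡* (eq (+ r) (+ suc k)))
    (ℚᵘₚ.≃-sym (ℚᵘₚ.≃-trans (ℚₚ.toℚᵘ-homo-+ (grid k r) (grid k 1))
      (ℚᵘₚ.+-cong (toℚᵘ-/ (+ r) k) (toℚᵘ-/ (+ 1) k))))))
    where
    eq : ∀ x y → (+ 1 ℤ.+ x) ℤ.* (y ℤ.* y) ≡ (x ℤ.* y ℤ.+ + 1 ℤ.* y) ℤ.* y
    eq = ℤ-Ring.solve-∀

  grid-mono : ∀ k {r t} → r ℕ.≤ t → grid k r ≤ grid k t
  grid-mono k {r} {t} r≤t = +/-≤ r k t k (ℕₚ.*-monoˡ-≤ (suc k) r≤t)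

  grid-0 : ∀ k → grid k 0 ≡ 0ℚ
  grid-0 k = ℚₚ.0/n≡0 (suc k)

  0≤grid : ∀ k r → 0ℚ ≤ grid k r
  0≤grid k r = subst (_≤ grid k r) (grid-0 k) (grid-mono k {0} {r} ℕ.z≤n)

  archimedean : ∀ ε → 0ℚ < ε → Eventually (λ n → grid n 1 ≤ ε)
  archimedean ε@(ℚ.mkℚ (+ suc a) d c) 0<ε = d , λ n d≤n →
    subst (grid n 1 ≤_) (ℚₚ.↥p/↧p≡p ε)
      (+/-≤ 1 n (suc a) d (ℕₚ.*-mono-≤ (ℕ.s≤s (ℕ.z≤n {a})) (ℕ.s≤s d≤n)))
  archimedean (ℚ.mkℚ (+ zero) d c) (ℚ.*<* lt) = ⊥-elim (ℤₚ.<-irrefl refl lt)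
  archimedean (ℚ.mkℚ (ℤ.-[1+ a ]) d c) (ℚ.*<* ())

  ≤∣↥∣ : ∀ q → q ≤ grid 0 ℤ.∣ ℚ.↥ q ∣
  ≤∣↥∣ q@(ℚ.mkℚ n d c) = subst (_≤ grid 0 ℤ.∣ n ∣) (ℚₚ.↥p/↧p≡p q)
    (/-≤ n d (+ ℤ.∣ n ∣) 0 (le n))
    where
    le : ∀ n → n ℤ.* + 1 ℤ.≤ + ℤ.∣ n ∣ ℤ.* + suc d
    le (+ n) = subst₂ ℤ._≤_ (ℤₚ.pos-* n 1) (ℤₚ.pos-* n (suc d))
                 (ℤ.+≤+ (ℕₚ.*-monoʳ-≤ n (ℕ.s≤s ℕ.z≤n)))
    le ℤ.-[1+ n ] = subst (ℤ.-[1+ n ] ℤ.* + 1 ℤ.≤_) (ℤₚ.pos-* (suc n) (suc d)) ℤ.-≤+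

  largest-satisfies : ∀ {P : ℕ → Set} (P? : ∀ r → Dec (P r)) B →
                      largest P? B ≡ 0 ⊎ P (largest P? B)
  largest-satisfies P? zero    = inj₁ refl
  largest-satisfies P? (suc r) with P? (suc r)
  ... | yes p = inj₂ p
  ... | no  _ = largest-satisfies P? r

  largest-maximal : ∀ {P : ℕ → Set} (P? : ∀ r → Dec (P r)) B →
                    ¬ P (suc B) → ¬ P (suc (largest P? B))
  largest-maximal P? zero    ¬p = ¬p
  largest-maximal P? (suc r) ¬p with P? (suc r)
  ... | yes _  = ¬p
  ... | no  ¬q = largest-maximal P? r ¬q

  searchBound : ℚ → ℕ → ℕ
  searchBound q k = suc ℤ.∣ ℚ.↥ q ∣ ℕ.* suc k

  0≤root : ∀ q k → 0ℚ ≤ rootℚ q k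
  0≤root q k = 0≤grid k (largest (squareBelow? q k) (searchBound q k))

  root-lower : ∀ q k → rootℚ q k ≡ 0ℚ ⊎ rootℚ q k * rootℚ q k ≤ q
  root-lower q k = map₁ (λ eq → trans (cong (grid k) eq) (grid-0 k))
    (largest-satisfies (squareBelow? q k) (searchBound q k))

  bound-exceeds : ∀ q k → q < grid k (suc (searchBound q k)) * grid k (suc (searchBound q k))
  bound-exceeds q k = begin-strict
    q                               ≤⟨ ≤∣↥∣ q ⟩
    grid 0 a                        ≡⟨ ℚₚ.+-identityʳ (grid 0 a) ⟨
    grid 0 a + 0ℚ                   <⟨ ℚₚ.+-monoʳ-< (grid 0 a) 0<1 ⟩
    grid 0 a + grid 0 1             ≡⟨ grid-+ 0 a ⟨
    m                               ≡⟨ ℚₚ.*-identityˡ m ⟨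
    1ℚ * m                          ≤⟨ *-mono-≤-nonNeg (ℚₚ.<⇒≤ 0<1) (grid-mono 0 {1} {suc a} (ℕ.s≤s ℕ.z≤n))
                                                (0≤grid 0 (suc a)) ℚₚ.≤-refl ⟩
    m * m                           ≤⟨ *-mono-≤-nonNeg (0≤grid 0 (suc a)) m≤ (0≤grid 0 (suc a)) m≤ ⟩
    grid k (suc B) * grid k (suc B) ∎
    where
    a = ℤ.∣ ℚ.↥ q ∣
    m = grid 0 (suc a)
    B = suc a ℕ.* suc k
    m≤ : m ≤ grid k (suc B)
    m≤ = +/-≤ (suc a) 0 (suc B) k
      (ℕₚ.≤-trans (ℕₚ.n≤1+n B) (ℕₚ.≤-reflexive (sym (ℕₚ.*-identityʳ (suc B)))))

  root-upper : ∀ q k → q < (rootℚ q k + grid k 1) * (rootℚ q k + grid k 1)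
  root-upper q k = subst (λ t → q < t * t)
    (grid-+ k (largest (squareBelow? q k) (searchBound q k)))
    (ℚₚ.≰⇒> (largest-maximal (squareBelow? q k) (searchBound q k)
      λ le → ℚₚ.<-irrefl refl (ℚₚ.<-≤-trans (bound-exceeds q k) le)))

  sq-mono : ∀ {a b} → 0ℚ ≤ a → a ≤ b → a * a ≤ b * b
  sq-mono 0≤a a≤b = *-mono-≤-nonNeg 0≤a a≤b 0≤a a≤b

  ≤-sum-square : ∀ {s t e g p q} → 0ℚ ≤ t → 0ℚ ≤ e → 0ℚ ≤ g → s * s ≤ p → p ≤ q + e * e →
                 q < (t + g) * (t + g) → s ≤ t + (e + g)
  ≤-sum-square {s} {t} {e} {g} {p} {q} 0≤t 0≤e 0≤g s²≤p p≤ q< =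
    ℚₚ.≮⇒≥ λ lt → ℚₚ.<-irrefl refl (begin-strict
      s * s                      ≤⟨ s²≤p ⟩
      p                          ≤⟨ p≤ ⟩
      q + e * e                  <⟨ ℚₚ.+-monoˡ-< (e * e) q< ⟩
      u * u + e * e              ≡⟨ ℚₚ.+-identityʳ (u * u + e * e) ⟨
      (u * u + e * e) + 0ℚ       ≤⟨ ℚₚ.+-monoʳ-≤ (u * u + e * e) (ℚₚ.+-mono-≤ 0≤ue 0≤ue) ⟩
      (u * u + e * e) + (u * e + u * e)
        ≡⟨ solve 3 (λ t e g →
             ((t :+ g) :* (t :+ g) :+ e :* e) :+ ((t :+ g) :* e :+ (t :+ g) :* e) :=
             (t :+ (e :+ g)) :* (t :+ (e :+ g))) refl t e g ⟩
      v * v                      ≤⟨ sq-mono (ℚₚ.+-mono-≤ 0≤t (ℚₚ.+-mono-≤ 0≤e 0≤g)) (ℚₚ.<⇒≤ lt) ⟩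
      s * s                      ∎)
    where
    u = t + g
    v = t + (e + g)
    0≤ue : 0ℚ ≤ u * e
    0≤ue = 0≤* (ℚₚ.+-mono-≤ 0≤t 0≤g) 0≤e

  root-close : ∀ p q k l e → 0ℚ ≤ e → p ≤ q + e * e →
               rootℚ p k ≤ rootℚ q l + (e + grid l 1)
  root-close p q k l e 0≤e p≤ =
    [ (λ eq → subst (_≤ rootℚ q l + (e + grid l 1)) (sym eq)
                (ℚₚ.+-mono-≤ (0≤root q l) (ℚₚ.+-mono-≤ 0≤e (0≤grid l 1))))
    , (λ le → ≤-sum-square (0≤root q l) 0≤e (0≤grid l 1) le p≤ (root-upper q l))
    ]′ (root-lower p k)

-- √ x is the square root of max(x, 0).
√ : ℝ → ℝ
√ x = mkℝ (λ n → rootℚ (approx x n) n) λ ε 0<ε →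
  let e = ½ * ε
      0<e = 0<* 0<½ 0<ε
      (N , f) = cauchy x (e * e) (0<* 0<e 0<e)
      (M , g) = archimedean e 0<e
      close : ∀ m n → N ℕ.⊔ M ℕ.≤ m → N ℕ.⊔ M ℕ.≤ n →
              rootℚ (approx x m) m ≤ rootℚ (approx x n) n + ε
      close m n ≤m ≤n = ℚₚ.≤-trans
        (root-close (approx x m) (approx x n) m n e (ℚₚ.<⇒≤ 0<e)
          (≤-dist {approx x m} {approx x n} (f m n (⊔-l N M ≤m) (⊔-l N M ≤n))))
        (ℚₚ.+-monoʳ-≤ (rootℚ (approx x n) n)
          (subst (e + grid n 1 ≤_) (halves ε) (ℚₚ.+-monoʳ-≤ e (g n (⊔-r N M ≤n)))))
  in N ℕ.⊔ M , λ m n ≤m ≤n → dist-≤ (close m n ≤m ≤n) (close n m ≤n ≤m)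

√-pos : ∀ x → 0ᴿ <ᴿ x → 0ᴿ <ᴿ √ x
√-pos x (δ , 0<δ , N , f) = η , 0<η , N ℕ.⊔ M , λ n ≤n → subst (_≤ rootℚ (approx x n) n)
    (sym (ℚₚ.+-identityˡ η)) (bound n (f n (⊔-l N M ≤n)) (g n (⊔-r N M ≤n)))
  where
  δ₁ = δ ℚ.⊓ 1ℚ
  0<δ₁ : 0ℚ < δ₁
  0<δ₁ with ℚₚ.⊓-sel δ 1ℚ
  ... | inj₁ eq = subst (0ℚ <_) (sym eq) 0<δ
  ... | inj₂ eq = subst (0ℚ <_) (sym eq) 0<1
  η = ½ * δ₁
  0<η : 0ℚ < η
  0<η = 0<* 0<½ 0<δ₁
  M = proj₁ (archimedean η 0<η)
  g = proj₂ (archimedean η 0<η)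
  bound : ∀ n → 0ℚ + δ ≤ approx x n → grid n 1 ≤ η → η ≤ rootℚ (approx x n) n
  bound n δ≤ g≤ = ℚₚ.≮⇒≥ λ lt → ℚₚ.<-irrefl refl (begin-strict
    δ                 ≡⟨ ℚₚ.+-identityˡ δ ⟨
    0ℚ + δ            ≤⟨ δ≤ ⟩
    approx x n        <⟨ root-upper (approx x n) n ⟩
    t * t             ≤⟨ sq-mono (ℚₚ.+-mono-≤ (0≤root (approx x n) n) (0≤grid n 1))
                                 (ℚₚ.+-mono-≤ (ℚₚ.<⇒≤ lt) g≤) ⟩
    (η + η) * (η + η) ≡⟨ cong (λ z → z * z) (halves δ₁) ⟩
    δ₁ * δ₁           ≤⟨ *-mono-≤-nonNeg (ℚₚ.<⇒≤ 0<δ₁) (ℚₚ.p⊓q≤p δ 1ℚ) (ℚₚ.<⇒≤ 0<δ₁) (ℚₚ.p⊓q≤q δ 1ℚ) ⟩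
    δ * 1ℚ            ≡⟨ ℚₚ.*-identityʳ δ ⟩
    δ                 ∎)
    where t = rootℚ (approx x n) n + grid n 1

*-pos : ∀ x y → 0ᴿ <ᴿ x → 0ᴿ <ᴿ y → 0ᴿ <ᴿ x *ᴿ y
*-pos x y (δ , 0<δ , N , f) (γ , 0<γ , M , g) = δ * γ , 0<* 0<δ 0<γ , N ℕ.⊔ M , λ n ≤n → begin
    0ℚ + δ * γ              ≡⟨ ℚₚ.+-identityˡ (δ * γ) ⟩
    δ * γ                   ≤⟨ *-mono-≤-nonNeg (ℚₚ.<⇒≤ 0<δ) (drop0 (f n (⊔-l N M ≤n)))
                                        (ℚₚ.<⇒≤ 0<γ) (drop0 (g n (⊔-r N M ≤n))) ⟩
    approx x n * approx y n ∎
  where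
  drop0 : ∀ {a b} → 0ℚ + a ≤ b → a ≤ b
  drop0 {a} {b} = subst (_≤ b) (ℚₚ.+-identityˡ a)

fromℚ-pos : ∀ q → 0ℚ < q → 0ᴿ <ᴿ fromℚ q
fromℚ-pos q 0<q = q , 0<q , 0 , λ _ _ → ℚₚ.≤-reflexive (ℚₚ.+-identityˡ q)

-- (-1)ᵏ
sign : ℕ → ℚ
sign zero    = 1ℚ
sign (suc k) = - sign k

-- The partial sums of Leibniz's series π = Σₖ (-1)ᵏ 4/(2k+1).
leibniz : ℕ → ℚ
leibniz zero    = 0ℚ
leibniz (suc n) = leibniz n + sign n * (+ 4 / suc (2 ℕ.* n))

module _ where

  term : ℕ → ℚ
  term k = + 4 / suc (2 ℕ.* k)

  alt : ℕ → ℕ → ℚ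
  alt m zero    = 0ℚ
  alt m (suc l) = term m - alt (suc m) l

  leibniz-alt : ∀ m l → leibniz (l ℕ.+ m) ≡ leibniz m + sign m * alt m l
  leibniz-alt m zero = solve 2 (λ s g → s := s :+ g :* con 0ℚ) refl (leibniz m) (sign m)
  leibniz-alt m (suc l) = begin-equality
    leibniz (suc l ℕ.+ m)  ≡⟨ cong leibniz (ℕₚ.+-suc l m) ⟨
    leibniz (l ℕ.+ suc m)  ≡⟨ leibniz-alt (suc m) l ⟩
    (leibniz m + sign m * term m) + (- sign m) * alt (suc m) l
      ≡⟨ solve 4 (λ s g t a → (s :+ g :* t) :+ (:- g) :* a := s :+ g :* (t :- a)) refl
           (leibniz m) (sign m) (term m) (alt (suc m) l) ⟩
    leibniz m + sign m * (term m - alt (suc m) l) ∎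

  term-anti : ∀ m → term (suc m) ≤ term m
  term-anti m = +/-≤ 4 (2 ℕ.* suc m) 4 (2 ℕ.* m)
    (ℕₚ.*-monoʳ-≤ 4 (ℕ.s≤s (ℕₚ.*-monoʳ-≤ 2 (ℕₚ.n≤1+n m))))

  0≤term : ∀ m → 0ℚ ≤ term m
  0≤term m = subst (_≤ term m) (grid-0 (2 ℕ.* m)) (grid-mono (2 ℕ.* m) {0} {4} ℕ.z≤n)

  alt-bounds : ∀ m l → 0ℚ ≤ alt m l × alt m l ≤ term m
  alt-bounds m zero    = ℚₚ.≤-refl , 0≤term m
  alt-bounds m (suc l) = let (lo , hi) = alt-bounds (suc m) l in
    subst (_≤ term m - alt (suc m) l) (ℚₚ.+-inverseʳ (alt (suc m) l))
      (ℚₚ.+-monoˡ-≤ (- alt (suc m) l) (ℚₚ.≤-trans hi (term-anti m))) ,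
    subst (term m - alt (suc m) l ≤_) (ℚₚ.+-identityʳ (term m))
      (ℚₚ.+-monoʳ-≤ (term m) (ℚₚ.neg-antimono-≤ lo))

  ∣sign∣ : ∀ m → ∣ sign m ∣ ≡ 1ℚ
  ∣sign∣ zero    = refl
  ∣sign∣ (suc m) = trans (ℚₚ.∣-p∣≡∣p∣ (sign m)) (∣sign∣ m)

  leibniz-near : ∀ m l → ∣ leibniz (l ℕ.+ m) - leibniz m ∣ ≤ term m
  leibniz-near m l = let (lo , hi) = alt-bounds m l in begin
    ∣ leibniz (l ℕ.+ m) - leibniz m ∣
      ≡⟨ cong (λ z → ∣ z - leibniz m ∣) (leibniz-alt m l) ⟩
    ∣ (leibniz m + sign m * alt m l) - leibniz m ∣
      ≡⟨ cong ∣_∣ (solve 2 (λ s t → (s :+ t) :- s := t) refl (leibniz m) (sign m * alt m l)) ⟩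
    ∣ sign m * alt m l ∣      ≡⟨ ℚₚ.∣p*q∣≡∣p∣*∣q∣ (sign m) (alt m l) ⟩
    ∣ sign m ∣ * ∣ alt m l ∣  ≡⟨ cong₂ _*_ (∣sign∣ m) (ℚₚ.0≤p⇒∣p∣≡p lo) ⟩
    1ℚ * alt m l              ≡⟨ ℚₚ.*-identityˡ (alt m l) ⟩
    alt m l                   ≤⟨ hi ⟩
    term m                    ∎

  leibniz-near-≤ : ∀ {m n} → m ℕ.≤ n → ∣ leibniz n - leibniz m ∣ ≤ term m
  leibniz-near-≤ {m} {n} m≤n =
    subst (λ i → ∣ leibniz i - leibniz m ∣ ≤ term m) (ℕₚ.m∸n+n≡m m≤n) (leibniz-near m (n ℕ.∸ m))

  term-small : ∀ ε → 0ℚ < ε → ∃ λ N → ∀ {m} → N ℕ.≤ m → term m ≤ ε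
  term-small ε 0<ε = let (N , f) = archimedean (grid 3 1 * ε) (0<* (ℚₚ.positive⁻¹ (grid 3 1)) 0<ε) in
    N , λ {m} N≤m → begin
      term m ≡⟨ four (2 ℕ.* m) ⟩
      grid 0 4 * grid (2 ℕ.* m) 1
        ≤⟨ ℚₚ.*-monoˡ-≤-nonNeg (grid 0 4) (f (2 ℕ.* m) (ℕₚ.≤-trans N≤m (ℕₚ.m≤n*m m 2))) ⟩
      grid 0 4 * (grid 3 1 * ε)  ≡⟨ ℚₚ.*-assoc (grid 0 4) (grid 3 1) ε ⟨
      1ℚ * ε                     ≡⟨ ℚₚ.*-identityˡ ε ⟩
      ε ∎
    where
    four : ∀ k → grid k 4 ≡ grid 0 4 * grid k 1
    four k = begin-equality
      grid k 4  ≡⟨ trans (grid-+ k 3) (cong (_+ grid k 1) (trans (grid-+ k 2) (cong (_+ grid k 1) (grid-+ k 1)))) ⟩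
      grid k 1 + grid k 1 + grid k 1 + grid k 1
        ≡⟨ solve 1 (λ g → g :+ g :+ g :+ g := con (grid 0 4) :* g) refl (grid k 1) ⟩
      grid 0 4 * grid k 1 ∎

π : ℝ
π = mkℝ leibniz λ ε 0<ε → let (N , small) = term-small ε 0<ε in
  N , λ m n N≤m N≤n → near N small m n N≤m N≤n (ℕₚ.≤-total m n)
  where
  near : ∀ N {ε} → (∀ {m} → N ℕ.≤ m → term m ≤ ε) → ∀ m n → N ℕ.≤ m → N ℕ.≤ n →
         m ℕ.≤ n ⊎ n ℕ.≤ m → ∣ leibniz m - leibniz n ∣ ≤ ε
  near N {ε} small m n N≤m N≤n (inj₁ m≤n) =
    subst (_≤ ε) (dist-sym (leibniz n) (leibniz m)) (ℚₚ.≤-trans (leibniz-near-≤ m≤n) (small N≤m))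
  near N small m n N≤m N≤n (inj₂ n≤m) = ℚₚ.≤-trans (leibniz-near-≤ n≤m) (small N≤n)

π-pos : 0ᴿ <ᴿ π
π-pos = 1ℚ , 0<1 , 1 , λ n 1≤n → begin
    0ℚ + 1ℚ             ≤⟨ ℚₚ.≤ᵇ⇒≤ {0ℚ + 1ℚ} {leibniz 1 - term 1} _ ⟩
    leibniz 1 - term 1  ≤⟨ lower n 1≤n ⟩
    leibniz n           ∎
  where
  lower : ∀ n → 1 ℕ.≤ n → leibniz 1 - term 1 ≤ leibniz n
  lower n 1≤n = begin
    leibniz 1 - term 1
      ≤⟨ ℚₚ.+-monoˡ-≤ (- term 1) (≤-dist {leibniz 1} {leibniz n}
           (subst (_≤ term 1) (dist-sym (leibniz n) (leibniz 1)) (leibniz-near-≤ 1≤n))) ⟩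
    leibniz n + term 1 - term 1
      ≡⟨ solve 2 (λ a b → a :+ b :- b := a) refl (leibniz n) (term 1) ⟩
    leibniz n ∎

fromℕ : ℕ → ℝ
fromℕ n = fromℚ (+ n / 1)

fromℕ-pos : ∀ n → .{{NonZero n}} → 0ᴿ <ᴿ fromℕ n
fromℕ-pos n = fromℚ-pos (+ n / 1) (ℚₚ.positive⁻¹ (+ n / 1) {{ℚₚ.normalize-pos n 1}})

-- aₙ ~ bₙ for sequences indexed by n ≥ 1: for large n the quotient aₙ/bₙ is
-- defined, and it tends to 1.
infix 4 _~_
_~_ : (a b : (n : ℕ) → .{{NonZero n}} → ℝ) → Set
a ~ b = ∀ ε → 0ℚ < ε → ∃ λ N → ∀ n → .{{_ : NonZero n}} → N ℕ.≤ n →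
  Σ (Apart0 (b n)) λ bₙ#0 → ∣ a n ÷ᴿ b n [ bₙ#0 ] -ᴿ fromℕ 1 ∣ᴿ <ᴿ fromℚ ε

√2 : ℝ
√2 = √ (fromℕ 2)

√[√2nπ]#0 : ∀ n → .{{NonZero n}} → Apart0 (√ (√2 *ᴿ fromℕ n *ᴿ π))
√[√2nπ]#0 n = 0<⇒apart0 {√ (√2 *ᴿ fromℕ n *ᴿ π)} (√-pos (√2 *ᴿ fromℕ n *ᴿ π)
  (*-pos (√2 *ᴿ fromℕ n) π (*-pos √2 (fromℕ n) (√-pos (fromℕ 2) (fromℕ-pos 2)) (fromℕ-pos n)) π-pos))

{-# OPTIONS --safe #-}
module Submission where

-- A path of 𝒮ₙ is covered exactly by the paths obtained from it by turning one H into UD or one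
-- DU into H: these moves raise the sum of the heights by one, and below any larger path there is
-- such a move.  Counting pairs (path, move) by starting height and width gives a recurrence, solved
-- by reflection in terms of Delannoy numbers D: rₙ = D(n,n) - D(n-1,n+1) and
-- ℓ(𝒮ₙ) = D(n-1,n+1) - D(n-2,n).
--
-- The three-term recurrence of d becomes the differential equation Δ D′ = (3-x) D, so that D √Δ
-- is constant; the series of r and ℓ follow.
--
-- For the asymptotics let aₙ = C(2n,n)/4ⁿ and eₙ = dₙ/aₙ.  The recurrence of d shows that the
-- ratios eₙ₊₁/eₙ increase to (1+√2)² with errors O(1/n²), hence eₖe₂ₙ₋ₖ ≈ eₙ² for most k.  As
-- Σ aₖa₂ₙ₋ₖ = 1 and Σ dₖd₂ₙ₋ₖ = U₂ₙ, the coefficient of x²ⁿ in 1/Δ, this gives dₙ² ~ aₙ² U₂ₙ,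
-- and U₂ₙ is given by Binet's formula.  Finally aₙ² ~ 1/(πn) is Wallis's product, which follows
-- from Leibniz's series: weighting its terms by C(2n+1,n-k)/C(2n+1,n) gives a finite sum equal to
-- 4(n+1)/((2n+1)aₙ)².

open import Defs
open import Algebra.Bundles using (CommutativeRing)
import Algebra.Solver.Ring as RingSolver
import Algebra.Solver.Ring.AlmostCommutativeRing as ACR
open import Data.Empty using (⊥-elim)
open import Data.Integer as ℤ using ()
import Data.Integer.Tactic.RingSolver as ℤ-Ring
open import Data.List.Base using (List; _++_; map; length; filter; cartesianProduct)
open import Data.List.Membership.Propositional using (_∈_)
open import Data.List.Membership.Propositional.Properties using (∈-map⁺; ∈-map⁻; ∈-++⁺ʳ; ∈-++⁻; ∈-filter⁺; ∈-filter⁻)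
open import Data.List.Membership.Propositional.Properties.WithK using (unique∧set⇒bag)
import Data.List.Properties as Listₚ
open import Data.List.Relation.Binary.BagAndSetEquality using (∼bag⇒↭)
open import Data.List.Relation.Binary.Disjoint.Propositional using (Disjoint)
open import Data.List.Relation.Binary.Permutation.Propositional.Properties using (↭-length)
import Data.List.Relation.Unary.All as All
open import Data.List.Relation.Unary.Any using (here; there)
open import Data.List.Relation.Unary.Unique.Propositional using (Unique)
import Data.List.Relation.Unary.Unique.Propositional.Properties as Uniq
open import Data.Maybe.Base using (Maybe; just; nothing)
open import Data.Nat as ℕ using (ℕ; zero; suc; 2+; NonZero; _!; z≤n; s≤s)
open import Data.Nat.Combinatorics using (_C_; nCk≡n!/k![n-k]!; k![n∸k]!∣n!)
open import Data.Nat.DivMod using (m/n*n≡m)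
import Data.Nat.Properties as ℕₚ
open import Data.Nat.Tactic.RingSolver using (solve-∀)
open import Data.Product using (∃; _×_; _,_; proj₁; proj₂; uncurry)
open import Data.Sum using (_⊎_; inj₁; inj₂)
open import Data.Vec.Base as Vec using (Vec; head; tail)
open import Data.Vec.Relation.Binary.Pointwise.Inductive as PW using (Pointwise)
open import Function.Base using (_∘_)
open import Function.Bundles using (mk⇔)
open import Level using (0ℓ)
open import Relation.Binary.PropositionalEquality
open import Relation.Nullary.Decidable using (yes; no; from-yes)
open import Relation.Unary using (Decidable)

-- Dividing d by a tames the ratios. Those of d differ from their limit by order 1/n, since dₙ
-- decays like n^(-1/2) against a geometric sequence; a decays in the same way, and the recurrence
-- left for e is perturbed only by 1/(4(n+1)²-1). Summing these perturbations bounds the relative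
-- error of eₖe₂ₙ₋ₖ ≈ eₙ² by 1/k (k ≥ 1), uniformly in n. The constant in eₙ ~ c(1+√2)²ⁿ is never
-- computed on its own: the convolution pins down eₙ² itself. All estimates are made for squares, so
-- that √(√2 n π) enters as √2 n π and meets n aₙ² π; the root is taken only at the end.
--
-- Reals are Cauchy sequences of rationals, so a limit statement concerns double sequences, in n and
-- in the precision m. In place of √2 stands a rational s with s² = 2 - τ, and every identity for √2
-- holds up to a bounded multiple of τ, with a bound that may grow with n. Hence the limits are
-- iterated, m after n, and asymptotic equality is stated without division; quotients appear only in
-- the last part.

-- Covers of Schröder paths

module _ where
  open import Data.List.Base using ([]; _∷_)
  open import Data.List.Relation.Unary.AllPairs using ([]; _∷_)
  open import Data.Nat.Base using (_+_; _≤_)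
  open import Data.Vec.Base using ([]; _∷_)
  open import Data.Vec.Relation.Binary.Pointwise.Inductive using ([]; _∷_)

  infix 4 _↝_
  data _↝_ : ∀ {h w} → Path h w → Path h w → Set where
    peak   : ∀ {h w} {p : Path h w} → H p ↝ U (D p)
    valley : ∀ {h w} {p : Path (suc h) w} → D (U p) ↝ H p
    U      : ∀ {h w} {p q : Path (suc h) w} → p ↝ q → U p ↝ U q
    D      : ∀ {h w} {p q : Path h w} → p ↝ q → D p ↝ D q
    H      : ∀ {h w} {p q : Path h w} → p ↝ q → H p ↝ H q

  infix 4 _≤ᵥ_
  _≤ᵥ_ : ∀ {n} → Vec ℕ n → Vec ℕ n → Set
  _≤ᵥ_ = Pointwise ℕ._≤_

  ≤ᵥ-refl : ∀ {n} {u : Vec ℕ n} → u ≤ᵥ u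
  ≤ᵥ-refl = PW.refl ℕₚ.≤-refl

  head-≤ : ∀ {n} {u v : Vec ℕ (suc n)} → u ≤ᵥ v → head u ℕ.≤ head v
  head-≤ (le ∷ _) = le

  tail-≤ : ∀ {n} {u v : Vec ℕ (suc n)} → u ≤ᵥ v → tail u ≤ᵥ tail v
  tail-≤ (_ ∷ le) = le

  start-≤ : ∀ {h k w} (p : Path h w) (q : Path k w) → heights p ≤ᵥ heights q → h ℕ.≤ k
  start-≤ p q p≤q = subst₂ ℕ._≤_ (head-heights p) (head-heights q) (head-≤ p≤q)

  area : ∀ {h w} → Path h w → ℕ
  area p = Vec.sum (heights p)

  sum-mono : ∀ {n} {u v : Vec ℕ n} → u ≤ᵥ v → Vec.sum u ℕ.≤ Vec.sum v
  sum-mono []         = z≤n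
  sum-mono (x≤y ∷ le) = ℕₚ.+-mono-≤ x≤y (sum-mono le)

  sum-strict : ∀ {n} {u v : Vec ℕ n} → u ≤ᵥ v → Vec.sum v ℕ.≤ Vec.sum u → u ≡ v
  sum-strict [] _ = refl
  sum-strict {u = x ∷ u} {y ∷ v} (x≤y ∷ le) s with ℕₚ.m≤n⇒m<n∨m≡n x≤y
  ... | inj₁ x<y  = ⊥-elim (ℕₚ.<⇒≱ (ℕₚ.+-mono-<-≤ x<y (sum-mono le)) s)
  ... | inj₂ refl = cong (x ∷_) (sum-strict le (ℕₚ.+-cancelˡ-≤ x _ _ s))

  ⊏-area : ∀ {h w} {p q : Path h w} → p ⊴ q → p ≢ q → area p ℕ.< area q
  ⊏-area p≤q p≢q = ℕₚ.≰⇒> λ le → p≢q (heights-injective _ _ (sum-strict p≤q le))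

  ↝⇒⊴ : ∀ {h w} {p q : Path h w} → p ↝ q → p ⊴ q
  ↝⇒⊴ peak   = ℕₚ.≤-refl ∷ ℕₚ.n≤1+n _ ∷ ≤ᵥ-refl
  ↝⇒⊴ valley = ℕₚ.≤-refl ∷ ℕₚ.n≤1+n _ ∷ ≤ᵥ-refl
  ↝⇒⊴ (U c)  = ℕₚ.≤-refl ∷ ↝⇒⊴ c
  ↝⇒⊴ (D c)  = ℕₚ.≤-refl ∷ ↝⇒⊴ c
  ↝⇒⊴ (H c)  = ℕₚ.≤-refl ∷ ℕₚ.≤-refl ∷ ↝⇒⊴ c

  ↝-area : ∀ {h w} {p q : Path h w} → p ↝ q → area q ≡ suc (area p)
  ↝-area {h} (peak {p = p})   = ℕₚ.+-suc h (h + area p)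
  ↝-area {suc h} (valley {p = p}) = cong suc (ℕₚ.+-suc h (h + area p))
  ↝-area {h} (U {p = p} c) = trans (cong (h +_) (↝-area c)) (ℕₚ.+-suc h (area p))
  ↝-area {h} (D {p = p} c) = trans (cong (h +_) (↝-area c)) (ℕₚ.+-suc h (area p))
  ↝-area {h} (H {p = p} c) = trans (cong (λ z → h + (h + z)) (↝-area c))
    (trans (cong (h +_) (ℕₚ.+-suc h (area p))) (ℕₚ.+-suc h (h + area p)))

  ↝⇒≢ : ∀ {h w} {p q : Path h w} → p ↝ q → p ≢ q
  ↝⇒≢ c refl = ℕₚ.1+n≢n (sym (↝-area c))

  next-≥ : ∀ {k w} (q : Path k (suc w)) → k ℕ.≤ suc (head (tail (heights q)))
  next-≥ (U q) = subst (λ z → _ ℕ.≤ suc z) (sym (head-heights q)) (ℕₚ.m≤n⇒m≤1+n (ℕₚ.n≤1+n _))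
  next-≥ (D q) = subst (λ z → _ ℕ.≤ suc z) (sym (head-heights q)) ℕₚ.≤-refl
  next-≥ (H q) = ℕₚ.n≤1+n _

  -- `heights q` reduces to a cons only once the first step of `q` is known; this compares with it
  -- without splitting on that step.
  ∷-view : ∀ {n a} {u : Vec ℕ n} (v : Vec ℕ (suc n)) → a ℕ.≤ head v → u ≤ᵥ tail v → (a ∷ u) ≤ᵥ v
  ∷-view (x ∷ v) a≤x le = a≤x ∷ le

  -- The part p of the path D p starts at least two below q; it is raised within this dip,
  -- which leaves room at the starting height.
  raise-dip : ∀ {h k w} (p : Path h w) (q : Path k w) → 2 + h ℕ.≤ k → heights p ≤ᵥ heights q →
              ∃ λ p′ → D p ↝ p′ × (∀ c → suc h ℕ.≤ c → heights p′ ≤ᵥ c ∷ heights q)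
  raise-dip end end () _
  raise-dip {h} {k} (U p) q 2+h≤k le = H p , valley , λ c h<c →
    h<c ∷ ∷-view (heights q) (subst (suc h ℕ.≤_) (sym (head-heights q)) (ℕₚ.<⇒≤ 2+h≤k)) (tail-≤ le)
  raise-dip {h} {k} {suc (suc w)} (H p) q 2+h≤k le = D (U (D p)) , D peak , λ c h<c →
    h<c ∷ ∷-view (heights q) (subst (h ℕ.≤_) (sym (head-heights q)) (ℕₚ.≤-trans (ℕₚ.m≤n+m h 2) 2+h≤k))
            (∷-view (tail (heights q)) (ℕₚ.≤-pred (ℕₚ.≤-trans 2+h≤k (next-≥ q))) (tail-≤ (tail-≤ le)))
  raise-dip {suc h} (D p) (U q) 2+h≤k (_ ∷ le) =
    let (p′ , p↝p′ , below) = raise-dip p q (ℕₚ.m≤n⇒m≤1+n (ℕₚ.<⇒≤ 2+h≤k)) le in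
    D p′ , D p↝p′ , λ c h<c → h<c ∷ below _ (ℕₚ.≤-trans (ℕₚ.m≤n+m (suc h) 2) 2+h≤k)
  raise-dip {suc h} (D p) (D q) 2+h≤k (_ ∷ le) =
    let (p′ , p↝p′ , below) = raise-dip p q (ℕₚ.≤-pred 2+h≤k) le in
    D p′ , D p↝p′ , λ c h<c → h<c ∷ below _ (ℕₚ.≤-trans (ℕₚ.m≤n+m (suc h) 2) 2+h≤k)
  raise-dip {suc h} (D (U p)) (H q) 2+h≤k (_ ∷ _ ∷ le) = D (H p) , D valley , λ c h<c →
    h<c ∷ ℕₚ.≤-trans (ℕₚ.m≤n+m (suc h) 2) 2+h≤k ∷ ℕₚ.≤-trans (ℕₚ.m≤n+m (suc h) 2) 2+h≤k ∷ le
  raise-dip {suc (suc h)} {k} (D (D p)) (H q) 2+h≤k (_ ∷ _ ∷ le) =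
    let (p′ , p↝p′ , below) = raise-dip p q (ℕₚ.≤-trans (ℕₚ.m≤n+m (2 + h) 2) 2+h≤k) le in
    D (D p′) , D (D p↝p′) , λ c h<c →
      h<c ∷ ℕₚ.≤-trans (ℕₚ.m≤n+m (2 + h) 2) 2+h≤k ∷ below k (ℕₚ.≤-trans (ℕₚ.m≤n+m (suc h) 3) 2+h≤k)
  raise-dip {suc h} (D (H p)) (H q) 2+h≤k (_ ∷ h≤k ∷ le) = D (D (U (D p))) , D (D peak) , λ c h<c →
    h<c ∷ ℕₚ.≤-trans (ℕₚ.m≤n+m (suc h) 2) 2+h≤k ∷ h≤k
        ∷ ∷-view (heights q) (subst (suc h ℕ.≤_) (sym (head-heights q)) (ℕₚ.≤-trans (ℕₚ.m≤n+m (suc h) 2) 2+h≤k)) (tail-≤ le)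

  -- Where the paths first differ, `p` takes the lower step: any other combination would lift it
  -- above `q` at once. An H below a U can become a peak. A D either starts a valley or a D H that
  -- can be raised on the spot, or it enters a dip that `raise-dip` follows downwards until it can
  -- be raised.
  raise : ∀ {h w} (p q : Path h w) → p ⊴ q → p ≢ q → ∃ λ p′ → p ↝ p′ × p′ ⊴ q
  raise end end _ p≢q = ⊥-elim (p≢q refl)
  raise (U p) (U q) (_ ∷ le) p≢q =
    let (p′ , p↝p′ , below) = raise p q le (p≢q ∘ cong U) in U p′ , U p↝p′ , ℕₚ.≤-refl ∷ below
  raise (D p) (D q) (_ ∷ le) p≢q =
    let (p′ , p↝p′ , below) = raise p q le (p≢q ∘ cong D) in D p′ , D p↝p′ , ℕₚ.≤-refl ∷ below
  raise (H p) (H q) (_ ∷ _ ∷ le) p≢q =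
    let (p′ , p↝p′ , below) = raise p q le (p≢q ∘ cong H) in H p′ , H p↝p′ , ℕₚ.≤-refl ∷ ℕₚ.≤-refl ∷ below
  raise (H p) (U q) (_ ∷ le) _ = U (D p) , peak , ℕₚ.≤-refl ∷ ∷-view (heights q)
    (ℕₚ.≤-reflexive (sym (head-heights q))) (tail-≤ le)
  raise (H p) (D q) (_ ∷ le) _ = ⊥-elim (ℕₚ.1+n≰n (subst (_ ℕ.≤_) (head-heights q) (head-≤ le)))
  raise (U p) (D q) (_ ∷ le) _ = ⊥-elim (ℕₚ.<⇒≱ (ℕₚ.m≤n⇒m≤1+n ℕₚ.≤-refl) (start-≤ p q le))
  raise (U p) (H q) (_ ∷ le) _ = ⊥-elim (ℕₚ.1+n≰n (subst (ℕ._≤ _) (head-heights p) (head-≤ le)))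
  raise {suc h} (D p) (U q) (_ ∷ le) _ =
    let (p′ , p↝p′ , below) = raise-dip p q ℕₚ.≤-refl le in p′ , p↝p′ , below (suc h) ℕₚ.≤-refl
  raise (D (U p)) (H q) (_ ∷ _ ∷ le) _ = H p , valley , ℕₚ.≤-refl ∷ ℕₚ.≤-refl ∷ le
  -- After D D the lower path is exactly two below the end of the H, so the second D starts a dip.
  raise {suc (suc h)} (D (D p)) (H q) (_ ∷ _ ∷ le) _ =
    let (p′ , p↝p′ , below) = raise-dip p q ℕₚ.≤-refl le in
    D p′ , D p↝p′ , ℕₚ.≤-refl ∷ below (suc (suc h)) (ℕₚ.n≤1+n (suc h))
  raise (D (H p)) (H q) (_ ∷ h≤ ∷ le) _ = D (U (D p)) , D peak , ℕₚ.≤-refl ∷ h≤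
    ∷ ∷-view (heights q) (ℕₚ.≤-reflexive (sym (head-heights q))) (tail-≤ le)

  -- `upsD p` is the valley move at the front of `D p`, if there is one: the only move that depends
  -- on two successive steps. It is kept apart so that it can be counted by itself.
  ups  : ∀ {h w} → Path h w → List (Path h w)
  upsD : ∀ {h w} → Path h w → List (Path (suc h) (suc w))
  ups end   = []
  ups (U p) = map U (ups p)
  ups (D p) = upsD p ++ map D (ups p)
  ups (H p) = U (D p) ∷ map H (ups p)
  upsD (U p) = H p ∷ []
  upsD _     = []

  ∈-ups⁺ : ∀ {h w} {p q : Path h w} → p ↝ q → q ∈ ups p
  ∈-ups⁺ peak    = here refl
  ∈-ups⁺ valley  = here refl
  ∈-ups⁺ (U c)   = ∈-map⁺ U (∈-ups⁺ c)
  ∈-ups⁺ (D {p = p} c) = ∈-++⁺ʳ (upsD p) (∈-map⁺ D (∈-ups⁺ c))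
  ∈-ups⁺ (H c)   = there (∈-map⁺ H (∈-ups⁺ c))

  ∈-ups⁻  : ∀ {h w} (p : Path h w) {q} → q ∈ ups p → p ↝ q
  ∈-upsD⁻ : ∀ {h w} (p : Path h w) {q} → q ∈ upsD p → D p ↝ q
  ∈-ups⁻ (U p) q∈ with ∈-map⁻ U q∈
  ... | _ , r∈ , refl = U (∈-ups⁻ p r∈)
  ∈-ups⁻ (D p) q∈ with ∈-++⁻ (upsD p) q∈
  ... | inj₁ q∈D = ∈-upsD⁻ p q∈D
  ... | inj₂ q∈′ with ∈-map⁻ D q∈′
  ... | _ , r∈ , refl = D (∈-ups⁻ p r∈)
  ∈-ups⁻ (H p) (here refl) = peak
  ∈-ups⁻ (H p) (there q∈) with ∈-map⁻ H q∈
  ... | _ , r∈ , refl = H (∈-ups⁻ p r∈)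
  ∈-upsD⁻ (U p) (here refl) = valley

  ups-unique : ∀ {h w} (p : Path h w) → Unique (ups p)
  ups-unique end   = []
  ups-unique (U p) = Uniq.map⁺ (λ { refl → refl }) (ups-unique p)
  ups-unique (D p) = Uniq.++⁺ (upsD-unique p) (Uniq.map⁺ (λ { refl → refl }) (ups-unique p)) (disjoint p)
    where
    upsD-unique : ∀ {h w} (p : Path h w) → Unique (upsD p)
    upsD-unique end   = []
    upsD-unique (U p) = All.[] ∷ []
    upsD-unique (D p) = []
    upsD-unique (H p) = []
    disjoint : ∀ {h w} (p : Path h w) → Disjoint (upsD p) (map D (ups p))
    disjoint (U p) (here refl , q∈) with ∈-map⁻ D q∈
    ... | _ , _ , ()
  ups-unique (H p) = All.tabulate fresh ∷ Uniq.map⁺ (λ { refl → refl }) (ups-unique p)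
    where
    fresh : ∀ {q} → q ∈ map H (ups p) → U (D p) ≢ q
    fresh q∈ eq with ∈-map⁻ H q∈
    fresh q∈ () | _ , _ , refl

  module _ (n : ℕ) where
    open FinitePoset (𝒮 n) using (_⋖_; _⋖?_; _⊏_)

    ↝⇒⋖ : ∀ {p q} → p ↝ q → p ⋖ q
    ↝⇒⋖ {p} {q} p↝q = (↝⇒⊴ p↝q , ↝⇒≢ p↝q) , λ z ((p≤z , p≢z) , (z≤q , z≢q)) →
      ℕₚ.<⇒≱ (⊏-area p≤z p≢z) (ℕₚ.≤-pred (subst (area z ℕ.<_) (↝-area p↝q) (⊏-area z≤q z≢q)))

    ⋖⇒↝ : ∀ {p q} → p ⋖ q → p ↝ q
    ⋖⇒↝ {p} {q} ((p≤q , p≢q) , none) with raise p q p≤q p≢q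
    ... | p′ , p↝p′ , p′≤q with FinitePoset._≟_ (𝒮 n) p′ q
    ...   | yes refl  = p↝p′
    ...   | no  p′≢q = ⊥-elim (none p′ ((↝⇒⊴ p↝p′ , ↝⇒≢ p↝p′) , (p′≤q , p′≢q)))

    length-covers : ∀ p → length (filter (p ⋖?_) (paths 0 (2 ℕ.* n))) ≡ length (ups p)
    length-covers p = ↭-length (∼bag⇒↭ (unique∧set⇒bag
      (Uniq.filter⁺ (p ⋖?_) (paths-unique 0 (2 ℕ.* n))) (ups-unique p)
      (mk⇔ (λ q∈ → ∈-ups⁺ (⋖⇒↝ (proj₂ (∈-filter⁻ (p ⋖?_) {xs = paths 0 (2 ℕ.* n)} q∈))))
           (λ q∈ → ∈-filter⁺ (p ⋖?_) (paths-complete _) (↝⇒⋖ (∈-ups⁻ p q∈))))))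

  total : ∀ {A : Set} → (A → ℕ) → List A → ℕ
  total f []       = 0
  total f (x ∷ xs) = f x + total f xs

  module _ {A B : Set} {P : A × B → Set} (P? : Decidable P) where

    length-filter-pairs : ∀ x ys → length (filter P? (map (x ,_) ys)) ≡ length (filter (λ y → P? (x , y)) ys)
    length-filter-pairs x []       = refl
    length-filter-pairs x (y ∷ ys) with P? (x , y)
    ... | yes _ = cong suc (length-filter-pairs x ys)
    ... | no  _ = length-filter-pairs x ys

    length-filter-cartesianProduct : ∀ xs ys →
      length (filter P? (cartesianProduct xs ys)) ≡ total (λ x → length (filter (λ y → P? (x , y)) ys)) xs
    length-filter-cartesianProduct []       ys = refl
    length-filter-cartesianProduct (x ∷ xs) ys = trans
      (cong length (Listₚ.filter-++ P? (map (x ,_) ys) (cartesianProduct xs ys)))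
      (trans (Listₚ.length-++ (filter P? (map (x ,_) ys)))
        (cong₂ _+_ (length-filter-pairs x ys) (length-filter-cartesianProduct xs ys)))

  total-cong : ∀ {A : Set} {f g : A → ℕ} → (∀ x → f x ≡ g x) → ∀ xs → total f xs ≡ total g xs
  total-cong eq []       = refl
  total-cong eq (x ∷ xs) = cong₂ _+_ (eq x) (total-cong eq xs)

  edges : ℕ → ℕ → ℕ
  edges h w = total (length ∘ ups) (paths h w)

  ℓ-edges : ∀ n → ℓ (𝒮 n) ≡ edges 0 (2 ℕ.* n)
  ℓ-edges n = trans
    (length-filter-cartesianProduct (uncurry (FinitePoset._⋖?_ (𝒮 n))) (paths 0 (2 ℕ.* n)) (paths 0 (2 ℕ.* n)))
    (total-cong (length-covers n) (paths 0 (2 ℕ.* n)))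

-- Schröder, edge and Delannoy numbers

module _ where
  open import Data.List.Base using ([]; _∷_)
  open import Data.Nat.Base using (_+_; _*_)
  open ≡-Reasoning

  module _ {A : Set} where

    total-++ : ∀ (f : A → ℕ) xs ys → total f (xs ++ ys) ≡ total f xs + total f ys
    total-++ f []       ys = refl
    total-++ f (x ∷ xs) ys = trans (cong (f x +_) (total-++ f xs ys)) (sym (ℕₚ.+-assoc (f x) _ _))

    total-+ : ∀ (f g : A → ℕ) xs → total (λ x → f x + g x) xs ≡ total f xs + total g xs
    total-+ f g []       = refl
    total-+ f g (x ∷ xs) = trans (cong (f x + g x +_) (total-+ f g xs)) (swap (f x) (g x) _ _)
      where
      swap : ∀ a b c d → a + b + (c + d) ≡ a + c + (b + d)
      swap = solve-∀

    total-map : ∀ {B : Set} (f : A → ℕ) (g : B → A) xs → total f (map g xs) ≡ total (f ∘ g) xs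
    total-map f g []       = refl
    total-map f g (x ∷ xs) = cong (f (g x) +_) (total-map f g xs)

    total-1 : ∀ (xs : List A) → total (λ _ → 1) xs ≡ length xs
    total-1 []       = refl
    total-1 (x ∷ xs) = cong suc (total-1 xs)

    total-0 : ∀ (xs : List A) → total (λ _ → 0) xs ≡ 0
    total-0 []       = refl
    total-0 (x ∷ xs) = total-0 xs

  -- Recurrences for the numbers of paths and of moves

  #paths : ℕ → ℕ → ℕ
  #paths h w = length (paths h w)

  total-paths : ∀ {h w} (f : Path h (suc w) → ℕ) →
    total f (paths h (suc w)) ≡ total (f ∘ U) (paths (suc h) w) + (total f (pathsD h w) + total f (pathsH h w))
  total-paths {h} {w} f = trans (total-++ f (pathsU h w) _)
    (cong₂ _+_ (total-map f U (paths (suc h) w)) (total-++ f (pathsD h w) (pathsH h w)))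

  #paths-0 : ∀ w → #paths 0 (2 + w) ≡ #paths 1 (1 + w) + #paths 0 w
  #paths-0 w = trans (Listₚ.length-++ (pathsU 0 (suc w)))
    (cong₂ _+_ (Listₚ.length-map U (paths 1 (suc w))) (Listₚ.length-map H (paths 0 w)))

  #paths-suc : ∀ h w → #paths (suc h) (2 + w) ≡ #paths (2 + h) (1 + w) + (#paths h (1 + w) + #paths (suc h) w)
  #paths-suc h w = trans (Listₚ.length-++ (pathsU (suc h) (suc w)))
    (cong₂ _+_ (Listₚ.length-map U (paths (2 + h) (suc w)))
      (trans (Listₚ.length-++ (pathsD (suc h) (suc w)))
        (cong₂ _+_ (Listₚ.length-map D (paths h (suc w))) (Listₚ.length-map H (paths (suc h) w)))))

  total-ups-U : ∀ {h w} (ps : List (Path (suc h) w)) → total (length ∘ ups ∘ U) ps ≡ total (length ∘ ups) ps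
  total-ups-U = total-cong (λ p → Listₚ.length-map U (ups p))

  total-ups-H : ∀ {h w} (ps : List (Path h w)) →
    total (length ∘ ups) (map H ps) ≡ length ps + total (length ∘ ups) ps
  total-ups-H ps = trans (total-map (length ∘ ups) H ps) (trans
    (total-cong (λ p → cong suc (Listₚ.length-map H (ups p))) ps)
    (trans (total-+ (λ _ → 1) (length ∘ ups) ps) (cong (_+ total (length ∘ ups) ps) (total-1 ps))))

  -- `D p` has a valley at its front exactly when `p` begins with U, and deleting that U leaves an
  -- arbitrary path from `suc h`.
  total-upsD : ∀ h w → total (length ∘ upsD) (paths h (suc w)) ≡ #paths (suc h) w
  total-upsD h w = begin
    total (length ∘ upsD) (paths h (suc w))
      ≡⟨ total-paths {h} {w} (length ∘ upsD) ⟩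
    total (λ _ → 1) (paths (suc h) w) + (total (length ∘ upsD) (pathsD h w) + total (length ∘ upsD) (pathsH h w))
      ≡⟨ cong₂ _+_ (total-1 (paths (suc h) w)) (cong₂ _+_ (onD h w) (onH h w)) ⟩
    #paths (suc h) w + 0
      ≡⟨ ℕₚ.+-identityʳ _ ⟩
    #paths (suc h) w ∎
    where
    onD : ∀ h w → total (length ∘ upsD) (pathsD h w) ≡ 0
    onD zero    w = refl
    onD (suc h) w = trans (total-map (length ∘ upsD) D (paths h w)) (total-0 (paths h w))
    onH : ∀ h w → total (length ∘ upsD) (pathsH h w) ≡ 0
    onH h zero    = refl
    onH h (suc w) = trans (total-map (length ∘ upsD) H (paths h w)) (total-0 (paths h w))

  total-ups-D : ∀ h w → total (length ∘ ups) (pathsD (suc h) w) ≡ total (length ∘ upsD) (paths h w) + edges h w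
  total-ups-D h w = begin
    total (length ∘ ups) (map D (paths h w))
      ≡⟨ total-map (length ∘ ups) D (paths h w) ⟩
    total (λ p → length (upsD p ++ map D (ups p))) (paths h w)
      ≡⟨ total-cong (λ p → trans (Listₚ.length-++ (upsD p)) (cong (length (upsD p) +_) (Listₚ.length-map D (ups p))))
                    (paths h w) ⟩
    total (λ p → length (upsD p) + length (ups p)) (paths h w)
      ≡⟨ total-+ (length ∘ upsD) (length ∘ ups) (paths h w) ⟩
    total (length ∘ upsD) (paths h w) + edges h w ∎

  edges-0 : ∀ w → edges 0 (2 + w) ≡ edges 1 (1 + w) + (#paths 0 w + edges 0 w)
  edges-0 w = trans (total-paths {0} {suc w} (length ∘ ups))
    (cong₂ _+_ (total-ups-U (paths 1 (suc w))) (total-ups-H (paths 0 w)))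

  edges-suc : ∀ h w → edges (suc h) (2 + w) ≡
    edges (2 + h) (1 + w) + (#paths (suc h) w + edges h (1 + w) + (#paths (suc h) w + edges (suc h) w))
  edges-suc h w = trans (total-paths {suc h} {suc w} (length ∘ ups))
    (cong₂ _+_ (total-ups-U (paths (2 + h) (suc w)))
      (cong₂ _+_ (trans (total-ups-D h (suc w)) (cong (_+ edges h (suc w)) (total-upsD h w)))
                 (total-ups-H (paths (suc h) w))))

  paths-below : ∀ {h w} → w ℕ.< h → paths h w ≡ []
  paths-below {suc h} {zero}        _         = refl
  paths-below {suc h} {suc zero}    (s≤s w<h) = cong (λ ps → map D ps ++ []) (paths-below w<h)
  paths-below {suc h} {suc (suc w)} (s≤s w<h) =
    cong₂ _++_ (cong (map U) (paths-below {suc (suc h)} {suc w} (ℕₚ.m≤n⇒m≤1+n (ℕₚ.m≤n⇒m≤1+n w<h))))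
      (cong₂ _++_ (cong (map D) (paths-below w<h))
                  (cong (map H) (paths-below {suc h} {w} (ℕₚ.m≤n⇒m≤1+n (ℕₚ.<⇒≤ w<h)))))

  #paths-diag : ∀ h → #paths h h ≡ 1
  #paths-diag zero          = refl
  #paths-diag (suc zero)    = refl
  #paths-diag (suc (suc h)) = trans (#paths-suc (suc h) h) (cong₂ _+_
    (cong length (paths-below {3 + h} {suc h} (ℕₚ.n≤1+n (2 + h))))
    (cong₂ _+_ (#paths-diag (suc h)) (cong length (paths-below {2 + h} {h} (ℕₚ.n≤1+n (suc h))))))

  edges-diag : ∀ h → edges h h ≡ 0
  edges-diag zero          = refl
  edges-diag (suc zero)    = refl
  edges-diag (suc (suc h)) = trans (edges-suc (suc h) h)
    (cong₂ _+_ (cong (total (length ∘ ups)) (paths-below {3 + h} {suc h} (ℕₚ.n≤1+n (2 + h))))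
      (cong₂ _+_ (cong₂ _+_ none (edges-diag (suc h)))
        (cong₂ _+_ none (cong (total (length ∘ ups)) below))))
    where
    below = paths-below {2 + h} {h} (ℕₚ.n≤1+n (suc h))
    none = cong length below

  -- The width 2a + h of a path from height h with a up or horizontal steps.
  width : ℕ → ℕ → ℕ
  width zero    h = h
  width (suc a) h = suc (suc (width a h))

  width-suc : ∀ a h → width a (suc h) ≡ suc (width a h)
  width-suc zero    h = refl
  width-suc (suc a) h = cong (2 +_) (width-suc a h)

  width-0 : ∀ n → 2 * n ≡ width n 0
  width-0 zero    = refl
  width-0 (suc n) = trans (ℕₚ.*-suc 2 n) (cong (2 +_) (width-0 n))

  delannoy-sym : ∀ m n → delannoy m n ≡ delannoy n m
  delannoy-sym zero    zero    = refl
  delannoy-sym zero    (suc n) = refl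
  delannoy-sym (suc m) zero    = refl
  delannoy-sym (suc m) (suc n)
    rewrite delannoy-sym m (suc n) | delannoy-sym (suc m) n | delannoy-sym m n =
    cong (_+ delannoy n m) (ℕₚ.+-comm (delannoy (suc n) m) (delannoy n (suc m)))

  -- The Delannoy numbers D(a-1,b) and D(a-2,b), with the value 0 off the quadrant.
  delannoy₁ delannoy₂ : ℕ → ℕ → ℕ
  delannoy₁ zero    b = 0
  delannoy₁ (suc a) b = delannoy a b
  delannoy₂ zero    b = 0
  delannoy₂ (suc a) b = delannoy₁ a b

  delannoy-step : ∀ a b → delannoy a (suc b) ≡ delannoy₁ a (suc b) + delannoy a b + delannoy₁ a b
  delannoy-step zero    b = refl
  delannoy-step (suc a) b = refl

  delannoy₁-step : ∀ a b → delannoy₁ a (suc b) ≡ delannoy₂ a (suc b) + delannoy₁ a b + delannoy₂ a b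
  delannoy₁-step zero    b = refl
  delannoy₁-step (suc a) b = delannoy-step a b

  -- Reflection principle: the walks that leave the quadrant correspond to all walks from height -h-2.
  #paths-delannoy : ∀ a h → #paths h (width a h) + delannoy₁ a (suc (a + h)) ≡ delannoy a (a + h)
  #paths-delannoy zero    h       = trans (ℕₚ.+-identityʳ _) (#paths-diag h)
  #paths-delannoy (suc a) zero    = begin
    #paths 0 (2 + width a 0) + delannoy a (2 + (a + 0))
      ≡⟨ cong₂ _+_ (trans (#paths-0 (width a 0)) (cong (λ w → #paths 1 w + #paths 0 (width a 0)) (sym (width-suc a 0))))
                   (delannoy-step a (suc (a + 0))) ⟩
    #paths 1 (width a 1) + #paths 0 (width a 0) + (delannoy₁ a (2 + (a + 0)) + delannoy a (1 + (a + 0)) + delannoy₁ a (1 + (a + 0)))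
      ≡⟨ regroup (#paths 1 (width a 1)) _ (delannoy₁ a (2 + (a + 0))) _ _ ⟩
    (#paths 1 (width a 1) + delannoy₁ a (2 + (a + 0))) + delannoy a (1 + (a + 0)) + (#paths 0 (width a 0) + delannoy₁ a (1 + (a + 0)))
      ≡⟨ cong₂ (λ x y → x + delannoy a (1 + (a + 0)) + y)
           (subst (λ z → #paths 1 (width a 1) + delannoy₁ a (suc z) ≡ delannoy a z) (ℕₚ.+-suc a 0) (#paths-delannoy a 1))
           (#paths-delannoy a 0) ⟩
    delannoy a (1 + (a + 0)) + delannoy a (1 + (a + 0)) + delannoy a (a + 0)
      -- At height 0 no down step contributes. Symmetry about the diagonal turns the second D(a,a+1)
      -- into the D(a+1,a) that the Delannoy recurrence asks for.
      ≡⟨ cong (λ z → delannoy a (1 + (a + 0)) + z + delannoy a (a + 0)) diagonal ⟩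
    delannoy (suc a) (suc (a + 0)) ∎
    where
    regroup : ∀ n m x y z → n + m + (x + y + z) ≡ n + x + y + (m + z)
    regroup = solve-∀
    diagonal : delannoy a (suc (a + 0)) ≡ delannoy (suc a) (a + 0)
    diagonal = trans (cong (delannoy a ∘ suc) (ℕₚ.+-identityʳ a))
      (trans (delannoy-sym a (suc a)) (cong (delannoy (suc a)) (sym (ℕₚ.+-identityʳ a))))
  #paths-delannoy (suc a) (suc h) = subst
    (λ z → #paths (suc h) (2 + width a (suc h)) + delannoy a (2 + z) ≡ delannoy (suc a) (1 + z))
    (sym (ℕₚ.+-suc a h)) (begin
    #paths (suc h) (2 + width a (suc h)) + delannoy a (3 + (a + h))
      ≡⟨ cong₂ _+_ (trans (#paths-suc h (width a (suc h)))
           (cong₂ (λ v w → #paths (2 + h) v + (#paths h w + #paths (suc h) (width a (suc h))))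
             (sym (width-suc a (suc h))) (cong suc (width-suc a h))))
           (delannoy-step a (2 + (a + h))) ⟩
    #paths (2 + h) (width a (2 + h)) + (#paths h (2 + width a h) + #paths (suc h) (width a (suc h)))
      + (delannoy₁ a (3 + (a + h)) + delannoy a (2 + (a + h)) + delannoy₁ a (2 + (a + h)))
      ≡⟨ regroup (#paths (2 + h) (width a (2 + h))) (#paths h (2 + width a h)) _ (delannoy₁ a (3 + (a + h))) _ _ ⟩
    (#paths (2 + h) (width a (2 + h)) + delannoy₁ a (3 + (a + h)))
      + (#paths h (2 + width a h) + delannoy a (2 + (a + h)))
      + (#paths (suc h) (width a (suc h)) + delannoy₁ a (2 + (a + h)))
      ≡⟨ cong₂ _+_ (cong₂ _+_
           (subst (λ z → #paths (2 + h) (width a (2 + h)) + delannoy₁ a (suc z) ≡ delannoy a z)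
             (trans (ℕₚ.+-suc a (suc h)) (cong suc (ℕₚ.+-suc a h))) (#paths-delannoy a (2 + h)))
           (#paths-delannoy (suc a) h))
           (subst (λ z → #paths (suc h) (width a (suc h)) + delannoy₁ a (suc z) ≡ delannoy a z)
             (ℕₚ.+-suc a h) (#paths-delannoy a (suc h))) ⟩
    delannoy (suc a) (2 + (a + h)) ∎)
    where
    regroup : ∀ n m k x y z → n + (m + k) + (x + y + z) ≡ (n + x) + (m + y) + (k + z)
    regroup = solve-∀

  -- Above height 0 the recurrence of `edges` is that of `#paths` with the source `2 * #paths`, from
  -- the valley at the front and the peak made of a leading H. The factor `1 + 2 * h` absorbs it: it
  -- changes by 2 between neighbouring heights, which leaves twice the difference of two Delannoy
  -- numbers, and by `#paths-delannoy` that difference is minus the number of paths. The `delannoy₂`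
  -- term solves the homogeneous recurrence and adjusts the boundary at height 0, where the source
  -- is only `#paths`.
  edges-delannoy : ∀ a h → edges h (width a h) ≡ (1 + 2 * h) * delannoy₁ a (a + h) + delannoy₂ a (suc (a + h))
  edges-delannoy zero h = trans (edges-diag h) (sym (trans (ℕₚ.+-identityʳ _) (ℕₚ.*-zeroʳ (1 + 2 * h))))
  edges-delannoy (suc a) zero rewrite ℕₚ.+-identityʳ a = begin
    edges 0 (2 + width a 0)
      ≡⟨ trans (edges-0 (width a 0)) (cong (λ w → edges 1 w + (#paths 0 (width a 0) + edges 0 (width a 0))) (sym (width-suc a 0))) ⟩
    edges 1 (width a 1) + (#paths 0 (width a 0) + edges 0 (width a 0))
      ≡⟨ cong₂ (λ x y → x + (#paths 0 (width a 0) + y)) (edges-delannoy a 1) (edges-delannoy a 0) ⟩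
    3 * delannoy₁ a (a + 1) + delannoy₂ a (suc (a + 1)) +
      (#paths 0 (width a 0) + (1 * delannoy₁ a (a + 0) + delannoy₂ a (suc (a + 0))))
      ≡⟨ cong₂ (λ x y → 3 * delannoy₁ a x + delannoy₂ a (suc x) + (#paths 0 (width a 0) + (1 * delannoy₁ a y + delannoy₂ a (suc y))))
          (trans (ℕₚ.+-suc a 0) (cong suc (ℕₚ.+-identityʳ a))) (ℕₚ.+-identityʳ a) ⟩
    3 * delannoy₁ a (1 + a) + delannoy₂ a (2 + a) + (#paths 0 (width a 0) + (1 * delannoy₁ a a + delannoy₂ a (1 + a)))
      ≡⟨ regroup (delannoy₁ a (1 + a)) (delannoy₂ a (2 + a)) (#paths 0 (width a 0)) (delannoy₁ a a) (delannoy₂ a (1 + a)) ⟩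
    (delannoy₁ a (1 + a) + (#paths 0 (width a 0) + delannoy₁ a (1 + a)) + delannoy₁ a a) + (delannoy₂ a (2 + a) + delannoy₁ a (1 + a) + delannoy₂ a (1 + a))
      ≡⟨ cong₂ (λ x y → (delannoy₁ a (1 + a) + x + delannoy₁ a a) + y)
          (subst (λ z → #paths 0 (width a 0) + delannoy₁ a (suc z) ≡ delannoy a z) (ℕₚ.+-identityʳ a) (#paths-delannoy a 0))
          (sym (delannoy₁-step a (1 + a))) ⟩
    (delannoy₁ a (1 + a) + delannoy a a + delannoy₁ a a) + delannoy₁ a (2 + a)
      ≡⟨ cong (_+ delannoy₁ a (2 + a)) (sym (trans (ℕₚ.*-identityˡ _) (delannoy-step a a))) ⟩
    1 * delannoy a (suc a) + delannoy₁ a (2 + a) ∎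
    where
    regroup : ∀ x y n u v → 3 * x + y + (n + (1 * u + v)) ≡ (x + (n + x) + u) + (y + x + v)
    regroup = solve-∀
  edges-delannoy (suc a) (suc h) = subst
    (λ z → edges (suc h) (2 + width a (suc h)) ≡ (1 + 2 * suc h) * delannoy a (1 + z) + delannoy₁ a (2 + z))
    (sym (ℕₚ.+-suc a h)) (begin
    edges (suc h) (2 + width a (suc h))
      ≡⟨ trans (edges-suc h (width a (suc h))) (cong₂ (λ v w → edges (2 + h) v + (P + edges h w + (P + edges (suc h) (width a (suc h)))))
             (sym (width-suc a (suc h))) (cong suc (width-suc a h))) ⟩
    edges (2 + h) (width a (2 + h)) + (P + edges h (2 + width a h) + (P + edges (suc h) (width a (suc h))))
      ≡⟨ cong₂ (λ x y → x + y)
          (subst (λ z → edges (2 + h) (width a (2 + h)) ≡ (1 + 2 * (2 + h)) * delannoy₁ a z + delannoy₂ a (suc z))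
             (trans (ℕₚ.+-suc a (suc h)) (cong suc (ℕₚ.+-suc a h))) (edges-delannoy a (2 + h)))
          (cong₂ (λ y z → P + y + (P + z)) (edges-delannoy (suc a) h)
            (subst (λ z → edges (suc h) (width a (suc h)) ≡ (1 + 2 * (suc h)) * delannoy₁ a z + delannoy₂ a (suc z))
              (ℕₚ.+-suc a h) (edges-delannoy a (suc h)))) ⟩
    ((1 + 2 * (2 + h)) * X₂ + Y₃) + (P + ((1 + 2 * h) * delannoy a (suc c) + X₂) + (P + ((1 + 2 * suc h) * X₁ + Y₂)))
      ≡⟨ regroup h X₂ Y₃ P (delannoy a (suc c)) X₁ Y₂ ⟩
    ((3 + 2 * h) * X₂ + (1 + 2 * h) * delannoy a (suc c) + (3 + 2 * h) * X₁ + 2 * (P + X₂)) + (Y₃ + X₂ + Y₂)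
      ≡⟨ cong₂ (λ x y → ((3 + 2 * h) * X₂ + (1 + 2 * h) * delannoy a (suc c) + (3 + 2 * h) * X₁ + 2 * x) + y)
          (subst (λ z → P + delannoy₁ a (suc z) ≡ delannoy a z) (ℕₚ.+-suc a h) (#paths-delannoy a (suc h)))
          (sym (delannoy₁-step a (2 + c))) ⟩
    ((3 + 2 * h) * X₂ + (1 + 2 * h) * delannoy a (suc c) + (3 + 2 * h) * X₁ + 2 * delannoy a (suc c)) + delannoy₁ a (3 + c)
      ≡⟨ collect h X₂ (delannoy a (suc c)) X₁ (delannoy₁ a (3 + c)) ⟩
    (1 + 2 * suc h) * (X₂ + delannoy a (suc c) + X₁) + delannoy₁ a (3 + c)
      ≡⟨ cong (λ z → (1 + 2 * suc h) * z + delannoy₁ a (3 + c)) (sym (delannoy-step a (suc c))) ⟩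
    (1 + 2 * suc h) * delannoy a (2 + c) + delannoy₁ a (3 + c) ∎)
    where
    c = a + h
    P = #paths (suc h) (width a (suc h))
    X₁ = delannoy₁ a (1 + c)
    X₂ = delannoy₁ a (2 + c)
    Y₂ = delannoy₂ a (2 + c)
    Y₃ = delannoy₂ a (3 + c)
    regroup : ∀ h x₂ y₃ p d x₁ y₂ →
      ((1 + 2 * (2 + h)) * x₂ + y₃) + (p + ((1 + 2 * h) * d + x₂) + (p + ((1 + 2 * suc h) * x₁ + y₂))) ≡
      ((3 + 2 * h) * x₂ + (1 + 2 * h) * d + (3 + 2 * h) * x₁ + 2 * (p + x₂)) + (y₃ + x₂ + y₂)
    regroup = solve-∀
    collect : ∀ h x₂ d x₁ z → ((3 + 2 * h) * x₂ + (1 + 2 * h) * d + (3 + 2 * h) * x₁ + 2 * d) + z ≡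
      (1 + 2 * suc h) * (x₂ + d + x₁) + z
    collect = solve-∀

  r-delannoy : ∀ n → r n + delannoy₁ n (suc n) ≡ d n
  r-delannoy n = subst₂ (λ w z → #paths 0 w + delannoy₁ n (suc z) ≡ delannoy n z)
    (sym (width-0 n)) (ℕₚ.+-identityʳ n) (#paths-delannoy n 0)

  ℓ-delannoy : ∀ n → ℓ (𝒮 n) ≡ delannoy₁ n n + delannoy₂ n (suc n)
  ℓ-delannoy n = trans (ℓ-edges n) (trans (cong (edges 0) (width-0 n)) (trans (edges-delannoy n 0)
    (trans (cong (λ z → 1 * delannoy₁ n z + delannoy₂ n (suc z)) (ℕₚ.+-identityʳ n))
           (cong (_+ delannoy₂ n (suc n)) (ℕₚ.*-identityˡ (delannoy₁ n n))))))

  ℓ-step : ∀ n → ℓ (𝒮 (suc n)) + delannoy₁ n (suc n) ≡ delannoy n (suc (suc n))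
  ℓ-step n = trans (cong (_+ delannoy₁ n (suc n)) (ℓ-delannoy (suc n)))
    (trans (swap (delannoy n (suc n)) (delannoy₁ n (2 + n)) (delannoy₁ n (suc n))) (sym (delannoy-step n (suc n))))
    where
    swap : ∀ a b c → a + b + c ≡ b + a + c
    swap = solve-∀

  -- By reflection `delannoy₁ n (suc n)` is d - r at `n`, so `ℓ-step` says that ℓ is the sequence of
  -- differences of d - r.
  ℓ-d-r : ∀ n → ℓ (𝒮 (suc n)) + r (suc n) + d n ≡ d (suc n) + r n
  ℓ-d-r n = ℕₚ.+-cancelʳ-≡ (delannoy₁ n (suc n)) _ _ (begin
    ℓ (𝒮 (suc n)) + r (suc n) + d n + e          ≡⟨ regroup (ℓ (𝒮 (suc n))) (r (suc n)) (d n) e ⟩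
    r (suc n) + (ℓ (𝒮 (suc n)) + e) + d n         ≡⟨ cong₂ (λ x y → r (suc n) + x + y) (ℓ-step n) (sym (r-delannoy n)) ⟩
    r (suc n) + delannoy n (2 + n) + (r n + e)    ≡⟨ cong (_+ (r n + e)) (r-delannoy (suc n)) ⟩
    d (suc n) + (r n + e)                         ≡⟨ ℕₚ.+-assoc (d (suc n)) (r n) e ⟨
    d (suc n) + r n + e ∎)
    where
    e = delannoy₁ n (suc n)
    regroup : ∀ l r d e → l + r + d + e ≡ r + (l + e) + d
    regroup = solve-∀

  delannoy-0 : ∀ m → delannoy m 0 ≡ 1
  delannoy-0 zero    = refl
  delannoy-0 (suc m) = refl

  delannoy-1 : ∀ m → delannoy m 1 ≡ 1 + 2 * m
  delannoy-1 zero    = refl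
  delannoy-1 (suc m) = trans (cong₂ (λ x y → x + 1 + y) (delannoy-1 m) (delannoy-0 m)) (two m)
    where
    two : ∀ m → 1 + 2 * m + 1 + 1 ≡ 1 + 2 * suc m
    two = solve-∀

  -- The generating function (1+x)ᵐ/(1-x)ᵐ⁺¹ of a row has logarithmic derivative (2m+1+x)/(1-x²).
  delannoy-recurrence : ∀ m n →
    (2 + n) * delannoy m (2 + n) ≡ (1 + 2 * m) * delannoy m (1 + n) + (1 + n) * delannoy m n
  delannoy-recurrence zero    n    = base n
    where
    base : ∀ n → (2 + n) * 1 ≡ (1 + 2 * 0) * 1 + (1 + n) * 1
    base = solve-∀
  delannoy-recurrence (suc m) zero = begin
    2 * (p₂ + (p₁ + 1 + delannoy m 0) + p₁)
      ≡⟨ cong₂ (λ z w → 2 * (p₂ + (z + 1 + w) + z)) (delannoy-1 m) (delannoy-0 m) ⟩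
    2 * (p₂ + (1 + 2 * m + 1 + 1) + (1 + 2 * m))
      ≡⟨ expand m p₂ ⟩
    2 * p₂ + 2 * (1 + 2 * m + 1 + 1) + 2 * (1 + 2 * m)
      ≡⟨ cong (λ z → z + 2 * (1 + 2 * m + 1 + 1) + 2 * (1 + 2 * m)) (delannoy-recurrence m 0) ⟩
    (1 + 2 * m) * p₁ + 1 * delannoy m 0 + 2 * (1 + 2 * m + 1 + 1) + 2 * (1 + 2 * m)
      ≡⟨ cong₂ (λ z w → (1 + 2 * m) * z + 1 * w + 2 * (1 + 2 * m + 1 + 1) + 2 * (1 + 2 * m)) (delannoy-1 m) (delannoy-0 m) ⟩
    (1 + 2 * m) * (1 + 2 * m) + 1 * 1 + 2 * (1 + 2 * m + 1 + 1) + 2 * (1 + 2 * m)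
      ≡⟨ collect m ⟩
    (1 + 2 * suc m) * (1 + 2 * m + 1 + 1) + 1 * 1
      ≡⟨ cong₂ (λ z w → (1 + 2 * suc m) * (z + 1 + w) + 1 * 1) (delannoy-1 m) (delannoy-0 m) ⟨
    (1 + 2 * suc m) * delannoy (suc m) 1 + 1 * 1 ∎
    where
    p₁ = delannoy m 1
    p₂ = delannoy m 2
    expand : ∀ m p → 2 * (p + (1 + 2 * m + 1 + 1) + (1 + 2 * m)) ≡ 2 * p + 2 * (1 + 2 * m + 1 + 1) + 2 * (1 + 2 * m)
    expand = solve-∀
    collect : ∀ m → (1 + 2 * m) * (1 + 2 * m) + 1 * 1 + 2 * (1 + 2 * m + 1 + 1) + 2 * (1 + 2 * m) ≡
      (1 + 2 * suc m) * (1 + 2 * m + 1 + 1) + 1 * 1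
    collect = solve-∀
  delannoy-recurrence (suc m) (suc n) = begin
    (3 + n) * (p₃ + y₂ + p₂)
      ≡⟨ expand n p₃ y₂ p₂ ⟩
    (3 + n) * p₃ + ((2 + n) * y₂ + y₂) + ((2 + n) * p₂ + p₂)
      ≡⟨ cong₂ (λ u v → u + (v + y₂) + ((2 + n) * p₂ + p₂)) (delannoy-recurrence m (suc n)) (delannoy-recurrence (suc m) n) ⟩
    ((1 + 2 * m) * p₂ + (2 + n) * p₁) + (((1 + 2 * suc m) * y₁ + (1 + n) * y₀) + y₂) + ((2 + n) * p₂ + p₂)
      ≡⟨ cong (λ u → ((1 + 2 * m) * p₂ + (2 + n) * p₁) + (((1 + 2 * suc m) * y₁ + (1 + n) * y₀) + y₂) + (u + p₂))
           (delannoy-recurrence m n) ⟩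
    ((1 + 2 * m) * p₂ + (2 + n) * p₁) + (((1 + 2 * suc m) * y₁ + (1 + n) * y₀) + y₂)
      + (((1 + 2 * m) * p₁ + (1 + n) * p₀) + p₂)
      ≡⟨ collect m n p₀ p₁ p₂ y₀ ⟩
    (1 + 2 * suc m) * y₂ + (2 + n) * y₁ ∎
    where
    p₀ = delannoy m n
    p₁ = delannoy m (1 + n)
    p₂ = delannoy m (2 + n)
    p₃ = delannoy m (3 + n)
    y₀ = delannoy (suc m) n
    y₁ = delannoy (suc m) (1 + n)
    y₂ = delannoy (suc m) (2 + n)
    expand : ∀ n p₃ y₂ p₂ → (3 + n) * (p₃ + y₂ + p₂) ≡ (3 + n) * p₃ + ((2 + n) * y₂ + y₂) + ((2 + n) * p₂ + p₂)
    expand = solve-∀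
    collect : ∀ m n p₀ p₁ p₂ y₀ →
      ((1 + 2 * m) * p₂ + (2 + n) * p₁) +
        (((1 + 2 * suc m) * (p₁ + y₀ + p₀) + (1 + n) * y₀) + (p₂ + (p₁ + y₀ + p₀) + p₁)) +
        (((1 + 2 * m) * p₁ + (1 + n) * p₀) + p₂)
      ≡ (1 + 2 * suc m) * (p₂ + (p₁ + y₀ + p₀) + p₁) + (2 + n) * (p₁ + y₀ + p₀)
    collect = solve-∀

  d-suc : ∀ n → d (suc n) ≡ 2 * delannoy n (suc n) + d n
  d-suc n = cong (_+ d n) (trans (cong (delannoy n (suc n) +_) (delannoy-sym (suc n) n)) (double (delannoy n (suc n))))
    where
    double : ∀ x → x + x ≡ 2 * x
    double = solve-∀

  -- This is Legendre's three-term recurrence at 3, the central Delannoy numbers being the values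
  -- Pₙ(3). It comes from the row recurrence in row `suc n`, whose off-diagonal entries `d-suc`
  -- expresses by diagonal ones.
  d-recurrence : ∀ n → (2 + n) * d (2 + n) + (1 + n) * d n ≡ 3 * (3 + 2 * n) * d (1 + n)
  d-recurrence n = begin
    (2 + n) * d (2 + n) + (1 + n) * x
      ≡⟨ cong (λ z → (2 + n) * z + (1 + n) * x) (d-suc (suc n)) ⟩
    (2 + n) * (2 * delannoy (suc n) (2 + n) + d (suc n)) + (1 + n) * x
      ≡⟨ expand n (delannoy (suc n) (2 + n)) (d (suc n)) x ⟩
    2 * ((2 + n) * delannoy (suc n) (2 + n)) + (2 + n) * d (suc n) + (1 + n) * x
      ≡⟨ cong (λ z → 2 * z + (2 + n) * d (suc n) + (1 + n) * x)
          (trans (delannoy-recurrence (suc n) n) (cong (λ z → (1 + 2 * suc n) * d (suc n) + (1 + n) * z) (delannoy-sym (suc n) n))) ⟩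
    2 * ((1 + 2 * suc n) * d (suc n) + (1 + n) * y) + (2 + n) * d (suc n) + (1 + n) * x
      ≡⟨ collect n (d (suc n)) y x ⟩
    2 * ((1 + 2 * suc n) * d (suc n)) + (2 + n) * d (suc n) + (1 + n) * (2 * y + x)
      ≡⟨ cong (λ z → 2 * ((1 + 2 * suc n) * d (suc n)) + (2 + n) * d (suc n) + (1 + n) * z) (d-suc n) ⟨
    2 * ((1 + 2 * suc n) * d (suc n)) + (2 + n) * d (suc n) + (1 + n) * d (suc n)
      ≡⟨ final n (d (suc n)) ⟩
    3 * (3 + 2 * n) * d (1 + n) ∎
    where
    x = d n
    y = delannoy n (suc n)
    expand : ∀ n y z x → (2 + n) * (2 * y + z) + (1 + n) * x ≡ 2 * ((2 + n) * y) + (2 + n) * z + (1 + n) * x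
    expand = solve-∀
    collect : ∀ n z y x → 2 * ((1 + 2 * suc n) * z + (1 + n) * y) + (2 + n) * z + (1 + n) * x ≡
      2 * ((1 + 2 * suc n) * z) + (2 + n) * z + (1 + n) * (2 * y + x)
    collect = solve-∀
    final : ∀ n z → 2 * ((1 + 2 * suc n) * z) + (2 + n) * z + (1 + n) * z ≡ 3 * (3 + 2 * n) * z
    final = solve-∀

  -- The reflected term of `r (suc n)` is D(n,n+2), which the row recurrence reduces to the
  -- diagonal. In this form r is matched with the coefficients of √Δ.
  r-from-d : ∀ n → 2 * (2 + n) * r (suc n) + d n ≡ 3 * d (suc n)
  r-from-d n = ℕₚ.+-cancelʳ-≡ ((1 + 2 * n) * x′) _ _ (begin
    2 * (2 + n) * r (suc n) + x + (1 + 2 * n) * x′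
      ≡⟨ cong (λ z → 2 * (2 + n) * r (suc n) + x + (1 + 2 * n) * z) (d-suc n) ⟩
    2 * (2 + n) * r (suc n) + x + (1 + 2 * n) * (2 * y + x)
      ≡⟨ regroup n (r (suc n)) x y ⟩
    2 * (2 + n) * r (suc n) + 2 * ((1 + 2 * n) * y + (1 + n) * x)
      ≡⟨ cong (λ z → 2 * (2 + n) * r (suc n) + 2 * z) (delannoy-recurrence n n) ⟨
    2 * (2 + n) * r (suc n) + 2 * ((2 + n) * delannoy n (2 + n))
      ≡⟨ factor n (r (suc n)) (delannoy n (2 + n)) ⟩
    2 * (2 + n) * (r (suc n) + delannoy n (2 + n))
      ≡⟨ cong (2 * (2 + n) *_) (r-delannoy (suc n)) ⟩
    2 * (2 + n) * x′
      ≡⟨ final n x′ ⟩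
    3 * x′ + (1 + 2 * n) * x′ ∎)
    where
    x = d n
    x′ = d (suc n)
    y = delannoy n (suc n)
    regroup : ∀ n r x y → 2 * (2 + n) * r + x + (1 + 2 * n) * (2 * y + x) ≡ 2 * (2 + n) * r + 2 * ((1 + 2 * n) * y + (1 + n) * x)
    regroup = solve-∀
    factor : ∀ n r z → 2 * (2 + n) * r + 2 * ((2 + n) * z) ≡ 2 * (2 + n) * (r + z)
    factor = solve-∀
    final : ∀ n x → 2 * (2 + n) * x ≡ 3 * x + (1 + 2 * n) * x
    final = solve-∀

  -- Delannoy paths by their number of diagonal steps

  -- The lattice paths counted by delannoy a b with exactly k diagonal steps.
  diagonal : ℕ → ℕ → ℕ → ℕ
  diagonal zero    b       zero    = 1
  diagonal zero    b       (suc k) = 0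
  diagonal (suc a) zero    zero    = 1
  diagonal (suc a) zero    (suc k) = 0
  diagonal (suc a) (suc b) zero    = diagonal a (suc b) zero + diagonal (suc a) b zero
  diagonal (suc a) (suc b) (suc k) = diagonal a (suc b) (suc k) + diagonal (suc a) b (suc k) + diagonal a b k

  diagonal-vanish : ∀ {a k} b → a ℕ.< k → diagonal a b k ≡ 0
  diagonal-vanish {zero}  {suc k} b       _         = refl
  diagonal-vanish {suc a} {suc k} zero    _         = refl
  diagonal-vanish {suc a} {suc k} (suc b) (s≤s a<k)
    rewrite diagonal-vanish {a} {suc k} (suc b) (ℕₚ.m≤n⇒m≤1+n a<k)
          | diagonal-vanish {suc a} {suc k} b (s≤s a<k)
          | diagonal-vanish {a} {k} b a<k = refl

  diagonal-vanish′ : ∀ {b k} a → b ℕ.< k → diagonal a b k ≡ 0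
  diagonal-vanish′ {zero}  {suc k} zero    _         = refl
  diagonal-vanish′ {zero}  {suc k} (suc a) _         = refl
  diagonal-vanish′ {suc b} {suc k} zero    _         = refl
  diagonal-vanish′ {suc b} {suc k} (suc a) (s≤s b<k)
    rewrite diagonal-vanish′ {suc b} {suc k} a (s≤s b<k)
          | diagonal-vanish′ {b} {suc k} (suc a) (ℕₚ.m≤n⇒m≤1+n b<k)
          | diagonal-vanish′ {b} {k} a b<k = refl

  -- The count is the multinomial coefficient of k diagonal, u horizontal and v vertical steps. In
  -- the induction the three possible steps contribute the shares u, v and k + 1 of one factorial;
  -- for u = 0 or v = 0 the corresponding share vanishes because there is no room for the diagonal
  -- steps.
  diagonal-! : ∀ k u v → k ! * u ! * v ! * diagonal (k + u) (k + v) k ≡ (k + u + v) !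
  diagonal-! zero zero v = trans (ℕₚ.*-identityʳ _) (ℕₚ.*-identityˡ (v !))
  diagonal-! zero (suc u) zero = trans (ℕₚ.*-identityʳ _) (trans (ℕₚ.*-identityʳ _) (trans (ℕₚ.*-identityˡ (suc u !)) (cong _! (sym (ℕₚ.+-identityʳ (suc u))))))
  diagonal-! zero (suc u) (suc v) = begin
    1 * (suc u * u !) * (suc v * v !) * (x + y)
      ≡⟨ split u v (u !) (v !) x y ⟩
    suc u * (1 * u ! * (suc v * v !) * x) + suc v * (1 * (suc u * u !) * v ! * y)
      ≡⟨ cong₂ (λ p q → suc u * p + suc v * q) (diagonal-! zero u (suc v)) (diagonal-! zero (suc u) v) ⟩
    suc u * (u + suc v) ! + suc v * (suc u + v) !
      ≡⟨ cong (λ z → suc u * z ! + suc v * (suc u + v) !) (ℕₚ.+-suc u v) ⟩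
    suc u * (suc u + v) ! + suc v * (suc u + v) !
      ≡⟨ join u v ((suc u + v) !) ⟩
    suc (suc (u + v)) * (suc u + v) !
      ≡⟨ cong (λ z → suc z !) (sym (ℕₚ.+-suc u v)) ⟩
    (suc u + suc v) ! ∎
    where
    x = diagonal u (suc v) 0
    y = diagonal (suc u) v 0
    split : ∀ u v p q x y → 1 * (suc u * p) * (suc v * q) * (x + y) ≡ suc u * (1 * p * (suc v * q) * x) + suc v * (1 * (suc u * p) * q * y)
    split = solve-∀
    join : ∀ u v f → suc u * f + suc v * f ≡ suc (suc (u + v)) * f
    join = solve-∀
  diagonal-! (suc k) u v = begin
    suc k ! * u ! * v ! * (x + y + z)
      ≡⟨ split k (k !) (u !) (v !) x y z ⟩
    suc k ! * u ! * v ! * x + suc k ! * u ! * v ! * y + suc k * (k ! * u ! * v ! * z)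
      ≡⟨ cong₂ _+_ (cong₂ _+_ (left u) (right v)) (cong (suc k *_) (diagonal-! k u v)) ⟩
    u * (k + u + v) ! + v * (k + u + v) ! + suc k * (k + u + v) !
      ≡⟨ join k u v ((k + u + v) !) ⟩
    (suc k + u + v) ! ∎
    where
    x = diagonal (k + u) (suc (k + v)) (suc k)
    y = diagonal (suc (k + u)) (k + v) (suc k)
    z = diagonal (k + u) (k + v) k
    split : ∀ k f g h x y z → suc k * f * g * h * (x + y + z) ≡ suc k * f * g * h * x + suc k * f * g * h * y + suc k * (f * g * h * z)
    split = solve-∀
    join : ∀ k u v f → u * f + v * f + suc k * f ≡ suc (k + u + v) * f
    join = solve-∀
    left : ∀ u → suc k ! * u ! * v ! * diagonal (k + u) (suc (k + v)) (suc k) ≡ u * (k + u + v) !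
    left zero = trans (cong (suc k ! * 1 * v ! *_) (diagonal-vanish {k + 0} (suc (k + v)) (s≤s (ℕₚ.≤-reflexive (ℕₚ.+-identityʳ k)))))
      (ℕₚ.*-zeroʳ (suc k ! * 1 * v !))
    left (suc u) = begin
      suc k ! * (suc u * u !) * v ! * diagonal (k + suc u) (suc (k + v)) (suc k)
        ≡⟨ cong (λ w → suc k ! * (suc u * u !) * v ! * diagonal w (suc (k + v)) (suc k)) (ℕₚ.+-suc k u) ⟩
      suc k ! * (suc u * u !) * v ! * diagonal (suc k + u) (suc k + v) (suc k)
        ≡⟨ pull u (suc k !) (u !) (v !) (diagonal (suc k + u) (suc k + v) (suc k)) ⟩
      suc u * (suc k ! * u ! * v ! * diagonal (suc k + u) (suc k + v) (suc k))
        ≡⟨ cong (suc u *_) (diagonal-! (suc k) u v) ⟩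
      suc u * (suc k + u + v) !
        ≡⟨ cong (λ w → suc u * (w + v) !) (sym (ℕₚ.+-suc k u)) ⟩
      suc u * (k + suc u + v) ! ∎
      where
      pull : ∀ u f g h x → f * (suc u * g) * h * x ≡ suc u * (f * g * h * x)
      pull = solve-∀
    right : ∀ v → suc k ! * u ! * v ! * diagonal (suc (k + u)) (k + v) (suc k) ≡ v * (k + u + v) !
    right zero = trans (cong (suc k ! * u ! * 1 *_) (diagonal-vanish′ {k + 0} (suc (k + u)) (s≤s (ℕₚ.≤-reflexive (ℕₚ.+-identityʳ k)))))
      (ℕₚ.*-zeroʳ (suc k ! * u ! * 1))
    right (suc v) = begin
      suc k ! * u ! * (suc v * v !) * diagonal (suc (k + u)) (k + suc v) (suc k)
        ≡⟨ cong (λ w → suc k ! * u ! * (suc v * v !) * diagonal (suc (k + u)) w (suc k)) (ℕₚ.+-suc k v) ⟩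
      suc k ! * u ! * (suc v * v !) * diagonal (suc k + u) (suc k + v) (suc k)
        ≡⟨ pull v (suc k !) (u !) (v !) (diagonal (suc k + u) (suc k + v) (suc k)) ⟩
      suc v * (suc k ! * u ! * v ! * diagonal (suc k + u) (suc k + v) (suc k))
        ≡⟨ cong (suc v *_) (diagonal-! (suc k) u v) ⟩
      suc v * (suc k + u + v) !
        ≡⟨ cong (λ w → suc v * w !) (sym (ℕₚ.+-suc (k + u) v)) ⟩
      suc v * (k + u + suc v) ! ∎
      where
      pull : ∀ v f g h x → f * g * (suc v * h) * x ≡ suc v * (f * g * h * x)
      pull = solve-∀

  diagonal₁ : ℕ → ℕ → ℕ → ℕ
  diagonal₁ zero    b k = 0
  diagonal₁ (suc a) b k = diagonal a b k

  -- These paths have u - 1 and u + 2 straight steps. The denominators are chosen as in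
  -- `edgeTerm-!`, so that the two contributions can be added; the factor u on the right makes up
  -- for u! in place of (u-1)! and also settles u = 0.
  diagonal₁-! : ∀ k u → k ! * u ! * (2 + u) ! * diagonal₁ (k + u) (2 + (k + u)) k ≡ u * (k + u + suc u) !
  diagonal₁-! k zero = trans (cong (k ! * 1 * 2 *_) (vanish k)) (ℕₚ.*-zeroʳ (k ! * 1 * 2))
    where
    vanish : ∀ k → diagonal₁ (k + 0) (2 + (k + 0)) k ≡ 0
    vanish zero    = refl
    vanish (suc k) = diagonal-vanish (3 + (k + 0)) (s≤s (ℕₚ.≤-reflexive (ℕₚ.+-identityʳ k)))
  diagonal₁-! k (suc u) = begin
    k ! * (suc u * u !) * (3 + u) ! * diagonal₁ (k + suc u) (2 + (k + suc u)) k
      ≡⟨ cong₂ (λ p q → k ! * (suc u * u !) * (3 + u) ! * diagonal₁ p q k) (ℕₚ.+-suc k u) (three k u) ⟩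
    k ! * (suc u * u !) * (3 + u) ! * diagonal (k + u) (k + (3 + u)) k
      ≡⟨ pull u (k !) (u !) ((3 + u) !) (diagonal (k + u) (k + (3 + u)) k) ⟩
    suc u * (k ! * u ! * (3 + u) ! * diagonal (k + u) (k + (3 + u)) k)
      ≡⟨ cong (suc u *_) (diagonal-! k u (3 + u)) ⟩
    suc u * (k + u + (3 + u)) !
      ≡⟨ cong (λ z → suc u * z !) (shuffle k u) ⟩
    suc u * (k + suc u + (2 + u)) ! ∎
    where
    three : ∀ k u → 2 + (k + suc u) ≡ k + (3 + u)
    three = solve-∀
    shuffle : ∀ k u → k + u + (3 + u) ≡ k + suc u + (2 + u)
    shuffle = solve-∀
    pull : ∀ u f g h x → f * (suc u * g) * h * x ≡ suc u * (f * g * h * x)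
    pull = solve-∀

  -- The contribution to ℓ(𝒮ₘ₊₁) = D(m,m+1) + D(m-1,m+2) of the paths with k diagonal steps.
  edgeTerm : ℕ → ℕ → ℕ
  edgeTerm m k = diagonal m (suc m) k + diagonal₁ m (2 + m) k

  edgeTerm-! : ∀ k u → k ! * u ! * (2 + u) ! * edgeTerm (k + u) k ≡ 2 * suc u * (k + u + suc u) !
  edgeTerm-! k u = begin
    k ! * u ! * (2 + u) ! * (x + y)
      ≡⟨ split u (k !) (u !) (suc u !) (2 + u) x y ⟩
    (2 + u) * (k ! * u ! * suc u ! * x) + k ! * u ! * (2 + u) ! * y
      ≡⟨ cong₂ (λ p q → (2 + u) * p + q)
           (trans (cong (λ w → k ! * u ! * suc u ! * diagonal (k + u) w k) (sym (ℕₚ.+-suc k u))) (diagonal-! k u (suc u)))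
           (diagonal₁-! k u) ⟩
    (2 + u) * (k + u + suc u) ! + u * (k + u + suc u) !
      ≡⟨ join u ((k + u + suc u) !) ⟩
    2 * suc u * (k + u + suc u) ! ∎
    where
    x = diagonal (k + u) (suc (k + u)) k
    y = diagonal₁ (k + u) (2 + (k + u)) k
    split : ∀ u f g h s x y → f * g * (s * h) * (x + y) ≡ s * (f * g * h * x) + f * g * (s * h) * y
    split = solve-∀
    join : ∀ u f → (2 + u) * f + u * f ≡ 2 * suc u * f
    join = solve-∀

  rising-! : ∀ p j → rising (suc p) j * p ! ≡ (j + p) !
  rising-! p zero    = ℕₚ.*-identityˡ (p !)
  rising-! p (suc j) = begin
    rising (suc p) j * (suc p + j) * p !    ≡⟨ pull (rising (suc p) j) p j (p !) ⟩
    suc (j + p) * (rising (suc p) j * p !)  ≡⟨ cong (suc (j + p) *_) (rising-! p j) ⟩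
    suc (j + p) * (j + p) ! ∎
    where
    pull : ∀ r p j f → r * (suc p + j) * f ≡ suc (j + p) * (r * f)
    pull = solve-∀

  central-! : ∀ k → ((2 * k) C k) * (k ! * k !) ≡ (2 * k) !
  central-! k = trans (cong (λ z → ((2 * k) C k) * (k ! * z !)) (sym 2k∸k))
    (trans (cong (_* (k ! * (2 * k ℕ.∸ k) !)) (nCk≡n!/k![n-k]! k≤2k)) (m/n*n≡m (k![n∸k]!∣n! k≤2k)))
    where
    instance _ = k ℕₚ.!* (2 * k ℕ.∸ k) !≢0
    k≤2k = ℕₚ.m≤m+n k (k + 0)
    2k∸k : 2 * k ℕ.∸ k ≡ k
    2k∸k = trans (ℕₚ.m+n∸m≡n k (k + 0)) (ℕₚ.+-identityʳ k)

  -- Here k counts diagonal steps, while `suc u` is the index of the sum with multiset coefficients.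
  -- With `p = 2u + 1` the rising factorial is (k+p)!/p!, and the factor 2(u+1) completes p! to
  -- (2u+2)!, the numerator of the central binomial coefficient.
  edgeTerm-binomial : ∀ k u → edgeTerm (k + u) k * (k ! * (2 + u)) ≡
    rising (2 * suc u) k * ((2 * suc u) C suc u) * suc u
  edgeTerm-binomial k u = ℕₚ.*-cancelʳ-≡ _ _ (u ! * suc u ! * (u + suc u) !) {{nonZero}} (begin
    c * (k ! * (2 + u)) * (u ! * suc u ! * p !)
      ≡⟨ regroup c (k !) (2 + u) (u !) (suc u !) (p !) ⟩
    k ! * u ! * (2 + u) ! * c * p !
      ≡⟨ cong (_* p !) (edgeTerm-! k u) ⟩
    2 * suc u * (k + u + suc u) ! * p !
      ≡⟨ cong (λ z → 2 * suc u * z ! * p !) (ℕₚ.+-assoc k u (suc u)) ⟩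
    2 * suc u * (k + p) ! * p !
      ≡⟨ cong (λ z → 2 * suc u * z * p !) (sym (rising-! p k)) ⟩
    2 * suc u * (rising (suc p) k * p !) * p !
      ≡⟨ regroup₂ (2 * suc u) (rising (suc p) k) (p !) ⟩
    rising (suc p) k * (2 * suc u * p !) * p !
      ≡⟨ cong₂ (λ z w → rising z k * w * p !) (sym twice) (trans (cong (_* p !) twice) (trans (sym (cong _! twice)) (sym (central-! (suc u))))) ⟩
    rising (2 * suc u) k * (((2 * suc u) C suc u) * (suc u ! * suc u !)) * p !
      ≡⟨ regroup₃ (rising (2 * suc u) k) ((2 * suc u) C suc u) u (u !) (suc u !) (p !) ⟩
    rising (2 * suc u) k * ((2 * suc u) C suc u) * suc u * (u ! * suc u ! * p !) ∎)
    where
    c = edgeTerm (k + u) k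
    p = u + suc u
    twice : 2 * suc u ≡ suc p
    twice = cong (λ z → suc (u + z)) (ℕₚ.+-identityʳ (suc u))
    nonZero = ℕₚ.m*n≢0 (u ! * suc u !) (p !) {{u ℕₚ.!* suc u !≢0}} {{p ℕₚ.!≢0}}
    regroup : ∀ c f s g h q → c * (f * s) * (g * h * q) ≡ f * g * (s * h) * c * q
    regroup = solve-∀
    regroup₂ : ∀ t r q → t * (r * q) * q ≡ r * (t * q) * q
    regroup₂ = solve-∀
    regroup₃ : ∀ r c u g h q → r * (c * ((suc u * g) * h)) * q ≡ r * c * suc u * (g * h * q)
    regroup₃ = solve-∀

-- The ring of formal power series

open import Data.Rational.Base as ℚ using (ℚ; 0ℚ; 1ℚ; ½; _+_; _*_; _-_; -_; _/_; ∣_∣; _≤_; _<_; nonNegative; positive)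
import Data.Rational.Properties as ℚₚ
import Data.Rational.Unnormalised.Base as ℚᵘ
import Data.Rational.Unnormalised.Properties as ℚᵘₚ
open import Data.Rational.Solver using (module +-*-Solver)

module _ where
  open ≡-Reasoning
  open +-*-Solver

  ι : ℕ → ℚ
  ι n = ℤ.+ n / 1

  ι-suc : ∀ n → ι (suc n) ≡ 1ℚ + ι n
  ι-suc n = trans (grid-+ 0 n) (ℚₚ.+-comm (ι n) 1ℚ)

  ι-+ : ∀ m n → ι (m ℕ.+ n) ≡ ι m + ι n
  ι-+ zero    n = sym (ℚₚ.+-identityˡ (ι n))
  ι-+ (suc m) n = begin
    ι (suc (m ℕ.+ n))   ≡⟨ ι-suc (m ℕ.+ n) ⟩
    1ℚ + ι (m ℕ.+ n)    ≡⟨ cong (1ℚ +_) (ι-+ m n) ⟩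
    1ℚ + (ι m + ι n)    ≡⟨ ℚₚ.+-assoc 1ℚ (ι m) (ι n) ⟨
    1ℚ + ι m + ι n      ≡⟨ cong (_+ ι n) (ι-suc m) ⟨
    ι (suc m) + ι n     ∎

  ι-* : ∀ m n → ι (m ℕ.* n) ≡ ι m * ι n
  ι-* zero    n = sym (ℚₚ.*-zeroˡ (ι n))
  ι-* (suc m) n = begin
    ι (n ℕ.+ m ℕ.* n)   ≡⟨ trans (ι-+ n (m ℕ.* n)) (cong (ι n +_) (ι-* m n)) ⟩
    ι n + ι m * ι n     ≡⟨ solve 2 (λ m n → n :+ m :* n := (con 1ℚ :+ m) :* n) refl (ι m) (ι n) ⟩
    (1ℚ + ι m) * ι n    ≡⟨ cong (_* ι n) (ι-suc m) ⟨
    ι (suc m) * ι n     ∎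

  ι-mono : ∀ {m n} → m ℕ.≤ n → ι m ≤ ι n
  ι-mono = grid-mono 0

  0≤ι : ∀ n → 0ℚ ≤ ι n
  0≤ι n = ι-mono {0} {n} ℕ.z≤n

  0<ι : ∀ n → 0ℚ < ι (suc n)
  0<ι n = ℚₚ.<-≤-trans 0<1 (ι-mono {1} {suc n} (ℕ.s≤s ℕ.z≤n))

  /-ι : ∀ a b .{{_ : NonZero b}} → (ℤ.+ a / b) * ι b ≡ ι a
  /-ι a (suc b) = ℚₚ.toℚᵘ-injective
    (ℚᵘₚ.≃-trans (ℚₚ.toℚᵘ-homo-* (ℤ.+ a / suc b) (ι (suc b)))
    (ℚᵘₚ.≃-trans (ℚᵘₚ.*-cong (toℚᵘ-/ (ℤ.+ a) b) (toℚᵘ-/ (ℤ.+ suc b) 0))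
    (ℚᵘₚ.≃-trans (ℚᵘ.*≡* (eq (ℤ.+ a) (ℤ.+ suc b)))
    (ℚᵘₚ.≃-sym (toℚᵘ-/ (ℤ.+ a) 0)))))
    where
    eq : ∀ x y → (x ℤ.* y) ℤ.* (ℤ.+ 1) ≡ x ℤ.* (y ℤ.* ℤ.+ 1)
    eq = ℤ-Ring.solve-∀

  Σ≤-shift : ∀ n f → Σ≤ (suc n) f ≡ f 0 + Σ≤ n (λ i → f (suc i))
  Σ≤-shift zero    f = refl
  Σ≤-shift (suc n) f = trans (cong (_+ f (2 ℕ.+ n)) (Σ≤-shift n f)) (ℚₚ.+-assoc (f 0) (Σ≤ n (λ i → f (suc i))) (f (2 ℕ.+ n)))

  Σ≤-reverse : ∀ n f → Σ≤ n f ≡ Σ≤ n (λ i → f (n ℕ.∸ i))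
  Σ≤-reverse zero    f = refl
  Σ≤-reverse (suc n) f = begin
    Σ≤ n f + f (suc n)                            ≡⟨ cong (_+ f (suc n)) (Σ≤-reverse n f) ⟩
    Σ≤ n (λ i → f (n ℕ.∸ i)) + f (suc n)          ≡⟨ ℚₚ.+-comm (Σ≤ n (λ i → f (n ℕ.∸ i))) (f (suc n)) ⟩
    f (suc n) + Σ≤ n (λ i → f (n ℕ.∸ i))          ≡⟨ Σ≤-shift n (λ i → f (suc n ℕ.∸ i)) ⟨
    Σ≤ (suc n) (λ i → f (suc n ℕ.∸ i))            ∎

  Σ≤-* : ∀ n c f → Σ≤ n (λ i → c * f i) ≡ c * Σ≤ n f
  Σ≤-* zero    c f = refl
  Σ≤-* (suc n) c f = trans (cong (_+ c * f (suc n)) (Σ≤-* n c f)) (sym (ℚₚ.*-distribˡ-+ c (Σ≤ n f) (f (suc n))))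

  infix 4 _≐_
  -- A record instead of the bare function type, so that both series can be inferred from a proof.
  record _≐_ (f g : Series) : Set where
    constructor pointwise
    field at : ∀ n → f n ≡ g n
  open _≐_

  ≐-refl : ∀ {f} → f ≐ f
  ≐-refl = pointwise λ _ → refl

  ≐-sym : ∀ {f g} → f ≐ g → g ≐ f
  ≐-sym (pointwise eq) = pointwise λ n → sym (eq n)

  ≐-trans : ∀ {f g h} → f ≐ g → g ≐ h → f ≐ h
  ≐-trans (pointwise eq) (pointwise eq′) = pointwise λ n → trans (eq n) (eq′ n)

  ⊛-cong : ∀ {f f′ g g′} → f ≐ f′ → g ≐ g′ → f ⊛ g ≐ f′ ⊛ g′
  ⊛-cong (pointwise eq) (pointwise eq′) = pointwise λ n → Σ≤-cong n λ i _ → cong₂ _*_ (eq i) (eq′ (n ℕ.∸ i))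

  shift : Series → Series
  shift f n = f (suc n)

  scale : ℚ → Series → Series
  scale c f n = c * f n

  ⊛-suc : ∀ f g n → (f ⊛ g) (suc n) ≡ f 0 * g (suc n) + (shift f ⊛ g) n
  ⊛-suc f g n = Σ≤-shift n (λ i → f i * g (suc n ℕ.∸ i))

  ⊛-comm : ∀ f g → f ⊛ g ≐ g ⊛ f
  ⊛-comm f g = pointwise λ n → trans (Σ≤-reverse n (λ i → f i * g (n ℕ.∸ i))) (Σ≤-cong n λ i i≤n →
    trans (cong (λ j → f (n ℕ.∸ i) * g j) (ℕₚ.m∸[m∸n]≡n i≤n)) (ℚₚ.*-comm (f (n ℕ.∸ i)) (g i)))

  ⊛-distribʳ : ∀ h f g → (f ⊕ g) ⊛ h ≐ (f ⊛ h) ⊕ (g ⊛ h)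
  ⊛-distribʳ h f g = pointwise λ n → trans
    (Σ≤-cong n λ i _ → ℚₚ.*-distribʳ-+ (h (n ℕ.∸ i)) (f i) (g i))
    (Σ≤-+ n (λ i → f i * h (n ℕ.∸ i)) (λ i → g i * h (n ℕ.∸ i)))

  ⊛-distribˡ : ∀ h f g → h ⊛ (f ⊕ g) ≐ (h ⊛ f) ⊕ (h ⊛ g)
  ⊛-distribˡ h f g = ≐-trans (⊛-comm h (f ⊕ g)) (≐-trans (⊛-distribʳ h f g)
    (pointwise λ n → cong₂ _+_ (at (⊛-comm f h) n) (at (⊛-comm g h) n)))

  scale-⊛ : ∀ c f g → scale c f ⊛ g ≐ scale c (f ⊛ g)
  scale-⊛ c f g = pointwise λ n → trans
    (Σ≤-cong n λ i _ → ℚₚ.*-assoc c (f i) (g (n ℕ.∸ i))) (Σ≤-* n c (λ i → f i * g (n ℕ.∸ i)))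

  -- Induction on the index, with `f` varying: peeling off the constant term of `f` leaves a product
  -- with `shift f`, and no double sum has to be interchanged.
  ⊛-assoc : ∀ f g h → (f ⊛ g) ⊛ h ≐ f ⊛ (g ⊛ h)
  ⊛-assoc f g h = pointwise λ n → coefficient n f
    where
    coefficient : ∀ n f → ((f ⊛ g) ⊛ h) n ≡ (f ⊛ (g ⊛ h)) n
    coefficient zero    f = ℚₚ.*-assoc (f 0) (g 0) (h 0)
    coefficient (suc n) f = begin
      ((f ⊛ g) ⊛ h) (suc n)
        ≡⟨ ⊛-suc (f ⊛ g) h n ⟩
      f 0 * g 0 * h (suc n) + (shift (f ⊛ g) ⊛ h) n
        ≡⟨ cong (f 0 * g 0 * h (suc n) +_) (at (⊛-cong {shift (f ⊛ g)} {scale (f 0) (shift g) ⊕ (shift f ⊛ g)} {h}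
             (pointwise λ k → ⊛-suc f g k) ≐-refl) n) ⟩
      f 0 * g 0 * h (suc n) + ((scale (f 0) (shift g) ⊕ (shift f ⊛ g)) ⊛ h) n
        ≡⟨ cong (f 0 * g 0 * h (suc n) +_) (at (⊛-distribʳ h (scale (f 0) (shift g)) (shift f ⊛ g)) n) ⟩
      f 0 * g 0 * h (suc n) + ((scale (f 0) (shift g) ⊛ h) n + ((shift f ⊛ g) ⊛ h) n)
        ≡⟨ cong₂ (λ x y → f 0 * g 0 * h (suc n) + (x + y)) (at (scale-⊛ (f 0) (shift g) h) n) (coefficient n (shift f)) ⟩
      f 0 * g 0 * h (suc n) + (f 0 * (shift g ⊛ h) n + (shift f ⊛ (g ⊛ h)) n)
        ≡⟨ solve 5 (λ a b c d e → a :* b :* c :+ (a :* d :+ e) := a :* (b :* c :+ d) :+ e) refl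
             (f 0) (g 0) (h (suc n)) ((shift g ⊛ h) n) ((shift f ⊛ (g ⊛ h)) n) ⟩
      f 0 * (g 0 * h (suc n) + (shift g ⊛ h) n) + (shift f ⊛ (g ⊛ h)) n
        ≡⟨ cong (λ z → f 0 * z + (shift f ⊛ (g ⊛ h)) n) (⊛-suc g h n) ⟨
      f 0 * (g ⊛ h) (suc n) + (shift f ⊛ (g ⊛ h)) n
        ≡⟨ ⊛-suc f (g ⊛ h) n ⟨
      (f ⊛ (g ⊛ h)) (suc n) ∎

  0ˢ : Series
  0ˢ _ = 0ℚ

  ⊖ˢ_ : Series → Series
  (⊖ˢ f) n = - f n

  0⊛ : ∀ f → 0ˢ ⊛ f ≐ 0ˢ
  0⊛ f = pointwise λ n → trans (Σ≤-cong n λ i _ → ℚₚ.*-zeroˡ (f (n ℕ.∸ i))) (Σ≤-zero n)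

  constant : ℚ → Series
  constant c = monomial c 0

  constant-⊛ : ∀ c f → constant c ⊛ f ≐ scale c f
  constant-⊛ c f = pointwise λ where
    zero    → refl
    (suc n) → trans (⊛-suc (constant c) f n) (trans (cong (c * f (suc n) +_) (at (0⊛ f) n)) (ℚₚ.+-identityʳ (c * f (suc n))))

  seriesRing : CommutativeRing 0ℓ 0ℓ
  seriesRing = record
    { Carrier = Series
    ; _≈_ = _≐_
    ; _+_ = _⊕_
    ; _*_ = _⊛_
    ; -_ = ⊖ˢ_
    ; 0# = 0ˢ
    ; 1# = constant 1ℚ
    ; isCommutativeRing = record
      { isRing = record
        { +-isAbelianGroup = record
          { isGroup = record
            { isMonoid = record
              { isSemigroup = record
                { isMagma = record
                  { isEquivalence = record { refl = ≐-refl ; sym = ≐-sym ; trans = ≐-trans }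
                  ; ∙-cong = λ (pointwise eq) (pointwise eq′) → pointwise λ n → cong₂ _+_ (eq n) (eq′ n)
                  }
                ; assoc = λ f g h → pointwise λ n → ℚₚ.+-assoc (f n) (g n) (h n)
                }
              ; identity = (λ f → pointwise λ n → ℚₚ.+-identityˡ (f n)) , (λ f → pointwise λ n → ℚₚ.+-identityʳ (f n))
              }
            ; inverse = (λ f → pointwise λ n → ℚₚ.+-inverseˡ (f n)) , (λ f → pointwise λ n → ℚₚ.+-inverseʳ (f n))
            ; ⁻¹-cong = λ (pointwise eq) → pointwise λ n → cong -_ (eq n)
            }
          ; comm = λ f g → pointwise λ n → ℚₚ.+-comm (f n) (g n)
          }
        ; *-cong = ⊛-cong
        ; *-assoc = ⊛-assoc
        ; *-identity = identityˡ , (λ f → ≐-trans (⊛-comm f (constant 1ℚ)) (identityˡ f))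
        ; distrib = ⊛-distribˡ , ⊛-distribʳ
        }
      ; *-comm = ⊛-comm
      }
    }
    where
    identityˡ : ∀ f → constant 1ℚ ⊛ f ≐ f
    identityˡ f = ≐-trans (constant-⊛ 1ℚ f) (pointwise λ n → ℚₚ.*-identityˡ (f n))

  constant-≟ : ∀ c c′ → Maybe (constant c ≐ constant c′)
  constant-≟ c c′ with c ℚₚ.≟ c′
  ... | yes refl = just ≐-refl
  ... | no  _    = nothing

  -- Rational constants become coefficients of the solver; `const k` is by definition
  -- `constant (ι k)`, so numerals in series identities are normalised too.
  constantMorphism : ℚₚ.+-*-rawRing ACR.-Raw-AlmostCommutative⟶ ACR.fromCommutativeRing seriesRing
  constantMorphism = record
    { ⟦_⟧ = constant
    ; +-homo = λ c c′ → pointwise λ { zero → refl ; (suc n) → refl }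
    ; *-homo = λ c c′ → pointwise λ { zero → refl ; (suc n) → trans (sym (ℚₚ.*-zeroʳ c)) (sym (at (constant-⊛ c (constant c′)) (suc n))) }
    ; -‿homo = λ c → pointwise λ { zero → refl ; (suc n) → refl }
    ; 0-homo = pointwise λ { zero → refl ; (suc n) → refl }
    ; 1-homo = ≐-refl
    }

  module SeriesSolver = RingSolver ℚₚ.+-*-rawRing (ACR.fromCommutativeRing seriesRing) constantMorphism constant-≟

  X-⊛-suc : ∀ f n → (X ⊛ f) (suc n) ≡ f n
  X-⊛-suc f n = begin
    (X ⊛ f) (suc n)                ≡⟨ ⊛-suc X f n ⟩
    0ℚ * f (suc n) + (shift X ⊛ f) n
      ≡⟨ cong₂ _+_ (ℚₚ.*-zeroˡ (f (suc n))) (at (⊛-cong {shift X} {constant 1ℚ} {f} (pointwise shift-X) ≐-refl) n) ⟩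
    0ℚ + (constant 1ℚ ⊛ f) n       ≡⟨ ℚₚ.+-identityˡ _ ⟩
    (constant 1ℚ ⊛ f) n            ≡⟨ at (constant-⊛ 1ℚ f) n ⟩
    1ℚ * f n                       ≡⟨ ℚₚ.*-identityˡ (f n) ⟩
    f n ∎
    where
    shift-X : ∀ n → shift X n ≡ constant 1ℚ n
    shift-X zero    = refl
    shift-X (suc n) = refl

  X-⊛-zero : ∀ f → (X ⊛ f) 0 ≡ 0ℚ
  X-⊛-zero f = ℚₚ.*-zeroˡ (f 0)

  -- The derivation x d/dx.
  θ : Series → Series
  θ f n = ι n * f n

  θ-⊛ : ∀ f g → θ (f ⊛ g) ≐ (θ f ⊛ g) ⊕ (f ⊛ θ g)
  θ-⊛ f g = pointwise λ n → begin
    ι n * Σ≤ n (λ i → f i * g (n ℕ.∸ i))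
      ≡⟨ Σ≤-* n (ι n) (λ i → f i * g (n ℕ.∸ i)) ⟨
    Σ≤ n (λ i → ι n * (f i * g (n ℕ.∸ i)))
      ≡⟨ (Σ≤-cong n λ i i≤n → trans
           (cong (_* (f i * g (n ℕ.∸ i))) (trans (cong ι (sym (ℕₚ.m+[n∸m]≡n i≤n))) (ι-+ i (n ℕ.∸ i))))
           (solve 4 (λ i j f g → (i :+ j) :* (f :* g) := i :* f :* g :+ f :* (j :* g)) refl
             (ι i) (ι (n ℕ.∸ i)) (f i) (g (n ℕ.∸ i)))) ⟩
    Σ≤ n (λ i → ι i * f i * g (n ℕ.∸ i) + f i * (ι (n ℕ.∸ i) * g (n ℕ.∸ i)))
      ≡⟨ Σ≤-+ n (λ i → ι i * f i * g (n ℕ.∸ i)) (λ i → f i * (ι (n ℕ.∸ i) * g (n ℕ.∸ i))) ⟩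
    (θ f ⊛ g) n + (f ⊛ θ g) n ∎

  ι-cancel : ∀ n {a b} → ι (suc n) * a ≡ ι (suc n) * b → a ≡ b
  ι-cancel n {a} {b} eq = begin
    a                              ≡⟨ undo a ⟨
    grid n 1 * (ι (suc n) * a)     ≡⟨ cong (grid n 1 *_) eq ⟩
    grid n 1 * (ι (suc n) * b)     ≡⟨ undo b ⟩
    b ∎
    where
    undo : ∀ a → grid n 1 * (ι (suc n) * a) ≡ a
    undo a = trans (sym (ℚₚ.*-assoc (grid n 1) (ι (suc n)) a)) (trans (cong (_* a) (/-ι 1 (suc n))) (ℚₚ.*-identityˡ a))

  θ≐0⇒constant : ∀ f → θ f ≐ 0ˢ → f ≐ constant (f 0)
  θ≐0⇒constant f eq = pointwise λ where
    zero    → refl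
    (suc n) → ι-cancel n (trans (at eq (suc n)) (sym (ℚₚ.*-zeroʳ (ι (suc n)))))

open _≐_
open CommutativeRing seriesRing using () renaming (setoid to seriesSetoid; +-cong to ⊕-cong)
import Relation.Binary.Reasoning.Setoid seriesSetoid as ≐-Reasoning

⊖-cong : ∀ {f f′ g g′} → f ≐ f′ → g ≐ g′ → f ⊖ g ≐ f′ ⊖ g′
⊖-cong (pointwise eq) (pointwise eq′) = pointwise λ n → cong₂ _-_ (eq n) (eq′ n)

θ-cong : ∀ {f g} → f ≐ g → θ f ≐ θ g
θ-cong (pointwise eq) = pointwise λ n → cong (ι n *_) (eq n)

-- Generating functions of the Delannoy, Schröder and edge numbers

Dˢ Rˢ Sˢ Lˢ : Series
Dˢ n = ι (d n)
Rˢ n = ι (r n)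
Lˢ n = ι (ℓ (𝒮 n))
Sˢ = √ˢ Δ

module _ where
  open SeriesSolver

  Δ-expand : ∀ f → Δ ⊛ f ≐ (f ⊖ const 6 ⊛ (X ⊛ f)) ⊕ X ⊛ (X ⊛ f)
  Δ-expand f = solve 2 (λ x f → (con 1ℚ :- con (ι 6) :* x :+ x :* x) :* f := (f :- con (ι 6) :* (x :* f)) :+ x :* (x :* f))
    ≐-refl X f

  X²-3X-expand : ∀ f → (X ⊛ X ⊖ const 3 ⊛ X) ⊛ f ≐ X ⊛ (X ⊛ f) ⊖ const 3 ⊛ (X ⊛ f)
  X²-3X-expand f = solve 2 (λ x f → (x :* x :- con (ι 3) :* x) :* f := x :* (x :* f) :- con (ι 3) :* (x :* f)) ≐-refl X f

  1-X-expand : ∀ f → (const 1 ⊖ X) ⊛ f ≐ f ⊖ X ⊛ f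
  1-X-expand f = solve 2 (λ x f → (con 1ℚ :- x) :* f := f :- x :* f) ≐-refl X f

  3X-X²-expand : ∀ f → (const 3 ⊛ X ⊖ X ⊛ X) ⊛ f ≐ const 3 ⊛ (X ⊛ f) ⊖ X ⊛ (X ⊛ f)
  3X-X²-expand f = solve 2 (λ x f → (con (ι 3) :* x :- x :* x) :* f := con (ι 3) :* (x :* f) :- x :* (x :* f)) ≐-refl X f

X²-⊛-suc : ∀ f n → (X ⊛ (X ⊛ f)) (2 ℕ.+ n) ≡ f n
X²-⊛-suc f n = trans (X-⊛-suc (X ⊛ f) (suc n)) (X-⊛-suc f n)

Δ-⊛-0 : ∀ f → (Δ ⊛ f) 0 ≡ f 0
Δ-⊛-0 f = ℚₚ.*-identityˡ (f 0)

module _ where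
  open +-*-Solver
  open ≡-Reasoning

  Δ-⊛-1 : ∀ f → (Δ ⊛ f) 1 ≡ f 1 - ι 6 * f 0
  Δ-⊛-1 f = begin
    (Δ ⊛ f) 1
      ≡⟨ at (Δ-expand f) 1 ⟩
    (f 1 - (const 6 ⊛ (X ⊛ f)) 1) + (X ⊛ (X ⊛ f)) 1
      ≡⟨ cong₂ (λ x y → (f 1 - x) + y) (trans (at (constant-⊛ (ι 6) (X ⊛ f)) 1) (cong (ι 6 *_) (X-⊛-suc f 0)))
           (trans (X-⊛-suc (X ⊛ f) 0) (X-⊛-zero f)) ⟩
    (f 1 - ι 6 * f 0) + 0ℚ
      ≡⟨ ℚₚ.+-identityʳ _ ⟩
    f 1 - ι 6 * f 0 ∎

  Δ-⊛-suc : ∀ f n → (Δ ⊛ f) (2 ℕ.+ n) ≡ (f (2 ℕ.+ n) - ι 6 * f (1 ℕ.+ n)) + f n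
  Δ-⊛-suc f n = trans (at (Δ-expand f) (2 ℕ.+ n)) (cong₂ (λ x y → (f (2 ℕ.+ n) - x) + y)
    (trans (at (constant-⊛ (ι 6) (X ⊛ f)) (2 ℕ.+ n)) (cong (ι 6 *_) (X-⊛-suc f (suc n)))) (X²-⊛-suc f n))

  -- The constant term of Δ is 1, so a coefficient of `f` is determined by the two before it.
  Δ-cancel : ∀ f → Δ ⊛ f ≐ 0ˢ → f ≐ 0ˢ
  Δ-cancel f (pointwise eq) = pointwise go
    where
    f0 : f 0 ≡ 0ℚ
    f0 = trans (sym (Δ-⊛-0 f)) (eq 0)
    go : ∀ n → f n ≡ 0ℚ
    go zero = f0
    go (suc zero) = begin
      f 1                       ≡⟨ solve 2 (λ a b → a := (a :- con (ι 6) :* b) :+ con (ι 6) :* b) refl (f 1) (f 0) ⟩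
      (f 1 - ι 6 * f 0) + ι 6 * f 0
        ≡⟨ cong₂ (λ x y → x + ι 6 * y) (trans (sym (Δ-⊛-1 f)) (eq 1)) f0 ⟩
      0ℚ ∎
    go (suc (suc n)) = begin
      f (2 ℕ.+ n)
        ≡⟨ solve 3 (λ a b c → a := ((a :- con (ι 6) :* b) :+ c) :+ (con (ι 6) :* b :- c)) refl (f (2 ℕ.+ n)) (f (1 ℕ.+ n)) (f n) ⟩
      ((f (2 ℕ.+ n) - ι 6 * f (1 ℕ.+ n)) + f n) + (ι 6 * f (1 ℕ.+ n) - f n)
        ≡⟨ cong₂ _+_ (trans (sym (Δ-⊛-suc f n)) (eq (2 ℕ.+ n))) (cong₂ (λ x y → ι 6 * x - y) (go (suc n)) (go n)) ⟩
      0ℚ ∎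

  ι-d-recurrence : ∀ n → ι (2 ℕ.+ n) * ι (d (2 ℕ.+ n)) + ι (1 ℕ.+ n) * ι (d n) ≡ ι 3 * (ι 3 + ι 2 * ι n) * ι (d (1 ℕ.+ n))
  ι-d-recurrence n = begin
    ι (2 ℕ.+ n) * ι (d (2 ℕ.+ n)) + ι (1 ℕ.+ n) * ι (d n)
      ≡⟨ cong₂ _+_ (ι-* (2 ℕ.+ n) (d (2 ℕ.+ n))) (ι-* (1 ℕ.+ n) (d n)) ⟨
    ι ((2 ℕ.+ n) ℕ.* d (2 ℕ.+ n)) + ι ((1 ℕ.+ n) ℕ.* d n)
      ≡⟨ ι-+ ((2 ℕ.+ n) ℕ.* d (2 ℕ.+ n)) ((1 ℕ.+ n) ℕ.* d n) ⟨
    ι ((2 ℕ.+ n) ℕ.* d (2 ℕ.+ n) ℕ.+ (1 ℕ.+ n) ℕ.* d n)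
      ≡⟨ cong ι (d-recurrence n) ⟩
    ι (3 ℕ.* (3 ℕ.+ 2 ℕ.* n) ℕ.* d (1 ℕ.+ n))
      ≡⟨ trans (ι-* (3 ℕ.* (3 ℕ.+ 2 ℕ.* n)) (d (1 ℕ.+ n))) (cong (_* ι (d (1 ℕ.+ n))) (trans (ι-* 3 (3 ℕ.+ 2 ℕ.* n))
           (cong (ι 3 *_) (trans (ι-+ 3 (2 ℕ.* n)) (cong (ι 3 +_) (ι-* 2 n)))))) ⟩
    ι 3 * (ι 3 + ι 2 * ι n) * ι (d (1 ℕ.+ n)) ∎

  ι-r-from-d : ∀ n → ι 2 * ι (2 ℕ.+ n) * ι (r (suc n)) + ι (d n) ≡ ι 3 * ι (d (suc n))
  ι-r-from-d n = begin
    ι 2 * ι (2 ℕ.+ n) * ι (r (suc n)) + ι (d n)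
      ≡⟨ cong (_+ ι (d n)) (trans (ι-* (2 ℕ.* (2 ℕ.+ n)) (r (suc n))) (cong (_* ι (r (suc n))) (ι-* 2 (2 ℕ.+ n)))) ⟨
    ι (2 ℕ.* (2 ℕ.+ n) ℕ.* r (suc n)) + ι (d n)
      ≡⟨ trans (cong ι (sym (r-from-d n))) (ι-+ (2 ℕ.* (2 ℕ.+ n) ℕ.* r (suc n)) (d n)) ⟨
    ι (3 ℕ.* d (suc n))
      ≡⟨ ι-* 3 (d (suc n)) ⟩
    ι 3 * ι (d (suc n)) ∎

  ι-ℓ : ∀ n → ι (ℓ (𝒮 (suc n))) ≡ (ι (d (suc n)) - ι (r (suc n))) - (ι (d n) - ι (r n))
  ι-ℓ n = begin
    l
      ≡⟨ solve 4 (λ l a b c → l := ((l :+ a :+ b) :- a :- b)) refl l (ι (r (suc n))) (ι (d n)) (ι (r n)) ⟩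
    (l + ι (r (suc n)) + ι (d n)) - ι (r (suc n)) - ι (d n)
      ≡⟨ cong (λ z → z - ι (r (suc n)) - ι (d n)) (trans
           (trans (cong (_+ ι (d n)) (sym (ι-+ (ℓ (𝒮 (suc n))) (r (suc n))))) (sym (ι-+ (ℓ (𝒮 (suc n)) ℕ.+ r (suc n)) (d n))))
           (trans (cong ι (ℓ-d-r n)) (ι-+ (d (suc n)) (r n)))) ⟩
    (ι (d (suc n)) + ι (r n)) - ι (r (suc n)) - ι (d n)
      ≡⟨ solve 4 (λ a b c e → (a :+ b) :- c :- e := (a :- c) :- (e :- b)) refl (ι (d (suc n))) (ι (r n)) (ι (r (suc n))) (ι (d n)) ⟩
    (ι (d (suc n)) - ι (r (suc n))) - (ι (d n) - ι (r n)) ∎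
    where l = ι (ℓ (𝒮 (suc n)))

  Δθd : Δ ⊛ θ Dˢ ≐ (const 3 ⊛ X ⊖ X ⊛ X) ⊛ Dˢ
  Δθd = pointwise λ where
    zero    → refl
    (suc zero) → refl
    (suc (suc n)) → begin
      (Δ ⊛ θ Dˢ) (2 ℕ.+ n)
        ≡⟨ Δ-⊛-suc (θ Dˢ) n ⟩
      (ι (2 ℕ.+ n) * Dˢ (2 ℕ.+ n) - ι 6 * (ι (1 ℕ.+ n) * Dˢ (1 ℕ.+ n))) + ι n * Dˢ n
        ≡⟨ solve 6 (λ a b i n e f → (a :* b :- con (ι 6) :* (i :* e)) :+ n :* f := (a :* b :+ i :* f) :+ (n :* f :- i :* f :- con (ι 6) :* (i :* e)))
             refl (ι (2 ℕ.+ n)) (Dˢ (2 ℕ.+ n)) (ι (1 ℕ.+ n)) (ι n) (Dˢ (1 ℕ.+ n)) (Dˢ n) ⟩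
      (ι (2 ℕ.+ n) * Dˢ (2 ℕ.+ n) + ι (1 ℕ.+ n) * Dˢ n) + (ι n * Dˢ n - ι (1 ℕ.+ n) * Dˢ n - ι 6 * (ι (1 ℕ.+ n) * Dˢ (1 ℕ.+ n)))
        ≡⟨ cong₂ (λ x i → x + (ι n * Dˢ n - i * Dˢ n - ι 6 * (i * Dˢ (1 ℕ.+ n)))) (ι-d-recurrence n) (ι-suc n) ⟩
      ι 3 * (ι 3 + ι 2 * ι n) * Dˢ (1 ℕ.+ n) + (ι n * Dˢ n - (1ℚ + ι n) * Dˢ n - ι 6 * ((1ℚ + ι n) * Dˢ (1 ℕ.+ n)))
        ≡⟨ solve 3 (λ n e f → con (ι 3) :* (con (ι 3) :+ con (ι 2) :* n) :* e :+ (n :* f :- (con 1ℚ :+ n) :* f :- con (ι 6) :* ((con 1ℚ :+ n) :* e)) := con (ι 3) :* e :- f)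
             refl (ι n) (Dˢ (1 ℕ.+ n)) (Dˢ n) ⟩
      ι 3 * Dˢ (1 ℕ.+ n) - Dˢ n
        ≡⟨ cong₂ _-_ (trans (at (constant-⊛ (ι 3) (X ⊛ Dˢ)) (2 ℕ.+ n)) (cong (ι 3 *_) (X-⊛-suc Dˢ (suc n)))) (X²-⊛-suc Dˢ n) ⟨
      (const 3 ⊛ (X ⊛ Dˢ) ⊖ X ⊛ (X ⊛ Dˢ)) (2 ℕ.+ n)
        ≡⟨ at (3X-X²-expand Dˢ) (2 ℕ.+ n) ⟨
      ((const 3 ⊛ X ⊖ X ⊛ X) ⊛ Dˢ) (2 ℕ.+ n) ∎

S² : Sˢ ⊛ Sˢ ≐ Δ
S² = pointwise (√ˢ-square Δ refl)

θΔ : θ Δ ≐ const 2 ⊛ (X ⊛ X ⊖ const 3 ⊛ X)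
θΔ = pointwise go
  where
  X-high : ∀ n → X (2 ℕ.+ n) ≡ 0ℚ
  X-high n = monomial-off 1ℚ 1 {2 ℕ.+ n} (λ ())
  X²-high : ∀ n → (X ⊛ X) (3 ℕ.+ n) ≡ 0ℚ
  X²-high n = trans (X-⊛-suc X (2 ℕ.+ n)) (X-high n)
  cX-high : ∀ c n → (constant c ⊛ X) (2 ℕ.+ n) ≡ 0ℚ
  cX-high c n = trans (at (constant-⊛ c X) (2 ℕ.+ n)) (trans (cong (c *_) (X-high n)) (ℚₚ.*-zeroʳ c))
  3X-high : ∀ n → (const 3 ⊛ X) (2 ℕ.+ n) ≡ 0ℚ
  3X-high = cX-high (ι 3)
  Δ-high : ∀ n → Δ (3 ℕ.+ n) ≡ 0ℚ
  Δ-high n = cong₂ (λ x y → (0ℚ - x) + y) (cX-high (ι 6) (suc n)) (X²-high n)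
  go : ∀ n → θ Δ n ≡ (const 2 ⊛ (X ⊛ X ⊖ const 3 ⊛ X)) n
  go zero = refl
  go (suc zero) = refl
  go (suc (suc zero)) = refl
  go (suc (suc (suc n))) = trans (trans (cong (ι (3 ℕ.+ n) *_) (Δ-high n)) (ℚₚ.*-zeroʳ (ι (3 ℕ.+ n))))
    (sym (trans (at (constant-⊛ (ι 2) (X ⊛ X ⊖ const 3 ⊛ X)) (3 ℕ.+ n))
      (trans (cong (ι 2 *_) (cong₂ _-_ (X²-high n) (3X-high (suc n)))) refl)))

SθS : Sˢ ⊛ θ Sˢ ≐ X ⊛ X ⊖ const 3 ⊛ X
SθS = begin
  Sˢ ⊛ θ Sˢ                          ≈⟨ solve 2 (λ s t → s :* t := con ½ :* (t :* s :+ s :* t)) ≐-refl Sˢ (θ Sˢ) ⟩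
  constant ½ ⊛ ((θ Sˢ ⊛ Sˢ) ⊕ (Sˢ ⊛ θ Sˢ))    ≈⟨ ⊛-cong {constant ½} ≐-refl (≐-trans (≐-sym (θ-⊛ Sˢ Sˢ)) (≐-trans (θ-cong S²) θΔ)) ⟩
  constant ½ ⊛ (const 2 ⊛ (X ⊛ X ⊖ const 3 ⊛ X))
    ≈⟨ solve 1 (λ x → con ½ :* (con (ι 2) :* (x :* x :- con (ι 3) :* x)) := x :* x :- con (ι 3) :* x) ≐-refl X ⟩
  X ⊛ X ⊖ const 3 ⊛ X ∎
  where
  open SeriesSolver
  open ≐-Reasoning

-- After multiplication by Δ both logarithmic derivatives are known: writing Δ as S² in the first
-- summand exposes S θS = x² - 3x, while Δ θD = (3x - x²) D, and the two cancel. The constant is the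
-- product of the constant terms, which evaluates to 1.
SD≐1 : Sˢ ⊛ Dˢ ≐ const 1
SD≐1 = θ≐0⇒constant (Sˢ ⊛ Dˢ) (Δ-cancel (θ (Sˢ ⊛ Dˢ)) (begin
  Δ ⊛ θ (Sˢ ⊛ Dˢ)
    ≈⟨ ⊛-cong {Δ} ≐-refl (θ-⊛ Sˢ Dˢ) ⟩
  Δ ⊛ ((θ Sˢ ⊛ Dˢ) ⊕ (Sˢ ⊛ θ Dˢ))
    ≈⟨ solve 5 (λ δ s t d e → δ :* (t :* d :+ s :* e) := δ :* (t :* d) :+ s :* (δ :* e)) ≐-refl Δ Sˢ (θ Sˢ) Dˢ (θ Dˢ) ⟩
  Δ ⊛ (θ Sˢ ⊛ Dˢ) ⊕ Sˢ ⊛ (Δ ⊛ θ Dˢ)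
    ≈⟨ ⊕-cong (⊛-cong (≐-sym S²) (≐-refl {θ Sˢ ⊛ Dˢ})) (⊛-cong (≐-refl {Sˢ}) Δθd) ⟩
  (Sˢ ⊛ Sˢ) ⊛ (θ Sˢ ⊛ Dˢ) ⊕ Sˢ ⊛ ((const 3 ⊛ X ⊖ X ⊛ X) ⊛ Dˢ)
    ≈⟨ solve 4 (λ s t d x → (s :* s) :* (t :* d) :+ s :* ((con (ι 3) :* x :- x :* x) :* d) := (s :* t) :* (s :* d) :+ s :* ((con (ι 3) :* x :- x :* x) :* d))
         ≐-refl Sˢ (θ Sˢ) Dˢ X ⟩
  (Sˢ ⊛ θ Sˢ) ⊛ (Sˢ ⊛ Dˢ) ⊕ Sˢ ⊛ ((const 3 ⊛ X ⊖ X ⊛ X) ⊛ Dˢ)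
    ≈⟨ ⊕-cong (⊛-cong SθS (≐-refl {Sˢ ⊛ Dˢ})) ≐-refl ⟩
  (X ⊛ X ⊖ const 3 ⊛ X) ⊛ (Sˢ ⊛ Dˢ) ⊕ Sˢ ⊛ ((const 3 ⊛ X ⊖ X ⊛ X) ⊛ Dˢ)
    ≈⟨ solve 3 (λ s d x → (x :* x :- con (ι 3) :* x) :* (s :* d) :+ s :* ((con (ι 3) :* x :- x :* x) :* d) := con 0ℚ) ≐-refl Sˢ Dˢ X ⟩
  constant 0ℚ
    ≈⟨ pointwise (λ { zero → refl ; (suc n) → refl }) ⟩
  0ˢ ∎))
  where
  open SeriesSolver
  open ≐-Reasoning

-- D is the inverse of S, so `SθS` can be solved for θS. The coefficients of √Δ become linear in d.
θS : θ Sˢ ≐ (X ⊛ X ⊖ const 3 ⊛ X) ⊛ Dˢ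
θS = begin
  θ Sˢ                     ≈⟨ solve 1 (λ t → t := con 1ℚ :* t) ≐-refl (θ Sˢ) ⟩
  const 1 ⊛ θ Sˢ           ≈⟨ ⊛-cong (≐-sym SD≐1) (≐-refl {θ Sˢ}) ⟩
  (Sˢ ⊛ Dˢ) ⊛ θ Sˢ           ≈⟨ solve 3 (λ s d t → s :* d :* t := s :* t :* d) ≐-refl Sˢ Dˢ (θ Sˢ) ⟩
  (Sˢ ⊛ θ Sˢ) ⊛ Dˢ           ≈⟨ ⊛-cong SθS (≐-refl {Dˢ}) ⟩
  (X ⊛ X ⊖ const 3 ⊛ X) ⊛ Dˢ ∎
  where
  open SeriesSolver
  open ≐-Reasoning

module _ where
  open ≡-Reasoning
  open +-*-Solver

  S-suc : ∀ n → ι (2 ℕ.+ n) * Sˢ (2 ℕ.+ n) ≡ Dˢ n - ι 3 * Dˢ (suc n)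
  S-suc n = begin
    θ Sˢ (2 ℕ.+ n)                                        ≡⟨ at θS (2 ℕ.+ n) ⟩
    ((X ⊛ X ⊖ const 3 ⊛ X) ⊛ Dˢ) (2 ℕ.+ n)
      ≡⟨ at (X²-3X-expand Dˢ) (2 ℕ.+ n) ⟩
    (X ⊛ (X ⊛ Dˢ) ⊖ const 3 ⊛ (X ⊛ Dˢ)) (2 ℕ.+ n)
      ≡⟨ cong₂ _-_ (X²-⊛-suc Dˢ n) (trans (at (constant-⊛ (ι 3) (X ⊛ Dˢ)) (2 ℕ.+ n)) (cong (ι 3 *_) (X-⊛-suc Dˢ (suc n)))) ⟩
    Dˢ n - ι 3 * Dˢ (suc n) ∎

  -- This is the generating function of the large Schröder numbers, solved for √Δ. Coefficients 0
  -- and 1 are evaluated; beyond them `S-suc` and `ι-r-from-d` describe the same combination of d.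
  S-from-R : Sˢ ≐ (const 1 ⊖ X) ⊖ const 2 ⊛ (X ⊛ Rˢ)
  S-from-R = pointwise λ where
    zero → refl
    (suc zero) → refl
    (suc (suc n)) → ι-cancel (suc n) (begin
      ι (2 ℕ.+ n) * Sˢ (2 ℕ.+ n)
        ≡⟨ S-suc n ⟩
      Dˢ n - ι 3 * Dˢ (suc n)
        ≡⟨ cong (λ z → Dˢ n - z) (ι-r-from-d n) ⟨
      Dˢ n - (ι 2 * ι (2 ℕ.+ n) * Rˢ (suc n) + Dˢ n)
        ≡⟨ solve 3 (λ a b i → a :- (con (ι 2) :* i :* b :+ a) := i :* ((con 0ℚ :- con 0ℚ) :- con (ι 2) :* b)) refl (Dˢ n) (Rˢ (suc n)) (ι (2 ℕ.+ n)) ⟩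
      ι (2 ℕ.+ n) * ((0ℚ - 0ℚ) - ι 2 * Rˢ (suc n))
        ≡⟨ cong (ι (2 ℕ.+ n) *_) (cong₂ (λ x y → (0ℚ - x) - y) (monomial-off 1ℚ 1 {2 ℕ.+ n} (λ ()))
            (trans (at (constant-⊛ (ι 2) (X ⊛ Rˢ)) (2 ℕ.+ n)) (cong (ι 2 *_) (X-⊛-suc Rˢ (suc n))))) ⟨
      ι (2 ℕ.+ n) * ((const 1 ⊖ X) ⊖ const 2 ⊛ (X ⊛ Rˢ)) (2 ℕ.+ n) ∎)

  L-from-D-R : Lˢ ≐ (const 1 ⊖ X) ⊛ (Dˢ ⊖ Rˢ)
  L-from-D-R = ≐-trans (pointwise go) (≐-sym (1-X-expand (Dˢ ⊖ Rˢ)))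
    where
    go : ∀ n → Lˢ n ≡ ((Dˢ ⊖ Rˢ) ⊖ (X ⊛ (Dˢ ⊖ Rˢ))) n
    go zero = refl
    go (suc n) = trans (ι-ℓ n) (cong (λ z → (Dˢ (suc n) - Rˢ (suc n)) - z) (sym (X-⊛-suc (Dˢ ⊖ Rˢ) n)))

-- In the cross product D occurs as SD = 1, and R only in the combination 1 - x - 2xR = S.
-- Multiplied by S, the latter is S² = Δ, which removes one of the two roots.
ℓ-generatingFunction : ⌜ Lˢ ⌝
  ≈ᶠ (const 1 ⊖ X) ⊛ (const 1 ⊖ const 4 ⊛ X ⊕ X ⊛ X ⊖ (const 1 ⊖ X) ⊛ √ˢ Δ) // const 2 ⊛ X ⊛ √ˢ Δ [ 2X√Δ≢0 ]
ℓ-generatingFunction = at (begin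
  Lˢ ⊛ (const 2 ⊛ X ⊛ Sˢ)
    ≈⟨ ⊛-cong L-from-D-R (≐-refl {const 2 ⊛ X ⊛ Sˢ}) ⟩
  (const 1 ⊖ X) ⊛ (Dˢ ⊖ Rˢ) ⊛ (const 2 ⊛ X ⊛ Sˢ)
    ≈⟨ solve 4 (λ x d r s → (con 1ℚ :- x) :* (d :- r) :* (con (ι 2) :* x :* s) :=
         (con 1ℚ :- x) :* (con (ι 2) :* x :* (s :* d) :- s :* (con 1ℚ :- x) :+ s :* ((con 1ℚ :- x) :- con (ι 2) :* (x :* r)))) ≐-refl X Dˢ Rˢ Sˢ ⟩
  (const 1 ⊖ X) ⊛ (const 2 ⊛ X ⊛ (Sˢ ⊛ Dˢ) ⊖ Sˢ ⊛ (const 1 ⊖ X) ⊕ Sˢ ⊛ ((const 1 ⊖ X) ⊖ const 2 ⊛ (X ⊛ Rˢ)))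
    ≈⟨ ⊛-cong (≐-refl {const 1 ⊖ X}) (⊕-cong (⊖-cong (⊛-cong (≐-refl {const 2 ⊛ X}) SD≐1) (≐-refl {Sˢ ⊛ (const 1 ⊖ X)}))
         (⊛-cong (≐-refl {Sˢ}) (≐-sym S-from-R))) ⟩
  (const 1 ⊖ X) ⊛ (const 2 ⊛ X ⊛ const 1 ⊖ Sˢ ⊛ (const 1 ⊖ X) ⊕ Sˢ ⊛ Sˢ)
    ≈⟨ ⊛-cong (≐-refl {const 1 ⊖ X}) (⊕-cong (≐-refl {const 2 ⊛ X ⊛ const 1 ⊖ Sˢ ⊛ (const 1 ⊖ X)}) S²) ⟩
  (const 1 ⊖ X) ⊛ (const 2 ⊛ X ⊛ const 1 ⊖ Sˢ ⊛ (const 1 ⊖ X) ⊕ Δ)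
    ≈⟨ solve 2 (λ x s → (con 1ℚ :- x) :* (con (ι 2) :* x :* con 1ℚ :- s :* (con 1ℚ :- x) :+ (con 1ℚ :- con (ι 6) :* x :+ x :* x)) :=
         (con 1ℚ :- x) :* (con 1ℚ :- con (ι 4) :* x :+ x :* x :- (con 1ℚ :- x) :* s) :* con 1ℚ) ≐-refl X Sˢ ⟩
  (const 1 ⊖ X) ⊛ (const 1 ⊖ const 4 ⊛ X ⊕ X ⊛ X ⊖ (const 1 ⊖ X) ⊛ √ˢ Δ) ⊛ const 1 ∎)
  where
  open SeriesSolver
  open ≐-Reasoning

-- The edge numbers as a sum over the number of up steps

module _ where
  open +-*-Solver

  -- A path to (a,b) has at most a diagonal steps, so every upper limit n ≥ a gives the full count.
  -- This freedom is needed since the recurrence relates sums over the rows a and a + 1, one of them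
  -- shifted.
  Σ≤-diagonal : ∀ a b n → a ℕ.≤ n → Σ≤ n (λ k → ι (diagonal a b k)) ≡ ι (delannoy a b)
  Σ≤-diagonal zero    b    n a≤n = Σ≤-first n (λ k → ι (diagonal 0 b k)) (λ _ → refl)
  Σ≤-diagonal (suc a) zero n a≤n = Σ≤-first n (λ k → ι (diagonal (suc a) 0 k)) (λ _ → refl)
  Σ≤-diagonal (suc a) (suc b) (suc n) (s≤s a≤n) = begin
    Σ≤ (suc n) (λ k → ι (diagonal (suc a) (suc b) k))
      ≡⟨ Σ≤-shift n (λ k → ι (diagonal (suc a) (suc b) k)) ⟩
    ι (x 0 ℕ.+ y 0) + Σ≤ n (λ k → ι (x (suc k) ℕ.+ y (suc k) ℕ.+ z k))
      ≡⟨ cong₂ _+_ (ι-+ (x 0) (y 0)) (trans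
           (Σ≤-cong n λ k _ → trans (ι-+ (x (suc k) ℕ.+ y (suc k)) (z k)) (cong (_+ ι (z k)) (ι-+ (x (suc k)) (y (suc k)))))
           (trans (Σ≤-+ n (λ k → ι (x (suc k)) + ι (y (suc k))) (λ k → ι (z k)))
             (cong (_+ Σ≤ n (λ k → ι (z k))) (Σ≤-+ n (λ k → ι (x (suc k))) (λ k → ι (y (suc k))))))) ⟩
    (ι (x 0) + ι (y 0)) + (Σ≤ n (λ k → ι (x (suc k))) + Σ≤ n (λ k → ι (y (suc k))) + Σ≤ n (λ k → ι (z k)))
      ≡⟨ solve 5 (λ a b c d e → (a :+ b) :+ (c :+ d :+ e) := (a :+ c) :+ (b :+ d) :+ e) refl
           (ι (x 0)) (ι (y 0)) (Σ≤ n (λ k → ι (x (suc k)))) (Σ≤ n (λ k → ι (y (suc k)))) (Σ≤ n (λ k → ι (z k))) ⟩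
    (ι (x 0) + Σ≤ n (λ k → ι (x (suc k)))) + (ι (y 0) + Σ≤ n (λ k → ι (y (suc k)))) + Σ≤ n (λ k → ι (z k))
      ≡⟨ cong₂ _+_ (cong₂ _+_
           (trans (sym (Σ≤-shift n (λ k → ι (x k)))) (Σ≤-diagonal a (suc b) (suc n) (ℕₚ.m≤n⇒m≤1+n a≤n)))
           (trans (sym (Σ≤-shift n (λ k → ι (y k)))) (Σ≤-diagonal (suc a) b (suc n) (s≤s a≤n))))
           (Σ≤-diagonal a b n a≤n) ⟩
    ι (delannoy a (suc b)) + ι (delannoy (suc a) b) + ι (delannoy a b)
      ≡⟨ trans (ι-+ (delannoy a (suc b) ℕ.+ delannoy (suc a) b) (delannoy a b))
           (cong (_+ ι (delannoy a b)) (ι-+ (delannoy a (suc b)) (delannoy (suc a) b))) ⟨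
    ι (delannoy (suc a) (suc b)) ∎
    where
    open ≡-Reasoning
    x = diagonal a (suc b)
    y = diagonal (suc a) b
    z = diagonal a b

module _ where
  open ≡-Reasoning
  open +-*-Solver

  *ι-cancel : ∀ n .{{_ : NonZero n}} {p q} → p * ι n ≡ q * ι n → p ≡ q
  *ι-cancel (suc n) {p} {q} eq = ι-cancel n (trans (ℚₚ.*-comm (ι (suc n)) p) (trans eq (ℚₚ.*-comm q (ι (suc n)))))

  summand : ℕ → ℕ → ℚ
  summand n k = multichoose (2 ℕ.* k) (n ℕ.∸ k) * (ℤ.+ ((2 ℕ.* k) C k) / 1) * (ℤ.+ k / suc k)

  edgeTerm-summand : ∀ k u → ι (edgeTerm (k ℕ.+ u) k) ≡
    multichoose (2 ℕ.* suc u) k * ι ((2 ℕ.* suc u) C suc u) * (ℤ.+ suc u / suc (suc u))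
  edgeTerm-summand k u = *ι-cancel (k ! ℕ.* (2 ℕ.+ u)) {{ℕₚ.m*n≢0 (k !) (2 ℕ.+ u) {{k ℕₚ.!≢0}}}} (begin
    ι (edgeTerm (k ℕ.+ u) k) * ι (k ! ℕ.* (2 ℕ.+ u))
      ≡⟨ ι-* (edgeTerm (k ℕ.+ u) k) (k ! ℕ.* (2 ℕ.+ u)) ⟨
    ι (edgeTerm (k ℕ.+ u) k ℕ.* (k ! ℕ.* (2 ℕ.+ u)))
      ≡⟨ cong ι (edgeTerm-binomial k u) ⟩
    ι (rising (2 ℕ.* suc u) k ℕ.* ((2 ℕ.* suc u) C suc u) ℕ.* suc u)
      ≡⟨ trans (ι-* (rising (2 ℕ.* suc u) k ℕ.* ((2 ℕ.* suc u) C suc u)) (suc u)) (cong (_* ι (suc u)) (ι-* (rising (2 ℕ.* suc u) k) ((2 ℕ.* suc u) C suc u))) ⟩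
    ι (rising (2 ℕ.* suc u) k) * ι ((2 ℕ.* suc u) C suc u) * ι (suc u)
      ≡⟨ cong₂ (λ x y → x * ι ((2 ℕ.* suc u) C suc u) * y) (/-ι (rising (2 ℕ.* suc u) k) (k !) {{k ℕₚ.!≢0}}) (/-ι (suc u) (2 ℕ.+ u)) ⟨
    mc * ι (k !) * ι ((2 ℕ.* suc u) C suc u) * (f * ι (2 ℕ.+ u))
      ≡⟨ solve 5 (λ m k c f s → m :* k :* c :* (f :* s) := m :* c :* f :* (k :* s)) refl mc (ι (k !)) (ι ((2 ℕ.* suc u) C suc u)) f (ι (2 ℕ.+ u)) ⟩
    mc * ι ((2 ℕ.* suc u) C suc u) * f * (ι (k !) * ι (2 ℕ.+ u))
      ≡⟨ cong (mc * ι ((2 ℕ.* suc u) C suc u) * f *_) (ι-* (k !) (2 ℕ.+ u)) ⟨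
    mc * ι ((2 ℕ.* suc u) C suc u) * f * ι (k ! ℕ.* (2 ℕ.+ u)) ∎)
    where
    mc = multichoose (2 ℕ.* suc u) k
    f = ℤ.+ suc u / suc (suc u)

  ℓ-multichoose : ∀ n → ι (ℓ (𝒮 n)) ≡ Σ≤ n (summand n)
  ℓ-multichoose zero    = refl
  ℓ-multichoose (suc m) = begin
    ι (ℓ (𝒮 (suc m)))
      ≡⟨ trans (cong ι (ℓ-delannoy (suc m))) (ι-+ (delannoy m (suc m)) (delannoy₁ m (2 ℕ.+ m))) ⟩
    ι (delannoy m (suc m)) + ι (delannoy₁ m (2 ℕ.+ m))
      ≡⟨ cong₂ _+_ (Σ≤-diagonal m (suc m) m ℕₚ.≤-refl) (Σ₁ m) ⟨
    Σ≤ m (λ k → ι (diagonal m (suc m) k)) + Σ≤ m (λ k → ι (diagonal₁ m (2 ℕ.+ m) k))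
      ≡⟨ trans (Σ≤-cong m λ k _ → ι-+ (diagonal m (suc m) k) (diagonal₁ m (2 ℕ.+ m) k))
           (Σ≤-+ m (λ k → ι (diagonal m (suc m) k)) (λ k → ι (diagonal₁ m (2 ℕ.+ m) k))) ⟨
    Σ≤ m (λ k → ι (edgeTerm m k))
      -- The sum over diagonal steps becomes one over u = m - k, and u + 1 is the index of the
      -- formula. Its summand 0, added below, vanishes through the factor k/(k+1).
      ≡⟨ Σ≤-reverse m (λ k → ι (edgeTerm m k)) ⟩
    Σ≤ m (λ u → ι (edgeTerm m (m ℕ.∸ u)))
      ≡⟨ (Σ≤-cong m λ u u≤m → trans (cong (λ z → ι (edgeTerm z (m ℕ.∸ u))) (sym (ℕₚ.m∸n+n≡m u≤m))) (edgeTerm-summand (m ℕ.∸ u) u)) ⟩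
    Σ≤ m (λ u → summand (suc m) (suc u))
      ≡⟨ ℚₚ.+-identityˡ _ ⟨
    0ℚ + Σ≤ m (λ u → summand (suc m) (suc u))
      ≡⟨ cong (_+ Σ≤ m (λ u → summand (suc m) (suc u))) (sym (ℚₚ.*-zeroʳ (multichoose 0 (suc m) * 1ℚ))) ⟩
    summand (suc m) 0 + Σ≤ m (λ u → summand (suc m) (suc u))
      ≡⟨ Σ≤-shift m (summand (suc m)) ⟨
    Σ≤ (suc m) (summand (suc m)) ∎
    where
    Σ₁ : ∀ m → Σ≤ m (λ k → ι (diagonal₁ m (2 ℕ.+ m) k)) ≡ ι (delannoy₁ m (2 ℕ.+ m))
    Σ₁ zero    = refl
    Σ₁ (suc m) = Σ≤-diagonal m (3 ℕ.+ m) (suc m) (ℕₚ.n≤1+n m)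

-- Delannoy numbers compared with central binomial coefficients

-- The coefficients of 1/Δ.
Uˢ : Series
Uˢ = Dˢ ⊛ Dˢ

ΔU≐1 : Δ ⊛ Uˢ ≐ const 1
ΔU≐1 = begin
  Δ ⊛ (Dˢ ⊛ Dˢ)                   ≈⟨ ⊛-cong (≐-sym S²) (≐-refl {Dˢ ⊛ Dˢ}) ⟩
  (Sˢ ⊛ Sˢ) ⊛ (Dˢ ⊛ Dˢ)           ≈⟨ solve 2 (λ s d → (s :* s) :* (d :* d) := (s :* d) :* (s :* d)) ≐-refl Sˢ Dˢ ⟩
  (Sˢ ⊛ Dˢ) ⊛ (Sˢ ⊛ Dˢ)           ≈⟨ ⊛-cong SD≐1 SD≐1 ⟩
  const 1 ⊛ const 1               ≈⟨ solve 0 (con 1ℚ :* con 1ℚ := con 1ℚ) ≐-refl ⟩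
  const 1 ∎
  where
  open SeriesSolver
  open ≐-Reasoning

U-suc : ∀ n → Uˢ (2 ℕ.+ n) ≡ ι 6 * Uˢ (1 ℕ.+ n) - Uˢ n
U-suc n = begin
  Uˢ (2 ℕ.+ n)
    ≡⟨ solve 3 (λ a b c → a := ((a :- con (ι 6) :* b) :+ c) :+ (con (ι 6) :* b :- c)) refl (Uˢ (2 ℕ.+ n)) (Uˢ (1 ℕ.+ n)) (Uˢ n) ⟩
  ((Uˢ (2 ℕ.+ n) - ι 6 * Uˢ (1 ℕ.+ n)) + Uˢ n) + (ι 6 * Uˢ (1 ℕ.+ n) - Uˢ n)
    ≡⟨ cong (_+ (ι 6 * Uˢ (1 ℕ.+ n) - Uˢ n)) (trans (sym (Δ-⊛-suc Uˢ n)) (at ΔU≐1 (2 ℕ.+ n))) ⟩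
  0ℚ + (ι 6 * Uˢ (1 ℕ.+ n) - Uˢ n)
    ≡⟨ ℚₚ.+-identityˡ _ ⟩
  ι 6 * Uˢ (1 ℕ.+ n) - Uˢ n ∎
  where
  open ≡-Reasoning
  open +-*-Solver

-- a n = C(2n,n) / 4ⁿ, the coefficients of 1/√(1-x).
a : ℕ → ℚ
a zero    = 1ℚ
a (suc n) = a n * (1ℚ - ½ * grid n 1)

a-suc : ∀ n → ι (suc n) * a (suc n) ≡ (ι n + ½) * a n
a-suc n = begin
  ι (suc n) * (a n * (1ℚ - ½ * grid n 1))
    ≡⟨ solve 3 (λ i a g → i :* (a :* (con 1ℚ :- con ½ :* g)) := (i :- con ½ :* (g :* i)) :* a) refl (ι (suc n)) (a n) (grid n 1) ⟩
  (ι (suc n) - ½ * (grid n 1 * ι (suc n))) * a n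
    ≡⟨ cong₂ (λ x y → (x - ½ * y) * a n) (ι-suc n) (/-ι 1 (suc n)) ⟩
  ((1ℚ + ι n) - ½ * 1ℚ) * a n
    ≡⟨ solve 2 (λ n a → ((con 1ℚ :+ n) :- con ½ :* con 1ℚ) :* a := (n :+ con ½) :* a) refl (ι n) (a n) ⟩
  (ι n + ½) * a n ∎
  where
  open ≡-Reasoning
  open +-*-Solver

θa : (const 1 ⊖ X) ⊛ θ a ≐ constant ½ ⊛ (X ⊛ a)
θa = ≐-trans (1-X-expand (θ a)) (pointwise go)
  where
  open ≡-Reasoning
  open +-*-Solver
  go : ∀ n → (θ a ⊖ X ⊛ θ a) n ≡ (constant ½ ⊛ (X ⊛ a)) n
  go zero    = refl
  go (suc n) = begin
    ι (suc n) * a (suc n) - (X ⊛ θ a) (suc n)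
      ≡⟨ cong₂ _-_ (a-suc n) (X-⊛-suc (θ a) n) ⟩
    (ι n + ½) * a n - ι n * a n
      ≡⟨ solve 2 (λ n a → (n :+ con ½) :* a :- n :* a := con ½ :* a) refl (ι n) (a n) ⟩
    ½ * a n
      ≡⟨ trans (at (constant-⊛ ½ (X ⊛ a)) (suc n)) (cong (½ *_) (X-⊛-suc a n)) ⟨
    (constant ½ ⊛ (X ⊛ a)) (suc n) ∎

-- The argument of `SD≐1` for (1-x)^(-1/2): by `θa` the derivative of (1-x)a² cancels.
a⊛a-geometric : (const 1 ⊖ X) ⊛ (a ⊛ a) ≐ const 1
a⊛a-geometric = θ≐0⇒constant ((const 1 ⊖ X) ⊛ (a ⊛ a)) (begin
  θ (Y ⊛ (a ⊛ a))
    ≈⟨ ≐-trans (θ-⊛ Y (a ⊛ a)) (⊕-cong (⊛-cong (pointwise θY) (≐-refl {a ⊛ a})) (⊛-cong (≐-refl {Y}) (θ-⊛ a a))) ⟩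
  (0ˢ ⊖ X) ⊛ (a ⊛ a) ⊕ Y ⊛ ((θ a ⊛ a) ⊕ (a ⊛ θ a))
    ≈⟨ ⊕-cong (⊛-cong (⊖-cong (pointwise zeroˢ) (≐-refl {X})) (≐-refl {a ⊛ a})) (solve 3 (λ y t a → y :* (t :* a :+ a :* t) := con (ι 2) :* (a :* (y :* t))) ≐-refl Y (θ a) a) ⟩
  (constant 0ℚ ⊖ X) ⊛ (a ⊛ a) ⊕ const 2 ⊛ (a ⊛ (Y ⊛ θ a))
    ≈⟨ ⊕-cong (≐-refl {(constant 0ℚ ⊖ X) ⊛ (a ⊛ a)}) (⊛-cong (≐-refl {const 2}) (⊛-cong (≐-refl {a}) θa)) ⟩
  (constant 0ℚ ⊖ X) ⊛ (a ⊛ a) ⊕ const 2 ⊛ (a ⊛ (constant ½ ⊛ (X ⊛ a)))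
    ≈⟨ solve 2 (λ x a → (con 0ℚ :- x) :* (a :* a) :+ con (ι 2) :* (a :* (con ½ :* (x :* a))) := con 0ℚ) ≐-refl X a ⟩
  constant 0ℚ
    ≈⟨ pointwise (λ n → sym (zeroˢ n)) ⟩
  0ˢ ∎)
  where
  open SeriesSolver
  open ≐-Reasoning
  Y : Series
  Y = const 1 ⊖ X
  zeroˢ : ∀ n → 0ˢ n ≡ constant 0ℚ n
  zeroˢ zero    = refl
  zeroˢ (suc n) = refl
  θY : ∀ n → θ Y n ≡ (0ˢ ⊖ X) n
  θY zero          = refl
  θY (suc zero)    = refl
  θY (suc (suc n)) = trans (cong (λ z → ι (2 ℕ.+ n) * (0ℚ - z)) (monomial-off 1ℚ 1 {2 ℕ.+ n} (λ ())))
    (trans (ℚₚ.*-zeroʳ (ι (2 ℕ.+ n))) (cong (λ z → 0ℚ - z) (sym (monomial-off 1ℚ 1 {2 ℕ.+ n} (λ ())))))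

a⊛a : ∀ n → (a ⊛ a) n ≡ 1ℚ
a⊛a zero    = refl
a⊛a (suc n) = begin
  c (suc n)                                ≡⟨ solve 2 (λ x y → x := (x :- y) :+ y) refl (c (suc n)) (c n) ⟩
  (c (suc n) - c n) + c n                  ≡⟨ cong (λ z → (c (suc n) - z) + c n) (sym (X-⊛-suc c n)) ⟩
  (c ⊖ X ⊛ c) (suc n) + c n                ≡⟨ cong₂ _+_ (trans (sym (at (1-X-expand c) (suc n))) (at a⊛a-geometric (suc n))) (a⊛a n) ⟩
  0ℚ + 1ℚ ∎
  where
  open ≡-Reasoning
  open +-*-Solver
  c : Series
  c = a ⊛ a

open +-*-Solver
open ℚₚ.≤-Reasoning

-- Inequalities in ℚ and the sequence 1/(n+1)

infix 9 #_
#_ : ∀ {n} → ℕ → Polynomial n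
# k = con (ι k)

≤-by : ∀ {x y} z → 0ℚ ≤ z → y ≡ x + z → x ≤ y
≤-by {x} {y} z 0≤z eq = begin
  x       ≡⟨ ℚₚ.+-identityʳ x ⟨
  x + 0ℚ  ≤⟨ ℚₚ.+-monoʳ-≤ x 0≤z ⟩
  x + z   ≡⟨ eq ⟨
  y       ∎

≤⇒0≤- : ∀ {x y} → x ≤ y → 0ℚ ≤ y - x
≤⇒0≤- {x} {y} x≤y = begin
  0ℚ     ≡⟨ ℚₚ.+-inverseʳ x ⟨
  x - x  ≤⟨ ℚₚ.+-monoˡ-≤ (- x) x≤y ⟩
  y - x  ∎

0≤+ : ∀ {x y} → 0ℚ ≤ x → 0ℚ ≤ y → 0ℚ ≤ x + y
0≤+ = ℚₚ.+-mono-≤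

*-monoˡ : ∀ {c x y} → 0ℚ ≤ c → x ≤ y → c * x ≤ c * y
*-monoˡ {c} 0≤c = ℚₚ.*-monoˡ-≤-nonNeg c {{nonNegative 0≤c}}

*-monoʳ : ∀ {c x y} → 0ℚ ≤ c → x ≤ y → x * c ≤ y * c
*-monoʳ {c} 0≤c = ℚₚ.*-monoʳ-≤-nonNeg c {{nonNegative 0≤c}}

*-cancelˡ : ∀ {c x y} → 0ℚ < c → c * x ≤ c * y → x ≤ y
*-cancelˡ {c} 0<c = ℚₚ.*-cancelˡ-≤-pos c {{positive 0<c}}

0≤½ : 0ℚ ≤ ½
0≤½ = ℚₚ.<⇒≤ 0<½

0≤1 : 0ℚ ≤ 1ℚ
0≤1 = ℚₚ.<⇒≤ 0<1

u : ℕ → ℚ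
u n = grid n 1

u-ι : ∀ n → u n * ι (suc n) ≡ 1ℚ
u-ι n = /-ι 1 (suc n)

0<u : ∀ n → 0ℚ < u n
0<u n = ℚₚ.positive⁻¹ (u n) {{ℚₚ.normalize-pos 1 (suc n)}}

0≤u : ∀ n → 0ℚ ≤ u n
0≤u n = ℚₚ.<⇒≤ (0<u n)

u-≤ : ∀ j m k n → j ℕ.* suc n ℕ.≤ k ℕ.* suc m → ι j * u m ≤ ι k * u n
u-≤ j m k n le = begin
  ι j * u m                        ≡⟨ solve 2 (λ j m → j :* m := (j :* m) :* # 1) refl (ι j) (u m) ⟩
  ι j * u m * 1ℚ                   ≡⟨ cong (ι j * u m *_) (u-ι n) ⟨
  ι j * u m * (u n * ι (suc n))    ≡⟨ solve 4 (λ j m n s → j :* m :* (n :* s) := (m :* n) :* (j :* s)) refl (ι j) (u m) (u n) (ι (suc n)) ⟩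
  u m * u n * (ι j * ι (suc n))    ≤⟨ *-monoˡ (0≤* (0≤u m) (0≤u n)) (subst₂ _≤_ (ι-* j (suc n)) (ι-* k (suc m)) (ι-mono le)) ⟩
  u m * u n * (ι k * ι (suc m))    ≡⟨ solve 4 (λ k m n s → m :* n :* (k :* s) := k :* n :* (m :* s)) refl (ι k) (u m) (u n) (ι (suc m)) ⟩
  ι k * u n * (u m * ι (suc m))    ≡⟨ cong (ι k * u n *_) (u-ι m) ⟩
  ι k * u n * 1ℚ                   ≡⟨ ℚₚ.*-identityʳ _ ⟩
  ι k * u n                        ∎

u-anti : ∀ {m n} → m ℕ.≤ n → u n ≤ u m
u-anti {m} {n} m≤n = subst₂ _≤_ (ℚₚ.*-identityˡ (u n)) (ℚₚ.*-identityˡ (u m))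
  (u-≤ 1 n 1 m (ℕₚ.*-monoʳ-≤ 1 (s≤s m≤n)))

u≤1 : ∀ n → u n ≤ 1ℚ
u≤1 n = u-anti {0} {n} z≤n

inv-anti : ∀ {p q} → 0ℚ < p → p ≤ q → inv q ≤ inv p
inv-anti {p} {q} 0<p p≤q = begin
  inv q                ≡⟨ ℚₚ.*-identityʳ (inv q) ⟨
  inv q * 1ℚ           ≡⟨ cong (inv q *_) (inv-inverse p (pos⇒≢ 0<p)) ⟨
  inv q * (inv p * p)  ≤⟨ *-monoˡ (ℚₚ.<⇒≤ (inv-pos q 0<q)) (*-monoˡ (ℚₚ.<⇒≤ (inv-pos p 0<p)) p≤q) ⟩
  inv q * (inv p * q)  ≡⟨ solve 3 (λ i j q → i :* (j :* q) := (i :* q) :* j) refl (inv q) (inv p) q ⟩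
  inv q * q * inv p    ≡⟨ cong (_* inv p) (inv-inverse q (pos⇒≢ 0<q)) ⟩
  1ℚ * inv p           ≡⟨ ℚₚ.*-identityˡ (inv p) ⟩
  inv p                ∎
  where 0<q = ℚₚ.<-≤-trans 0<p p≤q

-- The ratios of e and their near constancy

-- 1/(4(n+1)²-1)
ϵ : ℕ → ℚ
ϵ n = u (2 ℕ.* n) * u (2 ℕ.+ 2 ℕ.* n)

0≤ϵ : ∀ n → 0ℚ ≤ ϵ n
0≤ϵ n = 0≤* (0≤u (2 ℕ.* n)) (0≤u (2 ℕ.+ 2 ℕ.* n))

ϵ-anti : ∀ n → ϵ (suc n) ≤ ϵ n
ϵ-anti n = *-mono-≤-nonNeg (0≤u (2 ℕ.* suc n)) (u-anti (ℕₚ.*-monoʳ-≤ 2 (ℕₚ.n≤1+n n)))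
  (0≤u (2 ℕ.+ 2 ℕ.* suc n)) (u-anti (ℕₚ.+-monoʳ-≤ 2 (ℕₚ.*-monoʳ-≤ 2 (ℕₚ.n≤1+n n))))

ϵ≤⅓ : ∀ n → ϵ n ≤ u 2
ϵ≤⅓ n = begin
  u (2 ℕ.* n) * u (2 ℕ.+ 2 ℕ.* n)  ≤⟨ *-mono-≤-nonNeg (0≤u (2 ℕ.* n)) (u≤1 (2 ℕ.* n)) (0≤u (2 ℕ.+ 2 ℕ.* n)) (u-anti (ℕₚ.m≤m+n 2 (2 ℕ.* n))) ⟩
  1ℚ * u 2                         ≡⟨⟩
  u 2 ∎

-- The ratios eₙ₊₁/eₙ of the numbers eₙ = dₙ/aₙ.
q : ℕ → ℚ
q zero    = ι 6
q (suc n) = ι 6 - (1ℚ + ϵ n) * inv (q n)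

-- The interval from 5 to 6 is invariant, since ϵ is at most 1/3 and 6 - (4/3)/5 > 5. The lower end
-- 5 yields the contraction factor 1/25 below.
q-bounds : ∀ n → ι 5 ≤ q n × q n ≤ ι 6
q-bounds zero    = ℚₚ.≤ᵇ⇒≤ _ , ℚₚ.≤-refl
q-bounds (suc n) =
  (begin
    ι 5                                  ≤⟨ ℚₚ.≤ᵇ⇒≤ {ι 5} {ι 6 - (1ℚ + u 2) * u 4} _ ⟩
    ι 6 - (1ℚ + u 2) * u 4               ≤⟨ ℚₚ.+-monoʳ-≤ (ι 6) (ℚₚ.neg-antimono-≤
      (*-mono-≤-nonNeg 0≤1+ϵ (ℚₚ.+-monoʳ-≤ 1ℚ (ϵ≤⅓ n)) 0≤inv (inv-anti (0<ι 4) (proj₁ (q-bounds n))))) ⟩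
    ι 6 - (1ℚ + ϵ n) * inv (q n)         ∎) ,
  (begin
    ι 6 - (1ℚ + ϵ n) * inv (q n)         ≤⟨ ℚₚ.+-monoʳ-≤ (ι 6) (ℚₚ.neg-antimono-≤ (0≤* 0≤1+ϵ 0≤inv)) ⟩
    ι 6 - 0ℚ                             ≡⟨⟩
    ι 6                                  ∎)
  where
  0≤1+ϵ : 0ℚ ≤ 1ℚ + ϵ n
  0≤1+ϵ = 0≤+ 0≤1 (0≤ϵ n)
  0≤inv : 0ℚ ≤ inv (q n)
  0≤inv = ℚₚ.<⇒≤ (inv-pos (q n) (ℚₚ.<-≤-trans (0<ι 4) (proj₁ (q-bounds n))))

5≤q : ∀ n → ι 5 ≤ q n
5≤q n = proj₁ (q-bounds n)

q≤6 : ∀ n → q n ≤ ι 6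
q≤6 n = proj₂ (q-bounds n)

0<q : ∀ n → 0ℚ < q n
0<q n = ℚₚ.<-≤-trans (0<ι 4) (5≤q n)

p : ℕ → ℚ
p n = inv (q n)

p-q : ∀ n → p n * q n ≡ 1ℚ
p-q n = inv-inverse (q n) (pos⇒≢ (0<q n))

0≤p : ∀ n → 0ℚ ≤ p n
0≤p n = ℚₚ.<⇒≤ (inv-pos (q n) (0<q n))

p≤⅕ : ∀ n → p n ≤ u 4
p≤⅕ n = inv-anti (0<ι 4) (5≤q n)

e : ℕ → ℚ
e zero    = 1ℚ
e (suc n) = q n * e n

0<e : ∀ n → 0ℚ < e n
0<e zero    = 0<1
0<e (suc n) = 0<* (0<q n) (0<e n)

0≤e : ∀ n → 0ℚ ≤ e n
0≤e n = ℚₚ.<⇒≤ (0<e n)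

e-suc : ∀ n → e (2 ℕ.+ n) ≡ ι 6 * e (1 ℕ.+ n) - (1ℚ + ϵ n) * e n
e-suc n = begin-equality
  (ι 6 - (1ℚ + ϵ n) * p n) * (q n * e n)
    ≡⟨ solve 5 (λ s k p q e → (s :- k :* p) :* (q :* e) := s :* (q :* e) :- k :* (p :* q) :* e) refl (ι 6) (1ℚ + ϵ n) (p n) (q n) (e n) ⟩
  ι 6 * (q n * e n) - (1ℚ + ϵ n) * (p n * q n) * e n
    ≡⟨ cong (λ z → ι 6 * (q n * e n) - z * e n) (trans (cong ((1ℚ + ϵ n) *_) (p-q n)) (ℚₚ.*-identityʳ (1ℚ + ϵ n))) ⟩
  ι 6 * (q n * e n) - (1ℚ + ϵ n) * e n ∎

ι-odd : ∀ n → ι (suc (2 ℕ.* n)) ≡ 1ℚ + ι 2 * ι n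
ι-odd n = trans (ι-suc (2 ℕ.* n)) (cong (1ℚ +_) (ι-* 2 n))

ϵ-eq : ∀ n → (1ℚ + ι 2 * ι n) * (ι 3 + ι 2 * ι n) * ϵ n ≡ 1ℚ
ϵ-eq n = begin-equality
  (1ℚ + ι 2 * ι n) * (ι 3 + ι 2 * ι n) * (u (2 ℕ.* n) * u (2 ℕ.+ 2 ℕ.* n))
    ≡⟨ solve 4 (λ a b c d → a :* b :* (c :* d) := (c :* a) :* (d :* b)) refl (1ℚ + ι 2 * ι n) (ι 3 + ι 2 * ι n) (u (2 ℕ.* n)) (u (2 ℕ.+ 2 ℕ.* n)) ⟩
  (u (2 ℕ.* n) * (1ℚ + ι 2 * ι n)) * (u (2 ℕ.+ 2 ℕ.* n) * (ι 3 + ι 2 * ι n))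
    ≡⟨ cong₂ (λ x y → (u (2 ℕ.* n) * x) * (u (2 ℕ.+ 2 ℕ.* n) * y)) (ι-odd n) (trans (ι-+ 3 (2 ℕ.* n)) (cong (ι 3 +_) (ι-* 2 n))) ⟨
  (u (2 ℕ.* n) * ι (suc (2 ℕ.* n))) * (u (2 ℕ.+ 2 ℕ.* n) * ι (3 ℕ.+ 2 ℕ.* n))
    ≡⟨ cong₂ _*_ (u-ι (2 ℕ.* n)) (u-ι (2 ℕ.+ 2 ℕ.* n)) ⟩
  1ℚ ∎

-- Substituting a times e in the recurrence of d and dividing by (n + 3/2)aₙ₊₁ leaves the recurrence
-- of e. Its last coefficient is 4(n+1)²/((2n+1)(2n+3)) = 1 + ϵₙ, which is where ϵ comes from;
-- `drop` is this computation.
d≡ae : ∀ n → Dˢ n ≡ a n * e n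
d≡ae zero          = refl
d≡ae (suc zero)    = refl
d≡ae (suc (suc n)) = ι-cancel (suc n) (begin-equality
  ι (2 ℕ.+ n) * Dˢ (2 ℕ.+ n)
    ≡⟨ solve 2 (λ x y → x := (x :+ y) :- y) refl (ι (2 ℕ.+ n) * Dˢ (2 ℕ.+ n)) (ι (1 ℕ.+ n) * Dˢ n) ⟩
  (ι (2 ℕ.+ n) * Dˢ (2 ℕ.+ n) + ι (1 ℕ.+ n) * Dˢ n) - ι (1 ℕ.+ n) * Dˢ n
    ≡⟨ cong₂ _-_ (ι-d-recurrence n) (cong₂ _*_ (ι-suc n) (d≡ae n)) ⟩
  ι 3 * (ι 3 + ι 2 * ι n) * Dˢ (1 ℕ.+ n) - (1ℚ + ι n) * (a n * e n)
    ≡⟨ cong (λ z → ι 3 * (ι 3 + ι 2 * ι n) * z - (1ℚ + ι n) * (a n * e n)) (d≡ae (suc n)) ⟩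
  ι 3 * (ι 3 + ι 2 * ι n) * (a (suc n) * e (suc n)) - (1ℚ + ι n) * (a n * e n)
    ≡⟨ solve 5 (λ n a e b f → # 3 :* (# 3 :+ # 2 :* n) :* (a :* e) :- (# 1 :+ n) :* (b :* f) :=
         # 3 :* (# 3 :+ # 2 :* n) :* (a :* e) :- ((# 1 :+ n) :* b) :* f) refl (ι n) (a (suc n)) (e (suc n)) (a n) (e n) ⟩
  ι 3 * (ι 3 + ι 2 * ι n) * (a (suc n) * e (suc n)) - ((1ℚ + ι n) * a n) * e n
    ≡⟨ cong (λ z → ι 3 * (ι 3 + ι 2 * ι n) * (a (suc n) * e (suc n)) - z * e n) (sym drop) ⟩
  ι 3 * (ι 3 + ι 2 * ι n) * (a (suc n) * e (suc n)) - ((½ + (1ℚ + ι n)) * (1ℚ + ϵ n) * a (suc n)) * e n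
    ≡⟨ solve 5 (λ n k a e f → # 3 :* (# 3 :+ # 2 :* n) :* (a :* e) :- ((con ½ :+ (# 1 :+ n)) :* k :* a) :* f :=
         ((# 1 :+ n) :+ con ½) :* a :* (# 6 :* e :- k :* f)) refl (ι n) (1ℚ + ϵ n) (a (suc n)) (e (suc n)) (e n) ⟩
  ((1ℚ + ι n) + ½) * a (suc n) * (ι 6 * e (suc n) - (1ℚ + ϵ n) * e n)
    ≡⟨ cong₂ _*_ (trans (cong (λ z → (z + ½) * a (suc n)) (sym (ι-suc n))) (sym (a-suc (suc n)))) (sym (e-suc n)) ⟩
  (ι (2 ℕ.+ n) * a (2 ℕ.+ n)) * e (2 ℕ.+ n)
    ≡⟨ ℚₚ.*-assoc (ι (2 ℕ.+ n)) (a (2 ℕ.+ n)) (e (2 ℕ.+ n)) ⟩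
  ι (2 ℕ.+ n) * (a (2 ℕ.+ n) * e (2 ℕ.+ n)) ∎)
  where
  drop : (½ + (1ℚ + ι n)) * (1ℚ + ϵ n) * a (suc n) ≡ (1ℚ + ι n) * a n
  drop = ι-cancel n (begin-equality
    ι (suc n) * ((½ + (1ℚ + ι n)) * (1ℚ + ϵ n) * a (suc n))
      ≡⟨ solve 4 (λ i n k a → i :* ((con ½ :+ (# 1 :+ n)) :* k :* a) := (con ½ :+ (# 1 :+ n)) :* k :* (i :* a)) refl (ι (suc n)) (ι n) (1ℚ + ϵ n) (a (suc n)) ⟩
    (½ + (1ℚ + ι n)) * (1ℚ + ϵ n) * (ι (suc n) * a (suc n))
      ≡⟨ cong ((½ + (1ℚ + ι n)) * (1ℚ + ϵ n) *_) (a-suc n) ⟩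
    (½ + (1ℚ + ι n)) * (1ℚ + ϵ n) * ((ι n + ½) * a n)
      ≡⟨ solve 3 (λ n k a → (con ½ :+ (# 1 :+ n)) :* (# 1 :+ k) :* ((n :+ con ½) :* a) :=
           con (½ * ½) :* ((# 1 :+ # 2 :* n) :* (# 3 :+ # 2 :* n) :+ (# 1 :+ # 2 :* n) :* (# 3 :+ # 2 :* n) :* k) :* a) refl
           (ι n) (ϵ n) (a n) ⟩
    ½ * ½ * ((1ℚ + ι 2 * ι n) * (ι 3 + ι 2 * ι n) + (1ℚ + ι 2 * ι n) * (ι 3 + ι 2 * ι n) * ϵ n) * a n
      ≡⟨ cong (λ z → ½ * ½ * ((1ℚ + ι 2 * ι n) * (ι 3 + ι 2 * ι n) + z) * a n) (ϵ-eq n) ⟩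
    ½ * ½ * ((1ℚ + ι 2 * ι n) * (ι 3 + ι 2 * ι n) + 1ℚ) * a n
      ≡⟨ solve 2 (λ n a → con (½ * ½) :* ((# 1 :+ # 2 :* n) :* (# 3 :+ # 2 :* n) :+ # 1) :* a := (# 1 :+ n) :* ((# 1 :+ n) :* a)) refl (ι n) (a n) ⟩
    (1ℚ + ι n) * ((1ℚ + ι n) * a n)
      ≡⟨ cong (_* ((1ℚ + ι n) * a n)) (ι-suc n) ⟨
    ι (suc n) * ((1ℚ + ι n) * a n) ∎)

-- The step 6 - (1 + ϵ)/q preserves the order because ϵ decreases. Monotonicity starts at index 1,
-- as q₀ = 6 bounds all ratios from above; hence the shifted indices from here on.
q-increasing : ∀ n → q (1 ℕ.+ n) ≤ q (2 ℕ.+ n)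
q-increasing zero    = ℚₚ.≤ᵇ⇒≤ _
q-increasing (suc n) = ℚₚ.+-monoʳ-≤ (ι 6) (ℚₚ.neg-antimono-≤
  (*-mono-≤-nonNeg (0≤+ 0≤1 (0≤ϵ (2 ℕ.+ n))) (ℚₚ.+-monoʳ-≤ 1ℚ (ϵ-anti (suc n)))
                   (0≤p (2 ℕ.+ n)) (inv-anti (0<q (1 ℕ.+ n)) (q-increasing n))))

q-mono′ : ∀ {i j} → i ℕ.≤′ j → q (suc i) ≤ q (suc j)
q-mono′ ℕ.≤′-refl                = ℚₚ.≤-refl
q-mono′ {j = suc j} (ℕ.≤′-step i≤j) = ℚₚ.≤-trans (q-mono′ i≤j) (q-increasing j)

q-mono : ∀ {i j} → i ℕ.≤ j → q (suc i) ≤ q (suc j)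
q-mono i≤j = q-mono′ (ℕₚ.≤⇒≤′ i≤j)

-- 1/(2(n+1)(n+2)) bounds how much q can still grow after qₙ₊₁.
growth : ℕ → ℚ
growth n = ½ * (u n * u (suc n))

0≤growth : ∀ n → 0ℚ ≤ growth n
0≤growth n = 0≤* 0≤½ (0≤* (0≤u n) (0≤u (suc n)))

growth-ratio : ∀ n → growth n ≤ ι 3 * growth (suc n)
growth-ratio n = begin
  ½ * (u n * u (suc n))                  ≤⟨ *-monoˡ 0≤½ (*-monoʳ (0≤u (suc n)) u≤3u) ⟩
  ½ * (ι 3 * u (2 ℕ.+ n) * u (suc n))    ≡⟨ solve 2 (λ x y → con ½ :* (# 3 :* x :* y) := # 3 :* (con ½ :* (y :* x))) refl (u (2 ℕ.+ n)) (u (suc n)) ⟩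
  ι 3 * growth (suc n)                   ∎
  where
  u≤3u : u n ≤ ι 3 * u (2 ℕ.+ n)
  u≤3u = subst (_≤ ι 3 * u (2 ℕ.+ n)) (ℚₚ.*-identityˡ (u n)) (u-≤ 1 n 3 (2 ℕ.+ n)
    (ℕₚ.≤-trans (ℕₚ.≤-reflexive (ℕₚ.*-identityˡ (3 ℕ.+ n))) (ℕₚ.≤-trans (ℕₚ.+-monoʳ-≤ 3 (ℕₚ.m≤n*m n 3)) (ℕₚ.≤-reflexive (sym (ℕₚ.*-suc 3 n))))))

ϵ≤growth : ∀ n → ϵ (suc n) ≤ growth (suc n)
ϵ≤growth n = begin
  u (2 ℕ.* suc n) * u (2 ℕ.+ 2 ℕ.* suc n)
    ≤⟨ *-mono-≤-nonNeg (0≤u (2 ℕ.* suc n)) first (0≤u (2 ℕ.+ 2 ℕ.* suc n)) second ⟩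
  u (2 ℕ.+ n) * (½ * u (suc n))
    ≡⟨ solve 2 (λ x y → x :* (con ½ :* y) := con ½ :* (y :* x)) refl (u (2 ℕ.+ n)) (u (suc n)) ⟩
  growth (suc n) ∎
  where
  first : u (2 ℕ.* suc n) ≤ u (2 ℕ.+ n)
  first = u-anti (ℕₚ.≤-trans (ℕₚ.+-monoʳ-≤ 2 (ℕₚ.m≤n*m n 2)) (ℕₚ.≤-reflexive (sym (ℕₚ.*-suc 2 n))))
  second : u (2 ℕ.+ 2 ℕ.* suc n) ≤ ½ * u (suc n)
  second = begin
    u (2 ℕ.+ 2 ℕ.* suc n)
      ≡⟨ solve 1 (λ x → x := con ½ :* (# 2 :* x)) refl (u (2 ℕ.+ 2 ℕ.* suc n)) ⟩
    ½ * (ι 2 * u (2 ℕ.+ 2 ℕ.* suc n))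
      ≤⟨ *-monoˡ 0≤½ (u-≤ 2 (2 ℕ.+ 2 ℕ.* suc n) 1 (suc n) (ℕₚ.≤-trans (ℕₚ.≤-reflexive (ℕₚ.*-suc 2 (suc n)))
           (ℕₚ.≤-trans (ℕₚ.n≤1+n _) (ℕₚ.≤-reflexive (sym (ℕₚ.*-identityˡ _)))))) ⟩
    ½ * (1ℚ * u (suc n))
      ≡⟨ cong (½ *_) (ℚₚ.*-identityˡ (u (suc n))) ⟩
    ½ * u (suc n) ∎

-- q is nearly constant: q ↦ 6 - 1/q contracts by 1/25, and ϵₙ is of the order of growth n.
q-close : ∀ {i j} → i ℕ.≤ j → q (suc j) ≤ q (suc i) + growth i
-- q₁ = 52/9 and growth 0 = 1/4 add up to more than 6.
q-close {zero} {j} z≤n = ℚₚ.≤-trans (q≤6 (suc j)) (ℚₚ.≤ᵇ⇒≤ _)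
q-close {suc i} {suc j} (s≤s i≤j) = begin
  ι 6 - (1ℚ + ϵ (suc j)) * y
    ≤⟨ ≤-by (ϵ (suc j) * y) (0≤* (0≤ϵ (suc j)) (0≤p (suc j)))
         (solve 2 (λ k y → # 6 :- y := (# 6 :- (# 1 :+ k) :* y) :+ k :* y) refl (ϵ (suc j)) y) ⟩
  ι 6 - y
    ≤⟨ ℚₚ.+-monoʳ-≤ (ι 6) (ℚₚ.neg-antimono-≤ x-close) ⟩
  ι 6 - (x - u 4 * u 4 * growth i)
    ≤⟨ ≤-by (growth (suc i) - (u 4 * u 4 * growth i + ϵ (suc i) * x)) (≤⇒0≤- small)
         (solve 4 (λ k x g h → (# 6 :- (# 1 :+ k) :* x) :+ h := (# 6 :- (x :- con (u 4 * u 4) :* g)) :+ (h :- (con (u 4 * u 4) :* g :+ k :* x))) refl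
            (ϵ (suc i)) x (growth i) (growth (suc i))) ⟩
  ι 6 - (1ℚ + ϵ (suc i)) * x + growth (suc i) ∎
  where
  x = p (suc i)
  y = p (suc j)
  x-close : x - u 4 * u 4 * growth i ≤ y
  x-close = ≤-by (u 4 * u 4 * growth i - x * y * (q (suc j) - q (suc i)))
    (≤⇒0≤- (ℚₚ.≤-trans (*-monoˡ (0≤* (0≤p (suc i)) (0≤p (suc j))) difference)
      (*-monoʳ (0≤growth i) (*-mono-≤-nonNeg (0≤p (suc i)) (p≤⅕ (suc i)) (0≤p (suc j)) (p≤⅕ (suc j))))))
    (begin-equality
      y                                                        ≡⟨ solve 2 (λ x y → y := x :- (x :* # 1 :- y :* # 1)) refl x y ⟩
      x - (x * 1ℚ - y * 1ℚ)                                    ≡⟨ cong₂ (λ s t → x - (x * s - y * t)) (p-q (suc j)) (p-q (suc i)) ⟨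
      x - (x * (y * q (suc j)) - y * (x * q (suc i)))
        ≡⟨ solve 5 (λ x y a b g → x :- (x :* (y :* b) :- y :* (x :* a)) := (x :- con (u 4 * u 4) :* g) :+ (con (u 4 * u 4) :* g :- x :* y :* (b :- a))) refl x y (q (suc i)) (q (suc j)) (growth i) ⟩
      (x - u 4 * u 4 * growth i) + (u 4 * u 4 * growth i - x * y * (q (suc j) - q (suc i))) ∎)
    where
    difference : q (suc j) - q (suc i) ≤ growth i
    difference = begin
      q (suc j) - q (suc i)              ≤⟨ ℚₚ.+-monoˡ-≤ (- q (suc i)) (q-close i≤j) ⟩
      (q (suc i) + growth i) - q (suc i) ≡⟨ solve 2 (λ a g → a :+ g :- a := g) refl (q (suc i)) (growth i) ⟩
      growth i                           ∎
  small : u 4 * u 4 * growth i + ϵ (suc i) * x ≤ growth (suc i)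
  small = begin
    u 4 * u 4 * growth i + ϵ (suc i) * x
      ≤⟨ ℚₚ.+-mono-≤ (*-monoˡ (0≤* (0≤u 4) (0≤u 4)) (growth-ratio i))
           (*-mono-≤-nonNeg (0≤ϵ (suc i)) (ϵ≤growth i) (0≤p (suc i)) (p≤⅕ (suc i))) ⟩
    u 4 * u 4 * (ι 3 * growth (suc i)) + growth (suc i) * u 4
      -- The contraction leaves 3/25 and the perturbation 1/5, together 8/25, so 17/25 is to spare.
      ≤⟨ ≤-by (u 24 * ι 17 * growth (suc i)) (0≤* (0≤* (0≤u 24) (0≤ι 17)) (0≤growth (suc i)))
           (solve 1 (λ g → g := (con (u 4 * u 4) :* (# 3 :* g) :+ g :* con (u 4)) :+ con (u 24 * ι 17) :* g) refl (growth (suc i))) ⟩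
    growth (suc i) ∎

-- The ratios increase: moving the two indices one step apart multiplies by the later ratio and
-- divides by the earlier one.
e-logConvex : ∀ t i → e (suc (t ℕ.+ i)) * e (suc (t ℕ.+ i)) ≤ e (suc i) * e (suc (t ℕ.+ (t ℕ.+ i)))
e-logConvex zero    i = ℚₚ.≤-refl
e-logConvex (suc t) i = begin
  e (suc (suc t ℕ.+ i)) * e (suc (suc t ℕ.+ i))
    ≡⟨ cong (λ k → e (suc k) * e (suc k)) (ℕₚ.+-suc t i) ⟨
  e (suc (t ℕ.+ suc i)) * e (suc (t ℕ.+ suc i))
    ≤⟨ e-logConvex t (suc i) ⟩
  q (suc i) * e (suc i) * e (suc (t ℕ.+ (t ℕ.+ suc i)))
    ≡⟨ cong (λ k → q (suc i) * e (suc i) * e (suc (t ℕ.+ k))) (ℕₚ.+-suc t i) ⟩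
  q (suc i) * e (suc i) * e (suc k)
    ≡⟨ solve 3 (λ a b c → a :* b :* c := b :* (a :* c)) refl (q (suc i)) (e (suc i)) (e (suc k)) ⟩
  e (suc i) * (q (suc i) * e (suc k))
    ≤⟨ *-monoˡ (0≤e (suc i)) (*-monoʳ (0≤e (suc k)) (q-mono (ℕₚ.≤-trans (ℕₚ.m≤n+m i (suc t)) (ℕₚ.m≤n+m _ t)))) ⟩
  e (suc i) * (q (suc k) * e (suc k)) ∎
  where k = t ℕ.+ suc (t ℕ.+ i)

-- Here each step apart costs at most a factor 1 + growth. These factors telescope to 1 + uᵢ
-- whatever t is, because uᵢ - uᵢ₊₁ = uᵢuᵢ₊₁ is twice growth i.
e-nearlyGeometric : ∀ t i → e (suc i) * e (suc (t ℕ.+ (t ℕ.+ i))) ≤ (1ℚ + u i) * (e (suc (t ℕ.+ i)) * e (suc (t ℕ.+ i)))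
e-nearlyGeometric zero    i = ≤-by (u i * (e (suc i) * e (suc i))) (0≤* (0≤u i) (0≤* (0≤e (suc i)) (0≤e (suc i))))
  (solve 2 (λ a b → (# 1 :+ a) :* b := b :+ a :* b) refl (u i) (e (suc i) * e (suc i)))
e-nearlyGeometric (suc t) i = begin
  e (suc i) * (q (suc k) * e (suc k))
    ≤⟨ *-monoˡ (0≤e (suc i)) (*-monoʳ (0≤e (suc k)) (ℚₚ.≤-trans (q-close i≤k) q+growth)) ⟩
  e (suc i) * ((1ℚ + growth i) * q (suc i) * e (suc k))
    ≡⟨ solve 4 (λ a b c d → a :* (b :* c :* d) := b :* (c :* a :* d)) refl (e (suc i)) (1ℚ + growth i) (q (suc i)) (e (suc k)) ⟩
  (1ℚ + growth i) * (e (2 ℕ.+ i) * e (suc k))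
    ≤⟨ *-monoˡ (0≤+ 0≤1 (0≤growth i)) (subst₂ (λ k l → e (2 ℕ.+ i) * e (suc k) ≤ (1ℚ + u (suc i)) * (e (suc l) * e (suc l)))
         (cong (t ℕ.+_) (ℕₚ.+-suc t i)) (ℕₚ.+-suc t i) (e-nearlyGeometric t (suc i))) ⟩
  (1ℚ + growth i) * ((1ℚ + u (suc i)) * sq)
    ≡⟨ ℚₚ.*-assoc (1ℚ + growth i) (1ℚ + u (suc i)) sq ⟨
  (1ℚ + growth i) * (1ℚ + u (suc i)) * sq
    ≤⟨ *-monoʳ (0≤* (0≤e (suc (suc t ℕ.+ i))) (0≤e (suc (suc t ℕ.+ i)))) factor ⟩
  (1ℚ + u i) * sq ∎
  where
  k = t ℕ.+ suc (t ℕ.+ i)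
  sq = e (suc (suc t ℕ.+ i)) * e (suc (suc t ℕ.+ i))
  i≤k : i ℕ.≤ k
  i≤k = ℕₚ.≤-trans (ℕₚ.m≤n+m i (suc t)) (ℕₚ.m≤n+m _ t)
  q+growth : q (suc i) + growth i ≤ (1ℚ + growth i) * q (suc i)
  q+growth = ≤-by (growth i * (q (suc i) - 1ℚ)) (0≤* (0≤growth i) (≤⇒0≤- (ℚₚ.≤-trans (ι-mono {1} {5} (s≤s z≤n)) (5≤q (suc i)))))
    (solve 2 (λ g q → (# 1 :+ g) :* q := (q :+ g) :+ g :* (q :- # 1)) refl (growth i) (q (suc i)))
  u-difference : u i - u (suc i) ≡ u i * u (suc i)
  u-difference = begin-equality
    u i - u (suc i)
      ≡⟨ solve 2 (λ a b → a :- b := a :* # 1 :- b :* # 1) refl (u i) (u (suc i)) ⟩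
    u i * 1ℚ - u (suc i) * 1ℚ
      ≡⟨ cong₂ (λ x y → u i * x - u (suc i) * y) (trans (cong (u (suc i) *_) (sym (ι-suc (suc i)))) (u-ι (suc i))) (u-ι i) ⟨
    u i * (u (suc i) * (1ℚ + ι (suc i))) - u (suc i) * (u i * ι (suc i))
      ≡⟨ solve 3 (λ a b n → a :* (b :* (# 1 :+ n)) :- b :* (a :* n) := a :* b) refl (u i) (u (suc i)) (ι (suc i)) ⟩
    u i * u (suc i) ∎
  factor : (1ℚ + growth i) * (1ℚ + u (suc i)) ≤ 1ℚ + u i
  factor = ≤-by (growth i * (1ℚ - u (suc i))) (0≤* (0≤growth i) (≤⇒0≤- (u≤1 (suc i)))) (begin-equality
    1ℚ + u i                          ≡⟨ solve 2 (λ a b → # 1 :+ a := # 1 :+ b :+ (a :- b)) refl (u i) (u (suc i)) ⟩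
    1ℚ + u (suc i) + (u i - u (suc i)) ≡⟨ cong (1ℚ + u (suc i) +_) u-difference ⟩
    1ℚ + u (suc i) + u i * u (suc i)
      ≡⟨ solve 2 (λ a b → # 1 :+ b :+ a :* b := (# 1 :+ con ½ :* (a :* b)) :* (# 1 :+ b) :+ con ½ :* (a :* b) :* (# 1 :- b)) refl (u i) (u (suc i)) ⟩
    (1ℚ + growth i) * (1ℚ + u (suc i)) + growth i * (1ℚ - u (suc i)) ∎)

-- A relative error bound for eₖe₂ₙ₋ₖ against eₙ², the same for all n ≥ k. Index 0 is separate
-- because q₀ lies outside the monotone range.
spread : ℕ → ℚ
spread zero    = 1ℚ
spread (suc i) = u i

0≤spread : ∀ k → 0ℚ ≤ spread k
0≤spread zero    = 0≤1
0≤spread (suc i) = 0≤u i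

e-spread : ∀ k t → ∣ e k * e (t ℕ.+ (t ℕ.+ k)) - e (t ℕ.+ k) * e (t ℕ.+ k) ∣ ≤ spread k * (e (t ℕ.+ k) * e (t ℕ.+ k))
e-spread zero zero    = ℚₚ.≤ᵇ⇒≤ _
e-spread zero (suc t) = dist-≤ upper lower
  where
  m = t ℕ.+ (t ℕ.+ 0)
  sq = e (suc (t ℕ.+ 0)) * e (suc (t ℕ.+ 0))
  shape : 1ℚ * e (suc t ℕ.+ (suc t ℕ.+ 0)) ≡ q (suc m) * e (suc m)
  shape = trans (ℚₚ.*-identityˡ _) (cong (λ z → e (suc z)) (ℕₚ.+-suc t (t ℕ.+ 0)))
  upper : 1ℚ * e (suc t ℕ.+ (suc t ℕ.+ 0)) ≤ sq + 1ℚ * sq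
  upper = begin
    1ℚ * e (suc t ℕ.+ (suc t ℕ.+ 0))  ≡⟨ shape ⟩
    -- No ratio exceeds q₀ = 6 = e₁, so e₀e₂ₜ₊₂ is at most e₁e₂ₜ₊₁, a product already estimated.
    q (suc m) * e (suc m)             ≤⟨ *-monoʳ (0≤e (suc m)) (q≤6 (suc m)) ⟩
    e 1 * e (suc m)                   ≤⟨ e-nearlyGeometric t 0 ⟩
    (1ℚ + u 0) * sq                   ≡⟨ solve 1 (λ s → (# 1 :+ # 1) :* s := s :+ # 1 :* s) refl sq ⟩
    sq + 1ℚ * sq                      ∎
  lower : sq ≤ 1ℚ * e (suc t ℕ.+ (suc t ℕ.+ 0)) + 1ℚ * sq
  lower = ≤-by (1ℚ * e (suc t ℕ.+ (suc t ℕ.+ 0))) (0≤* 0≤1 (0≤e (suc t ℕ.+ (suc t ℕ.+ 0))))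
    (solve 2 (λ x s → x :+ # 1 :* s := s :+ x) refl (1ℚ * e (suc t ℕ.+ (suc t ℕ.+ 0))) sq)
e-spread (suc i) t = subst₂ (λ j k → ∣ e (suc i) * e j - e k * e k ∣ ≤ u i * (e k * e k))
  (sym (trans (cong (t ℕ.+_) (ℕₚ.+-suc t i)) (ℕₚ.+-suc t (t ℕ.+ i)))) (sym (ℕₚ.+-suc t i))
  (dist-≤
    (ℚₚ.≤-trans (e-nearlyGeometric t i) (ℚₚ.≤-reflexive (solve 2 (λ a s → (# 1 :+ a) :* s := s :+ a :* s) refl (u i) sq)))
    (ℚₚ.≤-trans (e-logConvex t i) (≤-by (u i * sq) (0≤* (0≤u i) (0≤* (0≤e (suc (t ℕ.+ i))) (0≤e (suc (t ℕ.+ i))))) refl)))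
  where sq = e (suc (t ℕ.+ i)) * e (suc (t ℕ.+ i))

-- The convolution of d with itself

0≤½u : ∀ n → 0ℚ ≤ 1ℚ - ½ * u n
0≤½u n = ≤⇒0≤- (ℚₚ.≤-trans (*-mono-≤-nonNeg {½} {1ℚ} {u n} {1ℚ} 0≤½ (ℚₚ.≤ᵇ⇒≤ _) (0≤u n) (u≤1 n)) (ℚₚ.≤-refl {1ℚ}))

0≤a : ∀ n → 0ℚ ≤ a n
0≤a zero    = 0≤1
0≤a (suc n) = 0≤* (0≤a n) (0≤½u n)

a-drop : ∀ n → a n ≡ a (suc n) + ½ * (a n * u n)
a-drop n = solve 2 (λ a u → a := a :* (# 1 :- con ½ :* u) :+ con ½ :* (a :* u)) refl (a n) (u n)

a-decreasing : ∀ n → a (suc n) ≤ a n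
a-decreasing n = ≤-by (½ * (a n * u n)) (0≤* 0≤½ (0≤* (0≤a n) (0≤u n))) (a-drop n)

a-anti : ∀ k n → a (k ℕ.+ n) ≤ a n
a-anti zero    n = ℚₚ.≤-refl
a-anti (suc k) n = ℚₚ.≤-trans (a-decreasing (k ℕ.+ n)) (a-anti k n)

Σ≤-mono : ∀ n {f g : ℕ → ℚ} → (∀ i → i ℕ.≤ n → f i ≤ g i) → Σ≤ n f ≤ Σ≤ n g
Σ≤-mono zero    le = le 0 z≤n
Σ≤-mono (suc n) le = ℚₚ.+-mono-≤ (Σ≤-mono n λ i i≤n → le i (ℕₚ.m≤n⇒m≤1+n i≤n)) (le (suc n) ℕₚ.≤-refl)

∣Σ≤∣ : ∀ n f → ∣ Σ≤ n f ∣ ≤ Σ≤ n (λ i → ∣ f i ∣)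
∣Σ≤∣ zero    f = ℚₚ.≤-refl
∣Σ≤∣ (suc n) f = ℚₚ.≤-trans (ℚₚ.∣p+q∣≤∣p∣+∣q∣ (Σ≤ n f) (f (suc n))) (ℚₚ.+-monoˡ-≤ ∣ f (suc n) ∣ (∣Σ≤∣ n f))

-- Telescoping: for k ≥ 1 the summand aₖ/k is at most aₖ₋₁/k, and that is exactly 2(aₖ₋₁ - aₖ). So
-- the weighted errors stay bounded although the sum of 1/k does not.
Σ≤-spread : ∀ n → Σ≤ n (λ k → a k * spread k) ≤ ι 3 - ι 2 * a n
Σ≤-spread zero    = ℚₚ.≤ᵇ⇒≤ _
Σ≤-spread (suc n) = begin
  Σ≤ n (λ k → a k * spread k) + a (suc n) * u n
    ≤⟨ ℚₚ.+-mono-≤ (Σ≤-spread n) (*-monoʳ (0≤u n) (a-decreasing n)) ⟩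
  (ι 3 - ι 2 * a n) + a n * u n
    ≡⟨ solve 2 (λ a u → (# 3 :- # 2 :* a) :+ a :* u := # 3 :- # 2 :* (a :* (# 1 :- con ½ :* u))) refl (a n) (u n) ⟩
  ι 3 - ι 2 * a (suc n) ∎

-- With n = t + k the second index is 2n - k, and its a is at most aₙ. The last summand of the bound
-- is added only for symmetry: the indices above n then follow by exchange.
weighted-spread : ∀ k t → a k * a (t ℕ.+ (t ℕ.+ k)) * ∣ e k * e (t ℕ.+ (t ℕ.+ k)) - e (t ℕ.+ k) * e (t ℕ.+ k) ∣
  ≤ a (t ℕ.+ k) * (e (t ℕ.+ k) * e (t ℕ.+ k)) * (a k * spread k + a (t ℕ.+ (t ℕ.+ k)) * spread (t ℕ.+ (t ℕ.+ k)))
weighted-spread k t = begin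
  a k * a m * ∣ e k * e m - sq ∣
    ≤⟨ *-mono-≤-nonNeg (0≤* (0≤a k) (0≤a m)) (*-monoˡ (0≤a k) (a-anti t n)) (ℚₚ.0≤∣p∣ (e k * e m - sq)) (e-spread k t) ⟩
  a k * a n * (spread k * sq)
    ≤⟨ ≤-by (a n * sq * (a m * spread m)) (0≤* (0≤* (0≤a n) (0≤* (0≤e n) (0≤e n))) (0≤* (0≤a m) (0≤spread m)))
         (solve 6 (λ k m n s h j → n :* s :* (k :* h :+ m :* j) := k :* n :* (h :* s) :+ n :* s :* (m :* j)) refl (a k) (a m) (a n) sq (spread k) (spread m)) ⟩
  a n * sq * (a k * spread k + a m * spread m) ∎
  where
  n = t ℕ.+ k
  m = t ℕ.+ n
  sq = e n * e n

weighted-spread-≤ : ∀ n k → k ℕ.≤ n ℕ.+ n → a k * a (n ℕ.+ n ℕ.∸ k) * ∣ e k * e (n ℕ.+ n ℕ.∸ k) - e n * e n ∣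
  ≤ a n * (e n * e n) * (a k * spread k + a (n ℕ.+ n ℕ.∸ k) * spread (n ℕ.+ n ℕ.∸ k))
weighted-spread-≤ n k k≤2n with ℕₚ.≤-total k n
... | inj₁ k≤n = lower k k≤n (n ℕ.+ n ℕ.∸ k) (trans (cong (ℕ._∸ k) (cong (n ℕ.+_) (sym (ℕₚ.m∸n+n≡m k≤n))))
    (trans (cong (ℕ._∸ k) (sym (ℕₚ.+-assoc n (n ℕ.∸ k) k))) (ℕₚ.m+n∸n≡m (n ℕ.+ (n ℕ.∸ k)) k)))
  where
  lower : ∀ k → k ℕ.≤ n → ∀ j → j ≡ n ℕ.+ (n ℕ.∸ k) → a k * a j * ∣ e k * e j - e n * e n ∣ ≤ a n * (e n * e n) * (a k * spread k + a j * spread j)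
  lower k k≤n j refl = subst₂ (λ n j → a k * a j * ∣ e k * e j - e n * e n ∣ ≤ a n * (e n * e n) * (a k * spread k + a j * spread j))
    (ℕₚ.m∸n+n≡m k≤n) (trans (cong (n ℕ.∸ k ℕ.+_) (ℕₚ.m∸n+n≡m k≤n)) (ℕₚ.+-comm (n ℕ.∸ k) n)) (weighted-spread k (n ℕ.∸ k))
... | inj₂ n≤k = subst₂ _≤_
    (cong₂ (λ x y → x * ∣ y - e n * e n ∣) (ℚₚ.*-comm (a j) (a k)) (ℚₚ.*-comm (e j) (e k)))
    (cong (a n * (e n * e n) *_) (ℚₚ.+-comm (a j * spread j) (a k * spread k)))
    (subst₂ (λ n′ k → a j * a k * ∣ e j * e k - e n′ * e n′ ∣ ≤ a n′ * (e n′ * e n′) * (a j * spread j + a k * spread k)) n-eq k-eq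
      (weighted-spread j t))
  where
  j = n ℕ.+ n ℕ.∸ k
  t = k ℕ.∸ n
  n-eq : t ℕ.+ j ≡ n
  n-eq = ℕₚ.+-cancelʳ-≡ n _ _ (trans
    (trans (ℕₚ.+-assoc t j n) (trans (cong (t ℕ.+_) (ℕₚ.+-comm j n)) (sym (ℕₚ.+-assoc t n j))))
    (trans (cong (ℕ._+ j) (ℕₚ.m∸n+n≡m n≤k)) (ℕₚ.m+[n∸m]≡n k≤2n)))
  k-eq : t ℕ.+ (t ℕ.+ j) ≡ k
  k-eq = trans (cong (t ℕ.+_) n-eq) (ℕₚ.m∸n+n≡m n≤k)

-- Since aₖa₂ₙ₋ₖ sums to 1, eₙ² can be subtracted inside the convolution. The symmetric error bound
-- consists of two sums of at most 3 each, whence the 6.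
U-close : ∀ n → ∣ Uˢ (n ℕ.+ n) - e n * e n ∣ ≤ ι 6 * a n * (e n * e n)
U-close n = begin
  ∣ Uˢ N - sq ∣
    ≡⟨ cong ∣_∣ difference ⟩
  ∣ Σ≤ N (λ k → a k * a (N ℕ.∸ k) * (e k * e (N ℕ.∸ k) - sq)) ∣
    ≤⟨ ∣Σ≤∣ N (λ k → a k * a (N ℕ.∸ k) * (e k * e (N ℕ.∸ k) - sq)) ⟩
  Σ≤ N (λ k → ∣ a k * a (N ℕ.∸ k) * (e k * e (N ℕ.∸ k) - sq) ∣)
    ≤⟨ Σ≤-mono N (λ k k≤N → ℚₚ.≤-trans (ℚₚ.≤-reflexive (trans (ℚₚ.∣p*q∣≡∣p∣*∣q∣ (a k * a (N ℕ.∸ k)) (e k * e (N ℕ.∸ k) - sq))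
         (cong (_* ∣ e k * e (N ℕ.∸ k) - sq ∣) (ℚₚ.0≤p⇒∣p∣≡p (0≤* (0≤a k) (0≤a (N ℕ.∸ k)))))))
         (weighted-spread-≤ n k k≤N)) ⟩
  Σ≤ N (λ k → a n * sq * (a k * spread k + a (N ℕ.∸ k) * spread (N ℕ.∸ k)))
    ≡⟨ trans (Σ≤-* N (a n * sq) (λ k → a k * spread k + a (N ℕ.∸ k) * spread (N ℕ.∸ k)))
         (cong (a n * sq *_) (trans (Σ≤-+ N (λ k → a k * spread k) (λ k → a (N ℕ.∸ k) * spread (N ℕ.∸ k)))
           (cong (s +_) (sym (Σ≤-reverse N (λ k → a k * spread k)))))) ⟩
  a n * sq * (s + s)
    ≤⟨ *-monoˡ 0≤asq (ℚₚ.+-mono-≤ s≤3 s≤3) ⟩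
  a n * sq * (ι 3 + ι 3)
    ≡⟨ solve 2 (λ a s → a :* s :* (# 3 :+ # 3) := # 6 :* a :* s) refl (a n) sq ⟩
  ι 6 * a n * sq ∎
  where
  N = n ℕ.+ n
  sq = e n * e n
  s = Σ≤ N (λ k → a k * spread k)
  0≤asq : 0ℚ ≤ a n * sq
  0≤asq = 0≤* (0≤a n) (0≤* (0≤e n) (0≤e n))
  s≤3 : s ≤ ι 3
  s≤3 = ℚₚ.≤-trans (Σ≤-spread N) (≤-by (ι 2 * a N) (0≤* (0≤ι 2) (0≤a N)) (solve 1 (λ a → # 3 := # 3 :- # 2 :* a :+ # 2 :* a) refl (a N)))
  difference : Uˢ N - sq ≡ Σ≤ N (λ k → a k * a (N ℕ.∸ k) * (e k * e (N ℕ.∸ k) - sq))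
  difference = begin-equality
    Uˢ N - sq
      ≡⟨ solve 2 (λ x s → x :- s := x :+ (:- s) :* # 1) refl (Uˢ N) sq ⟩
    Uˢ N + (- sq) * 1ℚ
      ≡⟨ cong₂ (λ x y → x + (- sq) * y) (Σ≤-cong N (λ k _ → cong₂ _*_ (d≡ae k) (d≡ae (N ℕ.∸ k)))) (sym (a⊛a N)) ⟩
    Σ≤ N (λ k → a k * e k * (a (N ℕ.∸ k) * e (N ℕ.∸ k))) + (- sq) * (a ⊛ a) N
      ≡⟨ cong (Σ≤ N (λ k → a k * e k * (a (N ℕ.∸ k) * e (N ℕ.∸ k))) +_) (Σ≤-* N (- sq) (λ k → a k * a (N ℕ.∸ k))) ⟨
    Σ≤ N (λ k → a k * e k * (a (N ℕ.∸ k) * e (N ℕ.∸ k))) + Σ≤ N (λ k → (- sq) * (a k * a (N ℕ.∸ k)))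
      ≡⟨ Σ≤-+ N (λ k → a k * e k * (a (N ℕ.∸ k) * e (N ℕ.∸ k))) (λ k → (- sq) * (a k * a (N ℕ.∸ k))) ⟨
    Σ≤ N (λ k → a k * e k * (a (N ℕ.∸ k) * e (N ℕ.∸ k)) + (- sq) * (a k * a (N ℕ.∸ k)))
      ≡⟨ Σ≤-cong N (λ k _ → solve 5 (λ a e b f s → a :* e :* (b :* f) :+ (:- s) :* (a :* b) := a :* b :* (e :* f :- s)) refl
           (a k) (e k) (a (N ℕ.∸ k)) (e (N ℕ.∸ k)) sq) ⟩
    Σ≤ N (λ k → a k * a (N ℕ.∸ k) * (e k * e (N ℕ.∸ k) - sq)) ∎

-- Asymptotic equality

-- Eventually in n, and then eventually in m depending on n: n is the index of a
-- sequence of reals and m the precision at which its n-th member is approximated.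
Eventually₂ : (ℕ → ℕ → Set) → Set
Eventually₂ P = Eventually λ n → Eventually (P n)

module _ {P Q : ℕ → ℕ → Set} where

  ev-map : (∀ {n m} → P n m → Q n m) → Eventually₂ P → Eventually₂ Q
  ev-map f (N , h) = N , λ n N≤n → let (M , g) = h n N≤n in M , λ m M≤m → f (g m M≤m)

  infixr 4 _ev×_
  _ev×_ : Eventually₂ P → Eventually₂ Q → Eventually₂ (λ n m → P n m × Q n m)
  (N , h) ev× (N′ , h′) = N ℕ.⊔ N′ , λ n ≤n →
    let (M , g) = h n (⊔-l N N′ ≤n)
        (M′ , g′) = h′ n (⊔-r N N′ ≤n)
    in M ℕ.⊔ M′ , λ m ≤m → g m (⊔-l M M′ ≤m) , g′ m (⊔-r M M′ ≤m)

ev-all : {P : ℕ → ℕ → Set} → (∀ n m → P n m) → Eventually₂ P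
ev-all f = 0 , λ n _ → 0 , λ m _ → f n m

ev-inner : {P : ℕ → Set} → Eventually P → Eventually₂ (λ _ m → P m)
ev-inner h = 0 , λ _ _ → h

Seq₂ : Set
Seq₂ = ℕ → ℕ → ℚ

Null : Seq₂ → Set
Null z = ∀ ε → 0ℚ < ε → Eventually₂ λ n m → ∣ z n m ∣ ≤ ε

null-≤ : ∀ {x z} → Null z → Eventually₂ (λ n m → ∣ x n m ∣ ≤ ∣ z n m ∣) → Null x
null-≤ hz le ε 0<ε = ev-map (λ (x≤z , z≤ε) → ℚₚ.≤-trans x≤z z≤ε) (le ev× hz ε 0<ε)

null-+ : ∀ {x y} → Null x → Null y → Null (λ n m → x n m + y n m)
null-+ {x} {y} hx hy ε 0<ε = ev-map
  (λ {n} {m} (x≤ , y≤) → ℚₚ.≤-trans (ℚₚ.∣p+q∣≤∣p∣+∣q∣ (x n m) (y n m)) (subst (∣ x n m ∣ + ∣ y n m ∣ ≤_) (halves ε) (ℚₚ.+-mono-≤ x≤ y≤)))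
  (hx (½ * ε) (0<* 0<½ 0<ε) ev× hy (½ * ε) (0<* 0<½ 0<ε))

null-* : ∀ {x g : Seq₂} B → 0ℚ < B → Eventually₂ (λ n m → ∣ g n m ∣ ≤ B) → Null x → Null (λ n m → g n m * x n m)
null-* {x} {g} B 0<B g≤B hx ε 0<ε = ev-map
  (λ {n} {m} (g≤ , x≤) → begin
    ∣ g n m * x n m ∣       ≡⟨ ℚₚ.∣p*q∣≡∣p∣*∣q∣ (g n m) (x n m) ⟩
    ∣ g n m ∣ * ∣ x n m ∣   ≤⟨ *-mono-≤-nonNeg (ℚₚ.0≤∣p∣ (g n m)) g≤ (ℚₚ.0≤∣p∣ (x n m)) x≤ ⟩
    B * (inv B * ε)         ≡⟨ solve 3 (λ b i e → b :* (i :* e) := (i :* b) :* e) refl B (inv B) ε ⟩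
    inv B * B * ε           ≡⟨ cong (_* ε) (inv-inverse B (pos⇒≢ 0<B)) ⟩
    1ℚ * ε                  ≡⟨ ℚₚ.*-identityˡ ε ⟩
    ε                       ∎)
  (g≤B ev× hx (inv B * ε) (0<* (inv-pos B 0<B) 0<ε))

∣const∣ : ∀ n → ∣ ι n ∣ ≤ ι (suc n)
∣const∣ n = ℚₚ.≤-trans (ℚₚ.≤-reflexive (ℚₚ.0≤p⇒∣p∣≡p (0≤ι n))) (ι-mono (ℕₚ.n≤1+n n))

null-scale : ∀ k {x} → Null x → Null (λ n m → ι k * x n m)
null-scale k {x} = null-* {x} {λ _ _ → ι k} (ι (suc k)) (0<ι k) (ev-all λ _ _ → ∣const∣ k)

∣u∣ : ∀ n → ∣ u n ∣ ≡ u n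
∣u∣ n = ℚₚ.0≤p⇒∣p∣≡p (0≤u n)

null-u-outer : Null (λ n _ → u n)
null-u-outer ε 0<ε = let (N , h) = archimedean ε 0<ε in
  N , λ n N≤n → 0 , λ _ _ → subst (_≤ ε) (sym (∣u∣ n)) (h n N≤n)

null-u-inner : Null (λ _ m → u m)
null-u-inner ε 0<ε = let (M , h) = archimedean ε 0<ε in
  0 , λ _ _ → M , λ m M≤m → subst (_≤ ε) (sym (∣u∣ m)) (h m M≤m)

null-∣∣ : ∀ {x} → Null x → Null (λ n m → ∣ x n m ∣)
null-∣∣ {x} hx = null-≤ hx (ev-all λ n m → ℚₚ.≤-reflexive (ℚₚ.∣∣p∣∣≡∣p∣ (x n m)))

null-suc : ∀ {x : ℕ → ℚ} → Null (λ n _ → x n) → Null (λ n _ → x (suc n))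
null-suc hx ε 0<ε = let (N , h) = hx ε 0<ε in N , λ n N≤n → h (suc n) (ℕₚ.m≤n⇒m≤1+n N≤n)

infix 4 _≃_
-- The error is relative to `b`, whose eventual positivity is part of the relation. Thus products
-- and transitivity need neither division nor separate hypotheses on signs.
record _≃_ (a b : Seq₂) : Set where
  constructor asymptotic
  field
    close : ∀ ε → 0ℚ < ε → Eventually₂ λ n m → 0ℚ < b n m × ∣ a n m - b n m ∣ ≤ ε * b n m
open _≃_

≃-intro : ∀ {a b} z → Null z → Eventually₂ (λ n m → 0ℚ < b n m) → Eventually₂ (λ n m → ∣ a n m - b n m ∣ ≤ ∣ z n m ∣ * b n m) → a ≃ b
≃-intro z hz 0<b le = asymptotic λ ε 0<ε → ev-map
  (λ (0<b , le , z≤ε) → 0<b , ℚₚ.≤-trans le (*-monoʳ (ℚₚ.<⇒≤ 0<b) z≤ε)) (0<b ev× le ev× hz ε 0<ε)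

≃-refl : ∀ {b} → Eventually₂ (λ n m → 0ℚ < b n m) → b ≃ b
≃-refl {b} 0<b = asymptotic λ ε 0<ε → ev-map (λ {n} {m} 0<b → 0<b ,
  subst (_≤ ε * b n m) (sym (cong ∣_∣ (ℚₚ.+-inverseʳ (b n m)))) (0≤* (ℚₚ.<⇒≤ 0<ε) (ℚₚ.<⇒≤ 0<b))) 0<b

≃-resp : ∀ {a a′ b b′} → (∀ n m → a n m ≡ a′ n m) → (∀ n m → b n m ≡ b′ n m) → a ≃ b → a′ ≃ b′
≃-resp eqa eqb a≃b = asymptotic λ ε 0<ε → ev-map
  (λ {n} {m} → subst₂ (λ x y → 0ℚ < y × ∣ x - y ∣ ≤ ε * y) (eqa n m) (eqb n m)) (close a≃b ε 0<ε)

-- Two relative errors t combine to (1+t)² - 1 = t(2+t). For t at most a third of both ε and 1 this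
-- does not exceed ε.
third : ℚ → ℚ
third ε = u 2 * (ε ℚ.⊓ 1ℚ)

module _ {ε : ℚ} (0<ε : 0ℚ < ε) where

  0<ε⊓1 : 0ℚ < ε ℚ.⊓ 1ℚ
  0<ε⊓1 with ℚₚ.⊓-sel ε 1ℚ
  ... | inj₁ eq = subst (0ℚ <_) (sym eq) 0<ε
  ... | inj₂ eq = subst (0ℚ <_) (sym eq) 0<1

  0<third : 0ℚ < third ε
  0<third = 0<* (0<u 2) 0<ε⊓1

  third-≤ : third ε * (ι 2 + third ε) ≤ ε
  third-≤ = begin
    t * (ι 2 + t)      ≤⟨ *-monoˡ (ℚₚ.<⇒≤ 0<third) (ℚₚ.+-monoʳ-≤ (ι 2) t≤1) ⟩
    t * (ι 2 + 1ℚ)     ≡⟨ solve 1 (λ x → con (u 2) :* x :* (# 2 :+ # 1) := x) refl (ε ℚ.⊓ 1ℚ) ⟩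
    ε ℚ.⊓ 1ℚ           ≤⟨ ℚₚ.p⊓q≤p ε 1ℚ ⟩
    ε                  ∎
    where
    t = third ε
    t≤1 : t ≤ 1ℚ
    t≤1 = *-mono-≤-nonNeg {b = 1ℚ} {d = 1ℚ} (0≤u 2) (u≤1 2) (ℚₚ.<⇒≤ 0<ε⊓1) (ℚₚ.p⊓q≤q ε 1ℚ)

∣∣-upper : ∀ {x y e} → ∣ x - y ∣ ≤ e → 0ℚ ≤ y → ∣ x ∣ ≤ y + e
∣∣-upper {x} {y} {e} le 0≤y = begin
  ∣ x ∣                ≡⟨ cong ∣_∣ (solve 2 (λ x y → x := y :+ (x :- y)) refl x y) ⟩
  ∣ y + (x - y) ∣      ≤⟨ ℚₚ.∣p+q∣≤∣p∣+∣q∣ y (x - y) ⟩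
  ∣ y ∣ + ∣ x - y ∣    ≤⟨ ℚₚ.+-mono-≤ (ℚₚ.≤-reflexive (ℚₚ.0≤p⇒∣p∣≡p 0≤y)) le ⟩
  y + e ∎

≃-trans : ∀ {a b c} → a ≃ b → b ≃ c → a ≃ c
≃-trans {a} {b} {c} a≃b b≃c = asymptotic λ ε 0<ε → ev-map (step ε 0<ε)
  (close a≃b (third ε) (0<third 0<ε) ev× close b≃c (third ε) (0<third 0<ε))
  where
  module _ (ε : ℚ) (0<ε : 0ℚ < ε) where
    t = third ε
    0<t = 0<third 0<ε
    0≤t = ℚₚ.<⇒≤ 0<t
    step : ∀ {n m} → (0ℚ < b n m × ∣ a n m - b n m ∣ ≤ t * b n m) × (0ℚ < c n m × ∣ b n m - c n m ∣ ≤ t * c n m) →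
           0ℚ < c n m × ∣ a n m - c n m ∣ ≤ ε * c n m
    step {n} {m} ((0<b , ab) , (0<c , bc)) = 0<c , (begin
      ∣ x - z ∣                   ≡⟨ cong ∣_∣ (solve 3 (λ x y z → x :- z := (x :- y) :+ (y :- z)) refl x y z) ⟩
      ∣ (x - y) + (y - z) ∣       ≤⟨ ℚₚ.∣p+q∣≤∣p∣+∣q∣ (x - y) (y - z) ⟩
      ∣ x - y ∣ + ∣ y - z ∣       ≤⟨ ℚₚ.+-mono-≤ (ℚₚ.≤-trans ab (*-monoˡ 0≤t (≤-dist {y} {z} bc))) bc ⟩
      t * (z + t * z) + t * z     ≡⟨ solve 2 (λ t z → t :* (z :+ t :* z) :+ t :* z := t :* (# 2 :+ t) :* z) refl t z ⟩
      t * (ι 2 + t) * z           ≤⟨ *-monoʳ (ℚₚ.<⇒≤ 0<c) (third-≤ 0<ε) ⟩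
      ε * z ∎)
      where x = a n m ; y = b n m ; z = c n m

≃-* : ∀ {a b c d} → a ≃ b → c ≃ d → (λ n m → a n m * c n m) ≃ (λ n m → b n m * d n m)
≃-* {a} {b} {c} {d} a≃b c≃d = asymptotic λ ε 0<ε → ev-map (step ε 0<ε)
  (close a≃b (third ε) (0<third 0<ε) ev× close c≃d (third ε) (0<third 0<ε))
  where
  module _ (ε : ℚ) (0<ε : 0ℚ < ε) where
    t = third ε
    0<t = 0<third 0<ε
    0≤t = ℚₚ.<⇒≤ 0<t
    step : ∀ {n m} → (0ℚ < b n m × ∣ a n m - b n m ∣ ≤ t * b n m) × (0ℚ < d n m × ∣ c n m - d n m ∣ ≤ t * d n m) →
           0ℚ < b n m * d n m × ∣ a n m * c n m - b n m * d n m ∣ ≤ ε * (b n m * d n m)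
    step {n} {m} ((0<y , xy) , (0<v , wv)) = 0<* 0<y 0<v , (begin
      ∣ x * w - y * v ∣
        ≡⟨ cong ∣_∣ (solve 4 (λ x y w v → x :* w :- y :* v := (x :- y) :* w :+ y :* (w :- v)) refl x y w v) ⟩
      ∣ (x - y) * w + y * (w - v) ∣
        ≤⟨ ℚₚ.∣p+q∣≤∣p∣+∣q∣ ((x - y) * w) (y * (w - v)) ⟩
      ∣ (x - y) * w ∣ + ∣ y * (w - v) ∣
        ≡⟨ cong₂ _+_ (ℚₚ.∣p*q∣≡∣p∣*∣q∣ (x - y) w) (trans (ℚₚ.∣p*q∣≡∣p∣*∣q∣ y (w - v)) (cong (_* ∣ w - v ∣) (ℚₚ.0≤p⇒∣p∣≡p (ℚₚ.<⇒≤ 0<y)))) ⟩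
      ∣ x - y ∣ * ∣ w ∣ + y * ∣ w - v ∣
        ≤⟨ ℚₚ.+-mono-≤ (*-mono-≤-nonNeg (ℚₚ.0≤∣p∣ (x - y)) xy (ℚₚ.0≤∣p∣ w) (∣∣-upper {w} {v} wv (ℚₚ.<⇒≤ 0<v)))
             (*-monoˡ (ℚₚ.<⇒≤ 0<y) wv) ⟩
      t * y * (v + t * v) + y * (t * v)
        ≡⟨ solve 3 (λ t y v → t :* y :* (v :+ t :* v) :+ y :* (t :* v) := t :* (# 2 :+ t) :* (y :* v)) refl t y v ⟩
      t * (ι 2 + t) * (y * v)
        ≤⟨ *-monoʳ (0≤* (ℚₚ.<⇒≤ 0<y) (ℚₚ.<⇒≤ 0<v)) (third-≤ 0<ε) ⟩
      ε * (y * v) ∎)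
      where x = a n m ; y = b n m ; w = c n m ; v = d n m

-- For x ≥ 0 the difference of squares is at least y times the difference of x and y, so the
-- relative error does not grow. This removes the squares at the end.
≃-√ : ∀ {a b} → Eventually₂ (λ n m → 0ℚ ≤ a n m) → Eventually₂ (λ n m → 0ℚ < b n m) →
      (λ n m → a n m * a n m) ≃ (λ n m → b n m * b n m) → a ≃ b
≃-√ {a} {b} 0≤a 0<b a²≃b² = asymptotic λ ε 0<ε → ev-map (step ε) (0≤a ev× 0<b ev× close a²≃b² ε 0<ε)
  where
  module _ (ε : ℚ) where
    step : ∀ {n m} → 0ℚ ≤ a n m × 0ℚ < b n m × 0ℚ < b n m * b n m × ∣ a n m * a n m - b n m * b n m ∣ ≤ ε * (b n m * b n m) →
           0ℚ < b n m × ∣ a n m - b n m ∣ ≤ ε * b n m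
    step {n} {m} (0≤x , 0<y , _ , le) = 0<y , *-cancelˡ 0<y (begin
      y * ∣ x - y ∣            ≤⟨ *-monoʳ (ℚₚ.0≤∣p∣ (x - y)) (≤-by {y} x 0≤x (ℚₚ.+-comm x y)) ⟩
      (x + y) * ∣ x - y ∣      ≡⟨ cong (_* ∣ x - y ∣) (ℚₚ.0≤p⇒∣p∣≡p (0≤+ 0≤x (ℚₚ.<⇒≤ 0<y))) ⟨
      ∣ x + y ∣ * ∣ x - y ∣    ≡⟨ ℚₚ.∣p*q∣≡∣p∣*∣q∣ (x + y) (x - y) ⟨
      ∣ (x + y) * (x - y) ∣    ≡⟨ cong ∣_∣ (solve 2 (λ x y → (x :+ y) :* (x :- y) := x :* x :- y :* y) refl x y) ⟩
      ∣ x * x - y * y ∣        ≤⟨ le ⟩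
      ε * (y * y)              ≡⟨ solve 2 (λ e y → e :* (y :* y) := y :* (e :* y)) refl ε y ⟩
      y * (ε * y)              ∎)
      where x = a n m ; y = b n m

-- Wallis's product from Leibniz's series

ι-∸ : ∀ {m n} → m ℕ.≤ n → ι (n ℕ.∸ m) ≡ ι n - ι m
ι-∸ {m} {n} m≤n = begin-equality
  ι (n ℕ.∸ m)                 ≡⟨ solve 2 (λ x y → x := (x :+ y) :- y) refl (ι (n ℕ.∸ m)) (ι m) ⟩
  (ι (n ℕ.∸ m) + ι m) - ι m   ≡⟨ cong (_- ι m) (trans (sym (ι-+ (n ℕ.∸ m) m)) (cong ι (ℕₚ.m∸n+n≡m m≤n))) ⟩
  ι n - ι m ∎

-- w n k = C(2n+1,n-k) / C(2n+1,n).
w : ℕ → ℕ → ℚ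
w n zero    = 1ℚ
w n (suc k) = w n k * (ι (n ℕ.∸ k) * u (n ℕ.+ suc k))

w-vanish : ∀ {n k} → n ℕ.< k → w n k ≡ 0ℚ
w-vanish {n} {suc k} (s≤s n≤k) = begin-equality
  w n k * (ι (n ℕ.∸ k) * u (n ℕ.+ suc k))
    ≡⟨ cong (λ z → w n k * (ι z * u (n ℕ.+ suc k))) (ℕₚ.m≤n⇒m∸n≡0 n≤k) ⟩
  w n k * (0ℚ * u (n ℕ.+ suc k))
    ≡⟨ solve 2 (λ a b → a :* (# 0 :* b) := # 0) refl (w n k) (u (n ℕ.+ suc k)) ⟩
  0ℚ ∎

-- Beyond k = n the truncated difference is wrong, but the weight is zero there. The identities for
-- w therefore hold for all k.
w-∸ : ∀ n k → w n k * ι (n ℕ.∸ k) ≡ w n k * (ι n - ι k)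
w-∸ n k with ℕₚ.≤-total k n
... | inj₁ k≤n = cong (w n k *_) (ι-∸ k≤n)
... | inj₂ n≤k with ℕₚ.m≤n⇒m<n∨m≡n n≤k
...   | inj₁ n<k  = begin-equality
  w n k * ι (n ℕ.∸ k)      ≡⟨ cong (_* ι (n ℕ.∸ k)) (w-vanish n<k) ⟩
  0ℚ * ι (n ℕ.∸ k)         ≡⟨ solve 2 (λ a b → # 0 :* a := # 0 :* b) refl (ι (n ℕ.∸ k)) (ι n - ι k) ⟩
  0ℚ * (ι n - ι k)         ≡⟨ cong (_* (ι n - ι k)) (w-vanish n<k) ⟨
  w n k * (ι n - ι k)      ∎
...   | inj₂ refl = cong (w n k *_) (ι-∸ {n} {n} ℕₚ.≤-refl)

ι-next : ∀ n k → ι (suc (n ℕ.+ suc k)) ≡ ι 2 + ι n + ι k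
ι-next n k = trans (cong (λ z → ι (suc z)) (ℕₚ.+-suc n k)) (trans (ι-+ 2 (n ℕ.+ k)) (trans (cong (ι 2 +_) (ι-+ n k)) (sym (ℚₚ.+-assoc (ι 2) (ι n) (ι k)))))

w-suc : ∀ n k → w n (suc k) * (ι 2 + ι n + ι k) ≡ w n k * (ι n - ι k)
w-suc n k = begin-equality
  w n k * (ι (n ℕ.∸ k) * u (n ℕ.+ suc k)) * (ι 2 + ι n + ι k)
    ≡⟨ cong (w n k * (ι (n ℕ.∸ k) * u (n ℕ.+ suc k)) *_) (ι-next n k) ⟨
  w n k * (ι (n ℕ.∸ k) * u (n ℕ.+ suc k)) * ι (suc (n ℕ.+ suc k))
    ≡⟨ solve 4 (λ a b c d → a :* (b :* c) :* d := a :* b :* (c :* d)) refl (w n k) (ι (n ℕ.∸ k)) (u (n ℕ.+ suc k)) (ι (suc (n ℕ.+ suc k))) ⟩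
  w n k * ι (n ℕ.∸ k) * (u (n ℕ.+ suc k) * ι (suc (n ℕ.+ suc k)))
    ≡⟨ cong₂ _*_ (w-∸ n k) (u-ι (n ℕ.+ suc k)) ⟩
  w n k * (ι n - ι k) * 1ℚ
    ≡⟨ ℚₚ.*-identityʳ _ ⟩
  w n k * (ι n - ι k) ∎

0≤w : ∀ n k → 0ℚ ≤ w n k
0≤w n zero    = 0≤1
0≤w n (suc k) = 0≤* (0≤w n k) (0≤* (0≤ι (n ℕ.∸ k)) (0≤u (n ℕ.+ suc k)))

w-drop : ∀ n k → w n k - w n (suc k) ≡ w n k * (ι 2 + ι 2 * ι k) * u (n ℕ.+ suc k)
w-drop n k = begin-equality
  w n k - w n (suc k)
    ≡⟨ solve 2 (λ a b → a :- b := (a :- b) :* # 1) refl (w n k) (w n (suc k)) ⟩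
  (w n k - w n (suc k)) * 1ℚ
    ≡⟨ cong ((w n k - w n (suc k)) *_) (trans (sym (u-ι (n ℕ.+ suc k))) (cong (u (n ℕ.+ suc k) *_) (ι-next n k))) ⟩
  (w n k - w n (suc k)) * (v * (ι 2 + ι n + ι k))
    ≡⟨ solve 5 (λ a b v n k → (a :- b) :* (v :* (# 2 :+ n :+ k)) := (a :* (# 2 :+ n :+ k) :- b :* (# 2 :+ n :+ k)) :* v) refl (w n k) (w n (suc k)) v (ι n) (ι k) ⟩
  (w n k * (ι 2 + ι n + ι k) - w n (suc k) * (ι 2 + ι n + ι k)) * v
    ≡⟨ cong (λ z → (w n k * (ι 2 + ι n + ι k) - z) * v) (w-suc n k) ⟩
  (w n k * (ι 2 + ι n + ι k) - w n k * (ι n - ι k)) * v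
    ≡⟨ solve 4 (λ a n k v → (a :* (# 2 :+ n :+ k) :- a :* (n :- k)) :* v := a :* (# 2 :+ # 2 :* k) :* v) refl (w n k) (ι n) (ι k) v ⟩
  w n k * (ι 2 + ι 2 * ι k) * v ∎
  where v = u (n ℕ.+ suc k)

0≤w-drop : ∀ n k → 0ℚ ≤ w n k - w n (suc k)
0≤w-drop n k = subst (0ℚ ≤_) (sym (w-drop n k)) (0≤* (0≤* (0≤w n k) (0≤+ (0≤ι 2) (0≤* (0≤ι 2) (0≤ι k)))) (0≤u (n ℕ.+ suc k)))

w≤1 : ∀ n k → w n k ≤ 1ℚ
w≤1 n zero    = ℚₚ.≤-refl
w≤1 n (suc k) = ℚₚ.≤-trans (≤-by (w n k - w n (suc k)) (0≤w-drop n k)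
  (solve 2 (λ a b → a := b :+ (a :- b)) refl (w n k) (w n (suc k)))) (w≤1 n k)

-- The ratio of the weights of two consecutive rows, left as a product since 1 + n - k vanishes at k
-- = n + 1. In the induction both rows are advanced by `w-suc`, after multiplication by n + k + 2,
-- which is never zero.
w-up : ∀ n k → w (suc n) k * ((1ℚ + ι n - ι k) * (ι 2 + ι n + ι k)) ≡ w n k * ((1ℚ + ι n) * (ι 2 + ι n))
w-up n zero    = solve 1 (λ n → # 1 :* ((# 1 :+ n :- # 0) :* (# 2 :+ n :+ # 0)) := # 1 :* ((# 1 :+ n) :* (# 2 :+ n))) refl (ι n)
w-up n (suc k) = cancel (begin-equality
  c * (w (suc n) (suc k) * ((1ℚ + ι n - ι (suc k)) * (ι 2 + ι n + ι (suc k))))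
    ≡⟨ cong (λ z → c * (w (suc n) (suc k) * ((1ℚ + ι n - z) * (ι 2 + ι n + z)))) (ι-suc k) ⟩
  c * (w (suc n) (suc k) * ((1ℚ + ι n - (1ℚ + ι k)) * (ι 2 + ι n + (1ℚ + ι k))))
    ≡⟨ solve 4 (λ c a n k → c :* (a :* ((# 1 :+ n :- (# 1 :+ k)) :* (# 2 :+ n :+ (# 1 :+ k)))) := c :* (n :- k) :* (a :* (# 2 :+ (# 1 :+ n) :+ k))) refl c (w (suc n) (suc k)) (ι n) (ι k) ⟩
  c * (ι n - ι k) * (w (suc n) (suc k) * (ι 2 + (1ℚ + ι n) + ι k))
    ≡⟨ cong (c * (ι n - ι k) *_) (trans (cong (λ z → w (suc n) (suc k) * (ι 2 + z + ι k)) (sym (ι-suc n))) (trans (w-suc (suc n) k) (cong (λ z → w (suc n) k * (z - ι k)) (ι-suc n)))) ⟩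
  c * (ι n - ι k) * (w (suc n) k * (1ℚ + ι n - ι k))
    ≡⟨ solve 3 (λ a n k → (# 2 :+ n :+ k) :* (n :- k) :* (a :* (# 1 :+ n :- k)) := (n :- k) :* (a :* ((# 1 :+ n :- k) :* (# 2 :+ n :+ k)))) refl (w (suc n) k) (ι n) (ι k) ⟩
  (ι n - ι k) * (w (suc n) k * ((1ℚ + ι n - ι k) * (ι 2 + ι n + ι k)))
    ≡⟨ cong ((ι n - ι k) *_) (w-up n k) ⟩
  (ι n - ι k) * (w n k * ((1ℚ + ι n) * (ι 2 + ι n)))
    ≡⟨ solve 3 (λ a x y → x :* (a :* y) := a :* x :* y) refl (w n k) (ι n - ι k) ((1ℚ + ι n) * (ι 2 + ι n)) ⟩
  w n k * (ι n - ι k) * ((1ℚ + ι n) * (ι 2 + ι n))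
    ≡⟨ cong (_* ((1ℚ + ι n) * (ι 2 + ι n))) (w-suc n k) ⟨
  w n (suc k) * c * ((1ℚ + ι n) * (ι 2 + ι n))
    ≡⟨ solve 3 (λ a c x → a :* c :* x := c :* (a :* x)) refl (w n (suc k)) c ((1ℚ + ι n) * (ι 2 + ι n)) ⟩
  c * (w n (suc k) * ((1ℚ + ι n) * (ι 2 + ι n))) ∎)
  where
  c = ι 2 + ι n + ι k
  cancel : ∀ {x y} → c * x ≡ c * y → x ≡ y
  cancel {x} {y} eq = ι-cancel (n ℕ.+ suc k) (subst (λ z → z * x ≡ z * y) (sym (ι-next n k)) eq)

alternating : ℕ → ℕ → ℚ
alternating N zero    = 0ℚ
alternating N (suc k) = alternating N k + sign k * ((1ℚ + ι 2 * ι k) * w N k)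

-- The right side is a discrete antiderivative of the summand. It contains the weight at k, which
-- vanishes past N; so the complete sum is zero for N ≥ 1.
alternating-sum : ∀ N k → ι N * alternating N k ≡ - (sign k * (ι k * (1ℚ + ι N + ι k) * w N k))
alternating-sum N zero    = solve 1 (λ n → n :* # 0 := :- (# 1 :* (# 0 :* (# 1 :+ n :+ # 0) :* # 1))) refl (ι N)
alternating-sum N (suc k) = begin-equality
  ι N * (alternating N k + sign k * ((1ℚ + ι 2 * ι k) * w N k))
    ≡⟨ solve 5 (λ n a s k w → n :* (a :+ s :* ((# 1 :+ # 2 :* k) :* w)) := n :* a :+ n :* (s :* ((# 1 :+ # 2 :* k) :* w))) refl (ι N) (alternating N k) (sign k) (ι k) (w N k) ⟩
  ι N * alternating N k + ι N * (sign k * ((1ℚ + ι 2 * ι k) * w N k))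
    ≡⟨ cong (_+ ι N * (sign k * ((1ℚ + ι 2 * ι k) * w N k))) (alternating-sum N k) ⟩
  - (sign k * (ι k * (1ℚ + ι N + ι k) * w N k)) + ι N * (sign k * ((1ℚ + ι 2 * ι k) * w N k))
    ≡⟨ solve 4 (λ s k n w → :- (s :* (k :* (# 1 :+ n :+ k) :* w)) :+ n :* (s :* ((# 1 :+ # 2 :* k) :* w)) := s :* (# 1 :+ k) :* (w :* (n :- k))) refl (sign k) (ι k) (ι N) (w N k) ⟩
  sign k * (1ℚ + ι k) * (w N k * (ι N - ι k))
    ≡⟨ cong (sign k * (1ℚ + ι k) *_) (w-suc N k) ⟨
  sign k * (1ℚ + ι k) * (w N (suc k) * (ι 2 + ι N + ι k))
    ≡⟨ solve 4 (λ s k n w → s :* (# 1 :+ k) :* (w :* (# 2 :+ n :+ k)) := :- ((:- s) :* ((# 1 :+ k) :* (# 1 :+ n :+ (# 1 :+ k)) :* w))) refl (sign k) (ι k) (ι N) (w N (suc k)) ⟩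
  - ((- sign k) * ((1ℚ + ι k) * (1ℚ + ι N + (1ℚ + ι k)) * w N (suc k)))
    ≡⟨ cong (λ z → - ((- sign k) * (z * (1ℚ + ι N + z) * w N (suc k)))) (ι-suc k) ⟨
  - (sign (suc k) * (ι (suc k) * (1ℚ + ι N + ι (suc k)) * w N (suc k))) ∎

alternating-vanish : ∀ n → alternating (suc n) (2 ℕ.+ n) ≡ 0ℚ
alternating-vanish n = ι-cancel n (trans (alternating-sum (suc n) (2 ℕ.+ n)) (begin-equality
  - (s * (ι (2 ℕ.+ n) * x * w (suc n) (2 ℕ.+ n)))
    ≡⟨ cong (λ z → - (s * (ι (2 ℕ.+ n) * x * z))) (w-vanish {suc n} {2 ℕ.+ n} ℕₚ.≤-refl) ⟩
  - (s * (ι (2 ℕ.+ n) * x * 0ℚ))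
    ≡⟨ solve 4 (λ s i x j → :- (s :* (i :* x :* # 0)) := j :* # 0) refl s (ι (2 ℕ.+ n)) x (ι (suc n)) ⟩
  ι (suc n) * 0ℚ ∎))
  where
  s = sign (2 ℕ.+ n)
  x = 1ℚ + ι (suc n) + ι (2 ℕ.+ n)

leibnizʷ : ℕ → ℕ → ℚ
leibnizʷ n zero    = 0ℚ
leibnizʷ n (suc k) = leibnizʷ n k + sign k * (w n k * term k)

term-ι : ∀ k → term k * (1ℚ + ι 2 * ι k) ≡ ι 4
term-ι k = trans (cong (term k *_) (sym (ι-odd k))) (/-ι 4 (suc (2 ℕ.* k)))

-- The summands differ by a factor which makes them telescope:
-- (2n+3)² - 4(n+1-k)(n+2+k) = (2k+1)².
leibnizʷ-up : ∀ n k → (ι 3 + ι 2 * ι n) * (ι 3 + ι 2 * ι n) * leibnizʷ (suc n) k ≡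
  ι 4 * ((1ℚ + ι n) * (ι 2 + ι n)) * leibnizʷ n k + ι 4 * alternating (suc n) k
leibnizʷ-up n zero    = solve 1 (λ n → (# 3 :+ # 2 :* n) :* (# 3 :+ # 2 :* n) :* # 0 := # 4 :* ((# 1 :+ n) :* (# 2 :+ n)) :* # 0 :+ # 4 :* # 0) refl (ι n)
leibnizʷ-up n (suc k) = begin-equality
  A * (leibnizʷ (suc n) k + s * (w′ * t))
    ≡⟨ solve 5 (λ A l s w t → A :* (l :+ s :* (w :* t)) := A :* l :+ s :* t :* (A :* w)) refl A (leibnizʷ (suc n) k) s w′ t ⟩
  A * leibnizʷ (suc n) k + s * t * (A * w′)
    ≡⟨ cong₂ (λ x y → x + s * t * y) (leibnizʷ-up n k) weight ⟩
  (ι 4 * B * leibnizʷ n k + ι 4 * alternating (suc n) k) + s * t * (ι 4 * (w n k * B) + c * c * w′)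
    ≡⟨ solve 8 (λ B l v s t w c w′ → (# 4 :* B :* l :+ # 4 :* v) :+ s :* t :* (# 4 :* (w :* B) :+ c :* c :* w′) :=
         # 4 :* B :* (l :+ s :* (w :* t)) :+ (# 4 :* v :+ (t :* c) :* (s :* (c :* w′)))) refl B (leibnizʷ n k) (alternating (suc n) k) s t (w n k) c w′ ⟩
  ι 4 * B * (leibnizʷ n k + s * (w n k * t)) + (ι 4 * alternating (suc n) k + (t * c) * (s * (c * w′)))
    ≡⟨ cong (λ z → ι 4 * B * (leibnizʷ n k + s * (w n k * t)) + (ι 4 * alternating (suc n) k + z * (s * (c * w′)))) (term-ι k) ⟩
  ι 4 * B * (leibnizʷ n k + s * (w n k * t)) + (ι 4 * alternating (suc n) k + ι 4 * (s * (c * w′)))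
    ≡⟨ cong (ι 4 * B * (leibnizʷ n k + s * (w n k * t)) +_) (ℚₚ.*-distribˡ-+ (ι 4) (alternating (suc n) k) (s * (c * w′))) ⟨
  ι 4 * B * leibnizʷ n (suc k) + ι 4 * alternating (suc n) (suc k) ∎
  where
  A = (ι 3 + ι 2 * ι n) * (ι 3 + ι 2 * ι n)
  B = (1ℚ + ι n) * (ι 2 + ι n)
  s = sign k
  t = term k
  w′ = w (suc n) k
  c = 1ℚ + ι 2 * ι k
  weight : A * w′ ≡ ι 4 * (w n k * B) + c * c * w′
  weight = begin-equality
    A * w′
      ≡⟨ solve 3 (λ n k w → (# 3 :+ # 2 :* n) :* (# 3 :+ # 2 :* n) :* w :=
           # 4 :* (w :* ((# 1 :+ n :- k) :* (# 2 :+ n :+ k))) :+ (# 1 :+ # 2 :* k) :* (# 1 :+ # 2 :* k) :* w) refl (ι n) (ι k) w′ ⟩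
    ι 4 * (w′ * ((1ℚ + ι n - ι k) * (ι 2 + ι n + ι k))) + c * c * w′
      ≡⟨ cong (λ z → ι 4 * z + c * c * w′) (w-up n k) ⟩
    ι 4 * (w n k * B) + c * c * w′ ∎

W : ℕ → ℚ
W n = leibnizʷ n (suc n)

-- At 2 + n summands the alternating sum is complete, hence zero, and the one summand too many in
-- row n has weight zero.
W-suc : ∀ n → (ι 3 + ι 2 * ι n) * (ι 3 + ι 2 * ι n) * W (suc n) ≡ ι 4 * ((1ℚ + ι n) * (ι 2 + ι n)) * W n
W-suc n = begin-equality
  A * W (suc n)                                                  ≡⟨ leibnizʷ-up n (2 ℕ.+ n) ⟩
  B * leibnizʷ n (2 ℕ.+ n) + ι 4 * alternating (suc n) (2 ℕ.+ n)
    ≡⟨ cong₂ (λ x y → B * (W n + sign (suc n) * (x * term (suc n))) + ι 4 * y) (w-vanish {n} {suc n} ℕₚ.≤-refl) (alternating-vanish n) ⟩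
  B * (W n + sign (suc n) * (0ℚ * term (suc n))) + ι 4 * 0ℚ
    ≡⟨ solve 4 (λ b w s t → b :* (w :+ s :* (# 0 :* t)) :+ # 4 :* # 0 := b :* w) refl B (W n) (sign (suc n)) (term (suc n)) ⟩
  B * W n ∎
  where
  A = (ι 3 + ι 2 * ι n) * (ι 3 + ι 2 * ι n)
  B = ι 4 * ((1ℚ + ι n) * (ι 2 + ι n))

wallis : ∀ n → W n * ((1ℚ + ι 2 * ι n) * a n * ((1ℚ + ι 2 * ι n) * a n)) ≡ ι 4 * (1ℚ + ι n)
wallis zero    = refl
wallis (suc n) = ι-cancel n (ι-cancel n (begin-equality
  ν * (ν * (W (suc n) * ((1ℚ + ι 2 * ν) * a′ * ((1ℚ + ι 2 * ν) * a′))))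
    ≡⟨ solve 3 (λ ν w a → ν :* (ν :* (w :* ((# 1 :+ # 2 :* ν) :* a :* ((# 1 :+ # 2 :* ν) :* a)))) :=
         ((# 1 :+ # 2 :* ν) :* (# 1 :+ # 2 :* ν) :* w) :* ((ν :* a) :* (ν :* a))) refl ν (W (suc n)) a′ ⟩
  ((1ℚ + ι 2 * ν) * (1ℚ + ι 2 * ν) * W (suc n)) * ((ν * a′) * (ν * a′))
    ≡⟨ cong₂ (λ x y → (x * x * W (suc n)) * (y * y)) (trans (cong (λ z → 1ℚ + ι 2 * z) (ι-suc n)) (solve 1 (λ n → # 1 :+ # 2 :* (# 1 :+ n) := # 3 :+ # 2 :* n) refl (ι n))) (a-suc n) ⟩
  ((ι 3 + ι 2 * ι n) * (ι 3 + ι 2 * ι n) * W (suc n)) * (((ι n + ½) * a n) * ((ι n + ½) * a n))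
    ≡⟨ cong (_* (((ι n + ½) * a n) * ((ι n + ½) * a n))) (W-suc n) ⟩
  (ι 4 * ((1ℚ + ι n) * (ι 2 + ι n)) * W n) * (((ι n + ½) * a n) * ((ι n + ½) * a n))
    ≡⟨ solve 3 (λ n w a → (# 4 :* ((# 1 :+ n) :* (# 2 :+ n)) :* w) :* (((n :+ con ½) :* a) :* ((n :+ con ½) :* a)) :=
         (# 1 :+ n) :* (# 2 :+ n) :* (w :* ((# 1 :+ # 2 :* n) :* a :* ((# 1 :+ # 2 :* n) :* a)))) refl (ι n) (W n) (a n) ⟩
  (1ℚ + ι n) * (ι 2 + ι n) * (W n * ((1ℚ + ι 2 * ι n) * a n * ((1ℚ + ι 2 * ι n) * a n)))
    ≡⟨ cong ((1ℚ + ι n) * (ι 2 + ι n) *_) (wallis n) ⟩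
  (1ℚ + ι n) * (ι 2 + ι n) * (ι 4 * (1ℚ + ι n))
    ≡⟨ solve 1 (λ n → (# 1 :+ n) :* (# 2 :+ n) :* (# 4 :* (# 1 :+ n)) := (# 1 :+ n) :* ((# 1 :+ n) :* (# 4 :* (# 1 :+ (# 1 :+ n))))) refl (ι n) ⟩
  (1ℚ + ι n) * ((1ℚ + ι n) * (ι 4 * (1ℚ + (1ℚ + ι n))))
    ≡⟨ cong (λ z → z * (z * (ι 4 * (1ℚ + z)))) (ι-suc n) ⟨
  ν * (ν * (ι 4 * (1ℚ + ν))) ∎))
  where
  ν = ι (suc n)
  a′ = a (suc n)

-- Summation by parts: W n is an average of the partial sums of Leibniz's series.
module _ (n m : ℕ) where

  -- From index k on, the terms of the series up to m all carry the weight `w n k`. The value passes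
  -- from `leibniz m` at k = 0 to `W n` at k = n + 1.
  abel : ℕ → ℚ
  abel k = leibnizʷ n k + w n k * (leibniz m - leibniz k)

  abel-step : ∀ k → suc k ℕ.≤ m → ∣ abel (suc k) - leibniz m ∣ ≤ ∣ abel k - leibniz m ∣ + (w n k - w n (suc k)) * term (suc k)
  abel-step k k<m = begin
    ∣ abel (suc k) - l ∣
      ≡⟨ cong ∣_∣ (solve 7 (λ L s w t l x w′ → ((L :+ s :* (w :* t)) :+ w′ :* (l :- (x :+ s :* t))) :- l :=
           ((L :+ w :* (l :- x)) :- l) :+ (w′ :- w) :* (l :- (x :+ s :* t))) refl (leibnizʷ n k) (sign k) (w n k) (term k) l (leibniz k) (w n (suc k))) ⟩
    ∣ (abel k - l) + (w n (suc k) - w n k) * (l - leibniz (suc k)) ∣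
      ≤⟨ ℚₚ.∣p+q∣≤∣p∣+∣q∣ (abel k - l) ((w n (suc k) - w n k) * (l - leibniz (suc k))) ⟩
    ∣ abel k - l ∣ + ∣ (w n (suc k) - w n k) * (l - leibniz (suc k)) ∣
      ≡⟨ cong (∣ abel k - l ∣ +_) (trans (ℚₚ.∣p*q∣≡∣p∣*∣q∣ (w n (suc k) - w n k) (l - leibniz (suc k)))
           (cong (_* ∣ l - leibniz (suc k) ∣) (trans (dist-sym (w n (suc k)) (w n k)) (ℚₚ.0≤p⇒∣p∣≡p (0≤w-drop n k))))) ⟩
    ∣ abel k - l ∣ + (w n k - w n (suc k)) * ∣ l - leibniz (suc k) ∣
      ≤⟨ ℚₚ.+-monoʳ-≤ ∣ abel k - l ∣ (*-monoˡ (0≤w-drop n k) (leibniz-near-≤ k<m)) ⟩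
    ∣ abel k - l ∣ + (w n k - w n (suc k)) * term (suc k) ∎
    where l = leibniz m

  -- The weight falls by at most (2k+2)/(n+k+2), and the factor 4/(2k+3) cancels the growth in k.
  w-drop-term : ∀ k → (w n k - w n (suc k)) * term (suc k) ≤ ι 4 * u n
  w-drop-term k = begin
    (w n k - w n (suc k)) * term (suc k)
      ≡⟨ cong (_* term (suc k)) (w-drop n k) ⟩
    w n k * (ι 2 + ι 2 * ι k) * v * term (suc k)
      ≤⟨ *-monoʳ (0≤term (suc k)) (*-monoʳ (0≤u (n ℕ.+ suc k)) (*-mono-≤-nonNeg (0≤w n k) (w≤1 n k) (0≤+ (0≤ι 2) (0≤* (0≤ι 2) (0≤ι k)))
            (≤-by 1ℚ 0≤1 (solve 1 (λ k → # 1 :+ # 2 :* (# 1 :+ k) := # 2 :+ # 2 :* k :+ # 1) refl (ι k))))) ⟩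
    1ℚ * (1ℚ + ι 2 * (1ℚ + ι k)) * v * term (suc k)
      ≡⟨ solve 3 (λ x v t → # 1 :* x :* v :* t := t :* x :* v) refl (1ℚ + ι 2 * (1ℚ + ι k)) v (term (suc k)) ⟩
    term (suc k) * (1ℚ + ι 2 * (1ℚ + ι k)) * v
      ≡⟨ cong (_* v) (trans (cong (λ z → term (suc k) * (1ℚ + ι 2 * z)) (sym (ι-suc k))) (term-ι (suc k))) ⟩
    ι 4 * v
      ≤⟨ *-monoˡ (0≤ι 4) (u-anti (ℕₚ.m≤m+n n (suc k))) ⟩
    ι 4 * u n ∎
    where v = u (n ℕ.+ suc k)

  abel-early : ∀ k → k ℕ.≤ m → ∣ abel k - leibniz m ∣ ≤ ι 4 * ι k * u n
  abel-early zero    _   = begin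
    ∣ abel 0 - leibniz m ∣    ≡⟨ cong ∣_∣ (solve 1 (λ l → (# 0 :+ # 1 :* (l :- # 0)) :- l := # 0) refl (leibniz m)) ⟩
    0ℚ                        ≡⟨ solve 1 (λ u → # 4 :* # 0 :* u := # 0) refl (u n) ⟨
    ι 4 * ι 0 * u n           ∎
  abel-early (suc k) k<m = begin
    ∣ abel (suc k) - leibniz m ∣   ≤⟨ abel-step k k<m ⟩
    ∣ abel k - leibniz m ∣ + (w n k - w n (suc k)) * term (suc k)
      ≤⟨ ℚₚ.+-mono-≤ (abel-early k (ℕₚ.<⇒≤ k<m)) (w-drop-term k) ⟩
    ι 4 * ι k * u n + ι 4 * u n    ≡⟨ solve 2 (λ k u → # 4 :* k :* u :+ # 4 :* u := # 4 :* (# 1 :+ k) :* u) refl (ι k) (u n) ⟩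
    ι 4 * (1ℚ + ι k) * u n         ≡⟨ cong (λ z → ι 4 * z * u n) (ι-suc k) ⟨
    ι 4 * ι (suc k) * u n          ∎

  term-anti′ : ∀ {j k} → j ℕ.≤ k → term k ≤ term j
  term-anti′ {j} {k} j≤k = subst₂ _≤_ (sym (4u k)) (sym (4u j)) (*-monoˡ (0≤ι 4) (u-anti (ℕₚ.*-monoʳ-≤ 2 j≤k)))
    where
    4u : ∀ k → term k ≡ ι 4 * u (2 ℕ.* k)
    4u k = ι-cancel (2 ℕ.* k) (begin-equality
      ι (suc (2 ℕ.* k)) * term k              ≡⟨ trans (ℚₚ.*-comm (ι (suc (2 ℕ.* k))) (term k)) (/-ι 4 (suc (2 ℕ.* k))) ⟩
      ι 4                                     ≡⟨ cong (ι 4 *_) (u-ι (2 ℕ.* k)) ⟨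
      ι 4 * (u (2 ℕ.* k) * ι (suc (2 ℕ.* k))) ≡⟨ solve 2 (λ x y → # 4 :* (x :* y) := y :* (# 4 :* x)) refl (u (2 ℕ.* k)) (ι (suc (2 ℕ.* k))) ⟩
      ι (suc (2 ℕ.* k)) * (ι 4 * u (2 ℕ.* k)) ∎)

  abel-late : ∀ j l → l ℕ.+ j ℕ.≤ m → ∣ abel (l ℕ.+ j) - leibniz m ∣ ≤ ι 4 * ι j * u n + (w n j - w n (l ℕ.+ j)) * term j
  abel-late j zero    j≤m = ℚₚ.≤-trans (abel-early j j≤m) (ℚₚ.≤-reflexive
    (solve 3 (λ x w t → x := x :+ (w :- w) :* t) refl (ι 4 * ι j * u n) (w n j) (term j)))
  abel-late j (suc l) lj<m = begin
    ∣ abel (suc (l ℕ.+ j)) - leibniz m ∣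
      ≤⟨ abel-step (l ℕ.+ j) lj<m ⟩
    ∣ abel (l ℕ.+ j) - leibniz m ∣ + (w n (l ℕ.+ j) - w n (suc (l ℕ.+ j))) * term (suc (l ℕ.+ j))
      ≤⟨ ℚₚ.+-mono-≤ (abel-late j l (ℕₚ.<⇒≤ lj<m)) (*-monoˡ (0≤w-drop n (l ℕ.+ j)) (term-anti′ (ℕₚ.m≤n+m j (suc l)))) ⟩
    (ι 4 * ι j * u n + (w n j - w n (l ℕ.+ j)) * term j) + (w n (l ℕ.+ j) - w n (suc (l ℕ.+ j))) * term j
      ≡⟨ solve 5 (λ x a b c t → (x :+ (a :- b) :* t) :+ (b :- c) :* t := x :+ (a :- c) :* t) refl (ι 4 * ι j * u n) (w n j) (w n (l ℕ.+ j)) (w n (suc (l ℕ.+ j))) (term j) ⟩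
    ι 4 * ι j * u n + (w n j - w n (suc l ℕ.+ j)) * term j ∎

  -- The first j steps cost at most 4/(n+1) each. The later ones cost at most `term j` altogether,
  -- because the weights fall by no more than 1 in total. The cut j is free, to be fixed before n
  -- grows.
  W-close : ∀ j → j ℕ.≤ n → suc n ℕ.≤ m → ∣ W n - leibniz m ∣ ≤ ι 4 * ι j * u n + term j
  W-close j j≤n n<m = begin
    ∣ W n - leibniz m ∣
      ≡⟨ cong (λ z → ∣ z - leibniz m ∣) abel-end ⟩
    ∣ abel (suc n) - leibniz m ∣
      ≡⟨ cong (λ k → ∣ abel k - leibniz m ∣) (ℕₚ.m∸n+n≡m j≤1+n) ⟨
    ∣ abel (suc n ℕ.∸ j ℕ.+ j) - leibniz m ∣
      ≤⟨ abel-late j (suc n ℕ.∸ j) (subst (ℕ._≤ m) (sym (ℕₚ.m∸n+n≡m j≤1+n)) n<m) ⟩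
    ι 4 * ι j * u n + (w n j - w n (suc n ℕ.∸ j ℕ.+ j)) * term j
      ≤⟨ ℚₚ.+-monoʳ-≤ (ι 4 * ι j * u n) (*-monoʳ (0≤term j) (≤-by {w n j - w n (suc n ℕ.∸ j ℕ.+ j)} (w n (suc n ℕ.∸ j ℕ.+ j) + (1ℚ - w n j))
           (0≤+ (0≤w n (suc n ℕ.∸ j ℕ.+ j)) (≤⇒0≤- (w≤1 n j))) (solve 2 (λ a b → # 1 := (a :- b) :+ (b :+ (# 1 :- a))) refl (w n j) (w n (suc n ℕ.∸ j ℕ.+ j))))) ⟩
    ι 4 * ι j * u n + 1ℚ * term j
      ≡⟨ cong (ι 4 * ι j * u n +_) (ℚₚ.*-identityˡ (term j)) ⟩
    ι 4 * ι j * u n + term j ∎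
    where
    j≤1+n = ℕₚ.m≤n⇒m≤1+n j≤n
    abel-end : W n ≡ abel (suc n)
    abel-end = begin-equality
      W n                                                          ≡⟨ solve 2 (λ x y → x := x :+ # 0 :* y) refl (W n) (leibniz m - leibniz (suc n)) ⟩
      W n + 0ℚ * (leibniz m - leibniz (suc n))                     ≡⟨ cong (λ z → W n + z * (leibniz m - leibniz (suc n))) (w-vanish {n} {suc n} ℕₚ.≤-refl) ⟨
      abel (suc n) ∎

-- Approximating √2 and π

sq-cancel : ∀ {x y} → 0ℚ ≤ y → x * x ≤ y * y → x ≤ y
sq-cancel {x} {y} 0≤y x²≤y² = ℚₚ.≮⇒≥ λ y<x → ℚₚ.<-irrefl refl (begin-strict
  y * y  ≤⟨ *-monoˡ 0≤y (ℚₚ.<⇒≤ y<x) ⟩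
  y * x  <⟨ ℚₚ.*-monoˡ-<-pos x {{positive (ℚₚ.≤-<-trans 0≤y y<x)}} y<x ⟩
  x * x  ≤⟨ x²≤y² ⟩
  y * y  ∎)

≤1+square : ∀ {t y} → 0ℚ ≤ t → t * t ≤ y → t ≤ 1ℚ + y
≤1+square {t} {y} 0≤t t²≤y with ℚₚ.≤-total t 1ℚ
... | inj₁ t≤1 = ℚₚ.≤-trans t≤1 (≤-by y (ℚₚ.≤-trans (0≤* 0≤t 0≤t) t²≤y) refl)
... | inj₂ 1≤t = begin
  t           ≡⟨ ℚₚ.*-identityˡ t ⟨
  1ℚ * t      ≤⟨ *-monoʳ 0≤t 1≤t ⟩
  t * t       ≤⟨ t²≤y ⟩
  y           ≤⟨ ≤-by 1ℚ 0≤1 (ℚₚ.+-comm 1ℚ y) ⟩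
  1ℚ + y      ∎

square-close : ∀ {t y v} → 0ℚ ≤ t → 0ℚ ≤ v → v ≤ 1ℚ → t * t ≤ y → y < (t + v) * (t + v) →
               ∣ t * t - y ∣ ≤ (ι 2 * y + ι 3) * v
square-close {t} {y} {v} 0≤t 0≤v v≤1 t²≤y y< = dist-≤
  (ℚₚ.≤-trans t²≤y (≤-by bound (0≤* (0≤+ (0≤* (0≤ι 2) (ℚₚ.≤-trans (0≤* 0≤t 0≤t) t²≤y)) (0≤ι 3)) 0≤v) refl)) (begin
  y                          ≤⟨ ℚₚ.<⇒≤ y< ⟩
  (t + v) * (t + v)          ≡⟨ solve 2 (λ t u → (t :+ u) :* (t :+ u) := t :* t :+ (# 2 :* t :+ u) :* u) refl t v ⟩
  t * t + (ι 2 * t + v) * v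
    ≤⟨ ℚₚ.+-monoʳ-≤ (t * t) (*-monoʳ 0≤v (ℚₚ.+-mono-≤ (*-monoˡ (0≤ι 2) (≤1+square 0≤t t²≤y)) v≤1)) ⟩
  t * t + (ι 2 * (1ℚ + y) + 1ℚ) * v
    ≡⟨ cong (λ z → t * t + z * v) (solve 1 (λ y → # 2 :* (# 1 :+ y) :+ # 1 := # 2 :* y :+ # 3) refl y) ⟩
  t * t + bound ∎)
  where
  bound = (ι 2 * y + ι 3) * v

-- All that the estimates use of the m-th approximation of a square root. They can thus be made for
-- variables s and T, with no square root to unfold.
record ApproximatesRoot (y T : ℚ) (m : ℕ) : Set where
  constructor approximatesRoot
  field
    0≤T    : 0ℚ ≤ T
    T²≤y   : T * T ≤ y
    T-upper : y < (T + u m) * (T + u m)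

  T²-close : ∣ T * T - y ∣ ≤ (ι 2 * y + ι 3) * u m
  T²-close = square-close 0≤T (0≤u m) (u≤1 m) T²≤y T-upper

rootℚ-approximates : ∀ y m → 0ℚ ≤ y → ApproximatesRoot y (rootℚ y m) m
rootℚ-approximates y m 0≤y = approximatesRoot (0≤root y m) (below (root-lower y m)) (root-upper y m)
  where
  below : ∀ {t} → t ≡ 0ℚ ⊎ t * t ≤ y → t * t ≤ y
  below (inj₁ refl) = 0≤y
  below (inj₂ le)   = le

pw : ℚ → ℕ → ℚ
pw x zero    = 1ℚ
pw x (suc k) = x * pw x k

pw-* : ∀ x k → pw x k * pw x k ≡ pw (x * x) k
pw-* x zero    = refl
pw-* x (suc k) = trans (solve 2 (λ x p → x :* p :* (x :* p) := x :* x :* (p :* p)) refl x (pw x k)) (cong (x * x *_) (pw-* x k))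

0≤pw : ∀ {x} k → 0ℚ ≤ x → 0ℚ ≤ pw x k
0≤pw zero    0≤x = 0≤1
0≤pw (suc k) 0≤x = 0≤* 0≤x (0≤pw k 0≤x)

pw-mono : ∀ {x y} k → 0ℚ ≤ x → x ≤ y → pw x k ≤ pw y k
pw-mono zero    0≤x x≤y = ℚₚ.≤-refl
pw-mono (suc k) 0≤x x≤y = *-mono-≤-nonNeg 0≤x x≤y (0≤pw k 0≤x) (pw-mono k 0≤x x≤y)

pw-1 : ∀ k → pw 1ℚ k ≡ 1ℚ
pw-1 zero    = refl
pw-1 (suc k) = cong (1ℚ *_) (pw-1 k)

pw-≥ : ∀ {x} k → ι 2 ≤ x → ι (suc k) ≤ pw x k
pw-≥ zero    2≤x = ℚₚ.≤-refl
pw-≥ {x} (suc k) 2≤x = begin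
  ι (2 ℕ.+ k)          ≤⟨ ι-mono (ℕₚ.≤-trans (ℕₚ.+-monoʳ-≤ 2 (ℕₚ.m≤n*m k 2)) (ℕₚ.≤-reflexive (sym (ℕₚ.*-suc 2 k)))) ⟩
  ι (2 ℕ.* suc k)      ≡⟨ ι-* 2 (suc k) ⟩
  ι 2 * ι (suc k)      ≤⟨ *-mono-≤-nonNeg (0≤ι 2) 2≤x (0≤ι (suc k)) (pw-≥ k 2≤x) ⟩
  x * pw x k           ∎

module √2-Approximation (s : ℕ → ℚ) (s-root : ∀ m → ApproximatesRoot (ι 2) (s m) m) where

  -- The defect of s as a square root of 2. Identities for √2 hold for s up to multiples of it.
  τ : ℕ → ℚ
  τ m = ι 2 - s m * s m

  0≤s : ∀ m → 0ℚ ≤ s m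
  0≤s m = ApproximatesRoot.0≤T (s-root m)

  s²≤2 : ∀ m → s m * s m ≤ ι 2
  s²≤2 m = ApproximatesRoot.T²≤y (s-root m)

  s≤3/2 : ∀ m → s m ≤ 1ℚ + ½
  s≤3/2 m = sq-cancel {y = 1ℚ + ½} (ℚₚ.≤ᵇ⇒≤ {0ℚ} {1ℚ + ½} _) (ℚₚ.≤-trans (s²≤2 m) (ℚₚ.≤ᵇ⇒≤ {ι 2} {(1ℚ + ½) * (1ℚ + ½)} _))

  0≤τ : ∀ m → 0ℚ ≤ τ m
  0≤τ m = ≤⇒0≤- (s²≤2 m)

  τ≤2 : ∀ m → τ m ≤ ι 2
  τ≤2 m = ≤-by (s m * s m) (0≤* (0≤s m) (0≤s m)) (solve 1 (λ x → # 2 := (# 2 :- x) :+ x) refl (s m * s m))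

  null-τ : Null (λ _ m → τ m)
  null-τ = null-≤ (null-scale 7 null-u-inner) (ev-all λ _ m → begin
    ∣ τ m ∣                  ≡⟨ dist-sym (ι 2) (s m * s m) ⟩
    ∣ s m * s m - ι 2 ∣      ≤⟨ ApproximatesRoot.T²-close (s-root m) ⟩
    ι 7 * u m                ≤⟨ p≤∣p∣ (ι 7 * u m) ⟩
    ∣ ι 7 * u m ∣            ∎)

  5/4≤s : Eventually₂ (λ _ m → 1ℚ + u 3 ≤ s m)
  5/4≤s = ev-map (λ {_} {m} le → ℚₚ.≮⇒≥ λ s< → ℚₚ.<-irrefl refl (begin-strict
      ι 2                        ≡⟨ solve 1 (λ x → # 2 := (# 2 :- x) :+ x) refl (s m * s m) ⟩
      τ m + s m * s m            ≤⟨ ℚₚ.+-mono-≤ (ℚₚ.≤-trans (p≤∣p∣ (τ m)) le) (sq-mono (0≤s m) (ℚₚ.<⇒≤ s<)) ⟩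
      u 3 + (1ℚ + u 3) * (1ℚ + u 3) <⟨ below ⟩
      ι 2                        ∎))
    (null-τ (u 3) (0<u 3))
    where
    below : u 3 + (1ℚ + u 3) * (1ℚ + u 3) < ι 2
    below = from-yes (u 3 + (1ℚ + u 3) * (1ℚ + u 3) ℚₚ.<? ι 2)

-- The limits of n aₙ² π, of eₙ²/U₂ₙ and of U₂ₙ

null-neg : ∀ {x} → Null x → Null (λ n m → - x n m)
null-neg {x} hx = null-≤ hx (ev-all λ n m → ℚₚ.≤-reflexive (ℚₚ.∣-p∣≡∣p∣ (x n m)))

-- aₙ²(2n+1) starts at 1 and decreases, being multiplied by (2n+1)(2n+3)/(2n+2)² < 1 at each step.
-- Both the decay of a and n aₙ² ≤ 1 follow.
a²-odd : ∀ n → a n * a n * (1ℚ + ι 2 * ι n) ≤ 1ℚ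
a²-odd zero    = ℚₚ.≤-refl
a²-odd (suc n) = *-cancelˡ (0<* (0<ι n) (0<ι n)) (begin
  ν * ν * (b * b * (1ℚ + ι 2 * ν))
    ≡⟨ solve 2 (λ v b → v :* v :* (b :* b :* (# 1 :+ # 2 :* v)) := (v :* b) :* (v :* b) :* (# 1 :+ # 2 :* v)) refl ν b ⟩
  (ν * b) * (ν * b) * (1ℚ + ι 2 * ν)
    ≡⟨ cong₂ (λ x y → x * x * (1ℚ + ι 2 * y)) (a-suc n) (ι-suc n) ⟩
  ((ι n + ½) * a n) * ((ι n + ½) * a n) * (1ℚ + ι 2 * (1ℚ + ι n))
    ≤⟨ ≤-by (½ * ½ * (a n * a n * (1ℚ + ι 2 * ι n))) (0≤* (0≤* 0≤½ 0≤½) (0≤* (0≤* (0≤a n) (0≤a n)) (0≤+ 0≤1 (0≤* (0≤ι 2) (0≤ι n)))))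
         (solve 2 (λ n a → (# 1 :+ n) :* (# 1 :+ n) :* (a :* a :* (# 1 :+ # 2 :* n)) :=
           ((n :+ con ½) :* a) :* ((n :+ con ½) :* a) :* (# 1 :+ # 2 :* (# 1 :+ n)) :+ con ½ :* con ½ :* (a :* a :* (# 1 :+ # 2 :* n))) refl (ι n) (a n)) ⟩
  (1ℚ + ι n) * (1ℚ + ι n) * (a n * a n * (1ℚ + ι 2 * ι n))
    ≡⟨ cong (λ x → x * x * (a n * a n * (1ℚ + ι 2 * ι n))) (ι-suc n) ⟨
  ν * ν * (a n * a n * (1ℚ + ι 2 * ι n))
    ≤⟨ *-monoˡ (0≤* (0≤ι (suc n)) (0≤ι (suc n))) (a²-odd n) ⟩
  ν * ν * 1ℚ ∎)
  where
  ν = ι (suc n)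
  b = a (suc n)

null-a : Null (λ n _ → a n)
null-a ε 0<ε = let (N , h) = archimedean (ε * ε) (0<* 0<ε 0<ε) in N , λ n N≤n → 0 , λ _ _ →
  subst (_≤ ε) (sym (ℚₚ.0≤p⇒∣p∣≡p (0≤a n))) (sq-cancel (ℚₚ.<⇒≤ 0<ε) (ℚₚ.≤-trans (a² n) (h n N≤n)))
  where
  a² : ∀ n → a n * a n ≤ u n
  a² n = begin
    a n * a n                                    ≡⟨ ℚₚ.*-identityʳ _ ⟨
    a n * a n * 1ℚ                               ≡⟨ cong (a n * a n *_) (u-ι n) ⟨
    a n * a n * (u n * ι (suc n))
      ≡⟨ trans (cong (λ z → a n * a n * (u n * z)) (ι-suc n)) (solve 3 (λ a u n → a :* a :* (u :* (# 1 :+ n)) := u :* (a :* a :* (# 1 :+ n))) refl (a n) (u n) (ι n)) ⟩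
    u n * (a n * a n * (1ℚ + ι n))
      ≤⟨ *-monoˡ (0≤u n) (ℚₚ.≤-trans (*-monoˡ (0≤* (0≤a n) (0≤a n)) (≤-by (ι n) (0≤ι n)
           (solve 1 (λ n → # 1 :+ # 2 :* n := # 1 :+ n :+ n) refl (ι n)))) (a²-odd n)) ⟩
    u n * 1ℚ                                     ≡⟨ ℚₚ.*-identityʳ (u n) ⟩
    u n ∎

-- The cut J is chosen first, so that the tail costs ε/2, and then n so large that the J early steps
-- cost ε/2. The precision m must exceed n, past the last weighted term; this is a case where m
-- depends on n.
null-W-π : Null (λ n m → leibniz m - W n)
null-W-π ε 0<ε =
  let (J , small) = term-small (½ * ε) 0<ε/2
      -- The added 1 keeps c invertible when J = 0.
      c = ι 4 * ι J + 1ℚ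
      0<c = ℚₚ.<-≤-trans 0<1 (≤-by (ι 4 * ι J) (0≤* (0≤ι 4) (0≤ι J)) (ℚₚ.+-comm (ι 4 * ι J) 1ℚ))
      (N , h) = archimedean (inv c * (½ * ε)) (0<* (inv-pos c 0<c) 0<ε/2)
  in J ℕ.⊔ N , λ n ≤n → suc n , λ m n<m → begin
    ∣ leibniz m - W n ∣              ≡⟨ dist-sym (leibniz m) (W n) ⟩
    ∣ W n - leibniz m ∣              ≤⟨ W-close n m J (⊔-l J N ≤n) n<m ⟩
    ι 4 * ι J * u n + term J         ≤⟨ ℚₚ.+-mono-≤ (*-mono-≤-nonNeg (0≤* (0≤ι 4) (0≤ι J)) (≤-by 1ℚ 0≤1 refl) (0≤u n) (h n (⊔-r J N ≤n))) (small ℕₚ.≤-refl) ⟩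
    c * (inv c * (½ * ε)) + ½ * ε    ≡⟨ cong (_+ ½ * ε) (trans (solve 3 (λ c i e → c :* (i :* e) := (i :* c) :* e) refl c (inv c) (½ * ε))
                                          (trans (cong (_* (½ * ε)) (inv-inverse c (pos⇒≢ 0<c))) (ℚₚ.*-identityˡ (½ * ε)))) ⟩
    ½ * ε + ½ * ε                    ≡⟨ halves ε ⟩
    ε                                ∎
  where
  0<ε/2 = 0<* 0<½ 0<ε

-- With W n in place of π the error is exact: `wallis` gives n aₙ² W n = 4n(n+1)/(2n+1)² = 1 -
-- 1/(2n+1)². As n aₙ² ≤ 1, replacing W n by `leibniz m` costs no more than their distance.
naₙ²π≃1 : (λ n m → ι n * (a n * a n) * leibniz m) ≃ (λ _ _ → 1ℚ)
naₙ²π≃1 = ≃-intro {λ n m → ι n * (a n * a n) * leibniz m} {λ _ _ → 1ℚ} (λ n m → u n + ∣ leibniz m - W n ∣) (null-+ null-u-outer (null-∣∣ null-W-π)) (ev-all λ _ _ → 0<1) (ev-all λ n m → begin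
  ∣ ι n * (a n * a n) * leibniz m - 1ℚ ∣
    ≡⟨ cong ∣_∣ (solve 3 (λ x l w → x :* l :- # 1 := (x :* w :- # 1) :+ x :* (l :- w)) refl (ι n * (a n * a n)) (leibniz m) (W n)) ⟩
  ∣ (ι n * (a n * a n) * W n - 1ℚ) + ι n * (a n * a n) * (leibniz m - W n) ∣
    ≤⟨ ℚₚ.∣p+q∣≤∣p∣+∣q∣ (ι n * (a n * a n) * W n - 1ℚ) (ι n * (a n * a n) * (leibniz m - W n)) ⟩
  ∣ ι n * (a n * a n) * W n - 1ℚ ∣ + ∣ ι n * (a n * a n) * (leibniz m - W n) ∣
    ≤⟨ ℚₚ.+-mono-≤ (exact n) (ℚₚ.≤-trans (ℚₚ.≤-reflexive (trans (ℚₚ.∣p*q∣≡∣p∣*∣q∣ (ι n * (a n * a n)) (leibniz m - W n))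
         (cong (_* ∣ leibniz m - W n ∣) (ℚₚ.0≤p⇒∣p∣≡p (0≤* (0≤ι n) (0≤* (0≤a n) (0≤a n)))))))
         (ℚₚ.≤-trans (*-monoʳ (ℚₚ.0≤∣p∣ (leibniz m - W n)) (na²≤1 n)) (ℚₚ.≤-reflexive (ℚₚ.*-identityˡ ∣ leibniz m - W n ∣)))) ⟩
  u n + ∣ leibniz m - W n ∣
    ≤⟨ p≤∣p∣ (u n + ∣ leibniz m - W n ∣) ⟩
  ∣ u n + ∣ leibniz m - W n ∣ ∣
    ≡⟨ ℚₚ.*-identityʳ _ ⟨
  ∣ u n + ∣ leibniz m - W n ∣ ∣ * 1ℚ ∎)
  where
  na²≤1 : ∀ n → ι n * (a n * a n) ≤ 1ℚ
  na²≤1 n = ℚₚ.≤-trans (*-monoʳ (0≤* (0≤a n) (0≤a n)) (≤-by {ι n} (1ℚ + ι n) (0≤+ 0≤1 (0≤ι n))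
    (solve 1 (λ n → # 1 :+ # 2 :* n := n :+ (# 1 :+ n)) refl (ι n))))
    (ℚₚ.≤-trans (ℚₚ.≤-reflexive (ℚₚ.*-comm (1ℚ + ι 2 * ι n) (a n * a n))) (a²-odd n))
  exact : ∀ n → ∣ ι n * (a n * a n) * W n - 1ℚ ∣ ≤ u n
  exact n = begin
    ∣ ι n * (a n * a n) * W n - 1ℚ ∣       ≡⟨ cong ∣_∣ (identity n) ⟩
    ∣ - (v * v) ∣                          ≡⟨ trans (ℚₚ.∣-p∣≡∣p∣ (v * v)) (ℚₚ.0≤p⇒∣p∣≡p (0≤* (0≤u (2 ℕ.* n)) (0≤u (2 ℕ.* n)))) ⟩
    v * v                                  ≤⟨ *-mono-≤-nonNeg (0≤u (2 ℕ.* n)) (u≤1 (2 ℕ.* n)) (0≤u (2 ℕ.* n)) (u-anti (ℕₚ.m≤n*m n 2)) ⟩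
    1ℚ * u n                               ≡⟨ ℚₚ.*-identityˡ (u n) ⟩
    u n ∎
    where
    v = u (2 ℕ.* n)
    identity : ∀ n → ι n * (a n * a n) * W n - 1ℚ ≡ - (u (2 ℕ.* n) * u (2 ℕ.* n))
    identity n = ι-cancel (2 ℕ.* n) (ι-cancel (2 ℕ.* n) (begin-equality
      c * (c * (ι n * (a n * a n) * W n - 1ℚ))
        ≡⟨ solve 4 (λ c n a w → c :* (c :* (n :* (a :* a) :* w :- # 1)) := n :* (w :* (c :* a :* (c :* a))) :- c :* c) refl c (ι n) (a n) (W n) ⟩
      ι n * (W n * (c * a n * (c * a n))) - c * c
        ≡⟨ cong (λ z → ι n * (W n * (z * a n * (z * a n))) - z * z) (ι-odd n) ⟩
      ι n * (W n * ((1ℚ + ι 2 * ι n) * a n * ((1ℚ + ι 2 * ι n) * a n))) - (1ℚ + ι 2 * ι n) * (1ℚ + ι 2 * ι n)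
        ≡⟨ cong (λ z → ι n * z - (1ℚ + ι 2 * ι n) * (1ℚ + ι 2 * ι n)) (wallis n) ⟩
      ι n * (ι 4 * (1ℚ + ι n)) - (1ℚ + ι 2 * ι n) * (1ℚ + ι 2 * ι n)
        ≡⟨ solve 1 (λ n → n :* (# 4 :* (# 1 :+ n)) :- (# 1 :+ # 2 :* n) :* (# 1 :+ # 2 :* n) := :- (# 1 :* # 1)) refl (ι n) ⟩
      - (1ℚ * 1ℚ)
        ≡⟨ cong (λ z → - (z * z)) (u-ι (2 ℕ.* n)) ⟨
      - ((u (2 ℕ.* n) * c) * (u (2 ℕ.* n) * c))
        ≡⟨ solve 2 (λ u c → :- ((u :* c) :* (u :* c)) := c :* (c :* (:- (u :* u)))) refl (u (2 ℕ.* n)) c ⟩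
      c * (c * - (u (2 ℕ.* n) * u (2 ℕ.* n))) ∎))
      where c = ι (suc (2 ℕ.* n))

-- `U-close` measures the error 6aₙ in units of eₙ². Once 6aₙ ≤ 1/2, eₙ² is at most 2U₂ₙ, so in
-- units of U₂ₙ the error is at most 12aₙ.
e²≃U : (λ n _ → e n * e n) ≃ (λ n _ → Uˢ (n ℕ.+ n))
e²≃U = ≃-intro {λ n _ → e n * e n} {λ n _ → U₂ n} (λ n _ → ι 12 * a n) (null-scale 12 null-a)
  (ev-map (λ {n} small → ℚₚ.<-≤-trans (0<* 0<½ (0<e² n)) (½e²≤U n small)) 6a≤½)
  (ev-map (λ {n} small → begin
    ∣ e n * e n - U₂ n ∣              ≡⟨ dist-sym (e n * e n) (U₂ n) ⟩
    ∣ U₂ n - e n * e n ∣              ≤⟨ U-close n ⟩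
    ι 6 * a n * (e n * e n)          ≡⟨ solve 2 (λ a e → # 6 :* a :* e := # 12 :* a :* (con ½ :* e)) refl (a n) (e n * e n) ⟩
    ι 12 * a n * (½ * (e n * e n))   ≤⟨ *-monoˡ (0≤* (0≤ι 12) (0≤a n)) (½e²≤U n small) ⟩
    ι 12 * a n * U₂ n                 ≡⟨ cong (_* U₂ n) (ℚₚ.0≤p⇒∣p∣≡p (0≤* (0≤ι 12) (0≤a n))) ⟨
    ∣ ι 12 * a n ∣ * U₂ n             ∎) 6a≤½)
  where
  U₂ : ℕ → ℚ
  U₂ n = Uˢ (n ℕ.+ n)
  6a≤½ : Eventually₂ (λ n _ → ∣ ι 6 * a n ∣ ≤ ½)
  6a≤½ = null-scale 6 null-a ½ 0<½
  0<e² : ∀ n → 0ℚ < e n * e n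
  0<e² n = 0<* (0<e n) (0<e n)
  ½e²≤U : ∀ n → ∣ ι 6 * a n ∣ ≤ ½ → ½ * (e n * e n) ≤ U₂ n
  ½e²≤U n small = begin
    ½ * (e n * e n)
      ≡⟨ solve 1 (λ e → con ½ :* e := e :- con ½ :* e) refl (e n * e n) ⟩
    e n * e n - ½ * (e n * e n)
      ≤⟨ ℚₚ.+-mono-≤ (≤-dist {e n * e n} {U₂ n} (subst (_≤ ½ * (e n * e n)) (dist-sym (U₂ n) (e n * e n))
           (ℚₚ.≤-trans (U-close n) (*-monoʳ (ℚₚ.<⇒≤ (0<e² n)) (ℚₚ.≤-trans (p≤∣p∣ (ι 6 * a n)) small))))) ℚₚ.≤-refl ⟩
    U₂ n + ½ * (e n * e n) - ½ * (e n * e n)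
      ≡⟨ solve 2 (λ u e → u :+ e :- e := u) refl (U₂ n) (½ * (e n * e n)) ⟩
    U₂ n ∎

module √2-Powers (s : ℕ → ℚ) (s-root : ∀ m → ApproximatesRoot (ι 2) (s m) m) where
  open √2-Approximation s s-root

  -- The roots (√2±1)² of x² - 6x + 1.
  Λ μ : ℕ → ℚ
  Λ m = (1ℚ + s m) * (1ℚ + s m)
  μ m = (s m - 1ℚ) * (s m - 1ℚ)

  0≤μ : ∀ m → 0ℚ ≤ μ m
  0≤μ m with ℚₚ.≤-total (s m) 1ℚ
  ... | inj₂ 1≤s = 0≤* (≤⇒0≤- 1≤s) (≤⇒0≤- 1≤s)
  ... | inj₁ s≤1 = subst (0ℚ ≤_) (solve 1 (λ s → (# 1 :- s) :* (# 1 :- s) := (s :- # 1) :* (s :- # 1)) refl (s m)) (0≤* (≤⇒0≤- s≤1) (≤⇒0≤- s≤1))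

  0≤2-s : ∀ m → ½ ≤ ι 2 - s m
  0≤2-s m = ≤-by ((1ℚ + ½) - s m) (≤⇒0≤- (s≤3/2 m)) (solve 1 (λ s → # 2 :- s := con ½ :+ ((# 1 :+ con ½) :- s)) refl (s m))

  μ≤1 : ∀ m → μ m ≤ 1ℚ
  μ≤1 m = ≤-by (s m * (ι 2 - s m)) (0≤* (0≤s m) (ℚₚ.≤-trans 0≤½ (0≤2-s m)))
    (solve 1 (λ s → # 1 := (s :- # 1) :* (s :- # 1) :+ s :* (# 2 :- s)) refl (s m))

  0≤1+s : ∀ m → 0ℚ ≤ 1ℚ + s m
  0≤1+s m = 0≤+ 0≤1 (0≤s m)

  0≤Λ : ∀ m → 0ℚ ≤ Λ m
  0≤Λ m = 0≤* (0≤1+s m) (0≤1+s m)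

  Λ≤7 : ∀ m → Λ m ≤ ι 7
  Λ≤7 m = ℚₚ.≤-trans (sq-mono (0≤1+s m) (ℚₚ.+-monoʳ-≤ 1ℚ (s≤3/2 m))) (ℚₚ.≤ᵇ⇒≤ {(1ℚ + (1ℚ + ½)) * (1ℚ + (1ℚ + ½))} {ι 7} _)

  -- The error in 4√2 Uₖ = Λᵏ⁺¹ - μᵏ⁺¹.
  binet : ℕ → ℕ → ℚ
  binet k m = (ι 4 * s m * Uˢ k + pw (μ m) (suc k)) - pw (Λ m) (suc k)

  -- Λ and μ satisfy x² = 6x - 1 only up to multiples of τ. The error in Binet's formula therefore
  -- obeys the recurrence of U up to τ times this term.
  residue : ℕ → ℕ → ℚ
  residue k m = pw (μ m) (suc k) * ((τ m - ι 4) + ι 4 * s m) - pw (Λ m) (suc k) * ((τ m - ι 4) - ι 4 * s m)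

  binet-suc : ∀ k m → binet (2 ℕ.+ k) m ≡ (ι 6 * binet (1 ℕ.+ k) m + - binet k m) + residue k m * τ m
  binet-suc k m = trans (cong (λ z → (ι 4 * s m * z + pw (μ m) (3 ℕ.+ k)) - pw (Λ m) (3 ℕ.+ k)) (U-suc k))
    (solve 5 (λ s P Q v w →
       let M = (s :- # 1) :* (s :- # 1) ; L = (# 1 :+ s) :* (# 1 :+ s) ; t = # 2 :- s :* s in
       (# 4 :* s :* (# 6 :* v :- w) :+ M :* (M :* P)) :- L :* (L :* Q) :=
       (# 6 :* ((# 4 :* s :* v :+ M :* P) :- L :* Q) :+ (:- ((# 4 :* s :* w :+ P) :- Q)))
         :+ (P :* ((t :- # 4) :+ # 4 :* s) :- Q :* ((t :- # 4) :- # 4 :* s)) :* t)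
     refl (s m) (pw (μ m) (suc k)) (pw (Λ m) (suc k)) (Uˢ (suc k)) (Uˢ k))

  residue-bounded : ∀ k m → ∣ residue k m ∣ ≤ ι 12 * (1ℚ + pw (ι 7) (suc k))
  residue-bounded k m = begin
    ∣ P * x - Q * y ∣                        ≤⟨ ℚₚ.∣p-q∣≤∣p∣+∣q∣ (P * x) (Q * y) ⟩
    ∣ P * x ∣ + ∣ Q * y ∣                    ≡⟨ cong₂ _+_ (ℚₚ.∣p*q∣≡∣p∣*∣q∣ P x) (ℚₚ.∣p*q∣≡∣p∣*∣q∣ Q y) ⟩
    ∣ P ∣ * ∣ x ∣ + ∣ Q ∣ * ∣ y ∣
      ≤⟨ ℚₚ.+-mono-≤ (*-mono-≤-nonNeg (ℚₚ.0≤∣p∣ P) P≤1 (ℚₚ.0≤∣p∣ x) x≤12) (*-mono-≤-nonNeg (ℚₚ.0≤∣p∣ Q) Q≤ (ℚₚ.0≤∣p∣ y) y≤12) ⟩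
    1ℚ * ι 12 + pw (ι 7) (suc k) * ι 12      ≡⟨ solve 1 (λ p → # 1 :* # 12 :+ p :* # 12 := # 12 :* (# 1 :+ p)) refl (pw (ι 7) (suc k)) ⟩
    ι 12 * (1ℚ + pw (ι 7) (suc k))           ∎
    where
    P = pw (μ m) (suc k)
    Q = pw (Λ m) (suc k)
    x = (τ m - ι 4) + ι 4 * s m
    y = (τ m - ι 4) - ι 4 * s m
    P≤1 : ∣ P ∣ ≤ 1ℚ
    P≤1 = subst₂ _≤_ (sym (ℚₚ.0≤p⇒∣p∣≡p (0≤pw (suc k) (0≤μ m)))) (pw-1 (suc k)) (pw-mono (suc k) (0≤μ m) (μ≤1 m))
    Q≤ : ∣ Q ∣ ≤ pw (ι 7) (suc k)
    Q≤ = subst (_≤ pw (ι 7) (suc k)) (sym (ℚₚ.0≤p⇒∣p∣≡p (0≤pw (suc k) (0≤Λ m)))) (pw-mono (suc k) (0≤Λ m) (Λ≤7 m))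
    4s≤6 : ι 4 * s m ≤ ι 6
    4s≤6 = *-monoˡ (0≤ι 4) (s≤3/2 m)
    x≤12 : ∣ x ∣ ≤ ι 12
    x≤12 = abs-≤ x
      (ℚₚ.≤-trans (ℚₚ.+-mono-≤ (ℚₚ.+-monoˡ-≤ (- ι 4) (τ≤2 m)) 4s≤6) (ℚₚ.≤ᵇ⇒≤ {(ι 2 - ι 4) + ι 6} {ι 12} _))
      (≤-by (ι 8 + τ m + ι 4 * s m) (0≤+ (0≤+ (0≤ι 8) (0≤τ m)) (0≤* (0≤ι 4) (0≤s m)))
        (solve 2 (λ t s → # 12 := (:- ((t :- # 4) :+ # 4 :* s)) :+ (# 8 :+ t :+ # 4 :* s)) refl (τ m) (s m)))
    y≤12 : ∣ y ∣ ≤ ι 12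
    y≤12 = abs-≤ y
      (≤-by (ι 14 - τ m + (ι 2 + ι 4 * s m)) (0≤+ (≤⇒0≤- (ℚₚ.≤-trans (τ≤2 m) (ι-mono {2} {14} (s≤s (s≤s z≤n))))) (0≤+ (0≤ι 2) (0≤* (0≤ι 4) (0≤s m))))
        (solve 2 (λ t s → # 12 := ((t :- # 4) :- # 4 :* s) :+ (# 14 :- t :+ (# 2 :+ # 4 :* s))) refl (τ m) (s m)))
      (≤-by (ι 2 + τ m + (ι 6 - ι 4 * s m)) (0≤+ (0≤+ (0≤ι 2) (0≤τ m)) (≤⇒0≤- 4s≤6))
        (solve 2 (λ t s → # 12 := (:- ((t :- # 4) :- # 4 :* s)) :+ (# 2 :+ t :+ (# 6 :- # 4 :* s))) refl (τ m) (s m)))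

  -- Two-step induction for fixed k. The bound on the residue is independent of m but grows with k,
  -- which is harmless because m tends to infinity for each index separately.
  null-binet : ∀ k → Null (λ _ m → binet k m)
  null-binet zero       = null-≤ null-τ (ev-all λ _ m → subst (_≤ ∣ τ m ∣) (cong ∣_∣ (sym (zero-eq m))) (ℚₚ.0≤∣p∣ (τ m)))
    where
    zero-eq : ∀ m → binet 0 m ≡ 0ℚ
    zero-eq m = solve 1 (λ s → (# 4 :* s :* # 1 :+ (s :- # 1) :* (s :- # 1) :* # 1) :- (# 1 :+ s) :* (# 1 :+ s) :* # 1 := # 0) refl (s m)
  null-binet (suc zero) = null-≤ (null-scale 12 null-τ) (ev-all λ _ m → begin
    ∣ binet 1 m ∣
      ≡⟨ cong ∣_∣ (solve 1 (λ s → let M = (s :- # 1) :* (s :- # 1) ; L = (# 1 :+ s) :* (# 1 :+ s) in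
           (# 4 :* s :* # 6 :+ M :* (M :* # 1)) :- L :* (L :* # 1) := # 8 :* s :* (# 2 :- s :* s)) refl (s m)) ⟩
    ∣ ι 8 * s m * τ m ∣           ≡⟨ ℚₚ.∣p*q∣≡∣p∣*∣q∣ (ι 8 * s m) (τ m) ⟩
    ∣ ι 8 * s m ∣ * ∣ τ m ∣       ≡⟨ cong (_* ∣ τ m ∣) (ℚₚ.0≤p⇒∣p∣≡p (0≤* (0≤ι 8) (0≤s m))) ⟩
    ι 8 * s m * ∣ τ m ∣           ≤⟨ *-monoʳ (ℚₚ.0≤∣p∣ (τ m)) (*-monoˡ (0≤ι 8) (s≤3/2 m)) ⟩
    ι 12 * ∣ τ m ∣                ≡⟨ ℚₚ.∣p*q∣≡∣p∣*∣q∣ (ι 12) (τ m) ⟨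
    ∣ ι 12 * τ m ∣                ∎)
  null-binet (suc (suc k)) = null-≤
    (null-+ (null-+ (null-scale 6 (null-binet (suc k))) (null-neg (null-binet k)))
      (null-* {λ _ m → τ m} {λ _ m → residue k m} (ι 12 * (1ℚ + pw (ι 7) (suc k))) (0<* (0<ι 11) (ℚₚ.<-≤-trans 0<1 (≤-by (pw (ι 7) (suc k)) (0≤pw (suc k) (0≤ι 7)) refl)))
        (ev-all λ _ m → residue-bounded k m) null-τ))
    (ev-all λ _ m → ℚₚ.≤-reflexive (cong ∣_∣ (binet-suc k m)))

  -- Of the two errors, the Binet error is made small through m. The power of μ is at most 1, and Λ
  -- ≥ 2 makes the main term at least k + 1, so a large n suffices for it.
  4sU≃Λ : (λ n m → ι 4 * s m * Uˢ (n ℕ.+ n)) ≃ (λ n m → pw (Λ m) (suc (n ℕ.+ n)))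
  4sU≃Λ = asymptotic λ ε 0<ε →
    let (N , h) = archimedean (½ * ε) (0<* 0<½ 0<ε)
        (K , g) = 5/4≤s
        (M , s-large) = g K ℕₚ.≤-refl
    in N , λ n N≤n →
      let (K′ , g′) = null-binet (n ℕ.+ n) (½ * ε) (0<* 0<½ 0<ε)
          (M′ , small) = g′ K′ ℕₚ.≤-refl
      in M ℕ.⊔ M′ , λ m ≤m → bound ε 0<ε n m (h n N≤n) (s-large m (⊔-l M M′ ≤m)) (small m (⊔-r M M′ ≤m))
    where
    bound : ∀ ε → 0ℚ < ε → ∀ n m → u n ≤ ½ * ε → 1ℚ + u 3 ≤ s m → ∣ binet (n ℕ.+ n) m ∣ ≤ ½ * ε →
            0ℚ < pw (Λ m) (suc (n ℕ.+ n)) × ∣ ι 4 * s m * Uˢ (n ℕ.+ n) - pw (Λ m) (suc (n ℕ.+ n)) ∣ ≤ ε * pw (Λ m) (suc (n ℕ.+ n))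
    bound ε 0<ε n m u≤ s-large small = ℚₚ.<-≤-trans (0<ι k) ιk≤L , (begin
      ∣ V - L ∣                      ≡⟨ cong ∣_∣ (solve 3 (λ V L P → V :- L := ((V :+ P) :- L) :- P) refl V L P) ⟩
      ∣ binet k m - P ∣              ≤⟨ ℚₚ.∣p-q∣≤∣p∣+∣q∣ (binet k m) P ⟩
      ∣ binet k m ∣ + ∣ P ∣          ≤⟨ ℚₚ.+-mono-≤ small P≤1 ⟩
      ½ * ε + 1ℚ                     ≡⟨ cong₂ _+_ (sym (ℚₚ.*-identityʳ (½ * ε))) (sym (u-ι k)) ⟩
      ½ * ε * 1ℚ + u k * ι (suc k)
        ≤⟨ ℚₚ.+-mono-≤ (*-monoˡ (ℚₚ.<⇒≤ 0<ε/2) (ℚₚ.≤-trans (ι-mono {1} {suc k} (s≤s z≤n)) ιk≤L))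
             (*-mono-≤-nonNeg (0≤u k) (ℚₚ.≤-trans (u-anti (ℕₚ.m≤m+n n n)) u≤) (0≤ι (suc k)) ιk≤L) ⟩
      ½ * ε * L + ½ * ε * L          ≡⟨ solve 2 (λ e l → con ½ :* e :* l :+ con ½ :* e :* l := e :* l) refl ε L ⟩
      ε * L                          ∎)
      where
      0<ε/2 = 0<* 0<½ 0<ε
      k = n ℕ.+ n
      V = ι 4 * s m * Uˢ k
      L = pw (Λ m) (suc k)
      P = pw (μ m) (suc k)
      P≤1 : ∣ P ∣ ≤ 1ℚ
      P≤1 = subst₂ _≤_ (sym (ℚₚ.0≤p⇒∣p∣≡p (0≤pw (suc k) (0≤μ m)))) (pw-1 (suc k)) (pw-mono (suc k) (0≤μ m) (μ≤1 m))
      2≤Λ : ι 2 ≤ Λ m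
      2≤Λ = ℚₚ.≤-trans (ℚₚ.≤ᵇ⇒≤ {ι 2} {(1ℚ + (1ℚ + u 3)) * (1ℚ + (1ℚ + u 3))} _) (sq-mono (ℚₚ.≤ᵇ⇒≤ {0ℚ} {1ℚ + (1ℚ + u 3)} _) (ℚₚ.+-monoʳ-≤ 1ℚ s-large))
      ιk≤L : ι (suc k) ≤ L
      ιk≤L = ℚₚ.≤-trans (ι-mono (ℕₚ.n≤1+n (suc k))) (pw-≥ (suc k) 2≤Λ)

-- The growth of the edge numbers

≃-suc : ∀ {a b} → a ≃ b → (λ n → a (suc n)) ≃ (λ n → b (suc n))
≃-suc a≃b = asymptotic λ ε 0<ε → let (N , h) = _≃_.close a≃b ε 0<ε in N , λ n N≤n → h (suc n) (ℕₚ.m≤n⇒m≤1+n N≤n)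

p≤1 : ∀ n → p n ≤ 1ℚ
p≤1 n = ℚₚ.≤-trans (p≤⅕ n) (u≤1 4)

-- By the recursion of q, p + q - 6 at an index is minus the next increment of q, up to ϵ p. So p
-- nearly solves x² - 6x + 1 = 0, which identifies its limit.
p+q-6 : ∀ n → ∣ (p (suc n) + q (suc n)) - ι 6 ∣ ≤ ι 2 * u n
p+q-6 n = begin
  ∣ (p k + q k) - ι 6 ∣
    ≡⟨ cong ∣_∣ (solve 3 (λ p q e → (p :+ q) :- # 6 := :- (((# 6 :- (# 1 :+ e) :* p) :- q) :+ e :* p)) refl (p k) (q k) (ϵ k)) ⟩
  ∣ - ((q (suc k) - q k) + ϵ k * p k) ∣
    ≡⟨ trans (ℚₚ.∣-p∣≡∣p∣ ((q (suc k) - q k) + ϵ k * p k)) (ℚₚ.0≤p⇒∣p∣≡p (0≤+ (≤⇒0≤- (q-increasing n)) (0≤* (0≤ϵ k) (0≤p k)))) ⟩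
  (q (suc k) - q k) + ϵ k * p k
    ≤⟨ ℚₚ.+-mono-≤ step (*-mono-≤-nonNeg (0≤ϵ k) ϵ≤u (0≤p k) (p≤1 k)) ⟩
  u n + u n * 1ℚ
    ≡⟨ solve 1 (λ u → u :+ u :* # 1 := # 2 :* u) refl (u n) ⟩
  ι 2 * u n ∎
  where
  k = suc n
  step : q (suc k) - q k ≤ u n
  step = begin
    q (suc k) - q k              ≤⟨ ℚₚ.+-monoˡ-≤ (- q k) (q-close (ℕₚ.n≤1+n n)) ⟩
    (q k + growth n) - q k       ≡⟨ solve 2 (λ q g → q :+ g :- q := g) refl (q k) (growth n) ⟩
    ½ * (u n * u (suc n))        ≤⟨ *-mono-≤-nonNeg {½} {1ℚ} 0≤½ (ℚₚ.≤ᵇ⇒≤ {½} {1ℚ} _) (0≤* (0≤u n) (0≤u (suc n))) (*-monoˡ (0≤u n) (u≤1 (suc n))) ⟩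
    1ℚ * (u n * 1ℚ)              ≡⟨ trans (ℚₚ.*-identityˡ _) (ℚₚ.*-identityʳ (u n)) ⟩
    u n                          ∎
  ϵ≤u : ϵ k ≤ u n
  ϵ≤u = begin
    u (2 ℕ.* k) * u (2 ℕ.+ 2 ℕ.* k)  ≤⟨ *-mono-≤-nonNeg (0≤u (2 ℕ.* k)) (u-anti (ℕₚ.≤-trans (ℕₚ.n≤1+n n) (ℕₚ.m≤n*m k 2))) (0≤u (2 ℕ.+ 2 ℕ.* k)) (u≤1 (2 ℕ.+ 2 ℕ.* k)) ⟩
    u n * 1ℚ                         ≡⟨ ℚₚ.*-identityʳ (u n) ⟩
    u n                              ∎

d-mono : ∀ n → Dˢ n ≤ Dˢ (suc n)
d-mono n = ι-mono (subst (d n ℕ.≤_) (sym (d-suc n)) (ℕₚ.m≤n+m (d n) (2 ℕ.* delannoy n (suc n))))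

1≤d : ∀ n → 1ℚ ≤ Dˢ n
1≤d zero    = ℚₚ.≤-refl
1≤d (suc n) = ℚₚ.≤-trans (1≤d n) (d-mono n)

0<d : ∀ n → 0ℚ < Dˢ n
0<d n = ℚₚ.<-≤-trans 0<1 (1≤d n)

0≤d : ∀ n → 0ℚ ≤ Dˢ n
0≤d n = ℚₚ.<⇒≤ (0<d n)

d-ratio : ∀ n → p n * Dˢ (suc n) ≡ Dˢ n - ½ * u n * Dˢ n
d-ratio n = begin-equality
  p n * Dˢ (suc n)                                    ≡⟨ cong (p n *_) (d≡ae (suc n)) ⟩
  p n * (a n * (1ℚ - ½ * u n) * (q n * e n))
    ≡⟨ solve 5 (λ p a u q e → p :* (a :* (# 1 :- con ½ :* u) :* (q :* e)) := (p :* q) :* (a :* e :- con ½ :* u :* (a :* e))) refl (p n) (a n) (u n) (q n) (e n) ⟩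
  (p n * q n) * (a n * e n - ½ * u n * (a n * e n))   ≡⟨ cong₂ (λ x y → x * (y - ½ * u n * y)) (p-q n) (sym (d≡ae n)) ⟩
  1ℚ * (Dˢ n - ½ * u n * Dˢ n)                        ≡⟨ ℚₚ.*-identityˡ _ ⟩
  Dˢ n - ½ * u n * Dˢ n                               ∎

-- Multiplied by n + 1, r becomes comparable with d: for n ≥ 1 the product lies between dₙ and 2dₙ.
R⁺ : ℕ → ℚ
R⁺ n = ι (suc n) * Rˢ n

2R⁺ : ∀ n → ι 2 * R⁺ (suc n) ≡ ι 3 * Dˢ (suc n) - Dˢ n
2R⁺ n = begin-equality
  ι 2 * (ι (2 ℕ.+ n) * Rˢ (suc n))
    ≡⟨ solve 3 (λ i r x → # 2 :* (i :* r) := (# 2 :* i :* r :+ x) :- x) refl (ι (2 ℕ.+ n)) (Rˢ (suc n)) (Dˢ n) ⟩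
  (ι 2 * ι (2 ℕ.+ n) * Rˢ (suc n) + Dˢ n) - Dˢ n
    ≡⟨ cong (_- Dˢ n) (ι-r-from-d n) ⟩
  ι 3 * Dˢ (suc n) - Dˢ n ∎

d≤R⁺ : ∀ n → Dˢ (suc n) ≤ R⁺ (suc n)
d≤R⁺ n = *-cancelˡ (0<ι 1) (≤-by (Dˢ (suc n) - Dˢ n) (≤⇒0≤- (d-mono n))
  (trans (2R⁺ n) (solve 2 (λ x y → # 3 :* x :- y := # 2 :* x :+ (x :- y)) refl (Dˢ (suc n)) (Dˢ n))))

0≤r : ∀ n → 0ℚ ≤ Rˢ n
0≤r n = 0≤ι (r n)

r-small : ∀ n → Rˢ (suc n) ≤ ι 2 * u (suc n) * Dˢ (suc n)
r-small n = begin
  Rˢ (suc n)                               ≡⟨ ℚₚ.*-identityˡ _ ⟨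
  1ℚ * Rˢ (suc n)                          ≡⟨ cong (_* Rˢ (suc n)) (u-ι (suc n)) ⟨
  u (suc n) * ι (2 ℕ.+ n) * Rˢ (suc n)     ≡⟨ ℚₚ.*-assoc (u (suc n)) (ι (2 ℕ.+ n)) (Rˢ (suc n)) ⟩
  u (suc n) * R⁺ (suc n)                   ≤⟨ *-monoˡ (0≤u (suc n)) R⁺≤2d ⟩
  u (suc n) * (ι 2 * Dˢ (suc n))           ≡⟨ solve 2 (λ u d → u :* (# 2 :* d) := # 2 :* u :* d) refl (u (suc n)) (Dˢ (suc n)) ⟩
  ι 2 * u (suc n) * Dˢ (suc n)             ∎
  where
  R⁺≤2d : R⁺ (suc n) ≤ ι 2 * Dˢ (suc n)
  R⁺≤2d = *-cancelˡ (0<ι 1) (≤-by (Dˢ (suc n) + Dˢ n) (0≤+ (0≤d (suc n)) (0≤d n))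
    (trans (solve 2 (λ x y → # 2 :* (# 2 :* x) := (# 3 :* x :- y) :+ (x :+ y)) refl (Dˢ (suc n)) (Dˢ n)) (cong (_+ (Dˢ (suc n) + Dˢ n)) (sym (2R⁺ n)))))

0<r : ∀ n → 0ℚ < Rˢ (suc n)
0<r n = ℚₚ.≰⇒> λ r≤0 → ℚₚ.<-irrefl refl (begin-strict
  0ℚ                         <⟨ 0<d (suc n) ⟩
  Dˢ (suc n)                 ≤⟨ d≤R⁺ n ⟩
  ι (2 ℕ.+ n) * Rˢ (suc n)   ≤⟨ *-monoˡ (0≤ι (2 ℕ.+ n)) r≤0 ⟩
  ι (2 ℕ.+ n) * 0ℚ           ≡⟨ ℚₚ.*-zeroʳ (ι (2 ℕ.+ n)) ⟩
  0ℚ                         ∎)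

1≤leibniz : ∀ m → 1 ℕ.≤ m → 1ℚ ≤ leibniz m
1≤leibniz m 1≤m = subst (_≤ leibniz m) (ℚₚ.+-identityˡ 1ℚ) (proj₂ (proj₂ (proj₂ π-pos)) m 1≤m)

module Growth (s : ℕ → ℚ) (s-root : ∀ m → ApproximatesRoot (ι 2) (s m) m) where
  open √2-Approximation s s-root
  open √2-Powers s s-root

  -- The ratio dₙ₋₁/dₙ ≈ pₙ₋₁ tends to 3 - 2√2.
  η : Seq₂
  η i m = (ι 3 - p (suc i)) - ι 2 * s m

  -- The conjugate factor 3 - p + 2s is at least 1, and the product with it is p² - 6p + 1 + 4τ.
  -- Since p q = 1, this equals p(p + q - 6) + 4τ.
  null-η : Null η
  null-η = null-≤ (null-+ (null-scale 2 null-u-outer) (null-scale 4 null-τ)) (ev-all λ i m → begin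
    ∣ η i m ∣                                      ≡⟨ ℚₚ.*-identityʳ _ ⟨
    ∣ η i m ∣ * 1ℚ                                 ≤⟨ *-monoˡ (ℚₚ.0≤∣p∣ (η i m)) (ℚₚ.≤-trans (1≤η′ i m) (p≤∣p∣ (η′ i m))) ⟩
    ∣ η i m ∣ * ∣ η′ i m ∣                         ≡⟨ ℚₚ.∣p*q∣≡∣p∣*∣q∣ (η i m) (η′ i m) ⟨
    ∣ η i m * η′ i m ∣                             ≡⟨ cong ∣_∣ (product i m) ⟩
    ∣ p (suc i) * ((p (suc i) + q (suc i)) - ι 6) + ι 4 * τ m ∣
      ≤⟨ ℚₚ.∣p+q∣≤∣p∣+∣q∣ (p (suc i) * ((p (suc i) + q (suc i)) - ι 6)) (ι 4 * τ m) ⟩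
    ∣ p (suc i) * ((p (suc i) + q (suc i)) - ι 6) ∣ + ∣ ι 4 * τ m ∣
      ≤⟨ ℚₚ.+-mono-≤ (small i) (ℚₚ.≤-reflexive (ℚₚ.0≤p⇒∣p∣≡p (0≤* (0≤ι 4) (0≤τ m)))) ⟩
    ι 2 * u i + ι 4 * τ m                          ≤⟨ p≤∣p∣ (ι 2 * u i + ι 4 * τ m) ⟩
    ∣ ι 2 * u i + ι 4 * τ m ∣                      ∎)
    where
    η′ : Seq₂
    η′ i m = (ι 3 - p (suc i)) + ι 2 * s m
    1≤η′ : ∀ i m → 1ℚ ≤ η′ i m
    1≤η′ i m = ≤-by ((1ℚ - p (suc i)) + (1ℚ + ι 2 * s m)) (0≤+ (≤⇒0≤- (p≤1 (suc i))) (0≤+ 0≤1 (0≤* (0≤ι 2) (0≤s m))))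
      (solve 2 (λ p s → (# 3 :- p) :+ # 2 :* s := # 1 :+ ((# 1 :- p) :+ (# 1 :+ # 2 :* s))) refl (p (suc i)) (s m))
    product : ∀ i m → η i m * η′ i m ≡ p (suc i) * ((p (suc i) + q (suc i)) - ι 6) + ι 4 * τ m
    product i m = begin-equality
      η i m * η′ i m
        ≡⟨ solve 2 (λ p s → ((# 3 :- p) :- # 2 :* s) :* ((# 3 :- p) :+ # 2 :* s) := (p :* p :- # 6 :* p) :+ # 1 :+ # 4 :* (# 2 :- s :* s)) refl (p (suc i)) (s m) ⟩
      (p (suc i) * p (suc i) - ι 6 * p (suc i)) + 1ℚ + ι 4 * τ m
        ≡⟨ cong (λ z → (p (suc i) * p (suc i) - ι 6 * p (suc i)) + z + ι 4 * τ m) (p-q (suc i)) ⟨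
      (p (suc i) * p (suc i) - ι 6 * p (suc i)) + p (suc i) * q (suc i) + ι 4 * τ m
        ≡⟨ cong (_+ ι 4 * τ m) (solve 2 (λ p q → (p :* p :- # 6 :* p) :+ p :* q := p :* ((p :+ q) :- # 6)) refl (p (suc i)) (q (suc i))) ⟩
      p (suc i) * ((p (suc i) + q (suc i)) - ι 6) + ι 4 * τ m ∎
    small : ∀ i → ∣ p (suc i) * ((p (suc i) + q (suc i)) - ι 6) ∣ ≤ ι 2 * u i
    small i = begin
      ∣ p (suc i) * x ∣        ≡⟨ ℚₚ.∣p*q∣≡∣p∣*∣q∣ (p (suc i)) x ⟩
      ∣ p (suc i) ∣ * ∣ x ∣    ≤⟨ *-mono-≤-nonNeg (ℚₚ.0≤∣p∣ (p (suc i))) (subst (_≤ 1ℚ) (sym (ℚₚ.0≤p⇒∣p∣≡p (0≤p (suc i)))) (p≤1 (suc i))) (ℚₚ.0≤∣p∣ x) (p+q-6 i) ⟩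
      1ℚ * (ι 2 * u i)         ≡⟨ ℚₚ.*-identityˡ _ ⟩
      ι 2 * u i                ∎
      where x = (p (suc i) + q (suc i)) - ι 6

  -- By `2R⁺` twice the right side is 3dₙ - dₙ₋₁, close to (3 - p)dₙ and so to 2√2 dₙ. The index 2 +
  -- i is the least for which the ratio p involved lies in the monotone range.
  sd≃R⁺ : (λ i m → s m * Dˢ (2+ i)) ≃ (λ i _ → R⁺ (2+ i))
  sd≃R⁺ = ≃-intro {λ i m → s m * Dˢ (2+ i)} {λ i _ → R⁺ (2+ i)} (λ i m → ∣ η i m ∣ + u i) (null-+ (null-∣∣ null-η) null-u-outer)
    (ev-all λ i _ → ℚₚ.<-≤-trans (0<d (2+ i)) (d≤R⁺ (suc i)))
    (ev-all λ i m → *-cancelˡ (0<ι 1) (begin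
      ι 2 * ∣ s m * Dˢ (2+ i) - R⁺ (2+ i) ∣
        ≡⟨ trans (sym (ℚₚ.∣p*q∣≡∣p∣*∣q∣ (ι 2) (s m * Dˢ (2+ i) - R⁺ (2+ i)))) (cong ∣_∣ (difference i m)) ⟩
      ∣ ½ * u (suc i) * Dˢ (suc i) - η i m * Dˢ (2+ i) ∣
        ≤⟨ ℚₚ.∣p-q∣≤∣p∣+∣q∣ (½ * u (suc i) * Dˢ (suc i)) (η i m * Dˢ (2+ i)) ⟩
      ∣ ½ * u (suc i) * Dˢ (suc i) ∣ + ∣ η i m * Dˢ (2+ i) ∣
        ≤⟨ ℚₚ.+-mono-≤ (½ud≤ i) (ℚₚ.≤-reflexive (∣ηd∣ i m)) ⟩
      u i * Dˢ (2+ i) + ∣ η i m ∣ * Dˢ (2+ i)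
        ≡⟨ solve 3 (λ u d h → u :* d :+ h :* d := (h :+ u) :* d) refl (u i) (Dˢ (2+ i)) ∣ η i m ∣ ⟩
      (∣ η i m ∣ + u i) * Dˢ (2+ i)
        ≤⟨ *-mono-≤-nonNeg (0≤+ (ℚₚ.0≤∣p∣ (η i m)) (0≤u i)) (p≤∣p∣ (∣ η i m ∣ + u i)) (0≤d (2+ i)) (d≤R⁺ (suc i)) ⟩
      ∣ ∣ η i m ∣ + u i ∣ * R⁺ (2+ i)
        ≤⟨ ≤-by (∣ ∣ η i m ∣ + u i ∣ * R⁺ (2+ i)) (0≤* (ℚₚ.0≤∣p∣ (∣ η i m ∣ + u i)) (ℚₚ.≤-trans (0≤d (2+ i)) (d≤R⁺ (suc i))))
             (solve 1 (λ x → # 2 :* x := x :+ x) refl (∣ ∣ η i m ∣ + u i ∣ * R⁺ (2+ i))) ⟩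
      ι 2 * (∣ ∣ η i m ∣ + u i ∣ * R⁺ (2+ i)) ∎))
    module Sd where
    difference : ∀ i m → ι 2 * (s m * Dˢ (2+ i) - R⁺ (2+ i)) ≡ ½ * u (suc i) * Dˢ (suc i) - η i m * Dˢ (2+ i)
    difference i m = begin-equality
      ι 2 * (s m * D₂ - R⁺ (2+ i))
        ≡⟨ solve 3 (λ s d r → # 2 :* (s :* d :- r) := # 2 :* s :* d :- # 2 :* r) refl (s m) D₂ (R⁺ (2+ i)) ⟩
      ι 2 * s m * D₂ - ι 2 * R⁺ (2+ i)
        ≡⟨ cong (λ z → ι 2 * s m * D₂ - z) (2R⁺ (suc i)) ⟩
      ι 2 * s m * D₂ - (ι 3 * D₂ - D₁)
        ≡⟨ solve 5 (λ s x y p u → # 2 :* s :* x :- (# 3 :* x :- y) := con ½ :* u :* y :- ((# 3 :- p) :- # 2 :* s) :* x :+ ((y :- con ½ :* u :* y) :- p :* x)) refl (s m) D₂ D₁ (p (suc i)) (u (suc i)) ⟩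
      ½ * u (suc i) * D₁ - η i m * D₂ + ((D₁ - ½ * u (suc i) * D₁) - p (suc i) * D₂)
        ≡⟨ cong (λ z → ½ * u (suc i) * D₁ - η i m * D₂ + ((D₁ - ½ * u (suc i) * D₁) - z)) (d-ratio (suc i)) ⟩
      ½ * u (suc i) * D₁ - η i m * D₂ + ((D₁ - ½ * u (suc i) * D₁) - (D₁ - ½ * u (suc i) * D₁))
        ≡⟨ solve 2 (λ x y → x :+ (y :- y) := x) refl (½ * u (suc i) * D₁ - η i m * D₂) (D₁ - ½ * u (suc i) * D₁) ⟩
      ½ * u (suc i) * D₁ - η i m * D₂ ∎
      where
      D₁ = Dˢ (suc i)
      D₂ = Dˢ (2+ i)
    ½ud≤ : ∀ i → ∣ ½ * u (suc i) * Dˢ (suc i) ∣ ≤ u i * Dˢ (2+ i)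
    ½ud≤ i = begin
      ∣ ½ * u (suc i) * Dˢ (suc i) ∣   ≡⟨ ℚₚ.0≤p⇒∣p∣≡p (0≤* (0≤* 0≤½ (0≤u (suc i))) (0≤d (suc i))) ⟩
      ½ * u (suc i) * Dˢ (suc i)       ≤⟨ *-mono-≤-nonNeg (0≤* 0≤½ (0≤u (suc i))) (*-mono-≤-nonNeg {½} {1ℚ} 0≤½ (ℚₚ.≤ᵇ⇒≤ {½} {1ℚ} _) (0≤u (suc i)) (u-anti (ℕₚ.n≤1+n i))) (0≤d (suc i)) (d-mono (suc i)) ⟩
      1ℚ * u i * Dˢ (2+ i)          ≡⟨ cong (_* Dˢ (2+ i)) (ℚₚ.*-identityˡ (u i)) ⟩
      u i * Dˢ (2+ i)               ∎
    ∣ηd∣ : ∀ i m → ∣ η i m * Dˢ (2+ i) ∣ ≡ ∣ η i m ∣ * Dˢ (2+ i)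
    ∣ηd∣ i m = trans (ℚₚ.∣p*q∣≡∣p∣*∣q∣ (η i m) (Dˢ (2+ i))) (cong (∣ η i m ∣ *_) (ℚₚ.0≤p⇒∣p∣≡p (0≤d (2+ i))))

  ¼≤s-1 : Eventually₂ (λ _ m → u 3 ≤ s m - 1ℚ)
  ¼≤s-1 = ev-map (λ {_} {m} le → ≤-by (s m - (1ℚ + u 3)) (≤⇒0≤- le) (solve 1 (λ s → s :- # 1 := con (u 3) :+ (s :- (# 1 :+ con (u 3)))) refl (s m))) 5/4≤s

  2s-2 : ℕ → ℚ
  2s-2 m = ι 2 * (s m - 1ℚ)

  ½≤2s-2 : Eventually₂ (λ _ m → ½ ≤ 2s-2 m)
  ½≤2s-2 = ev-map (λ le → *-monoˡ {ι 2} {u 3} (0≤ι 2) le) ¼≤s-1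

  -- ℓ is dₙ - dₙ₋₁ up to Schröder numbers, which are smaller by a factor of order 1/n. The ratio
  -- dₙ₋₁/dₙ tends to 3 - 2√2, which leaves the factor 2√2 - 2.
  ℓ≃d : (λ i _ → Lˢ (2+ i)) ≃ (λ i m → Dˢ (2+ i) * 2s-2 m)
  ℓ≃d = ≃-intro {λ i _ → Lˢ (2+ i)} {λ i m → Dˢ (2+ i) * 2s-2 m} (λ i m → ι 2 * (∣ η i m ∣ + ι 5 * u i)) (null-scale 2 (null-+ (null-∣∣ null-η) (null-scale 5 null-u-outer)))
    (ev-map (λ {i} {m} le → 0<* (0<d (2+ i)) (ℚₚ.<-≤-trans 0<½ le)) ½≤2s-2)
    (ev-map (λ {i} {m} le → begin
      ∣ Lˢ (2+ i) - Dˢ (2+ i) * 2s-2 m ∣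
        ≡⟨ cong ∣_∣ (difference i m) ⟩
      ∣ (η i m * D₂ i - ½ * u (suc i) * D₁ i) + (Rˢ (suc i) - Rˢ (2+ i)) ∣
        ≤⟨ ℚₚ.≤-trans (ℚₚ.∣p+q∣≤∣p∣+∣q∣ (η i m * D₂ i - ½ * u (suc i) * D₁ i) (Rˢ (suc i) - Rˢ (2+ i)))
             (ℚₚ.+-mono-≤ (ℚₚ.∣p-q∣≤∣p∣+∣q∣ (η i m * D₂ i) (½ * u (suc i) * D₁ i)) (ℚₚ.∣p-q∣≤∣p∣+∣q∣ (Rˢ (suc i)) (Rˢ (2+ i)))) ⟩
      (∣ η i m * D₂ i ∣ + ∣ ½ * u (suc i) * D₁ i ∣) + (∣ Rˢ (suc i) ∣ + ∣ Rˢ (2+ i) ∣)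
        ≤⟨ ℚₚ.+-mono-≤ (ℚₚ.+-mono-≤ (ℚₚ.≤-reflexive (Sd.∣ηd∣ i m)) (Sd.½ud≤ i)) (ℚₚ.+-mono-≤ (r≤₁ i) (r≤₂ i)) ⟩
      (∣ η i m ∣ * D₂ i + u i * D₂ i) + (ι 2 * u i * D₂ i + ι 2 * u i * D₂ i)
        ≡⟨ solve 3 (λ h d u → (h :* d :+ u :* d) :+ (# 2 :* u :* d :+ # 2 :* u :* d) := (# 2 :* (h :+ # 5 :* u)) :* (d :* con ½)) refl ∣ η i m ∣ (D₂ i) (u i) ⟩
      ι 2 * (∣ η i m ∣ + ι 5 * u i) * (D₂ i * ½)
        ≤⟨ *-mono-≤-nonNeg (0≤* (0≤ι 2) (0≤+ (ℚₚ.0≤∣p∣ (η i m)) (0≤* (0≤ι 5) (0≤u i)))) (p≤∣p∣ (ι 2 * (∣ η i m ∣ + ι 5 * u i))) (0≤* (0≤d (2+ i)) 0≤½) (*-monoˡ (0≤d (2+ i)) le) ⟩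
      ∣ ι 2 * (∣ η i m ∣ + ι 5 * u i) ∣ * (D₂ i * 2s-2 m) ∎) ½≤2s-2)
    where
    D₁ D₂ : ℕ → ℚ
    D₁ i = Dˢ (suc i)
    D₂ i = Dˢ (2+ i)
    difference : ∀ i m → Lˢ (2+ i) - D₂ i * 2s-2 m ≡ (η i m * D₂ i - ½ * u (suc i) * D₁ i) + (Rˢ (suc i) - Rˢ (2+ i))
    difference i m = begin-equality
      Lˢ (2+ i) - D₂ i * 2s-2 m
        ≡⟨ cong (_- D₂ i * 2s-2 m) (ι-ℓ (suc i)) ⟩
      ((D₂ i - Rˢ (2+ i)) - (D₁ i - Rˢ (suc i))) - D₂ i * 2s-2 m
        ≡⟨ solve 7 (λ x y r r′ s p u → ((x :- r) :- (y :- r′)) :- x :* (# 2 :* (s :- # 1)) :=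
             ((((# 3 :- p) :- # 2 :* s) :* x :- con ½ :* u :* y) :+ (r′ :- r)) :+ (p :* x :- (y :- con ½ :* u :* y))) refl
             (D₂ i) (D₁ i) (Rˢ (2+ i)) (Rˢ (suc i)) (s m) (p (suc i)) (u (suc i)) ⟩
      ((η i m * D₂ i - ½ * u (suc i) * D₁ i) + (Rˢ (suc i) - Rˢ (2+ i))) + (p (suc i) * D₂ i - (D₁ i - ½ * u (suc i) * D₁ i))
        ≡⟨ cong (λ z → ((η i m * D₂ i - ½ * u (suc i) * D₁ i) + (Rˢ (suc i) - Rˢ (2+ i))) + (z - (D₁ i - ½ * u (suc i) * D₁ i))) (d-ratio (suc i)) ⟩
      ((η i m * D₂ i - ½ * u (suc i) * D₁ i) + (Rˢ (suc i) - Rˢ (2+ i))) + ((D₁ i - ½ * u (suc i) * D₁ i) - (D₁ i - ½ * u (suc i) * D₁ i))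
        ≡⟨ solve 2 (λ x y → x :+ (y :- y) := x) refl ((η i m * D₂ i - ½ * u (suc i) * D₁ i) + (Rˢ (suc i) - Rˢ (2+ i))) (D₁ i - ½ * u (suc i) * D₁ i) ⟩
      (η i m * D₂ i - ½ * u (suc i) * D₁ i) + (Rˢ (suc i) - Rˢ (2+ i)) ∎
    r≤₁ : ∀ i → ∣ Rˢ (suc i) ∣ ≤ ι 2 * u i * D₂ i
    r≤₁ i = begin
      ∣ Rˢ (suc i) ∣                  ≡⟨ ℚₚ.0≤p⇒∣p∣≡p (0≤r (suc i)) ⟩
      Rˢ (suc i)                      ≤⟨ r-small i ⟩
      ι 2 * u (suc i) * D₁ i          ≤⟨ *-mono-≤-nonNeg (0≤* (0≤ι 2) (0≤u (suc i))) (*-monoˡ (0≤ι 2) (u-anti (ℕₚ.n≤1+n i))) (0≤d (suc i)) (d-mono (suc i)) ⟩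
      ι 2 * u i * D₂ i                ∎
    r≤₂ : ∀ i → ∣ Rˢ (2+ i) ∣ ≤ ι 2 * u i * D₂ i
    r≤₂ i = begin
      ∣ Rˢ (2+ i) ∣                ≡⟨ ℚₚ.0≤p⇒∣p∣≡p (0≤r (2+ i)) ⟩
      Rˢ (2+ i)                    ≤⟨ r-small (suc i) ⟩
      ι 2 * u (2+ i) * D₂ i        ≤⟨ *-monoʳ (0≤d (2+ i)) (*-monoˡ (0≤ι 2) (u-anti (ℕₚ.m≤n+m i 2))) ⟩
      ι 2 * u i * D₂ i                ∎

  1≤s : Eventually₂ (λ _ m → 1ℚ ≤ s m)
  1≤s = ev-map (λ le → ℚₚ.≤-trans (≤-by {1ℚ} (u 3) (0≤u 3) refl) le) 5/4≤s

  s[2-s] : ℕ → ℚ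
  s[2-s] m = s m * (ι 2 - s m)

  -- The two sides differ by τ. The factor √2 is split off in order to turn dₙ into (n+1)rₙ by
  -- `sd≃R⁺`.
  2s-2≃s[2-s] : (λ _ m → 2s-2 m) ≃ (λ _ m → s[2-s] m)
  2s-2≃s[2-s] = ≃-intro {λ _ m → 2s-2 m} {λ _ m → s[2-s] m} (λ _ m → ι 2 * τ m) (null-scale 2 null-τ)
    (ev-map (λ {_} {m} le → ℚₚ.<-≤-trans 0<½ (½≤ m le)) 1≤s)
    (ev-map (λ {_} {m} le → begin
      ∣ 2s-2 m - s[2-s] m ∣       ≡⟨ cong ∣_∣ (solve 1 (λ s → # 2 :* (s :- # 1) :- s :* (# 2 :- s) := :- (# 2 :- s :* s)) refl (s m)) ⟩
      ∣ - τ m ∣                   ≡⟨ trans (ℚₚ.∣-p∣≡∣p∣ (τ m)) (ℚₚ.0≤p⇒∣p∣≡p (0≤τ m)) ⟩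
      τ m                         ≡⟨ solve 1 (λ t → t := # 2 :* t :* con ½) refl (τ m) ⟩
      ι 2 * τ m * ½               ≤⟨ *-mono-≤-nonNeg (0≤* (0≤ι 2) (0≤τ m)) (p≤∣p∣ (ι 2 * τ m)) 0≤½ (½≤ m le) ⟩
      ∣ ι 2 * τ m ∣ * s[2-s] m    ∎) 1≤s)
    where
    ½≤ : ∀ m → 1ℚ ≤ s m → ½ ≤ s[2-s] m
    ½≤ m le = *-mono-≤-nonNeg {1ℚ} {s m} {½} 0≤1 le 0≤½ (0≤2-s m)

  ℓ≃r : (λ i _ → Lˢ (2+ i)) ≃ (λ i m → Rˢ (2+ i) * ((ι 2 - s m) * ι (2+ i)))
  ℓ≃r = ≃-trans {b = λ i m → Dˢ (2+ i) * 2s-2 m} ℓ≃d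
    (≃-trans {b = λ i m → Dˢ (2+ i) * s[2-s] m}
      (≃-* {λ i _ → Dˢ (2+ i)} {λ i _ → Dˢ (2+ i)} (≃-refl (ev-all λ i _ → 0<d (2+ i))) 2s-2≃s[2-s])
    (≃-trans {b = λ i m → R⁺ (2+ i) * (ι 2 - s m)}
      (≃-resp (λ i m → solve 2 (λ d s → s :* d :* (# 2 :- s) := d :* (s :* (# 2 :- s))) refl (Dˢ (2+ i)) (s m)) (λ _ _ → refl)
        (≃-* sd≃R⁺ (≃-refl (ev-all λ _ m → 0<2-s m))))
      (≃-resp {λ i m → ι (3 ℕ.+ i) * (Rˢ (2+ i) * (ι 2 - s m))}
        (λ i m → sym (ℚₚ.*-assoc (ι (3 ℕ.+ i)) (Rˢ (2+ i)) (ι 2 - s m)))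
        (λ i m → solve 3 (λ n r x → n :* (r :* x) := r :* (x :* n)) refl (ι (2+ i)) (Rˢ (2+ i)) (ι 2 - s m))
        (≃-* ι-suc≃ι (≃-refl {λ i m → Rˢ (2+ i) * (ι 2 - s m)} (ev-all λ i m → 0<* (0<r (suc i)) (0<2-s m)))))))
    where
    0<2-s : ∀ m → 0ℚ < ι 2 - s m
    0<2-s m = ℚₚ.<-≤-trans 0<½ (0≤2-s m)
    ι-suc≃ι : (λ i _ → ι (3 ℕ.+ i)) ≃ (λ i _ → ι (2+ i))
    ι-suc≃ι = ≃-intro {λ i _ → ι (3 ℕ.+ i)} {λ i _ → ι (2+ i)} (λ i _ → u (suc i)) (null-suc null-u-outer) (ev-all λ i _ → 0<ι (suc i)) (ev-all λ i _ → ℚₚ.≤-reflexive (begin-equality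
      ∣ ι (3 ℕ.+ i) - ι (2+ i) ∣           ≡⟨ cong (λ z → ∣ z - ι (2+ i) ∣) (ι-suc (2+ i)) ⟩
      ∣ (1ℚ + ι (2+ i)) - ι (2+ i) ∣    ≡⟨ cong ∣_∣ (solve 1 (λ x → # 1 :+ x :- x := # 1) refl (ι (2+ i))) ⟩
      1ℚ                                      ≡⟨ u-ι (suc i) ⟨
      u (suc i) * ι (2+ i)                 ≡⟨ cong (_* ι (2+ i)) (∣u∣ (suc i)) ⟨
      ∣ u (suc i) ∣ * ι (2+ i)             ∎))

  module _ (T : Seq₂) (T-root : ∀ n m → ApproximatesRoot (s m * ι n * leibniz m) (T n m) m) where

    y : Seq₂
    y n m = s m * ι n * leibniz m

    1≤y : Eventually₂ (λ i m → 1ℚ ≤ y (2+ i) m)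
    1≤y = ev-map (λ {i} {m} (1≤s , 1≤l) → *-mono-≤-nonNeg {1ℚ} {s m * ι (2+ i)} {1ℚ} 0≤1
        (*-mono-≤-nonNeg {1ℚ} {s m} {1ℚ} 0≤1 1≤s 0≤1 (ι-mono {1} {2+ i} (s≤s z≤n))) 0≤1 1≤l)
      (1≤s ev× ev-inner (1 , 1≤leibniz))

    T²≃y : (λ i m → T (2+ i) m * T (2+ i) m) ≃ (λ i m → y (2+ i) m)
    T²≃y = ≃-intro {λ i m → T (2+ i) m * T (2+ i) m} {λ i m → y (2+ i) m} (λ _ m → ι 5 * u m) (null-scale 5 null-u-inner) (ev-map (ℚₚ.<-≤-trans 0<1) 1≤y)
      (ev-map (λ {i} {m} 1≤y → begin
        ∣ T (2+ i) m * T (2+ i) m - y (2+ i) m ∣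
          ≤⟨ ApproximatesRoot.T²-close (T-root (2+ i) m) ⟩
        (ι 2 * y (2+ i) m + ι 3) * u m
          ≤⟨ *-monoʳ (0≤u m) (ℚₚ.+-monoʳ-≤ (ι 2 * y (2+ i) m) (*-monoˡ {ι 3} {1ℚ} (0≤ι 3) 1≤y)) ⟩
        (ι 2 * y (2+ i) m + ι 3 * y (2+ i) m) * u m
          ≡⟨ solve 2 (λ y u → (# 2 :* y :+ # 3 :* y) :* u := # 5 :* u :* y) refl (y (2+ i) m) (u m) ⟩
        ι 5 * u m * y (2+ i) m
          ≡⟨ cong (_* y (2+ i) m) (ℚₚ.0≤p⇒∣p∣≡p (0≤* (0≤ι 5) (0≤u m))) ⟨
        ∣ ι 5 * u m ∣ * y (2+ i) m ∎) 1≤y)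

    0<μ : Eventually₂ (λ _ m → 0ℚ < μ m)
    0<μ = ev-map (λ le → let 0<s-1 = ℚₚ.<-≤-trans (0<u 3) le in 0<* 0<s-1 0<s-1) ¼≤s-1

    -- The product is (s² - 1)² = (1 - τ)². It disposes of the surplus power in Binet's formula,
    -- where U₂ₙ belongs to the exponent 2n + 1.
    Λμ≃1 : (λ _ m → Λ m * μ m) ≃ (λ _ _ → 1ℚ)
    Λμ≃1 = ≃-intro {λ _ m → Λ m * μ m} {λ _ _ → 1ℚ} (λ _ m → ι 2 * τ m) (null-scale 2 null-τ) (ev-all λ _ _ → 0<1) (ev-all λ _ m → begin
      ∣ Λ m * μ m - 1ℚ ∣
        ≡⟨ cong ∣_∣ (solve 1 (λ s → (# 1 :+ s) :* (# 1 :+ s) :* ((s :- # 1) :* (s :- # 1)) :- # 1 := :- ((# 2 :- (# 2 :- s :* s)) :* (# 2 :- s :* s))) refl (s m)) ⟩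
      ∣ - ((ι 2 - τ m) * τ m) ∣
        ≡⟨ trans (ℚₚ.∣-p∣≡∣p∣ ((ι 2 - τ m) * τ m)) (ℚₚ.0≤p⇒∣p∣≡p (0≤* (≤⇒0≤- (τ≤2 m)) (0≤τ m))) ⟩
      (ι 2 - τ m) * τ m
        ≤⟨ *-monoʳ (0≤τ m) (≤-by {ι 2 - τ m} (τ m) (0≤τ m) (solve 1 (λ t → # 2 := # 2 :- t :+ t) refl (τ m))) ⟩
      ι 2 * τ m
        ≡⟨ trans (sym (ℚₚ.0≤p⇒∣p∣≡p (0≤* (0≤ι 2) (0≤τ m)))) (sym (ℚₚ.*-identityʳ _)) ⟩
      ∣ ι 2 * τ m ∣ * 1ℚ ∎)

    0<pw : ∀ {x} k → 0ℚ < x → 0ℚ < pw x k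
    0<pw zero    0<x = 0<1
    0<pw (suc k) 0<x = 0<* 0<x (0<pw k 0<x)

    0<1+s : ∀ m → 0ℚ < 1ℚ + s m
    0<1+s m = ℚₚ.<-≤-trans 0<1 (≤-by (s m) (0≤s m) refl)

    -- For the squares: d²(2s-2)² times s n π regroups as n a² π times e² times 4sμ. The first
    -- factor tends to 1, e² is replaced by U₂ₙ, and 4s U₂ₙ is just the left side of Binet's
    -- formula. It becomes Λ²ⁿ⁺¹, and the remaining μ lowers the exponent to 2n.
    ℓT≃power : (λ i m → Lˢ (2+ i) * T (2+ i) m) ≃ (λ i m → pw (1ℚ + s m) ((2+ i) ℕ.+ (2+ i)))
    ℓT≃power = ≃-√ (ev-all λ i m → 0≤* (0≤ι (ℓ (𝒮 (2+ i)))) (ApproximatesRoot.0≤T (T-root (2+ i) m)))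
      (ev-all λ i m → 0<pw ((2+ i) ℕ.+ (2+ i)) (0<1+s m))
      (≃-trans step₁ (≃-trans step₂ (≃-trans step₃ step₄)))
      where
      step₁ : (λ i m → Lˢ (2+ i) * T (2+ i) m * (Lˢ (2+ i) * T (2+ i) m)) ≃
              (λ i m → (ι (2+ i) * (a (2+ i) * a (2+ i)) * leibniz m) * (e (2+ i) * e (2+ i) * (ι 4 * s m * μ m)))
      step₁ = ≃-resp
        (λ i m → solve 2 (λ l t → l :* l :* (t :* t) := l :* t :* (l :* t)) refl (Lˢ (2+ i)) (T (2+ i) m))
        (λ i m → trans (cong (λ z → z * 2s-2 m * (z * 2s-2 m) * y (2+ i) m) (d≡ae (2+ i)))
          (solve 5 (λ a e s n l → a :* e :* (# 2 :* (s :- # 1)) :* (a :* e :* (# 2 :* (s :- # 1))) :* (s :* n :* l) :=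
            n :* (a :* a) :* l :* (e :* e :* (# 4 :* s :* ((s :- # 1) :* (s :- # 1))))) refl (a (2+ i)) (e (2+ i)) (s m) (ι (2+ i)) (leibniz m)))
        (≃-* (≃-* ℓ≃d ℓ≃d) T²≃y)
      0<4sμ : Eventually₂ (λ _ m → 0ℚ < ι 4 * s m * μ m)
      0<4sμ = ev-map (λ (1≤s , 0<μ) → 0<* (0<* (0<ι 3) (ℚₚ.<-≤-trans 0<1 1≤s)) 0<μ) (1≤s ev× 0<μ)
      step₂ : (λ i m → (ι (2+ i) * (a (2+ i) * a (2+ i)) * leibniz m) * (e (2+ i) * e (2+ i) * (ι 4 * s m * μ m))) ≃
              (λ i m → ι 4 * s m * Uˢ ((2+ i) ℕ.+ (2+ i)) * μ m)
      step₂ = ≃-resp {b = λ i m → 1ℚ * (Uˢ ((2+ i) ℕ.+ (2+ i)) * (ι 4 * s m * μ m))} (λ _ _ → refl)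
        (λ i m → solve 3 (λ U s μ → # 1 :* (U :* (# 4 :* s :* μ)) := # 4 :* s :* U :* μ) refl (Uˢ ((2+ i) ℕ.+ (2+ i))) (s m) (μ m))
        (≃-* (≃-suc (≃-suc naₙ²π≃1)) (≃-* (≃-suc (≃-suc e²≃U)) (≃-refl 0<4sμ)))
      step₃ : (λ i m → ι 4 * s m * Uˢ ((2+ i) ℕ.+ (2+ i)) * μ m) ≃ (λ i m → pw (Λ m) (suc ((2+ i) ℕ.+ (2+ i))) * μ m)
      step₃ = ≃-* (≃-suc (≃-suc 4sU≃Λ)) (≃-refl 0<μ)
      step₄ : (λ i m → pw (Λ m) (suc ((2+ i) ℕ.+ (2+ i))) * μ m) ≃
              (λ i m → pw (1ℚ + s m) ((2+ i) ℕ.+ (2+ i)) * pw (1ℚ + s m) ((2+ i) ℕ.+ (2+ i)))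
      step₄ = ≃-resp {λ i m → pw (Λ m) ((2+ i) ℕ.+ (2+ i)) * (Λ m * μ m)} {b = λ i m → pw (Λ m) ((2+ i) ℕ.+ (2+ i)) * 1ℚ}
        (λ i m → solve 3 (λ p l μ → p :* (l :* μ) := l :* p :* μ) refl (pw (Λ m) ((2+ i) ℕ.+ (2+ i))) (Λ m) (μ m))
        (λ i m → trans (ℚₚ.*-identityʳ _) (sym (pw-* (1ℚ + s m) ((2+ i) ℕ.+ (2+ i)))))
        (≃-* (≃-refl (ev-all λ i m → 0<pw ((2+ i) ℕ.+ (2+ i)) (0<* (0<1+s m) (0<1+s m)))) Λμ≃1)

-- From asymptotic equality to quotients of real numbers

inv-unique : ∀ {x y} → x * y ≡ 1ℚ → inv y ≡ x
inv-unique {x} {y} xy≡1 = begin-equality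
  inv y              ≡⟨ ℚₚ.*-identityʳ (inv y) ⟨
  inv y * 1ℚ         ≡⟨ cong (inv y *_) xy≡1 ⟨
  inv y * (x * y)    ≡⟨ solve 3 (λ i x y → i :* (x :* y) := (i :* y) :* x) refl (inv y) x y ⟩
  inv y * y * x      ≡⟨ cong (_* x) (inv-inverse y y≢0) ⟩
  1ℚ * x             ≡⟨ ℚₚ.*-identityˡ x ⟩
  x                  ∎
  where
  y≢0 : y ≢ 0ℚ
  y≢0 refl = 0≢1 (trans (sym (ℚₚ.*-zeroʳ x)) xy≡1)
    where
    0≢1 : 0ℚ ≢ 1ℚ
    0≢1 ()

ratio-close : ∀ {x y ε} → 0ℚ < y → ∣ x - y ∣ ≤ ε * y → ∣ x * inv y - 1ℚ ∣ ≤ ε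
ratio-close {x} {y} {ε} 0<y le = begin
  ∣ x * inv y - 1ℚ ∣            ≡⟨ cong (λ z → ∣ x * inv y - z ∣) (inv-inverse y (pos⇒≢ 0<y)) ⟨
  ∣ x * inv y - inv y * y ∣     ≡⟨ cong ∣_∣ (solve 3 (λ x y i → x :* i :- i :* y := (x :- y) :* i) refl x y (inv y)) ⟩
  ∣ (x - y) * inv y ∣           ≡⟨ trans (ℚₚ.∣p*q∣≡∣p∣*∣q∣ (x - y) (inv y)) (cong (∣ x - y ∣ *_) (ℚₚ.0≤p⇒∣p∣≡p 0≤inv)) ⟩
  ∣ x - y ∣ * inv y             ≤⟨ *-monoʳ 0≤inv le ⟩
  ε * y * inv y                 ≡⟨ solve 3 (λ e y i → e :* y :* i := e :* (i :* y)) refl ε y (inv y) ⟩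
  ε * (inv y * y)               ≡⟨ trans (cong (ε *_) (inv-inverse y (pos⇒≢ 0<y))) (ℚₚ.*-identityʳ ε) ⟩
  ε                             ∎
  where 0≤inv = ℚₚ.<⇒≤ (inv-pos y 0<y)

double-ratio-close : ∀ {l t P ε} → 0ℚ < t → 0ℚ < P → ∣ l * t - P ∣ ≤ ε * P → ∣ l * inv (P * inv t) - 1ℚ ∣ ≤ ε
double-ratio-close {l} {t} {P} {ε} 0<t 0<P le = begin
  ∣ l * inv (P * inv t) - 1ℚ ∣   ≡⟨ cong (λ z → ∣ l * z - 1ℚ ∣) (inv-unique {t * inv P} invert) ⟩
  ∣ l * (t * inv P) - 1ℚ ∣       ≡⟨ cong (λ z → ∣ z - 1ℚ ∣) (sym (ℚₚ.*-assoc l t (inv P))) ⟩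
  ∣ l * t * inv P - 1ℚ ∣         ≤⟨ ratio-close {l * t} {P} 0<P le ⟩
  ε                              ∎
  where
  invert : t * inv P * (P * inv t) ≡ 1ℚ
  invert = trans (solve 4 (λ t i p j → t :* i :* (p :* j) := (j :* t) :* (i :* p)) refl t (inv P) P (inv t))
    (cong₂ _*_ (inv-inverse t (pos⇒≢ 0<t)) (inv-inverse P (pos⇒≢ 0<P)))

multiple-ratio-close : ∀ {x r l z ε} → x * r ≡ l → 0ℚ < r → 0ℚ < z → ∣ l - r * z ∣ ≤ ε * (r * z) → ∣ x * inv z - 1ℚ ∣ ≤ ε
multiple-ratio-close {x} {r} {l} {z} {ε} xr≡l 0<r 0<z le = ratio-close {x} {z} 0<z (*-cancelˡ 0<r (begin
  r * ∣ x - z ∣        ≡⟨ cong (_* ∣ x - z ∣) (ℚₚ.0≤p⇒∣p∣≡p (ℚₚ.<⇒≤ 0<r)) ⟨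
  ∣ r ∣ * ∣ x - z ∣    ≡⟨ ℚₚ.∣p*q∣≡∣p∣*∣q∣ r (x - z) ⟨
  ∣ r * (x - z) ∣      ≡⟨ cong ∣_∣ (solve 3 (λ r x z → r :* (x :- z) := x :* r :- r :* z) refl r x z) ⟩
  ∣ x * r - r * z ∣    ≡⟨ cong (λ w → ∣ w - r * z ∣) xr≡l ⟩
  ∣ l - r * z ∣        ≤⟨ le ⟩
  ε * (r * z)          ≡⟨ solve 3 (λ e r z → e :* (r :* z) := r :* (e :* z)) refl ε r z ⟩
  r * (ε * z)          ∎))

halve-+ : ∀ {x} ε → x ≤ ½ * ε → x + ½ * ε ≤ ε
halve-+ {x} ε le = ℚₚ.≤-trans (ℚₚ.+-monoˡ-≤ (½ * ε) le) (ℚₚ.≤-reflexive (halves ε))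

leibniz-bounds : ∀ m → 0ℚ ≤ leibniz m × leibniz m ≤ ι 4
leibniz-bounds m = subst (λ z → 0ℚ ≤ z × z ≤ ι 4) (sym alt-eq) (alt-bounds 0 m)
  where
  alt-eq : leibniz m ≡ alt 0 m
  alt-eq = trans (cong leibniz (sym (ℕₚ.+-identityʳ m))) (trans (leibniz-alt 0 m) (solve 1 (λ x → # 0 :+ # 1 :* x := x) refl (alt 0 m)))

module Quotients (s : ℕ → ℚ) (s-root : ∀ m → ApproximatesRoot (ι 2) (s m) m)
                 (T : Seq₂) (T-root : ∀ n m → ApproximatesRoot (s m * ι n * leibniz m) (T n m) m) where
  open √2-Approximation s s-root
  open √2-Powers s s-root
  open Growth s s-root

  power : Seq₂
  power n m = pw (1ℚ + s m) (n ℕ.+ n)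

  1≤pw : ∀ {x} k → 1ℚ ≤ x → 1ℚ ≤ pw x k
  1≤pw zero    1≤x = ℚₚ.≤-refl
  1≤pw {x} (suc k) 1≤x = *-mono-≤-nonNeg {1ℚ} {x} {1ℚ} 0≤1 1≤x 0≤1 (1≤pw k 1≤x)

  1≤power : ∀ n m → 1ℚ ≤ power n m
  1≤power n m = 1≤pw (n ℕ.+ n) (≤-by (s m) (0≤s m) refl)

  -- T is only known to be nonnegative, and `inv` has the value 0 at 0. Positivity follows from that
  -- of its square, which is at least half of the radicand.
  0<T : Eventually₂ (λ i m → 0ℚ < T (2+ i) m)
  0<T = ev-map (λ {i} {m} → positive-root i m) (_≃_.close (T²≃y T T-root) ½ 0<½)
    where
    positive-root : ∀ i m → let z = s m * ι (2+ i) * leibniz m ; t = T (2+ i) m in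
      0ℚ < z × ∣ t * t - z ∣ ≤ ½ * z → 0ℚ < t
    positive-root i m (0<z , le) = ℚₚ.≰⇒> λ t≤0 → ℚₚ.<-irrefl refl (begin-strict
      0ℚ                      <⟨ 0<* 0<½ 0<z ⟩
      ½ * z                   ≡⟨ solve 1 (λ z → con ½ :* z := z :- con ½ :* z) refl z ⟩
      z - ½ * z               ≤⟨ ℚₚ.+-monoˡ-≤ (- (½ * z)) (≤-dist {z} {t * t} (subst (_≤ ½ * z) (dist-sym (t * t) z) le)) ⟩
      t * t + ½ * z - ½ * z   ≡⟨ solve 2 (λ t z → t :+ z :- z := t) refl (t * t) (½ * z) ⟩
      t * t                   ≤⟨ *-monoˡ (ApproximatesRoot.0≤T (T-root (2+ i) m)) t≤0 ⟩
      t * 0ℚ                  ≡⟨ ℚₚ.*-zeroʳ t ⟩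
      0ℚ                      ∎)
      where
      z = s m * ι (2+ i) * leibniz m
      t = T (2+ i) m

  -- A crude bound on T, with 2 for s and 4 for the Leibniz sums. Its use is to be independent of m:
  -- apartness of the divisor asks for one lower bound valid at all large precisions.
  T-bound : ℕ → ℚ
  T-bound n = 1ℚ + ι 2 * ι n * ι 4

  0<T-bound : ∀ n → 0ℚ < T-bound n
  0<T-bound n = ℚₚ.<-≤-trans 0<1 (≤-by (ι 2 * ι n * ι 4) (0≤* (0≤* (0≤ι 2) (0≤ι n)) (0≤ι 4)) refl)

  T≤ : ∀ n m → T n m ≤ T-bound n
  T≤ n m = ℚₚ.≤-trans (≤1+square (ApproximatesRoot.0≤T (T-root n m)) (ApproximatesRoot.T²≤y (T-root n m)))
    (ℚₚ.+-monoʳ-≤ 1ℚ (*-mono-≤-nonNeg (0≤* (0≤s m) (0≤ι n)) (*-monoʳ (0≤ι n) (ℚₚ.≤-trans (s≤3/2 m) (ℚₚ.≤ᵇ⇒≤ {1ℚ + ½} {ι 2} _)))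
      (proj₁ (leibniz-bounds m)) (proj₂ (leibniz-bounds m))))

  power/T-apart : ∀ n m → 0ℚ < T n m → inv (T-bound n) ≤ ∣ power n m * inv (T n m) ∣
  power/T-apart n m 0<T = begin
    inv (T-bound n)               ≤⟨ inv-anti 0<T (T≤ n m) ⟩
    inv (T n m)                   ≡⟨ ℚₚ.*-identityˡ _ ⟨
    1ℚ * inv (T n m)              ≤⟨ *-monoʳ (ℚₚ.<⇒≤ (inv-pos (T n m) 0<T)) (1≤power n m) ⟩
    power n m * inv (T n m)       ≤⟨ p≤∣p∣ (power n m * inv (T n m)) ⟩
    ∣ power n m * inv (T n m) ∣   ∎

  ℓ-quotient : ∀ ε → 0ℚ < ε → Eventually₂ λ i m → let n = 2+ i in
    inv (T-bound n) ≤ ∣ power n m * inv (T n m) ∣ × ∣ Lˢ n * inv (power n m * inv (T n m)) - 1ℚ ∣ + ½ * ε ≤ ε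
  ℓ-quotient ε 0<ε = ev-map
    (λ {i} {m} (0<T , 0<P , le) → power/T-apart (2+ i) m 0<T ,
      halve-+ {∣ Lˢ (2+ i) * inv (power (2+ i) m * inv (T (2+ i) m)) - 1ℚ ∣} ε
        (double-ratio-close {Lˢ (2+ i)} {T (2+ i) m} {power (2+ i) m} {½ * ε} 0<T 0<P le))
    (0<T ev× _≃_.close ℓT≃power′ (½ * ε) (0<* 0<½ 0<ε))
    where
    ℓT≃power′ : (λ i m → Lˢ (2+ i) * T (2+ i) m) ≃ (λ i m → power (2+ i) m)
    ℓT≃power′ = ℓT≃power T T-root

  ½≤slope : ∀ n m → 1 ℕ.≤ n → ½ ≤ (ι 2 - s m) * ι n
  ½≤slope n m 1≤n = *-mono-≤-nonNeg {½} {ι 2 - s m} {1ℚ} 0≤½ (0≤2-s m) 0≤1 (ι-mono {1} {n} 1≤n)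

  i-quotient : ∀ ε → 0ℚ < ε → Eventually₂ λ k m → let n = 2+ k in
    ∣ i (𝒮 n) {{𝒮-nonEmpty n}} * inv ((ι 2 - s m) * ι n) - 1ℚ ∣ + ½ * ε ≤ ε
  i-quotient ε 0<ε = ev-map
    (λ {k} {m} (_ , le) → halve-+ {∣ i (𝒮 (2+ k)) {{𝒮-nonEmpty (2+ k)}} * inv ((ι 2 - s m) * ι (2+ k)) - 1ℚ ∣} ε
      (multiple-ratio-close {i (𝒮 (2+ k)) {{𝒮-nonEmpty (2+ k)}}} {Rˢ (2+ k)} {Lˢ (2+ k)} {((ι 2 - s m) * ι (2+ k))} {½ * ε}
        (i-ratio (2+ k)) (0<r (suc k)) (ℚₚ.<-≤-trans 0<½ (½≤slope (2+ k) m (s≤s z≤n))) le))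
    (_≃_.close ℓ≃r′ (½ * ε) (0<* 0<½ 0<ε))
    where
    ℓ≃r′ : (λ k _ → Lˢ (2+ k)) ≃ (λ k m → Rˢ (2+ k) * ((ι 2 - s m) * ι (2+ k)))
    ℓ≃r′ = ℓ≃r
    i-ratio : ∀ n → i (𝒮 n) {{𝒮-nonEmpty n}} * Rˢ n ≡ Lˢ n
    i-ratio n = /-ι (ℓ (𝒮 n)) (r n) {{𝒮-nonEmpty n}}

-- The two witnesses over the reals are c n for the apartness of the divisor and ε/2 for the strict
-- inequality, which is why the estimates are requested with a slack of ε/2. The approximations of
-- `b` enter only through an equation with β, so they are rewritten and not computed.
~-intro : ∀ (a : ℕ → ℚ) (b : (n : ℕ) → .{{NonZero n}} → ℝ) (β : Seq₂) (c : ℕ → ℚ) →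
  (∀ n .{{_ : NonZero n}} m → approx (b n) m ≡ β n m) → (∀ n → 0ℚ < c n) →
  (∀ ε → 0ℚ < ε → Eventually₂ λ i m → let n = 2+ i in c n ≤ ∣ β n m ∣ × ∣ a n * inv (β n m) - 1ℚ ∣ + ½ * ε ≤ ε) →
  (λ n → fromℚ (a n)) ~ b
~-intro a b β c β-eq 0<c h ε 0<ε = let (N , g) = h ε 0<ε in 2 ℕ.+ N , λ where
  (suc (suc i)) (s≤s (s≤s N≤i)) → let (M , close) = g i N≤i ; n = 2+ i in
    (c n , 0<c n , M , λ m M≤m → subst₂ _≤_ (sym (ℚₚ.+-identityˡ (c n))) (cong ∣_∣ (sym (β-eq n m))) (proj₁ (close m M≤m))) ,
    (½ * ε , 0<* 0<½ 0<ε , M , λ m M≤m →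
      subst (λ z → ∣ a n * inv z - 1ℚ ∣ + ½ * ε ≤ ε) (sym (β-eq n m)) (proj₂ (close m M≤m)))

approx-^ : ∀ x k m → approx (x ^ᴿ k) m ≡ pw (approx x m) k
approx-^ x zero    m = refl
approx-^ x (suc k) m = cong (approx x m *_) (approx-^ x k m)

approx-* : ∀ x y m → approx (x *ᴿ y) m ≡ approx x m * approx y m
approx-* x y m = refl

approx-- : ∀ x y m → approx (x -ᴿ y) m ≡ approx x m - approx y m
approx-- x y m = refl

approx-fromℕ : ∀ n m → approx (fromℕ n) m ≡ ι n
approx-fromℕ n m = refl

-- ρ stands for √2 and y n for √(√2 n π), whose unfolding would be expensive.
module _ (ρ : ℝ) (ρ-root : ∀ m → ApproximatesRoot (ι 2) (approx ρ m) m)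
         (y : ℕ → ℝ) (y-root : ∀ n m → ApproximatesRoot (approx ρ m * ι n * leibniz m) (approx (y n) m) m) where
  open Quotients (approx ρ) ρ-root (λ n → approx (y n)) y-root

  ℓ~-generic : (y#0 : ∀ n → .{{_ : NonZero n}} → Apart0 (y n)) →
    (λ n → fromℚ (Lˢ n)) ~ (λ n → (fromℕ 1 +ᴿ ρ) ^ᴿ (2 ℕ.* n) ÷ᴿ y n [ y#0 n ])
  ℓ~-generic y#0 = ~-intro Lˢ (λ n → (fromℕ 1 +ᴿ ρ) ^ᴿ (2 ℕ.* n) ÷ᴿ y n [ y#0 n ])
    (λ n m → power n m * inv (approx (y n) m)) (λ n → inv (T-bound n))
    (λ n m → cong (_* inv (approx (y n) m)) (trans (approx-^ (fromℕ 1 +ᴿ ρ) (2 ℕ.* n) m)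
      (cong (λ k → pw (1ℚ + approx ρ m) (n ℕ.+ k)) (ℕₚ.+-identityʳ n))))
    (λ n → inv-pos (T-bound n) (0<T-bound n)) ℓ-quotient

  ~-slope : (a : ℕ → ℚ) →
    (∀ ε → 0ℚ < ε → Eventually₂ λ k m → let n = 2+ k in ∣ a n * inv ((ι 2 - approx ρ m) * ι n) - 1ℚ ∣ + ½ * ε ≤ ε) →
    (λ n → fromℚ (a n)) ~ (λ n → (fromℕ 2 -ᴿ ρ) *ᴿ fromℕ n)
  ~-slope a h = ~-intro a (λ n → (fromℕ 2 -ᴿ ρ) *ᴿ fromℕ n) (λ n m → (ι 2 - approx ρ m) * ι n) (λ _ → ½)
    (λ n m → trans (approx-* (fromℕ 2 -ᴿ ρ) (fromℕ n) m) (cong₂ _*_ (trans (approx-- (fromℕ 2) ρ m) (cong (_- approx ρ m) (approx-fromℕ 2 m))) (approx-fromℕ n m))) (λ _ → 0<½)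
    λ ε 0<ε → ev-map (λ {k} {m} le → ℚₚ.≤-trans (½≤slope (2+ k) m (s≤s z≤n)) (p≤∣p∣ ((ι 2 - approx ρ m) * ι (2+ k))) , le) (h ε 0<ε)

  i~-generic : (λ n → fromℚ (i (𝒮 n) {{𝒮-nonEmpty n}})) ~ (λ n → (fromℕ 2 -ᴿ ρ) *ᴿ fromℕ n)
  i~-generic = ~-slope (λ n → i (𝒮 n) {{𝒮-nonEmpty n}}) i-quotient

√-approximates : ∀ x {y ρ} → ρ ≡ √ x → ∀ m → approx x m ≡ y → 0ℚ ≤ y → ApproximatesRoot y (approx ρ m) m
√-approximates x refl m refl 0≤x = rootℚ-approximates (approx x m) m 0≤x

√2-root : ∀ m → ApproximatesRoot (ι 2) (approx √2 m) m
√2-root m = √-approximates (fromℕ 2) {ι 2} {√2} refl m refl (0≤ι 2)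

approx-nπ : ∀ ρ n m → approx (ρ *ᴿ fromℕ n *ᴿ π) m ≡ approx ρ m * ι n * leibniz m
approx-nπ ρ n m = trans (approx-* (ρ *ᴿ fromℕ n) π m) (cong (_* leibniz m) (trans (approx-* ρ (fromℕ n) m) (cong (approx ρ m *_) (approx-fromℕ n m))))

√[√2nπ]-root : ∀ n m → ApproximatesRoot (approx √2 m * ι n * leibniz m) (approx (√ (√2 *ᴿ fromℕ n *ᴿ π)) m) m
√[√2nπ]-root n m = √-approximates (√2 *ᴿ fromℕ n *ᴿ π) {approx √2 m * ι n * leibniz m} {√ (√2 *ᴿ fromℕ n *ᴿ π)} refl m (approx-nπ √2 n m)
  (0≤* (0≤* (ApproximatesRoot.0≤T (√2-root m)) (0≤ι n)) (proj₁ (leibniz-bounds m)))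

ℓ~ : (λ n → fromℕ (ℓ (𝒮 n))) ~ (λ n → (fromℕ 1 +ᴿ √2) ^ᴿ (2 ℕ.* n) ÷ᴿ √ (√2 *ᴿ fromℕ n *ᴿ π) [ √[√2nπ]#0 n ])
ℓ~ = ℓ~-generic √2 √2-root (λ n → √ (√2 *ᴿ fromℕ n *ᴿ π)) √[√2nπ]-root √[√2nπ]#0

i~ : (λ n → fromℚ (i (𝒮 n) {{𝒮-nonEmpty n}})) ~ (λ n → (fromℕ 2 -ᴿ √2) *ᴿ fromℕ n)
i~ = i~-generic √2 √2-root (λ n → √ (√2 *ᴿ fromℕ n *ᴿ π)) √[√2nπ]-root

ℓ-formula : ∀ n → ℤ.+ ℓ (𝒮 (suc n)) ≡ ℤ.+ d (suc n) ℤ.- ℤ.+ r (suc n) ℤ.- ℤ.+ d n ℤ.+ ℤ.+ r n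
ℓ-formula n = trans (isolate (ℤ.+ ℓ (𝒮 (suc n))) (ℤ.+ r (suc n)) (ℤ.+ d n))
  (trans (cong (λ z → z ℤ.- ℤ.+ r (suc n) ℤ.- ℤ.+ d n) (cong ℤ.+_ (ℓ-d-r n)))
    (rearrange (ℤ.+ d (suc n)) (ℤ.+ r n) (ℤ.+ r (suc n)) (ℤ.+ d n)))
  where
  isolate : ∀ l r d → l ≡ l ℤ.+ r ℤ.+ d ℤ.- r ℤ.- d
  isolate = ℤ-Ring.solve-∀
  rearrange : ∀ d′ r r′ d → d′ ℤ.+ r ℤ.- r′ ℤ.- d ≡ d′ ℤ.- r′ ℤ.- d ℤ.+ r
  rearrange = ℤ-Ring.solve-∀

open ℤ using (+_)

mainTheorem13 : (⌜ (λ n → + ℓ (𝒮 n) / 1) ⌝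
    ≈ᶠ (const 1 ⊖ X) ⊛ (const 1 ⊖ const 4 ⊛ X ⊕ X ⊛ X ⊖ (const 1 ⊖ X) ⊛ √ˢ Δ)
    // const 2 ⊛ X ⊛ √ˢ Δ [ 2X√Δ≢0 ])
    × (∀ n → + ℓ (𝒮 (suc n)) ≡ + d (suc n) ℤ.- + r (suc n) ℤ.- + d n ℤ.+ + r n)
    × (∀ n → + ℓ (𝒮 n) / 1
    ≡ Σ≤ n (λ k → multichoose (2 ℕ.* k) (n ℕ.∸ k) * (+ ((2 ℕ.* k) C k) / 1) * (+ k / suc k)))
    × ((λ n → fromℕ (ℓ (𝒮 n)))
    ~ (λ n → (fromℕ 1 +ᴿ √2) ^ᴿ (2 ℕ.* n) ÷ᴿ √ (√2 *ᴿ fromℕ n *ᴿ π) [ √[√2nπ]#0 n ]))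
    × ((λ n → fromℚ (i (𝒮 n) {{𝒮-nonEmpty n}}))
    ~ (λ n → (fromℕ 2 -ᴿ √2) *ᴿ fromℕ n))
mainTheorem13 = ℓ-generatingFunction , ℓ-formula , ℓ-multichoose , ℓ~ , i~
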